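{- Let $k\ge 1$ and let $w$ be any finite word in the alphabet $\{g_1^{\pm1},\ldots,g_k^{\pm1}\}$. Then $\phi(w)=2$ if and only if $\beta(w)=2$.
   Context: Words: $w=g_{i_1}^{\alpha_1}\cdots g_{i_m}^{\alpha_m}$ with $i_j\in\{1,\ldots,k\}$, $\alpha_j\in\{\pm1\}$, $m=|w|$ (not necessarily reduced). For $\sigma_1,\ldots,\sigma_k\in S_n$, $w(\sigma_1,\ldots,\sigma_k)\in S_n$ is obtained by substituting $\sigma_i$ for $g_i$. Definition of $\phi$: let $X_w^{(n)}(\sigma_1,\ldots,\sigma_k)$ be the number of fixed points of $w(\sigma_1,\ldots,\sigma_k)$, where $(\sigma_1,\ldots,\sigma_k)$ is uniform on $S_n^k$. It is known that for $n\ge |w|$ one has $\frac{\mathbb{E}(X_w^{(n)})-1}{n}=\sum_{i\ge 0} a_i(w) n^{ -i}$ with integer coefficients $a_i(w)$ depending only on $w$. Define $\phi(w)=\infty$ if $\mathbb{E}(X_w^{(n)})\equiv 1$, and otherwise $\phi(w)$ is the smallest $i$ with $a_i(w)\ne 0$. Definition of $\beta$: the open trail $T_w$ is the path with vertices $s_0,\ldots,s_m$ where for each $1\le j\le m$ there is an edge labeled $i_j$ between $s_{j-1}$ and $s_j$, directed from $s_{j-1}$ to $s_j$ if $\alpha_j=1$ and from $s_j$ to $s_{j-1}$ if $\alpha_j=-1$. A quotient graph of $T_w$ corresponds to a partition of $\{s_0,\ldots,s_m\}$: vertices are blocks, and there is a $j$-labeled directed edge from block $U$ to block $V$ whenever $T_w$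 has a $j$-labeled edge from some element of $U$ to some element of $V$ (parallel identical edges identified). Write $s_h\equiv s_l$ if they lie in the same block. A quotient is realizable if (1) $s_0\equiv s_m$; (2) whenever $i_h=i_l$ and $\alpha_h=\alpha_l$, $s_{h-1}\equiv s_{l-1}\iff s_h\equiv s_l$; (3) whenever $i_h=i_l$ and $\alpha_h=-\alpha_l$, $s_{h-1}\equiv s_l\iff s_h\equiv s_{l-1}$. Let $\mathcal{Q}_w$ be the set of realizable quotients. A realizable quotient $\Gamma$ is generated by a set $E$ of pairs $\{s_a,s_b\}$ if its partition is the finest partition in which every pair in $E$ is in one block and no two edges with the same label share the same origin or the same terminus. For a graph $\Gamma$, $\chi(\Gamma)=e_\Gamma-v_\Gamma+1$ (number of edges minus number of vertices plus one); the smallest size of a generating set of $\Gamma\in\mathcal{Q}_w$ equals $\chi(\Gamma)$. $\Gamma$ has type A if some generating set of smallest size contains the pair $\{s_0,s_m\}$, and type B otherwise. Then $\beta(w)=\min(\{\chi(\Gamma):\Gamma\in\mathcal{Q}_w \text{ of type B}\}\cup\{\infty\})$. -}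

module Defs where

open import Data.Bool using (Bool; true; false; not; _∧_; if_then_else_)
open import Data.Nat as ℕ using (ℕ; zero; suc; _≤_; _∸_; _^_)
open import Data.Nat.Properties using (_!≢0; m^n≢0)
open import Data.Fin as Fin using (Fin; zero; suc; inject₁; fromℕ)
open import Data.Fin.Properties using () renaming (_≟_ to _≟ᶠ_)
open import Data.Vec as Vec using (Vec; []; _∷_)
open import Data.List as List using (List; []; _∷_; [_]; length; map; concatMap;
  filterᵇ; allFin; deduplicate)
open import Data.Bool.ListAction using (any)
open import Data.Nat.ListAction using (sum)
open import Data.List.Membership.Propositional using (_∈_)
open import Data.Integer as ℤ using (ℤ; +_)
open import Data.Rational as ℚ using (ℚ; 0ℚ; 1ℚ; _<_; ∣_∣)
open import Data.Product using (Σ; ∃; ∃-syntax; _×_; _,_; proj₁; proj₂)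
open import Data.Product.Properties using (≡-dec)
open import Data.Sum using (_⊎_)
open import Data.Bool.Properties using () renaming (_≟_ to _≟ᵇ_)
open import Relation.Nullary using (¬_; ⌊_⌋)
open import Relation.Binary.PropositionalEquality using (_≡_; _≢_)
open import Function.Bundles using (_⇔_)

-- Words in the alphabet {g_1^{±1},…,g_k^{±1}} (not necessarily reduced).
-- A letter is (i , α) with i : Fin k (generator g_{i+1}) and
-- α = true meaning exponent +1, α = false meaning exponent -1.

Letter : ℕ → Set
Letter k = Fin k × Bool

Word : ℕ → Set
Word k = List (Letter k)

-- The symmetric group S_n, enumerated explicitly.
-- A permutation of {0,…,n-1} is stored as the vector of its values.

vecsOf : {A : Set} → List A → (m : ℕ) → List (Vec A m)
vecsOf xs zero    = [ [] ]
vecsOf xs (suc m) = concatMap (λ x → map (x ∷_) (vecsOf xs m)) xs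

allDistinct : {n : ℕ} → List (Fin n) → Bool
allDistinct []       = true
allDistinct (x ∷ xs) = not (any (λ y → ⌊ x ≟ᶠ y ⌋) xs) ∧ allDistinct xs

-- S_n : all injective (hence bijective) maps Fin n → Fin n, each exactly once
Sym : (n : ℕ) → List (Vec (Fin n) n)
Sym n = filterᵇ (λ v → allDistinct (Vec.toList v)) (vecsOf (allFin n) n)

app : {n : ℕ} → Vec (Fin n) n → Fin n → Fin n
app σ x = Vec.lookup σ x

appInv : {n : ℕ} → Vec (Fin n) n → Fin n → Fin n
appInv {n} σ y = go (allFin n)
  where
  go : List (Fin n) → Fin n
  go []       = y
  go (x ∷ xs) = if ⌊ app σ x ≟ᶠ y ⌋ then x else go xs

appLetter : {n : ℕ} → Vec (Fin n) n → Bool → Fin n → Fin n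
appLetter σ true  = app σ
appLetter σ false = appInv σ

-- w(σ_1,…,σ_k) applied to a point: w = l_1 ⋯ l_m acts as the composite
-- l_1 ∘ ⋯ ∘ l_m (rightmost letter first).
evalWord : {n k : ℕ} → Vec (Vec (Fin n) n) k → Word k → Fin n → Fin n
evalWord σs []            x = x
evalWord σs ((i , α) ∷ w) x = appLetter (Vec.lookup σs i) α (evalWord σs w x)

fixedPoints : {n k : ℕ} → Word k → Vec (Vec (Fin n) n) k → ℕ
fixedPoints {n} w σs =
  length (filterᵇ (λ x → ⌊ evalWord σs w x ≟ᶠ x ⌋) (allFin n))

totalFixed : (n : ℕ) {k : ℕ} → Word k → ℕ
totalFixed n {k} w = sum (map (fixedPoints w) (vecsOf (Sym n) k))

-- E(X_w^{(n)}) for (σ_1,…,σ_k) uniform on S_n^k  (|S_n^k| = (n!)^k)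
expectation : (n : ℕ) {k : ℕ} → Word k → ℚ
expectation n {k} w =
  ℚ._/_ (+ totalFixed n w) ((n ℕ.!) ^ k) {{m^n≢0 (n ℕ.!) k {{n !≢0}}}}

powℚ : ℚ → ℕ → ℚ
powℚ q zero    = 1ℚ
powℚ q (suc i) = q ℚ.* powℚ q i

recipSuc : ℕ → ℚ
recipSuc m = ℚ._/_ (+ 1) (suc m)

partialSum : (ℕ → ℤ) → ℕ → ℕ → ℚ
partialSum a m zero    = 0ℚ
partialSum a m (suc M) =
  partialSum a m M ℚ.+ (ℚ._/_ (a M) 1 ℚ.* powℚ (recipSuc m) M)

SeriesConvergesTo : (ℕ → ℤ) → ℕ → ℚ → Set
SeriesConvergesTo a m q =
  ∀ (ε : ℚ) → 0ℚ < ε → ∃[ N ] ∀ M → N ≤ M → ∣ partialSum a m M ℚ.- q ∣ < ε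

-- a is the coefficient sequence (a_i(w))_i : for every n = m+1 ≥ |w|,
-- (E(X_w^{(n)}) - 1)/n = Σ_i a_i n^{-i}.
IsExpansion : {k : ℕ} → Word k → (ℕ → ℤ) → Set
IsExpansion w a =
  ∀ (m : ℕ) → length w ≤ suc m →
    SeriesConvergesTo a m ((expectation (suc m) w ℚ.- 1ℚ) ℚ.* recipSuc m)

-- φ(w) = 2 : the (unique) coefficient sequence has a_0 = a_1 = 0 ≠ a_2.
φ≡2 : {k : ℕ} → Word k → Set
φ≡2 w = ∃[ a ] (IsExpansion w a × a 0 ≡ + 0 × a 1 ≡ + 0 × a 2 ≢ + 0)

-- The open trail T_w and its quotients.
-- Vertices s_0,…,s_m are Fin (suc m), m = |w|.  Edge number j+1 (j : Fin m)
-- joins s_j and s_{j+1} with label i_{j+1}.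
-- A partition of the vertex set is given by a labelling
-- p : Fin (suc m) → Fin (suc m) ; s_a ≡ s_b iff p a ≡ p b.
-- (Every partition arises this way.)

Vtx : {k : ℕ} → Word k → Set
Vtx w = Fin (suc (length w))

Part : {k : ℕ} → Word k → Set
Part w = Vtx w → Vtx w

module _ {k : ℕ} (w : Word k) where

  EIdx : Set
  EIdx = Fin (length w)

  label : EIdx → Fin k
  label j = proj₁ (List.lookup w j)

  sign : EIdx → Bool
  sign j = proj₂ (List.lookup w j)

  -- s_{j-1} and s_j for edge number j (here indexed from 0)
  before after : EIdx → Vtx w
  before j = inject₁ j
  after  j = suc j

  origin terminus : EIdx → Vtx w
  origin j   = if sign j then before j else after j
  terminus j = if sign j then after j else before j

  first last : Vtx w
  first = zero
  last  = fromℕ (length w)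

  Realizable : Part w → Set
  Realizable p =
    (p first ≡ p last) ×
    (∀ h l → label h ≡ label l → sign h ≡ sign l →
       (p (before h) ≡ p (before l)) ⇔ (p (after h) ≡ p (after l))) ×
    (∀ h l → label h ≡ label l → sign h ≡ not (sign l) →
       (p (before h) ≡ p (after l)) ⇔ (p (after h) ≡ p (before l)))

  Folded : Part w → Set
  Folded p =
    ∀ h l → label h ≡ label l →
      ((p (origin h) ≡ p (origin l)) → (p (terminus h) ≡ p (terminus l))) ×
      ((p (terminus h) ≡ p (terminus l)) → (p (origin h) ≡ p (origin l)))

  Finer : Part w → Part w → Set
  Finer p q = ∀ a b → p a ≡ p b → q a ≡ q b

  Identifies : Part w → List (Vtx w × Vtx w) → Set
  Identifies p E = ∀ a b → (a , b) ∈ E → p a ≡ p b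

  GeneratedBy : Part w → List (Vtx w × Vtx w) → Set
  GeneratedBy p E =
    Identifies p E × Folded p ×
    (∀ q → Identifies q E → Folded q → Finer p q)

  numVertices : Part w → ℕ
  numVertices p = length (deduplicate Fin._≟_ (map p (allFin (suc (length w)))))

  numEdges : Part w → ℕ
  numEdges p =
    length (deduplicate (≡-dec Fin._≟_ (≡-dec Fin._≟_ Fin._≟_))
      (map (λ j → (label j , p (origin j) , p (terminus j))) (allFin (length w))))

  -- χ(Γ) = e - v + 1 (nonnegative since Γ is connected)
  χ : Part w → ℕ
  χ p = suc (numEdges p) ∸ numVertices p

  -- type A : some generating set of smallest size contains {s_0, s_m}
  -- (sets of pairs represented by lists; a smallest list has no repetitions)
  TypeA : Part w → Set
  TypeA p =
    ∃[ E ] (GeneratedBy p E ×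
            (∀ E′ → GeneratedBy p E′ → length E ≤ length E′) ×
            ((first , last) ∈ E ⊎ (last , first) ∈ E))

  TypeB : Part w → Set
  TypeB p = ¬ TypeA p

β≡2 : {k : ℕ} → Word k → Set
β≡2 w =
  (∃[ p ] (Realizable w p × TypeB w p × χ w p ≡ 2)) ×
  (∀ p → Realizable w p → TypeB w p → 2 ≤ χ w p)

{-# OPTIONS --safe #-}

-- Counting the images of the trail of w by the quotient graph that they realize gives
-- E(X_w) = Σ_Γ n(n-1)⋯(n-v+1) / Π_i n(n-1)⋯(n-eᵢ+1), the sum over all realizable quotients Γ, so
-- that Γ first contributes to (E - 1)/n at the power n^{-χ(Γ)}, with coefficient 1, and next with
-- coefficient Σ_i C(eᵢ,2) - C(v,2).  If β(w) ≥ 2, the only quotient with χ ≤ 1 is the quotient Γ₁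
-- generated by {s₀,s_m}, and a₂ is the number of quotients with χ = 2, minus C(v,2) - Σ_i C(eᵢ,2)
-- computed for Γ₁.  It remains to see that the latter is the number of type A quotients with χ = 2.
--
-- Those are the quotients of Γ₁ generated by one pair of vertices.  Let Υ be the graph on the
-- unordered pairs of vertices of Γ₁ whose edges are the pairs of equally labelled edges of Γ₁.
-- Pairs in one component of Υ generate the same quotient, so we need that Υ is a forest and that
-- distinct components generate distinct quotients.  A quotient Δ generated by a pair P has χ = 2,
-- hence folding Γ₁/P into Δ never lowers e - v, and so there is a potential on Δ with values in the
-- group ring 𝔽₂[F] of the free group and value 1 at P (Fox calculus).  Along a path of Υ the value
-- is translated by the label of the path; closed paths thus have trivial label and Υ is a forest.
-- If P and P′ generate the same Δ, the value of the potential of P at P′ is a unit of 𝔽₂[F], hence a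
-- group element, as F is left-orderable; this element translates P to P′ in Γ₁ completed by infinite
-- trees, and its reduced form is the label of a path of Υ.
module Submission where

-- Coefficients are taken mod 2 because pairs of vertices are unordered: transport along Υ may
-- exchange the two ends of a pair, which over the integers would bring in signs. Potentials are
-- functions on the vertices of the trail, of which only the differences between identified vertices
-- matter. Whenever two distinct classes are merged, the potential can be shifted on one of them,
-- which gives the new difference any desired value and leaves the old ones alone. A step that
-- lowers e - v closes a cycle instead: it constrains differences that are already fixed, and no
-- shift is left to satisfy it. Values are allowed in the span of an arbitrary F-set because the
-- potential of P is compared with two others. Its value λ at P′ carries, by convolution, the value
-- at P of any potential to the value at P′. For the potential of P′ this exhibits an inverse of λ;
-- for the tautological potential, which sends each vertex of Γ₁ to itself, it shows which pair λ
-- translates to which. The letters act only partially on Γ₁, hence the completion by trees.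

-- Finite sums, numbers of distinct values, and merging of classes

module FiniteSums where

  open import Data.Bool using (Bool; true; false; _∧_; if_then_else_)
  open import Data.Nat using (ℕ; suc; _+_; _*_; _≤_; z≤n; s≤s)
  open import Data.Nat.Properties
  open import Data.Nat.ListAction using (sum)
  open import Data.List using (List; []; _∷_; _++_; map; concatMap; length; filterᵇ; deduplicate)
  open import Data.List.Properties using (map-cong; map-∘)
  open import Data.List.Membership.Propositional using (_∈_; _∉_)
  open import Data.List.Membership.Propositional.Properties using (∈-map⁺; ∈-map⁻; ∈-deduplicate⁺; ∈-deduplicate⁻; ∈-∃++; ∈-++⁺ˡ; ∈-++⁺ʳ; ∈-++⁻)
  open import Data.List.Relation.Unary.Any using (here; there)
  open import Data.List.Relation.Unary.All as All using (All; []; _∷_)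
  open import Data.List.Relation.Unary.AllPairs using ([]; _∷_)
  open import Data.List.Relation.Unary.Unique.Propositional using (Unique)
  import Data.List.Relation.Unary.Unique.DecPropositional.Properties as UDP
  import Data.List.Membership.DecPropositional as DecMem
  open import Data.Product using (_,_)
  open import Data.Sum using (inj₁; inj₂)
  open import Relation.Nullary using (yes; no; ⌊_⌋; contradiction)
  open import Relation.Binary using (DecidableEquality)
  open import Relation.Binary.PropositionalEquality
  open import Function using (_∘_)

  private variable
    A B C : Set

  ∑ : List A → (A → ℕ) → ℕ
  ∑ xs f = sum (map f xs)

  𝟙 : Bool → ℕ
  𝟙 true  = 1
  𝟙 false = 0

  𝟙-∧ : ∀ a b → 𝟙 (a ∧ b) ≡ 𝟙 a * 𝟙 b
  𝟙-∧ true  b = sym (+-identityʳ _)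
  𝟙-∧ false b = refl

  ∑-cong : ∀ (xs : List A) {f g : A → ℕ} → (∀ x → f x ≡ g x) → ∑ xs f ≡ ∑ xs g
  ∑-cong xs h = cong sum (map-cong h xs)

  ∑-cong-∈ : ∀ (xs : List A) {f g : A → ℕ} → (∀ {x} → x ∈ xs → f x ≡ g x) → ∑ xs f ≡ ∑ xs g
  ∑-cong-∈ []       h = refl
  ∑-cong-∈ (x ∷ xs) h = cong₂ _+_ (h (here refl)) (∑-cong-∈ xs (h ∘ there))

  ∑-++ : ∀ (xs ys : List A) f → ∑ (xs ++ ys) f ≡ ∑ xs f + ∑ ys f
  ∑-++ []       ys f = refl
  ∑-++ (x ∷ xs) ys f = trans (cong (f x +_) (∑-++ xs ys f)) (sym (+-assoc (f x) _ _))

  ∑-map : ∀ (h : A → B) xs (f : B → ℕ) → ∑ (map h xs) f ≡ ∑ xs (f ∘ h)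
  ∑-map h xs f = cong sum (sym (map-∘ xs))

  ∑-concatMap : ∀ (h : A → List B) xs (f : B → ℕ) → ∑ (concatMap h xs) f ≡ ∑ xs (λ x → ∑ (h x) f)
  ∑-concatMap h []       f = refl
  ∑-concatMap h (x ∷ xs) f = trans (∑-++ (h x) (concatMap h xs) f) (cong (∑ (h x) f +_) (∑-concatMap h xs f))

  ∑-zero : ∀ (xs : List A) → ∑ xs (λ _ → 0) ≡ 0
  ∑-zero []       = refl
  ∑-zero (x ∷ xs) = ∑-zero xs

  ∑-+ : ∀ (xs : List A) f g → ∑ xs (λ x → f x + g x) ≡ ∑ xs f + ∑ xs g
  ∑-+ []       f g = refl
  ∑-+ (x ∷ xs) f g rewrite ∑-+ xs f g = begin
    (f x + g x) + (∑ xs f + ∑ xs g) ≡⟨ +-assoc (f x) (g x) _ ⟩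
    f x + (g x + (∑ xs f + ∑ xs g)) ≡⟨ cong (f x +_) (sym (+-assoc (g x) _ _)) ⟩
    f x + ((g x + ∑ xs f) + ∑ xs g) ≡⟨ cong (λ z → f x + (z + ∑ xs g)) (+-comm (g x) _) ⟩
    f x + ((∑ xs f + g x) + ∑ xs g) ≡⟨ cong (f x +_) (+-assoc (∑ xs f) _ _) ⟩
    f x + (∑ xs f + (g x + ∑ xs g)) ≡⟨ sym (+-assoc (f x) _ _) ⟩
    (f x + ∑ xs f) + (g x + ∑ xs g) ∎
    where open ≡-Reasoning

  ∑-*ˡ : ∀ (xs : List A) c f → ∑ xs (λ x → c * f x) ≡ c * ∑ xs f
  ∑-*ˡ []       c f = sym (*-zeroʳ c)
  ∑-*ˡ (x ∷ xs) c f = trans (cong (c * f x +_) (∑-*ˡ xs c f)) (sym (*-distribˡ-+ c (f x) _))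

  ∑-*ʳ : ∀ (xs : List A) f c → ∑ xs (λ x → f x * c) ≡ ∑ xs f * c
  ∑-*ʳ xs f c = trans (∑-cong xs (λ x → *-comm (f x) c)) (trans (∑-*ˡ xs c f) (*-comm c _))

  ∑-swap : ∀ (xs : List A) (ys : List B) (f : A → B → ℕ) →
    ∑ xs (λ x → ∑ ys (f x)) ≡ ∑ ys (λ y → ∑ xs (λ x → f x y))
  ∑-swap []       ys f = sym (∑-zero ys)
  ∑-swap (x ∷ xs) ys f = trans (cong (∑ ys (f x) +_) (∑-swap xs ys f)) (sym (∑-+ ys (f x) _))

  ∑-const : ∀ (xs : List A) c → ∑ xs (λ _ → c) ≡ length xs * c
  ∑-const []       c = refl
  ∑-const (x ∷ xs) c = cong (c +_) (∑-const xs c)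

  ∑-filterᵇ : ∀ (P : A → Bool) xs f → ∑ (filterᵇ P xs) f ≡ ∑ xs (λ x → 𝟙 (P x) * f x)
  ∑-filterᵇ P []       f = refl
  ∑-filterᵇ P (x ∷ xs) f with P x
  ... | true  = cong₂ _+_ (sym (+-identityʳ _)) (∑-filterᵇ P xs f)
  ... | false = ∑-filterᵇ P xs f

  length-filterᵇ : ∀ (P : A → Bool) xs → length (filterᵇ P xs) ≡ ∑ xs (𝟙 ∘ P)
  length-filterᵇ P []       = refl
  length-filterᵇ P (x ∷ xs) with P x
  ... | true  = cong suc (length-filterᵇ P xs)
  ... | false = length-filterᵇ P xs

  ∑-single : ∀ {xs : List A} {c} (f : A → ℕ) → Unique xs → c ∈ xs →
    (∀ {x} → x ∈ xs → x ≢ c → f x ≡ 0) → ∑ xs f ≡ f c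
  ∑-single {xs = x ∷ xs} f (x∉ ∷ u) (here refl) h =
    trans (cong (f x +_) (trans (∑-cong-∈ xs (λ {y} y∈ → h (there y∈) (λ e → All.lookup x∉ y∈ (sym e)))) (∑-zero xs)))
          (+-identityʳ _)
  ∑-single {xs = x ∷ xs} f (x∉ ∷ u) (there c∈) h =
    cong₂ _+_ (h (here refl) (All.lookup x∉ c∈)) (∑-single f u c∈ (h ∘ there))

  ⊆-length : ∀ {xs ys : List A} → Unique xs → (∀ {z} → z ∈ xs → z ∈ ys) → length xs ≤ length ys
  ⊆-length {xs = []} u s = z≤n
  ⊆-length {A} {xs = x ∷ xs} (x∉ ∷ u) s with ∈-∃++ (s (here refl))
  ... | as , bs , refl = begin
      suc (length xs)         ≤⟨ s≤s (⊆-length u sub) ⟩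
      suc (length (as ++ bs)) ≡⟨ len as ⟩
      length (as ++ x ∷ bs)   ∎
    where
    open ≤-Reasoning
    len : ∀ (cs : List A) → suc (length (cs ++ bs)) ≡ length (cs ++ x ∷ bs)
    len []       = refl
    len (c ∷ cs) = cong suc (len cs)
    sub : ∀ {z} → z ∈ xs → z ∈ as ++ bs
    sub z∈ with ∈-++⁻ as (s (there z∈))
    ... | inj₁ z∈a          = ∈-++⁺ˡ z∈a
    ... | inj₂ (there z∈b)  = ∈-++⁺ʳ as z∈b
    ... | inj₂ (here refl)  = contradiction refl (All.lookup x∉ z∈)

  module Distinct {A : Set} (_≟_ : DecidableEquality A) where

    open DecMem _≟_ using (_∈?_)

    D : List A → ℕ
    D xs = length (deduplicate _≟_ xs)

    dedup-! : ∀ xs → Unique (deduplicate _≟_ xs)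
    dedup-! = UDP.deduplicate-! _≟_

    D-unique : ∀ {xs ys} → Unique ys → (∀ {z} → z ∈ xs → z ∈ ys) → (∀ {z} → z ∈ ys → z ∈ xs) → D xs ≡ length ys
    D-unique {xs} u f g = ≤-antisym
      (⊆-length (dedup-! xs) (f ∘ ∈-deduplicate⁻ _≟_ xs))
      (⊆-length u (∈-deduplicate⁺ _≟_ ∘ g))

    D-same : ∀ {xs ys} → (∀ {z} → z ∈ xs → z ∈ ys) → (∀ {z} → z ∈ ys → z ∈ xs) → D xs ≡ D ys
    D-same {xs} {ys} f g = D-unique (dedup-! ys) (∈-deduplicate⁺ _≟_ ∘ f) (g ∘ ∈-deduplicate⁻ _≟_ ys)

    D-∈ : ∀ {x xs} → x ∈ xs → D (x ∷ xs) ≡ D xs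
    D-∈ x∈ = D-same (λ { (here refl) → x∈ ; (there z∈) → z∈ }) there

    D-∉ : ∀ {x xs} → x ∉ xs → D (x ∷ xs) ≡ suc (D xs)
    D-∉ {x} {xs} x∉ = D-unique (All.tabulate (λ y∈ e → x∉ (subst (_∈ xs) (sym e) (∈-deduplicate⁻ _≟_ xs y∈))) ∷ dedup-! xs)
       (λ { (here e) → here e ; (there z∈) → there (∈-deduplicate⁺ _≟_ z∈) })
       (λ { (here e) → here e ; (there z∈) → there (∈-deduplicate⁻ _≟_ xs z∈) })

  module _ {B C : Set} (_≟B_ : DecidableEquality B) (_≟C_ : DecidableEquality C) where
    private
      module DB = Distinct _≟B_
      module DC = Distinct _≟C_

    -- The number of distinct values depends only on which entries coincide. Vertex and edge counts
    -- can therefore be compared between labellings with values in different types.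
    D-kernel : ∀ (xs : List A) {f : A → B} {g : A → C} →
      (∀ {a b} → a ∈ xs → b ∈ xs → f a ≡ f b → g a ≡ g b) → (∀ {a b} → a ∈ xs → b ∈ xs → g a ≡ g b → f a ≡ f b) →
      DB.D (map f xs) ≡ DC.D (map g xs)
    D-kernel []       h k = refl
    D-kernel (x ∷ xs) {f} {g} h k with DecMem._∈?_ _≟B_ (f x) (map f xs) | D-kernel xs {f} {g} (λ a b → h (there a) (there b)) (λ a b → k (there a) (there b))
    ... | yes fx∈ | ih with ∈-map⁻ f fx∈
    ...   | y , y∈ , e = trans (DB.D-∈ fx∈) (trans ih (sym (DC.D-∈ (subst (_∈ map g xs) (sym (h (here refl) (there y∈) e)) (∈-map⁺ g y∈)))))
    D-kernel (x ∷ xs) {f} {g} h k | no fx∉ | ih = trans (DB.D-∉ fx∉) (trans (cong suc ih) (sym (DC.D-∉ gx∉)))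
      where
      gx∉ : g x ∉ map g xs
      gx∉ gx∈ with ∈-map⁻ g gx∈
      ... | y , y∈ , e = fx∉ (subst (_∈ map f xs) (sym (k (here refl) (there y∈) e)) (∈-map⁺ f y∈))

  module Merge {A B : Set} (_≟_ : DecidableEquality B) where
    open Distinct _≟_

    merge : (A → B) → A → A → A → B
    merge f u v z = if ⌊ f z ≟ f u ⌋ then f v else f z

    merge-≡ : ∀ f {u v z} → f z ≡ f u → merge f u v z ≡ f v
    merge-≡ f {u} {v} {z} e with f z ≟ f u
    ... | yes _ = refl
    ... | no ne = contradiction e ne

    merge-≢ : ∀ f {u v z} → f z ≢ f u → merge f u v z ≡ f z
    merge-≢ f {u} {v} {z} e with f z ≟ f u
    ... | yes q = contradiction q e
    ... | no _  = refl

    merge-mono : ∀ f {u v a b} → f a ≡ f b → merge f u v a ≡ merge f u v b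
    merge-mono f {u} {v} e rewrite e = refl

    merge-joins : ∀ f {u v} → merge f u v u ≡ merge f u v v
    merge-joins f {u} {v} with f v ≟ f u
    ... | yes e = merge-≡ f refl
    ... | no ne = merge-≡ f refl

    data Related (f : A → B) (u v a b : A) : Set where
      same  : f a ≡ f b → Related f u v a b
      cross : f a ≡ f u → f b ≡ f v → Related f u v a b
      cross′ : f a ≡ f v → f b ≡ f u → Related f u v a b

    merge-inv : ∀ f {u v a b} → merge f u v a ≡ merge f u v b → Related f u v a b
    merge-inv f {u} {v} {a} {b} e with f a ≟ f u | f b ≟ f u
    ... | yes p | yes q = same (trans p (sym q))
    ... | yes p | no _  = cross p (sym e)
    ... | no _  | yes q = cross′ e q
    ... | no _  | no _  = same e

    -- Exactly the value `f u` disappears: the entries that carried it now carry `f v`, which was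
    -- already a value since `v` is listed.
    D-merge : ∀ f {u v xs} → f u ≢ f v → u ∈ xs → v ∈ xs → D (map f xs) ≡ suc (D (map (merge f u v) xs))
    D-merge f {u} {v} {xs} ne u∈ v∈ = trans
        (D-same {ys = f u ∷ map (merge f u v) xs} to from) (D-∉ fu∉)
      where
      to : ∀ {z} → z ∈ map f xs → z ∈ f u ∷ map (merge f u v) xs
      to z∈ with ∈-map⁻ f z∈
      ... | y , y∈ , refl with f y ≟ f u
      ...   | yes e = here e
      ...   | no ny = there (subst (_∈ map (merge f u v) xs) (merge-≢ f ny) (∈-map⁺ (merge f u v) y∈))
      from : ∀ {z} → z ∈ f u ∷ map (merge f u v) xs → z ∈ map f xs
      from (here refl) = ∈-map⁺ f u∈
      from (there z∈) with ∈-map⁻ (merge f u v) z∈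
      ... | y , y∈ , refl with f y ≟ f u
      ...   | yes e = ∈-map⁺ f v∈
      ...   | no ny = ∈-map⁺ f y∈
      fu∉ : f u ∉ map (merge f u v) xs
      fu∉ z∈ with ∈-map⁻ (merge f u v) z∈
      ... | y , y∈ , e with f y ≟ f u
      ...   | yes _ = ne e
      ...   | no ny = ny (sym e)

-- Sets with an action of the free group, and their mod 2 chains

module FreeActions where

  open import Defs
  open import Data.Bool using (Bool; true; false; not; _∧_; _xor_; T)
  open import Data.Bool.Properties using (T-∧; xor-assoc; not-involutive) renaming (_≟_ to _≟ᵇ_)
  open import Data.Nat using (ℕ; zero; suc)
  open import Data.Vec as Vec using (Vec; []; _∷_)
  open import Data.List using (List; []; _∷_; _++_; map; foldr)
  open import Data.Product using (_,_; proj₁; proj₂)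
  open import Relation.Nullary using (yes; no; ⌊_⌋; contradiction)
  open import Relation.Binary using (DecidableEquality)
  open import Relation.Binary.PropositionalEquality
  open import Function using (_∘_)
  open import Function.Bundles using (Equivalence)

  agreesᵇ : ∀ n → (Vec Bool n → Bool) → (Vec Bool n → Bool) → Bool
  agreesᵇ zero    f g = not (f [] xor g [])
  agreesᵇ (suc n) f g = agreesᵇ n (f ∘ (true ∷_)) (g ∘ (true ∷_)) ∧ agreesᵇ n (f ∘ (false ∷_)) (g ∘ (false ∷_))

  -- Identities of `_xor_` are decided by evaluation: at concrete `n`, `f` and `g` the hypothesis
  -- reduces to the unit type, so that `_` can stand for it.
  truthTable : ∀ n (f g : Vec Bool n → Bool) → T (agreesᵇ n f g) → ∀ v → f v ≡ g v
  truthTable zero f g t [] with f [] | g []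
  ... | true  | true  = refl
  ... | false | false = refl
  truthTable (suc n) f g t (true ∷ v)  = truthTable n _ _ (proj₁ (Equivalence.to T-∧ t)) v
  truthTable (suc n) f g t (false ∷ v) = truthTable n _ _ (proj₂ (Equivalence.to (T-∧ {agreesᵇ n (f ∘ (true ∷_)) (g ∘ (true ∷_))}) t)) v

  inv : ∀ {k} → Letter k → Letter k
  inv (i , b) = i , not b

  inv-inv : ∀ {k} (l : Letter k) → inv (inv l) ≡ l
  inv-inv (i , b) = cong (i ,_) (not-involutive b)

  -- Only the letters have to act: a free group has no relations besides the cancellation of a
  -- letter with its inverse. The action is a left action, so `act*` applies the last letter of a
  -- word first.
  record FSet (k : ℕ) : Set₁ where
    field
      X       : Set
      _≟X_    : DecidableEquality X
      act     : Letter k → X → X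
      act-inv : ∀ l x → act (inv l) (act l x) ≡ x

    act-inv′ : ∀ l x → act l (act (inv l) x) ≡ x
    act-inv′ l x = trans (cong (λ z → act z (act (inv l) x)) (sym (inv-inv l))) (act-inv (inv l) x)

    act* : Word k → X → X
    act* w x = foldr act x w

    -- Elements of 𝔽₂[X] are lists; only the parities of the multiplicities matter.
    par : X → List X → Bool
    par x []       = false
    par x (y ∷ ys) = ⌊ x ≟X y ⌋ xor par x ys

    infix 4 _≈_
    _≈_ : List X → List X → Set
    xs ≈ ys = ∀ x → par x xs ≡ par x ys

    par-++ : ∀ x xs ys → par x (xs ++ ys) ≡ par x xs xor par x ys
    par-++ x []       ys = refl
    par-++ x (y ∷ xs) ys = trans (cong (⌊ x ≟X y ⌋ xor_) (par-++ x xs ys)) (sym (xor-assoc ⌊ x ≟X y ⌋ _ _))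

    par-act : ∀ l x ys → par x (map (act l) ys) ≡ par (act (inv l) x) ys
    par-act l x []       = refl
    par-act l x (y ∷ ys) = cong₂ _xor_ same (par-act l x ys)
      where
      same : ⌊ x ≟X act l y ⌋ ≡ ⌊ act (inv l) x ≟X y ⌋
      same with x ≟X act l y | act (inv l) x ≟X y
      ... | yes _ | yes _ = refl
      ... | no _  | no _  = refl
      ... | yes p | no q  = contradiction (trans (cong (act (inv l)) p) (act-inv l y)) q
      ... | no p  | yes q = contradiction (trans (sym (act-inv′ l x)) (cong (act l) q)) p

-- Folding a trail, and potentials that survive it

module Folding where

  open import Defs
  open FiniteSums
  open FreeActions
  open import Data.Bool using (Bool; true; false; _xor_; if_then_else_)
  open import Data.Nat as ℕ using (ℕ; suc; _≤_; _<_; _+_; s≤s)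
  open import Data.Nat.Properties using (≤-refl; ≤-trans; ≤-reflexive; suc-injective; +-suc; +-identityʳ; n<1+n; m<n⇒m<1+n; ≤-pred; <-≤-trans; <⇒≤)
  open import Data.Fin as Fin using (Fin; suc)
  open import Data.Fin.Properties using (any?)
  open import Data.Vec using ([]; _∷_)
  open import Data.List using (List; []; _∷_; _++_; map; length; allFin)
  open import Data.List.Properties using (map-id; length-tabulate)
  open import Data.List.Membership.Propositional using (_∈_)
  open import Data.List.Membership.Propositional.Properties using (∈-allFin)
  open import Data.List.Relation.Unary.Any using (here; there)
  open import Data.List.Relation.Unary.Unique.Propositional.Properties using (allFin⁺)
  open import Data.Product using (Σ; _×_; _,_; proj₁; proj₂)
  open import Data.Product.Properties using (≡-dec)
  open import Data.Sum using (_⊎_; inj₁; inj₂)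
  open import Relation.Nullary using (¬_; yes; no; Dec; ⌊_⌋; contradiction; ¬?)
  open import Relation.Nullary.Decidable using (_×-dec_; _⊎-dec_; decidable-stable)
  open import Relation.Binary.PropositionalEquality
  open import Function using (_∘_; id)

  Dallfin-id : ∀ n → Distinct.D Fin._≟_ (map id (allFin n)) ≡ n
  Dallfin-id n = trans (Distinct.D-unique Fin._≟_ {ys = allFin n} (allFin⁺ n)
    (λ {z} _ → ∈-allFin z) (λ z∈ → subst (_ ∈_) (sym (map-id (allFin n))) z∈)) (length-tabulate id)

  module _ {k : ℕ} (w : Word k) where

    private
      V : Set
      V = Vtx w
      N : ℕ
      N = suc (length w)
      lab : EIdx w → Fin k
      o t : EIdx w → V
      o = origin w
      t = terminus w
      lab = label w

    -- The finest folded partition identifying the pairs of `E`, as an inductive relation: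
    -- potentials can then be carried along by recursion on the reason why two vertices are
    -- identified.
    data Cl (E : List (V × V)) : V → V → Set where
      base : ∀ {a b} → (a , b) ∈ E → Cl E a b
      rf   : ∀ {a} → Cl E a a
      sy   : ∀ {a b} → Cl E a b → Cl E b a
      tr   : ∀ {a b c} → Cl E a b → Cl E b c → Cl E a c
      fo   : ∀ {h l} → lab h ≡ lab l → Cl E (o h) (o l) → Cl E (t h) (t l)
      ft   : ∀ {h l} → lab h ≡ lab l → Cl E (t h) (t l) → Cl E (o h) (o l)

    Cl-mono : ∀ {E E′ a b} → (∀ {e} → e ∈ E → e ∈ E′) → Cl E a b → Cl E′ a b
    Cl-mono s (base x) = base (s x)
    Cl-mono s rf = rf
    Cl-mono s (sy c) = sy (Cl-mono s c)
    Cl-mono s (tr c c′) = tr (Cl-mono s c) (Cl-mono s c′)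
    Cl-mono s (fo e c) = fo e (Cl-mono s c)
    Cl-mono s (ft e c) = ft e (Cl-mono s c)

    Cl-min : ∀ {E q} → Identifies w q E → Folded w q → ∀ {a b} → Cl E a b → q a ≡ q b
    Cl-min i f (base x) = i _ _ x
    Cl-min i f rf = refl
    Cl-min i f (sy c) = sym (Cl-min i f c)
    Cl-min i f (tr c d) = trans (Cl-min i f c) (Cl-min i f d)
    Cl-min i f (fo {h} {l} e c) = proj₁ (f h l e) (Cl-min i f c)
    Cl-min i f (ft {h} {l} e c) = proj₂ (f h l e) (Cl-min i f c)

    Gen : Part w → List (V × V) → Set
    Gen p E = ∀ a b → (p a ≡ p b → Cl E a b) × (Cl E a b → p a ≡ p b)

    open Distinct (Fin._≟_ {N}) using () renaming (D to DV)
    open Distinct (Fin._≟_ {length w}) using () renaming (D to DE)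
    private
      module MV = Merge {V} {V} Fin._≟_
      module ME = Merge {EIdx w} {EIdx w} Fin._≟_

    module _ (S : FSet k) where
      open FSet S

      -- In characteristic 2 this is the difference f a − f b.
      δ : (V → List X) → X → V → V → Bool
      δ f x a b = par x (f a) xor par x (f b)

      -- For edges labelled i this is f(t h) - f(t l) = g_i (f(o h) - f(o l)), read off at the point
      -- g_i x: the transport rule of Fox calculus.
      Rule : (V → List X) → EIdx w → EIdx w → Set
      Rule f h l = ∀ x → δ f (act (lab h , true) x) (t h) (t l) ≡ δ f x (o h) (o l)

      δ-trans : ∀ f x a b c → δ f x a b xor δ f x b c ≡ δ f x a c
      δ-trans f x a b c = truthTable 3
        (λ { (a ∷ b ∷ c ∷ []) → (a xor b) xor (b xor c) }) (λ { (a ∷ b ∷ c ∷ []) → a xor c }) _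
        (par x (f a) ∷ par x (f b) ∷ par x (f c) ∷ [])

      δ-sym : ∀ f x a b → δ f x a b ≡ δ f x b a
      δ-sym f x a b = truthTable 2 (λ { (a ∷ b ∷ []) → a xor b }) (λ { (a ∷ b ∷ []) → b xor a }) _
        (par x (f a) ∷ par x (f b) ∷ [])

      δ-refl : ∀ f x a → δ f x a a ≡ false
      δ-refl f x a = truthTable 1 (λ { (a ∷ []) → a xor a }) (λ _ → false) _ (par x (f a) ∷ [])

      Rule-trans : ∀ {f h l j} → lab h ≡ lab l → Rule f h l → Rule f l j → Rule f h j
      Rule-trans {f} {h} {l} {j} e r s x = begin
        δ f (act (lab h , true) x) (t h) (t j)
          ≡⟨ δ-trans f _ (t h) (t l) (t j) ⟨
        δ f (act (lab h , true) x) (t h) (t l) xor δ f (act (lab h , true) x) (t l) (t j)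
          ≡⟨ cong₂ _xor_ (r x) (trans (cong (λ i → δ f (act (i , true) x) (t l) (t j)) e) (s x)) ⟩
        δ f x (o h) (o l) xor δ f x (o l) (o j)
          ≡⟨ δ-trans f x (o h) (o l) (o j) ⟩
        δ f x (o h) (o j) ∎
        where open ≡-Reasoning

      Rule-sym : ∀ {f h l} → lab h ≡ lab l → Rule f h l → Rule f l h
      Rule-sym {f} {h} {l} e r x = trans (δ-sym f _ (t l) (t h))
        (trans (cong (λ i → δ f (act (i , true) x) (t h) (t l)) (sym e)) (trans (r x) (δ-sym f x (o h) (o l))))

      Rule-refl : ∀ {f} h → Rule f h h
      Rule-refl {f} h x = trans (δ-refl f _ (t h)) (sym (δ-refl f x (o h)))

      module _ (q : V → V) {a b : V} (ne : q a ≢ q b) (f : V → List X) (c : List X) where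
        private
          shift = f a ++ f b ++ c

        -- Adding one constant on the whole class of `a` preserves all differences inside classes.
        -- The constant f(a) + f(b) + c turns the difference between `a` and `b` into `c`.
        gauge : V → List X
        gauge z = if ⌊ q z Fin.≟ q a ⌋ then shift ++ f z else f z

        gauge-same : ∀ {z z′} → q z ≡ q z′ → ∀ x → δ gauge x z z′ ≡ δ f x z z′
        gauge-same {z} {z′} e x with q z Fin.≟ q a | q z′ Fin.≟ q a
        ... | yes _ | yes _ rewrite par-++ x shift (f z) | par-++ x shift (f z′) = truthTable 3
          (λ { (s ∷ a ∷ b ∷ []) → (s xor a) xor (s xor b) }) (λ { (s ∷ a ∷ b ∷ []) → a xor b }) _ (par x shift ∷ _ ∷ _ ∷ [])
        ... | no _  | no _  = refl
        ... | yes p | no n  = contradiction (trans (sym e) p) n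
        ... | no n  | yes p = contradiction (trans e p) n

        gauge-joined : ∀ x → δ gauge x a b ≡ par x c
        gauge-joined x with q a Fin.≟ q a | q b Fin.≟ q a
        ... | no n  | _     = contradiction refl n
        ... | yes _ | yes e = contradiction (sym e) ne
        ... | yes _ | no _ rewrite par-++ x shift (f a) | par-++ x (f a) (f b ++ c) | par-++ x (f b) c = truthTable 3
          (λ { (a ∷ b ∷ c ∷ []) → ((a xor (b xor c)) xor a) xor b }) (λ { (a ∷ b ∷ c ∷ []) → c }) _ (par x (f a) ∷ par x (f b) ∷ par x c ∷ [])

    Prescribed : List (V × V) → (S : FSet k) (v : V × V → List (FSet.X S)) → (V → List (FSet.X S)) → Set
    Prescribed E S v f = ∀ {a b} → (a , b) ∈ E → ∀ x → δ S f x a b ≡ FSet.par S x (v (a , b))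

    -- Every prescription on the generating pairs is allowed; this freedom expresses that the pairs
    -- satisfy no linear relation over the group ring.
    Potentials : List (V × V) → (EIdx w → EIdx w → Set) → Set₁
    Potentials E _~_ = ∀ (S : FSet k) v → Σ (V → List (FSet.X S)) λ f →
      Prescribed E S v f × (∀ {h l} → h ~ l → Rule S f h l)

    #V : (V → V) → ℕ
    #V q = DV (map q (allFin N))

    #E : (EIdx w → EIdx w) → ℕ
    #E κ = DE (map κ (allFin (length w)))

    -- An intermediate stage of the folding: vertices are identified by q, edges by κ.
    -- Each identification keeps e − v or lowers it, and as long as it has never been
    -- lowered, potentials with arbitrary prescribed values survive.
    record Stage (E : List (V × V)) : Set₁ where
      field
        q     : V → V
        κ     : EIdx w → EIdx w
        κ-lab : ∀ {h l} → κ h ≡ κ l → lab h ≡ lab l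
        κ-o   : ∀ {h l} → κ h ≡ κ l → q (o h) ≡ q (o l)
        κ-t   : ∀ {h l} → κ h ≡ κ l → q (t h) ≡ q (t l)
        sound : ∀ {a b} → q a ≡ q b → Cl E a b
        ident : ∀ {a b} → (a , b) ∈ E → q a ≡ q b
        count : (suc (#E κ) < #V q + length E) ⊎ (suc (#E κ) ≡ #V q + length E × Potentials E (λ h l → κ h ≡ κ l))
      v e : ℕ
      v = #V q
      e = #E κ

    start : Stage []
    start = record
      { q = id ; κ = id ; κ-lab = cong lab ; κ-o = cong o ; κ-t = cong t
      ; sound = λ { refl → rf } ; ident = λ ()
      -- The trail is a path, with one more vertex than edges. There is nothing to prescribe yet,
      -- and the zero potential serves.
      ; count = inj₂ (trans (cong suc (Dallfin-id (length w))) (trans (sym (Dallfin-id N)) (sym (+-identityʳ _))) ,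
          λ S v → (λ _ → []) , (λ ()) , λ { {h} refl → Rule-refl S {λ _ → []} h }) }

    identify : ∀ {E} a b → Stage E → Stage ((a , b) ∷ E)
    identify {E} a b s with Stage.q s a Fin.≟ Stage.q s b
    ... | yes eq = record
      { q = q ; κ = κ ; κ-lab = κ-lab ; κ-o = κ-o ; κ-t = κ-t ; sound = Cl-mono there ∘ sound
      ; ident = λ { (here refl) → eq ; (there m) → ident m }
      -- A pair that is already identified lengthens `E` without lowering the number of classes, so
      -- the inequality becomes strict and stays so.
      ; count = inj₁ (lower count) }
      where
      open Stage s
      lower : (suc e < v + length E) ⊎ (suc e ≡ v + length E × Potentials E (λ h l → κ h ≡ κ l)) → suc e < v + suc (length E)
      lower (inj₁ lt) = ≤-trans (m<n⇒m<1+n lt) (≤-reflexive (sym (+-suc v (length E))))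
      lower (inj₂ (eq , _)) = ≤-trans (s≤s (≤-reflexive eq)) (≤-reflexive (sym (+-suc v (length E))))
    ... | no ne = record
      { q = q′ ; κ = κ ; κ-lab = κ-lab ; κ-o = MV.merge-mono q ∘ κ-o ; κ-t = MV.merge-mono q ∘ κ-t
      ; sound = snd ∘ MV.merge-inv q
      ; ident = λ { (here refl) → MV.merge-joins q ; (there m) → MV.merge-mono q (ident m) }
      ; count = step count }
      where
      open Stage s
      q′ = MV.merge q a b
      v′ = #V q′
      v≡ : v + length E ≡ v′ + suc (length E)
      v≡ = trans (cong (_+ length E) (MV.D-merge q ne (∈-allFin a) (∈-allFin b))) (sym (+-suc v′ (length E)))
      snd : ∀ {c d} → MV.Related q a b c d → Cl ((a , b) ∷ E) c d
      snd (MV.same x)     = Cl-mono there (sound x)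
      snd (MV.cross x y)  = tr (Cl-mono there (sound x)) (tr (base (here refl)) (sy (Cl-mono there (sound y))))
      snd (MV.cross′ x y) = tr (Cl-mono there (sound x)) (tr (sy (base (here refl))) (sy (Cl-mono there (sound y))))
      step : (suc e < v + length E) ⊎ (suc e ≡ v + length E × Potentials E (λ h l → κ h ≡ κ l)) →
             (suc e < v′ + suc (length E)) ⊎ (suc e ≡ v′ + suc (length E) × Potentials ((a , b) ∷ E) (λ h l → κ h ≡ κ l))
      step (inj₁ lt) = inj₁ (≤-trans lt (≤-reflexive v≡))
      step (inj₂ (eq , pot)) = inj₂ (trans eq v≡ , λ S val →
        let (f , pre , rule) = pot S val
            c = val (a , b)
            g = gauge S q ne f c
            old : ∀ {z z′} → q z ≡ q z′ → ∀ x → δ S g x z z′ ≡ δ S f x z z′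
            old = gauge-same S q ne f c
        in g , (λ { (here refl) → gauge-joined S q ne f c
                  ; (there m) x → trans (old (ident m) x) (pre m x) })
             , λ r x → trans (old (κ-t r) _) (trans (rule r x) (sym (old (κ-o r) x))))

    initial : ∀ E → Stage E
    initial []            = start
    initial ((a , b) ∷ E) = identify a b (initial E)

    module _ {E : List (V × V)} (s : Stage E) {h l : EIdx w} (lb : lab h ≡ lab l) (ne : Stage.κ s h ≢ Stage.κ s l) where
      open Stage s
      private
        κ′ = ME.merge κ h l
        e′ = #E κ′
        e≡ : e ≡ suc e′
        e≡ = ME.D-merge κ ne (∈-allFin h) (∈-allFin l)

      -- Gluing two edge classes lowers e by one. If the vertices are `kept`, then e - v drops and
      -- nothing more is claimed. If two vertex classes are `joined` as well, then e - v is
      -- unchanged and the potential has to be repaired.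
      data Glued (q′ : V → V) : Set₁ where
        kept   : q′ ≡ q → Glued q′
        joined : suc (#V q′) ≡ v →
          (∀ S (f : V → List (FSet.X S)) → (∀ {i j} → κ i ≡ κ j → Rule S f i j) →
             Σ (V → List (FSet.X S)) λ g → (∀ {z z′} → q z ≡ q z′ → ∀ x → δ S g x z z′ ≡ δ S f x z z′) × Rule S g h l) →
          Glued q′

      glueEdges : (q′ : V → V) → (∀ {a b} → q a ≡ q b → q′ a ≡ q′ b) → (∀ {a b} → q′ a ≡ q′ b → Cl E a b) →
        q′ (o h) ≡ q′ (o l) → q′ (t h) ≡ q′ (t l) → Glued q′ → Σ (Stage E) λ s′ → e ≡ suc (Stage.e s′)
      glueEdges q′ mono snd eo et gl = record
        { q = q′ ; κ = κ′
        ; κ-lab = lab′ ∘ ME.merge-inv κ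
        ; κ-o = λ r → end o (mono ∘ κ-o) eo (ME.merge-inv κ r)
        ; κ-t = λ r → end t (mono ∘ κ-t) et (ME.merge-inv κ r)
        ; sound = snd ; ident = mono ∘ ident ; count = cnt gl count } , e≡
        where
        lab′ : ∀ {i j} → ME.Related κ h l i j → lab i ≡ lab j
        lab′ (ME.same x)     = κ-lab x
        lab′ (ME.cross x y)  = trans (κ-lab x) (trans lb (sym (κ-lab y)))
        lab′ (ME.cross′ x y) = trans (κ-lab x) (trans (sym lb) (sym (κ-lab y)))
        end : (c : EIdx w → V) → (∀ {i j} → κ i ≡ κ j → q′ (c i) ≡ q′ (c j)) → q′ (c h) ≡ q′ (c l) →
              ∀ {i j} → ME.Related κ h l i j → q′ (c i) ≡ q′ (c j)
        end c κ-c ec (ME.same x)     = κ-c x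
        end c κ-c ec (ME.cross x y)  = trans (κ-c x) (trans ec (sym (κ-c y)))
        end c κ-c ec (ME.cross′ x y) = trans (κ-c x) (trans (sym ec) (sym (κ-c y)))
        v′ = #V q′
        cnt : Glued q′ → (suc e < v + length E) ⊎ (suc e ≡ v + length E × Potentials E (λ i j → κ i ≡ κ j)) →
              (suc e′ < v′ + length E) ⊎ (suc e′ ≡ v′ + length E × Potentials E (λ i j → κ′ i ≡ κ′ j))
        cnt (kept refl) (inj₁ lt) = inj₁ (<-≤-trans (n<1+n _) (≤-trans (≤-reflexive (cong suc (sym e≡))) (<⇒≤ lt)))
        cnt (kept refl) (inj₂ (eq , _)) = inj₁ (≤-reflexive (trans (cong suc (sym e≡)) eq))
        cnt (joined dv _) (inj₁ lt) = inj₁ (≤-pred (subst₂ (λ x y → suc x < y + length E) e≡ (sym dv) lt))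
        cnt (joined dv ext) (inj₂ (eq , pot)) = inj₂ (suc-injective (trans (cong suc (sym e≡)) (trans eq (cong (_+ length E) (sym dv)))) ,
          λ S val → let (f , pre , rule) = pot S val
                        (g , old , new)  = ext S f rule
                        rule′ : ∀ {i j} → κ i ≡ κ j → Rule S g i j
                        rule′ r x = trans (old (κ-t r) _) (trans (rule r x) (sym (old (κ-o r) x)))
                        all : ∀ {i j} → ME.Related κ h l i j → Rule S g i j
                        all = λ { (ME.same x) → rule′ x
                                ; (ME.cross x y) → Rule-trans S {g} (κ-lab x) (rule′ x) (Rule-trans S {g} lb new (rule′ (sym y)))
                                ; (ME.cross′ x y) → Rule-trans S {g} (κ-lab x) (rule′ x) (Rule-trans S {g} (sym lb) (Rule-sym S {g} lb new) (rule′ (sym y))) }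
                    in g , (λ m x → trans (old (ident m) x) (pre m x)) , all ∘ ME.merge-inv κ)

      private
        merged-sound : ∀ {a b} → Cl E a b → ∀ {c d} → MV.Related q a b c d → Cl E c d
        merged-sound r (MV.same x)     = sound x
        merged-sound r (MV.cross x y)  = tr (sound x) (tr r (sy (sound y)))
        merged-sound r (MV.cross′ x y) = tr (sound x) (tr (sy r) (sy (sound y)))

      foldAtOrigin : q (o h) ≡ q (o l) → Σ (Stage E) λ s′ → e ≡ suc (Stage.e s′)
      foldAtOrigin eo with q (t h) Fin.≟ q (t l)
      ... | yes et = glueEdges q id sound eo et (kept refl)
      ... | no net = glueEdges (MV.merge q (t h) (t l)) (MV.merge-mono q)
          (merged-sound (fo lb (sound eo)) ∘ MV.merge-inv q) (MV.merge-mono q eo) (MV.merge-joins q)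
          (joined (sym (MV.D-merge q net (∈-allFin (t h)) (∈-allFin (t l)))) λ S f rule →
            let open FSet S
                -- The difference at the origins is already determined, and its translate by the
                -- label is imposed on the termini, which were distinct until now.
                c = map (act (lab h , true)) (f (o h) ++ f (o l))
                g = gauge S q net f c
            in g , gauge-same S q net f c , λ x → begin
              δ S g (act (lab h , true) x) (t h) (t l) ≡⟨ gauge-joined S q net f c _ ⟩
              par (act (lab h , true) x) c             ≡⟨ par-act (lab h , true) _ (f (o h) ++ f (o l)) ⟩
              par (act (inv (lab h , true)) (act (lab h , true) x)) (f (o h) ++ f (o l))
                ≡⟨ cong (λ y → par y (f (o h) ++ f (o l))) (act-inv (lab h , true) x) ⟩
              par x (f (o h) ++ f (o l))               ≡⟨ par-++ x (f (o h)) (f (o l)) ⟩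
              δ S f x (o h) (o l)                      ≡⟨ gauge-same S q net f c eo x ⟨
              δ S g x (o h) (o l) ∎)
        where open ≡-Reasoning

      foldAtTerminus : q (t h) ≡ q (t l) → Σ (Stage E) λ s′ → e ≡ suc (Stage.e s′)
      foldAtTerminus et with q (o h) Fin.≟ q (o l)
      ... | yes eo = glueEdges q id sound eo et (kept refl)
      ... | no neo = glueEdges (MV.merge q (o h) (o l)) (MV.merge-mono q)
          (merged-sound (ft lb (sound et)) ∘ MV.merge-inv q) (MV.merge-joins q) (MV.merge-mono q et)
          (joined (sym (MV.D-merge q neo (∈-allFin (o h)) (∈-allFin (o l)))) λ S f rule →
            let open FSet S
                c = map (act (lab h , false)) (f (t h) ++ f (t l))
                g = gauge S q neo f c
            in g , gauge-same S q neo f c , λ x → sym (begin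
              δ S g x (o h) (o l)                      ≡⟨ gauge-joined S q neo f c _ ⟩
              par x c                                  ≡⟨ par-act (lab h , false) _ (f (t h) ++ f (t l)) ⟩
              par (act (lab h , true) x) (f (t h) ++ f (t l)) ≡⟨ par-++ _ (f (t h)) (f (t l)) ⟩
              δ S f (act (lab h , true) x) (t h) (t l) ≡⟨ gauge-same S q neo f c et _ ⟨
              δ S g (act (lab h , true) x) (t h) (t l) ∎))
        where open ≡-Reasoning

    Unfolded : (V → V) → (EIdx w → EIdx w) → EIdx w → EIdx w → Set
    Unfolded q κ h l = lab h ≡ lab l × κ h ≢ κ l × (q (o h) ≡ q (o l) ⊎ q (t h) ≡ q (t l))

    unfolded? : ∀ q κ h l → Dec (Unfolded q κ h l)
    unfolded? q κ h l = (lab h Fin.≟ lab l) ×-dec ¬? (κ h Fin.≟ κ l) ×-dec ((q (o h) Fin.≟ q (o l)) ⊎-dec (q (t h) Fin.≟ q (t l)))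

    -- Each fold lowers the number of edge classes, which bounds the recursion.
    saturate : ∀ {E} n (s : Stage E) → Stage.e s ≤ n → Σ (Stage E) λ s → ∀ h l → ¬ Unfolded (Stage.q s) (Stage.κ s) h l
    saturate n s le with any? (λ h → any? (λ l → unfolded? (Stage.q s) (Stage.κ s) h l))
    ... | no none = s , λ h l u → none (h , l , u)
    ... | yes (h , l , lb , ne , ends) = next n le (fold ends)
      where
      fold : _ → Σ (Stage _) λ s′ → Stage.e s ≡ suc (Stage.e s′)
      fold (inj₁ eo) = foldAtOrigin s lb ne eo
      fold (inj₂ et) = foldAtTerminus s lb ne et
      next : ∀ n → Stage.e s ≤ n → (Σ (Stage _) λ s′ → Stage.e s ≡ suc (Stage.e s′)) → _
      next n le (s′ , eq) with ≤-trans (≤-reflexive (sym eq)) le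
      next (suc n) le (s′ , eq) | s≤s le′ = saturate n s′ le′

    SameEdge : Part w → EIdx w → EIdx w → Set
    SameEdge p h l = lab h ≡ lab l × p (o h) ≡ p (o l)

    record Generated (E : List (V × V)) : Set₁ where
      field
        p      : Part w
        folded : Folded w p
        gen    : Gen p E
        count  : (suc (numEdges w p) < numVertices w p + length E) ⊎
                 (suc (numEdges w p) ≡ numVertices w p + length E × Potentials E (SameEdge p))

    generate : ∀ E → Generated E
    generate E = record { p = q ; folded = folded ; gen = λ a b → sound , Cl-min (λ _ _ → ident) folded ; count = cnt count }
      where
      sat = saturate (Stage.e (initial E)) (initial E) ≤-refl
      s = proj₁ sat
      done = proj₂ sat
      open Stage s
      κ≡ : ∀ {h l} → lab h ≡ lab l → q (o h) ≡ q (o l) ⊎ q (t h) ≡ q (t l) → κ h ≡ κ l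
      κ≡ {h} {l} lb ends = decidable-stable (κ h Fin.≟ κ l) (λ ne → done h l (lb , ne , ends))
      folded : Folded w q
      folded h l lb = (λ eo → κ-t (κ≡ lb (inj₁ eo))) , (λ et → κ-o (κ≡ lb (inj₂ et)))
      -- With nothing left to fold, a label and one end determine the class under `κ`. The edge
      -- classes counted so far are thus the edges of the quotient.
      edges : numEdges w q ≡ e
      edges = D-kernel (≡-dec Fin._≟_ (≡-dec Fin._≟_ Fin._≟_)) Fin._≟_ (allFin (length w))
        (λ {h} {l} _ _ eq → κ≡ (cong proj₁ eq) (inj₁ (cong (proj₁ ∘ proj₂) eq)))
        (λ {h} {l} _ _ eq → cong₂ _,_ (κ-lab eq) (cong₂ _,_ (κ-o eq) (κ-t eq)))
      cnt : (suc e < v + length E) ⊎ (suc e ≡ v + length E × Potentials E (λ i j → κ i ≡ κ j)) →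
            (suc (numEdges w q) < v + length E) ⊎ (suc (numEdges w q) ≡ v + length E × Potentials E (SameEdge q))
      cnt (inj₁ lt) = inj₁ (subst (λ z → suc z < v + length E) (sym edges) lt)
      cnt (inj₂ (eq , pot)) = inj₂ (trans (cong suc edges) eq , λ S val →
        let (f , pre , rule) = pot S val in f , pre , λ { (lb , eo) → rule (κ≡ lb (inj₁ eo)) })

-- Generating sets and the Euler characteristic of a quotient

module GeneratingSets where

  open import Defs
  open FiniteSums
  open FreeActions
  open Folding
  open import Data.Bool using (true; false; not)
  open import Data.Bool.Properties using () renaming (_≟_ to _≟ᵇ_)
  open import Data.Nat as ℕ using (ℕ; zero; suc; _≤_; _<_; _+_; _∸_)
  open import Data.Nat.Properties using (≤-trans; ≤-reflexive; +-suc; m+n∸n≡m; m≤n+o⇒m∸n≤o; <⇒≤; m∸n+n≡m; m+n≤o⇒n≤o)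
  open import Data.Fin as Fin using (Fin; zero; suc)
  open import Data.List using (List; []; _∷_; map; length; allFin)
  open import Data.List.Properties using (map-∘; length-map; map-tabulate; map-cong)
  open import Data.List.Membership.Propositional using (_∈_; _∉_)
  open import Data.List.Membership.Propositional.Properties using (∈-map⁺; ∈-map⁻; ∈-allFin)
  import Data.List.Membership.DecPropositional as DecMem
  open import Data.List.Relation.Unary.Any using (here; there)
  open import Data.Product using (Σ; _×_; _,_; proj₁; proj₂; ∃-syntax)
  open import Data.Product.Properties using (≡-dec)
  open import Data.Sum using (_⊎_; inj₁; inj₂)
  open import Relation.Nullary using (yes; no; contradiction)
  open import Relation.Binary using (DecidableEquality)
  open import Relation.Binary.PropositionalEquality
  open import Function using (_∘_; id; mk⇔)
  open import Function.Bundles using (Equivalence)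

  module _ {k : ℕ} (w : Word k) where

    private
      V : Set
      V = Vtx w

    _≋_ : Part w → Part w → Set
    p ≋ q = ∀ a b → (p a ≡ p b → q a ≡ q b) × (q a ≡ q b → p a ≡ p b)

    ≋-sym : ∀ {p q} → p ≋ q → q ≋ p
    ≋-sym s a b = proj₂ (s a b) , proj₁ (s a b)

    ≋-trans : ∀ {p q r} → p ≋ q → q ≋ r → p ≋ r
    ≋-trans s u a b = proj₁ (u a b) ∘ proj₁ (s a b) , proj₂ (s a b) ∘ proj₂ (u a b)

    numVertices-≋ : ∀ {p q} → p ≋ q → numVertices w p ≡ numVertices w q
    numVertices-≋ {p} {q} s = D-kernel Fin._≟_ Fin._≟_ (allFin (suc (length w))) {p} {q} (λ _ _ → proj₁ (s _ _)) (λ _ _ → proj₂ (s _ _))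

    numEdges-≋ : ∀ {p q} → p ≋ q → numEdges w p ≡ numEdges w q
    numEdges-≋ {p} {q} s = D-kernel (≡-dec Fin._≟_ (≡-dec Fin._≟_ Fin._≟_)) (≡-dec Fin._≟_ (≡-dec Fin._≟_ Fin._≟_)) (allFin (length w))
      {λ j → label w j , p (origin w j) , p (terminus w j)} {λ j → label w j , q (origin w j) , q (terminus w j)}
      (λ _ _ e → cong₂ _,_ (cong proj₁ e) (cong₂ _,_ (proj₁ (s _ _) (cong (proj₁ ∘ proj₂) e)) (proj₁ (s _ _) (cong (proj₂ ∘ proj₂) e))))
      (λ _ _ e → cong₂ _,_ (cong proj₁ e) (cong₂ _,_ (proj₂ (s _ _) (cong (proj₁ ∘ proj₂) e)) (proj₂ (s _ _) (cong (proj₂ ∘ proj₂) e))))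

    χ-≋ : ∀ {p q} → p ≋ q → χ w p ≡ χ w q
    χ-≋ s = cong₂ (λ e v → suc e ∸ v) (numEdges-≋ s) (numVertices-≋ s)

    realizable⇒folded : ∀ {p} → Realizable w p → Folded w p
    realizable⇒folded {p} (_ , pos , neg) h l e with sign w h in sh | sign w l in sl
    ... | true  | true  = Equivalence.to (pos h l e (trans sh (sym sl))) , Equivalence.from (pos h l e (trans sh (sym sl)))
    ... | false | false = Equivalence.from (pos h l e (trans sh (sym sl))) , Equivalence.to (pos h l e (trans sh (sym sl)))
    ... | true  | false = Equivalence.to (neg h l e (trans sh (cong not (sym sl)))) , Equivalence.from (neg h l e (trans sh (cong not (sym sl))))
    ... | false | true  = (λ x → Equivalence.from (neg h l e (trans sh (cong not (sym sl)))) x) , (λ x → Equivalence.to (neg h l e (trans sh (cong not (sym sl)))) x)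

    folded⇒realizable : ∀ {p} → Folded w p → p (first w) ≡ p (last w) → Realizable w p
    folded⇒realizable {p} f z = z , pos , neg
      where
      pos : ∀ h l → _ → sign w h ≡ sign w l → _
      pos h l e s with sign w h | sign w l | f h l e
      ... | true  | true  | g = mk⇔ (proj₁ g) (proj₂ g)
      ... | false | false | g = mk⇔ (proj₂ g) (proj₁ g)
      neg : ∀ h l → _ → sign w h ≡ not (sign w l) → _
      neg h l e s with sign w h | sign w l | f h l e
      ... | true  | false | g = mk⇔ (proj₁ g) (proj₂ g)
      ... | false | true  | g = mk⇔ (proj₂ g) (proj₁ g)

    Gen⇒GeneratedBy : ∀ {p E} → Gen w p E → GeneratedBy w p E
    Gen⇒GeneratedBy g = (λ a b m → proj₂ (g a b) (base m)) ,
      (λ h l e → (λ x → proj₂ (g _ _) (fo {h = h} {l} e (proj₁ (g _ _) x))) , (λ x → proj₂ (g _ _) (ft {h = h} {l} e (proj₁ (g _ _) x)))) ,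
      λ q i f a b x → Cl-min w i f (proj₁ (g a b) x)

    -- Minimality compares `p` with partitions only, so the closure is first realized by one, namely
    -- the result of folding.
    GeneratedBy⇒Gen : ∀ {p E} → GeneratedBy w p E → Gen w p E
    GeneratedBy⇒Gen {p} {E} (i , f , m) a b =
      (λ x → proj₁ (G.gen a b) (m G.p (λ c d e → proj₂ (G.gen c d) (base e)) G.folded a b x)) , Cl-min w i f
      where module G = Generated (generate w E)

    Gen-≋ : ∀ {p q E} → Gen w p E → Gen w q E → p ≋ q
    Gen-≋ g h a b = proj₂ (h a b) ∘ proj₁ (g a b) , proj₂ (g a b) ∘ proj₁ (h a b)

    ≋-Gen : ∀ {p q E} → p ≋ q → Gen w p E → Gen w q E
    ≋-Gen s g a b = proj₁ (g a b) ∘ proj₂ (s a b) , proj₁ (s a b) ∘ proj₂ (g a b)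

    -- The trail has e - v + 1 = 0. A generating pair raises this number by at most one, and folding
    -- never raises it.
    χ≤length : ∀ {p E} → Gen w p E → χ w p ≤ length E
    χ≤length {p} {E} g = ≤-trans (≤-reflexive (χ-≋ (Gen-≋ g G.gen)))
        (m≤n+o⇒m∸n≤o (suc (numEdges w G.p)) (numVertices w G.p) (bound G.count))
      where
      module G = Generated (generate w E)
      bound : ∀ {a b} {P : Set₁} → (a < b) ⊎ (a ≡ b × P) → a ≤ b
      bound (inj₁ x) = <⇒≤ x
      bound (inj₂ (x , _)) = ≤-reflexive x

    -- `Folded` with values in any type. The recursion in `coincidences` removes the first letter,
    -- and the rest of a partition does not take its values among the vertices of the shorter trail.
    FoldedG : {A : Set} → (V → A) → Set
    FoldedG P = ∀ h l → label w h ≡ label w l →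
        ((P (origin w h) ≡ P (origin w l)) → (P (terminus w h) ≡ P (terminus w l))) ×
        ((P (terminus w h) ≡ P (terminus w l)) → (P (origin w h) ≡ P (origin w l)))

    triple : {A : Set} → (V → A) → EIdx w → Fin k × A × A
    triple P j = label w j , P (origin w j) , P (terminus w j)

  origin-suc : ∀ {k} (x : Letter k) w j → origin (x ∷ w) (suc j) ≡ suc (origin w j)
  origin-suc x w j with sign w j
  ... | true  = refl
  ... | false = refl

  terminus-suc : ∀ {k} (x : Letter k) w j → terminus (x ∷ w) (suc j) ≡ suc (terminus w j)
  terminus-suc x w j with sign w j
  ... | true  = refl
  ... | false = refl

  ends₀ : ∀ {k} (x : Letter k) w → (origin (x ∷ w) zero ≡ zero × terminus (x ∷ w) zero ≡ suc zero)
                                 ⊎ (origin (x ∷ w) zero ≡ suc zero × terminus (x ∷ w) zero ≡ zero)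
  ends₀ (i , true)  w = inj₁ (refl , refl)
  ends₀ (i , false) w = inj₂ (refl , refl)

  allFin-suc : ∀ n → allFin (suc n) ≡ zero ∷ map suc (allFin n)
  allFin-suc n = cong (zero ∷_) (sym (map-tabulate id suc))

  FoldedG-tail : ∀ {k} (x : Letter k) w {A : Set} {P : Vtx (x ∷ w) → A} → FoldedG (x ∷ w) P → FoldedG w (P ∘ suc)
  FoldedG-tail x w {P = P} f h l e with f (suc h) (suc l) e
  ... | g rewrite origin-suc x w h | origin-suc x w l | terminus-suc x w h | terminus-suc x w l = g

  -- Read the trail from its far end.  A new vertex class comes with a new edge class; a new edge
  -- class ending in an old vertex class is a coincidence, recorded in the generating list; everything
  -- else is forced by folding.
  coincidences : ∀ {k} (w : Word k) {A : Set} (_≟_ : DecidableEquality A) (P : Vtx w → A) → FoldedG w P →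
    Σ (List (Vtx w × Vtx w)) λ E →
      length E + Distinct.D _≟_ (map P (allFin (suc (length w))))
        ≡ suc (Distinct.D (≡-dec Fin._≟_ (≡-dec _≟_ _≟_)) (map (triple w P) (allFin (length w)))) ×
      (∀ a b → (a , b) ∈ E → P a ≡ P b) ×
      (∀ {B : Set} (Q : Vtx w → B) → (∀ a b → (a , b) ∈ E → Q a ≡ Q b) → FoldedG w Q → ∀ a b → P a ≡ P b → Q a ≡ Q b)
  coincidences [] _≟_ P f = [] , refl , (λ _ _ ()) , λ { Q i g zero zero e → refl }
  coincidences {k} w@(x@(i , s) ∷ w′) {A} _≟_ P f = result
    where
    ih = coincidences w′ _≟_ (P ∘ suc) (FoldedG-tail x w′ {P = P} f)
    E = proj₁ ih
    E↑ = map (λ { (a , b) → (suc a , suc b) }) E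
    _≟₃_ : DecidableEquality (Fin k × A × A)
    _≟₃_ = ≡-dec Fin._≟_ (≡-dec _≟_ _≟_)
    open Distinct _≟_ using (D; D-∈; D-∉)
    module D₃ = Distinct _≟₃_
    vs = map (P ∘ suc) (allFin (suc (length w′)))
    es = map (triple w′ (P ∘ suc)) (allFin (length w′))
    new = triple w P zero
    dv : D (map P (allFin (suc (length w)))) ≡ D (P zero ∷ vs)
    dv = cong D (trans (cong (map P) (allFin-suc (suc (length w′)))) (cong (P zero ∷_) (sym (map-∘ (allFin (suc (length w′)))))))
    triple-suc : ∀ j → triple w P (suc j) ≡ triple w′ (P ∘ suc) j
    triple-suc j = cong₂ (λ a b → label w′ j , P a , P b) (origin-suc x w′ j) (terminus-suc x w′ j)
    de : D₃.D (map (triple w P) (allFin (length w))) ≡ D₃.D (new ∷ es)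
    de = cong D₃.D (trans (cong (map (triple w P)) (allFin-suc (length w′)))
      (cong (new ∷_) (trans (sym (map-∘ (allFin (length w′)))) (map-cong triple-suc (allFin (length w′))))))
    length-E↑ : length E↑ ≡ length E
    length-E↑ = length-map _ E
    ident↑ : ∀ a b → (a , b) ∈ E↑ → P a ≡ P b
    ident↑ a b m with ∈-map⁻ _ m
    ... | (c , d) , m′ , refl = proj₁ (proj₂ (proj₂ ih)) c d m′
    lift : ∀ {B : Set} (Q : Vtx w → B) → (∀ a b → (a , b) ∈ E↑ → Q a ≡ Q b) → FoldedG w Q →
      ∀ a b → P (suc a) ≡ P (suc b) → Q (suc a) ≡ Q (suc b)
    lift Q i g = proj₂ (proj₂ (proj₂ ih)) (Q ∘ suc) (λ a b m → i (suc a) (suc b) (∈-map⁺ _ m)) (FoldedG-tail x w′ {P = Q} g)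
    extend : ∀ {B : Set} (Q : Vtx w → B) → (∀ a b → P (suc a) ≡ P (suc b) → Q (suc a) ≡ Q (suc b)) →
      (∀ c → P zero ≡ P (suc c) → Q zero ≡ Q (suc c)) → ∀ a b → P a ≡ P b → Q a ≡ Q b
    extend Q h z zero    zero    e = refl
    extend Q h z zero    (suc b) e = z b e
    extend Q h z (suc a) zero    e = sym (z a (sym e))
    extend Q h z (suc a) (suc b) e = h a b e
    result : Σ (List (Vtx w × Vtx w)) λ E →
      length E + D (map P (allFin (suc (length w)))) ≡ suc (D₃.D (map (triple w P) (allFin (length w)))) ×
      (∀ a b → (a , b) ∈ E → P a ≡ P b) ×
      (∀ {B : Set} (Q : Vtx w → B) → (∀ a b → (a , b) ∈ E → Q a ≡ Q b) → FoldedG w Q → ∀ a b → P a ≡ P b → Q a ≡ Q b)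
    result with DecMem._∈?_ _≟_ (P zero) vs
    -- A new class of s₀ makes the first edge new too, since s₀ is one of its ends; e and v grow
    -- together.
    ... | no P0∉ = E↑ , count , ident↑ , λ Q i g → extend Q (lift Q i g) (λ c e → contradiction (subst (_∈ vs) (sym e) (∈-map⁺ (P ∘ suc) (∈-allFin c))) P0∉)
      where
      new∉ : new ∉ es
      new∉ m with ∈-map⁻ (triple w′ (P ∘ suc)) m
      ... | j , _ , e with ends₀ x w′
      ...   | inj₁ (z , _) = P0∉ (subst (_∈ vs) (trans (sym (cong (proj₁ ∘ proj₂) e)) (cong P z)) (∈-map⁺ (P ∘ suc) (∈-allFin _)))
      ...   | inj₂ (_ , z) = P0∉ (subst (_∈ vs) (trans (sym (cong (proj₂ ∘ proj₂) e)) (cong P z)) (∈-map⁺ (P ∘ suc) (∈-allFin _)))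
      count : length E↑ + D (map P (allFin (suc (length w)))) ≡ suc (D₃.D (map (triple w P) (allFin (length w))))
      count = trans (cong₂ _+_ length-E↑ (trans dv (D-∉ P0∉))) (trans (+-suc (length E) (D vs))
        (trans (cong suc (proj₁ (proj₂ ih))) (cong suc (sym (trans de (D₃.D-∉ new∉))))))
    ... | yes P0∈ with DecMem._∈?_ _≟₃_ new es
    -- An earlier edge has the same label and the same end at s₁, so folding forces the class of s₀
    -- in any other folded labelling as well.
    ...   | yes new∈ = E↑ , count , ident↑ , λ Q i g → extend Q (lift Q i g) (forced Q i g)
      where
      count : length E↑ + D (map P (allFin (suc (length w)))) ≡ suc (D₃.D (map (triple w P) (allFin (length w))))
      count = trans (cong₂ _+_ length-E↑ (trans dv (D-∈ P0∈))) (trans (proj₁ (proj₂ ih)) (cong suc (sym (trans de (D₃.D-∈ new∈)))))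
      forced : ∀ {B : Set} (Q : Vtx w → B) → (∀ a b → (a , b) ∈ E↑ → Q a ≡ Q b) → FoldedG w Q → ∀ c → P zero ≡ P (suc c) → Q zero ≡ Q (suc c)
      forced Q i g c e with ∈-map⁻ (triple w′ (P ∘ suc)) new∈
      ... | j , _ , e₃ with g zero (suc j) (cong proj₁ e₃) | cong (proj₁ ∘ proj₂) e₃ | cong (proj₂ ∘ proj₂) e₃
      ...   | gj | eo | et rewrite origin-suc x w′ j | terminus-suc x w′ j with ends₀ x w′
      ...     | inj₁ (z , z′) = trans (trans (cong Q (sym z)) (proj₂ gj (trans (cong Q z′) (lift Q i g _ _ (trans (cong P (sym z′)) et)))))
                                      (lift Q i g _ _ (trans (sym eo) (trans (cong P z) e)))
      ...     | inj₂ (z′ , z) = trans (trans (cong Q (sym z)) (proj₁ gj (trans (cong Q z′) (lift Q i g _ _ (trans (cong P (sym z′)) eo)))))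
                                      (lift Q i g _ _ (trans (sym et) (trans (cong P z) e)))
    result | yes P0∈ | no new∉ with ∈-map⁻ (P ∘ suc) P0∈
    ... | c , _ , ec = (zero , suc c) ∷ E↑ , count , (λ { _ _ (here refl) → ec ; a b (there m) → ident↑ a b m }) , λ Q i g →
        let h = lift Q (λ a b → i a b ∘ there) g
        in extend Q h (λ d e → trans (i zero (suc c) (here refl)) (h c d (trans (sym ec) e)))
      where
      count : suc (length E↑) + D (map P (allFin (suc (length w)))) ≡ suc (D₃.D (map (triple w P) (allFin (length w))))
      count = cong suc (trans (cong₂ _+_ length-E↑ (trans dv (D-∈ P0∈))) (trans (proj₁ (proj₂ ih)) (sym (trans de (D₃.D-∉ new∉)))))

  module _ {k : ℕ} (w : Word k) where

    private
      walk : ∀ {p} → Folded w p → _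
      walk {p} f = coincidences w Fin._≟_ p f

    -- The truncated subtraction in `χ` loses nothing, because e + 1 exceeds v by the number of
    -- coincidences.
    χ+vertices : ∀ {p} → Folded w p → χ w p + numVertices w p ≡ suc (numEdges w p)
    χ+vertices {p} f = m∸n+n≡m (m+n≤o⇒n≤o (length (proj₁ (walk f))) (≤-reflexive (proj₁ (proj₂ (walk f)))))

    -- The coincidences of the trail number exactly e - v + 1, and all other identifications follow
    -- from them. Together with `χ≤length` this makes χ the smallest size of a generating set.
    smallGenerators : ∀ {p} → Folded w p → ∃[ E ] (GeneratedBy w p E × length E ≤ χ w p)
    smallGenerators {p} f = E , Gen⇒GeneratedBy w (≋-Gen w same G.gen) , ≤-reflexive (sym len)
      where
      E = proj₁ (walk f)
      module G = Generated (generate w E)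
      len : χ w p ≡ length E
      len = trans (cong (_∸ numVertices w p) (sym (proj₁ (proj₂ (walk f))))) (m+n∸n≡m (length E) (numVertices w p))
      same : _≋_ w G.p p
      same a b = (λ e → Cl-min w (proj₁ (proj₂ (proj₂ (walk f)))) f (proj₁ (G.gen a b) e)) , proj₂ (proj₂ (proj₂ (walk f))) G.p (λ a b m → proj₂ (G.gen a b) (base m)) G.folded a b

-- Completion of folded graphs by trees; the free group as a special case

module FreeGroup where

  open import Defs
  open FreeActions
  open import Data.Bool using (Bool; true; not; _∧_; T)
  open import Data.Bool.Properties using (T-∧; T?) renaming (_≟_ to _≟ᵇ_)
  open import Data.Nat using (ℕ)
  open import Data.Fin as Fin using (Fin)
  open import Data.Unit using (⊤; tt)
  open import Data.Maybe using (Maybe; just; nothing; is-nothing)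
  open import Data.List using ([]; _∷_; _++_)
  open import Data.List.Properties using (foldr-++) renaming (≡-dec to ≡-decL)
  open import Data.Product using (proj₂)
  open import Data.Product.Properties using (≡-dec)
  open import Relation.Nullary using (yes; no; Dec; ⌊_⌋; contradiction)
  open import Relation.Nullary.Decidable using (recompute)
  open import Relation.Binary using (DecidableEquality)
  open import Relation.Binary.PropositionalEquality
  open import Function using (_∘_)
  open import Function.Bundles using (Equivalence)

  _≟ₗ_ : ∀ {k} → DecidableEquality (Letter k)
  _≟ₗ_ = ≡-dec Fin._≟_ _≟ᵇ_

  record Automaton (k : ℕ) : Set₁ where
    field
      V        : Set
      _≟V_     : DecidableEquality V
      step     : Letter k → V → Maybe V
      step-inv : ∀ l {v v′} → step l v ≡ just v′ → step (inv l) v′ ≡ just v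

  -- The completion of a folded graph by infinite trees: a state is a vertex together with the reduced
  -- word (most recent letter first) that leads from it into the attached trees.
  module Completion {k : ℕ} (A : Automaton k) where
    open Automaton A

    -- The bottom letter of the stack is the one that leaves the graph, so the vertex must have no
    -- edge for it. Above it the word only has to be reduced.
    validᵇ : V → Word k → Bool
    validᵇ v []           = true
    validᵇ v (y ∷ [])     = is-nothing (step y v)
    validᵇ v (y ∷ y′ ∷ r) = not ⌊ y ≟ₗ inv y′ ⌋ ∧ validᵇ v (y′ ∷ r)

    -- Validity is irrelevant, so that states are equal as soon as their vertices and stacks are;
    -- `valid!` recovers it by decidability.
    record State : Set where
      constructor state
      field
        vertex : V
        stack  : Word k
        .valid : T (validᵇ vertex stack)
    open State public

    valid! : ∀ s → T (validᵇ (vertex s) (stack s))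
    valid! (state v r t) = recompute (T? _) t

    state-≡ : ∀ {s s′ : State} → vertex s ≡ vertex s′ → stack s ≡ stack s′ → s ≡ s′
    state-≡ refl refl = refl

    _≟S_ : DecidableEquality State
    s ≟S s′ with vertex s ≟V vertex s′ | ≡-decL _≟ₗ_ (stack s) (stack s′)
    ... | yes p | yes q = yes (state-≡ p q)
    ... | no p  | _     = no (p ∘ cong vertex)
    ... | _     | no q  = no (q ∘ cong stack)

    pop : ∀ v y r → T (validᵇ v (y ∷ r)) → T (validᵇ v r)
    pop v y []       t = tt
    pop v y (y′ ∷ r) t = proj₂ (Equivalence.to (T-∧ {not ⌊ y ≟ₗ inv y′ ⌋}) t)

    push : ∀ v l y r → l ≢ inv y → T (validᵇ v (y ∷ r)) → T (validᵇ v (l ∷ y ∷ r))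
    push v l y r ne t with l ≟ₗ inv y
    ... | yes e = contradiction e ne
    ... | no _  = t

    -- The result of `step` is an argument rather than the subject of a `with`, so that later proofs
    -- can generalize over it. `turn` is split off for the same reason.
    leave : ∀ l v (m : Maybe V) → .(step l v ≡ m) → State
    leave l v (just v′) _  = state v′ [] tt
    leave l v nothing   eq = state v (l ∷ []) (subst (T ∘ is-nothing) (sym eq) tt)

    turn : ∀ l v y r → Dec (l ≡ inv y) → .(T (validᵇ v (y ∷ r))) → State
    turn l v y r (yes _) ok = state v r (pop v y r ok)
    turn l v y r (no ne) ok = state v (l ∷ y ∷ r) (push v l y r ne ok)

    act : Letter k → State → State
    act l (state v [] _) = leave l v (step l v) refl
    act l (state v (y ∷ r) ok) = turn l v y r (l ≟ₗ inv y) ok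

    act-step : ∀ l {v v′} .{t t′} → step l v ≡ just v′ → act l (state v [] t) ≡ state v′ [] t′
    act-step l {v} {v′} {t} {t′} e = go (step l v) refl e
      where
      go : ∀ m .(eq : step l v ≡ m) → m ≡ just v′ → leave l v m eq ≡ state v′ [] t′
      go (just _) _ refl = refl

    act-pop : ∀ y v r .{t t′} → act (inv y) (state v (y ∷ r) t) ≡ state v r t′
    act-pop y v r {t} {t′} = go (inv y ≟ₗ inv y)
      where
      go : ∀ d → turn (inv y) v y r d t ≡ state v r t′
      go (yes _) = refl
      go (no ne) = contradiction refl ne

    act-push : ∀ l v y r .{t t′} → l ≢ inv y → act l (state v (y ∷ r) t) ≡ state v (l ∷ y ∷ r) t′
    act-push l v y r {t} {t′} ne = go (l ≟ₗ inv y)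
      where
      go : ∀ d → turn l v y r d t ≡ state v (l ∷ y ∷ r) t′
      go (yes e) = contradiction e ne
      go (no _)  = refl

    valid-≢ : ∀ v y y′ r → T (validᵇ v (y ∷ y′ ∷ r)) → y ≢ inv y′
    valid-≢ v y y′ r t e with y ≟ₗ inv y′
    ... | no ne = ne e

    unpop : ∀ v y r .(t : T (validᵇ v (y ∷ r))) .{t′} → act y (state v r t′) ≡ state v (y ∷ r) t
    unpop v y [] t = go (step y v) refl (recompute (T? _) t)
      where
      go : ∀ m .(eq : step y v ≡ m) → T (is-nothing m) → leave y v m eq ≡ state v (y ∷ []) t
      go nothing _ _ = refl
    unpop v y (y′ ∷ r) t = act-push y v y′ r (valid-≢ v y y′ r (recompute (T? _) t))

    act-inv : ∀ l s → act (inv l) (act l s) ≡ s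
    act-inv l (state v [] ok) = go (step l v) refl
      where
      go : ∀ m (eq : step l v ≡ m) → act (inv l) (leave l v m eq) ≡ state v [] ok
      go (just v′) eq = act-step (inv l) (step-inv l eq)
      go nothing   eq = act-pop l v []
    act-inv l (state v (y ∷ r) ok) = go (l ≟ₗ inv y)
      where
      go : ∀ d → act (inv l) (turn l v y r d ok) ≡ state v (y ∷ r) ok
      go (yes refl) = trans (cong (λ z → act z (state v r (pop v y r ok))) (inv-inv y)) (unpop v y r ok)
      go (no ne)    = act-pop l v (y ∷ r)

    completion : FSet k
    completion = record { X = State ; _≟X_ = _≟S_ ; act = act ; act-inv = act-inv }

  module Free (k : ℕ) where

    -- One vertex without edges: its completion is the Cayley tree, whose states are the reduced
    -- words, that is, the elements of the free group.
    trivial : Automaton k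
    trivial = record { V = ⊤ ; _≟V_ = λ _ _ → yes refl ; step = λ _ _ → nothing ; step-inv = λ _ () }

    open Completion trivial public renaming (State to F; act to actF; act-inv to actF-inv; completion to free)

    ε : F
    ε = state tt [] tt

    nf : Word k → F
    nf z = FSet.act* free z ε

    nf-stack : ∀ u → nf (stack u) ≡ u
    nf-stack (state tt z ok) = go z ok
      where
      go : ∀ z .(t : T (validᵇ tt z)) → nf z ≡ state tt z t
      go []      t = refl
      go (y ∷ r) t = trans (cong (actF y) (go r (pop tt y r t))) (unpop tt y r t)

    invW : Word k → Word k
    invW []      = []
    invW (l ∷ z) = invW z ++ (inv l ∷ [])

    module Act (S : FSet k) where
      open FSet S

      act*-++ : ∀ z z′ x → act* (z ++ z′) x ≡ act* z (act* z′ x)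
      act*-++ z z′ x = foldr-++ act x z z′

      act*-actF : ∀ l u x → act* (stack (actF l u)) x ≡ act l (act* (stack u) x)
      act*-actF l (state tt [] _) x = refl
      act*-actF l (state tt (y ∷ r) t) x = go (l ≟ₗ inv y)
        where
        go : ∀ d → act* (stack (turn l tt y r d t)) x ≡ act l (act y (act* r x))
        go (yes refl) = sym (act-inv y _)
        go (no _)     = refl

      act*-nf : ∀ z x → act* (stack (nf z)) x ≡ act* z x
      act*-nf []      x = refl
      act*-nf (l ∷ z) x = trans (act*-actF l (nf z) x) (cong (act l) (act*-nf z x))

      infixr 6 _▷_
      _▷_ : F → X → X
      u ▷ x = act* (stack u) x

      act*-inv : ∀ z x → act* (invW z) (act* z x) ≡ x
      act*-inv []      x = refl
      act*-inv (l ∷ z) x = trans (act*-++ (invW z) _ _) (trans (cong (act* (invW z)) (act-inv l _)) (act*-inv z x))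

      act*-inv′ : ∀ z x → act* z (act* (invW z) x) ≡ x
      act*-inv′ []      x = refl
      act*-inv′ (l ∷ z) x = trans (cong (act l ∘ act* z) (act*-++ (invW z) (inv l ∷ []) x))
        (trans (cong (act l) (act*-inv′ z (act (inv l) x))) (act-inv′ l x))

    _⁻¹ : F → F
    u ⁻¹ = nf (invW (stack u))

    module Act⁻¹ (S : FSet k) where
      open FSet S
      open Act S
      ⁻¹-▷ : ∀ u x → u ⁻¹ ▷ u ▷ x ≡ x
      ⁻¹-▷ u x = trans (act*-nf (invW (stack u)) _) (act*-inv (stack u) x)

      ▷-⁻¹ : ∀ u x → u ▷ u ⁻¹ ▷ x ≡ x
      ▷-⁻¹ u x = trans (cong (u ▷_) (act*-nf (invW (stack u)) x)) (act*-inv′ (stack u) x)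

    module FA = Act free
    module FA⁻¹ = Act⁻¹ free

    -- Elements act through their reduced words, and by `act*-nf` reduction does not affect the
    -- action. Hence the product of two elements acts like the concatenation of their words.
    ▷-▷ : ∀ (S : FSet k) u v x → Act._▷_ S (u FA.▷ v) x ≡ Act._▷_ S u (Act._▷_ S v x)
    ▷-▷ S u v x = begin
      (u FA.▷ v) ▷ x                          ≡⟨ cong (λ y → act* (stack (FA._▷_ u y)) x) (sym (nf-stack v)) ⟩
      act* (stack (u FA.▷ nf (stack v))) x    ≡⟨ cong (λ y → act* (stack y) x) (sym (FA.act*-++ (stack u) (stack v) ε)) ⟩
      act* (stack (nf (stack u ++ stack v))) x ≡⟨ act*-nf (stack u ++ stack v) x ⟩
      act* (stack u ++ stack v) x             ≡⟨ act*-++ (stack u) (stack v) x ⟩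
      u ▷ v ▷ x ∎
      where
      open FSet S
      open Act S
      open ≡-Reasoning

    ▷-cancelʳ : ∀ {u v} r → u FA.▷ r ≡ v FA.▷ r → u ≡ v
    ▷-cancelʳ {u} {v} r e = begin
      u                        ≡⟨ nf-stack u ⟨
      u FA.▷ ε                 ≡⟨ cong (u FA.▷_) (FA⁻¹.▷-⁻¹ r ε) ⟨
      u FA.▷ (r FA.▷ r ⁻¹ FA.▷ ε) ≡⟨ ▷-▷ free u r _ ⟨
      (u FA.▷ r) FA.▷ (r ⁻¹ FA.▷ ε) ≡⟨ cong (FA._▷ (r ⁻¹ FA.▷ ε)) e ⟩
      (v FA.▷ r) FA.▷ (r ⁻¹ FA.▷ ε) ≡⟨ ▷-▷ free v r _ ⟩
      v FA.▷ (r FA.▷ r ⁻¹ FA.▷ ε) ≡⟨ cong (v FA.▷_) (FA⁻¹.▷-⁻¹ r ε) ⟩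
      v FA.▷ ε                 ≡⟨ nf-stack v ⟩
      v ∎
      where open ≡-Reasoning

-- The Magnus expansion and a left-invariant order on the free group

module MagnusOrder where

  open import Defs
  open FreeActions
  open FreeGroup
  open import Data.Bool using (Bool; true; false; not; _∧_; T; if_then_else_)
  open import Data.Bool.Properties using (T?; ¬-not) renaming (_≟_ to _≟ᵇ_)
  open import Data.Nat as ℕ using (ℕ; zero; suc; _≤_; z≤n; s≤s)
  import Data.Nat.Properties as ℕP
  open import Data.Integer as ℤ using (ℤ; +_; -[1+_]; _+_; _*_; _<_)
  import Data.Integer.Properties as ℤP
  open import Data.Integer.Tactic.RingSolver using (solve-∀)
  open import Data.Fin as Fin using (Fin)
  open import Data.Unit using (tt)
  open import Data.List using (List; []; _∷_; _++_; map; length; concatMap; allFin)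
  open import Data.List.Properties using (length-++)
  open import Data.List.Membership.Propositional using (_∈_)
  open import Data.List.Membership.Propositional.Properties using (∈-map⁺; ∈-map⁻; ∈-concatMap⁺; ∈-concatMap⁻; ∈-allFin; ∈-++⁺ˡ; ∈-++⁺ʳ)
  open import Data.List.Relation.Unary.Any as Any using (here; there)
  open import Data.Product using (_×_; _,_; ∃-syntax)
  open import Data.Sum using (_⊎_; inj₁; inj₂; [_,_]′)
  open import Relation.Nullary using (¬_; yes; no; ⌊_⌋; contradiction)
  open import Relation.Nullary.Decidable using (recompute)
  open import Relation.Binary using (tri<; tri≈; tri>)
  open import Relation.Binary.PropositionalEquality
  open import Function using (_∘_)

  module Order (k : ℕ) where
    open Free k

    Mon : Set
    Mon = List (Fin k)

    okᵇ : Fin k → Mon → Bool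
    okᵇ i []      = true
    okᵇ i (j ∷ _) = not ⌊ i Fin.≟ j ⌋

    sgn : Bool → ℤ
    sgn true  = + 1
    sgn false = -[1+ 0 ]

    -- c m z is the coefficient of the monomial m in the image of the word z under the Magnus map
    -- g_i ↦ 1 + X_i into the ring of noncommutative power series modulo the relations X_i² = 0.
    c : Mon → Word k → ℤ
    c []      z             = + 1
    c (i ∷ m) []            = + 0
    c (i ∷ m) ((j , b) ∷ z) = c (i ∷ m) z + (if ⌊ i Fin.≟ j ⌋ ∧ okᵇ i m then sgn b * c m z else + 0)

    c-skip : ∀ m {j} b z → T (okᵇ j m) → c m ((j , b) ∷ z) ≡ c m z
    c-skip []      b z ok = refl
    c-skip (i ∷ m) {j} b z ok with i Fin.≟ j | j Fin.≟ i
    ... | no _  | _     = ℤP.+-identityʳ _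
    ... | yes e | no ne = contradiction (sym e) ne

    c-hit : ∀ i m b z → T (okᵇ i m) → c (i ∷ m) ((i , b) ∷ z) ≡ c (i ∷ m) z + sgn b * c m z
    c-hit i m b z ok with i Fin.≟ i | okᵇ i m
    ... | yes _ | true = refl
    ... | no ne | _    = contradiction refl ne

    -- (1 + X)(1 - X) = 1 as X² = 0. The coefficients are thus functions on the group, and the
    -- quotient by squares keeps the image of an inverse letter as simple as that of the letter.
    c-cancel : ∀ m l z → c m (inv l ∷ l ∷ z) ≡ c m z
    c-cancel []      l       z = refl
    c-cancel (i ∷ m) (j , b) z with i Fin.≟ j | okᵇ i m in eq
    ... | no _     | _     = trans (ℤP.+-identityʳ _) (ℤP.+-identityʳ _)
    ... | yes refl | false = trans (ℤP.+-identityʳ _) (ℤP.+-identityʳ _)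
    ... | yes refl | true  = begin
        (c (i ∷ m) z + sgn b * c m z) + sgn (not b) * c m ((i , b) ∷ z)
          ≡⟨ cong (λ y → (c (i ∷ m) z + sgn b * c m z) + sgn (not b) * y) (c-skip m b z (subst T (sym eq) tt)) ⟩
        (c (i ∷ m) z + sgn b * c m z) + sgn (not b) * c m z
          ≡⟨ opp b (c (i ∷ m) z) (c m z) ⟩
        c (i ∷ m) z ∎
      where
      open ≡-Reasoning
      pos : ∀ x y → (x + + 1 * y) + -[1+ 0 ] * y ≡ x
      pos = solve-∀
      neg : ∀ x y → (x + -[1+ 0 ] * y) + + 1 * y ≡ x
      neg = solve-∀
      opp : ∀ b x y → (x + sgn b * y) + sgn (not b) * y ≡ x
      opp true  = pos
      opp false = neg

    C : Mon → F → ℤ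
    C m u = c m (stack u)

    C-act : ∀ m l u → C m (actF l u) ≡ c m (l ∷ stack u)
    C-act m l (state tt [] _) = refl
    C-act m l (state tt (y ∷ r) t) = go (l ≟ₗ inv y)
      where
      go : ∀ d → c m (stack (turn l tt y r d t)) ≡ c m (l ∷ y ∷ r)
      go (yes refl) = sym (c-cancel m y r)
      go (no _)     = refl

    -- Left multiplication by 1 ± X_j changes the coefficient of a monomial at most by a multiple of
    -- the coefficient of its tail. Elements with equal coefficients at the tail are shifted
    -- equally.
    C-shift : ∀ i m l u v → C m u ≡ C m v →
      ∃[ d ] (C (i ∷ m) (actF l u) ≡ C (i ∷ m) u + d × C (i ∷ m) (actF l v) ≡ C (i ∷ m) v + d)
    C-shift i m l@(j , b) u v e = _ , C-act (i ∷ m) l u ,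
      trans (C-act (i ∷ m) l v) (cong (λ y → C (i ∷ m) v + (if ⌊ i Fin.≟ j ⌋ ∧ okᵇ i m then sgn b * y else + 0)) (sym e))

    data _<[_]_ (u : F) : List Mon → F → Set where
      here  : ∀ {m ms v} → C m u < C m v → u <[ m ∷ ms ] v
      there : ∀ {m ms v} → C m u ≡ C m v → u <[ ms ] v → u <[ m ∷ ms ] v

    Agree : List Mon → F → F → Set
    Agree ms u v = ∀ {m} → m ∈ ms → C m u ≡ C m v

    lex-compare : ∀ ms u v → (u <[ ms ] v) ⊎ Agree ms u v ⊎ (v <[ ms ] u)
    lex-compare []       u v = inj₂ (inj₁ λ ())
    lex-compare (m ∷ ms) u v with ℤP.<-cmp (C m u) (C m v) | lex-compare ms u v
    ... | tri< lt _ _ | _ = inj₁ (here lt)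
    ... | tri> _ _ gt | _ = inj₂ (inj₂ (here gt))
    ... | tri≈ _ e _  | inj₁ lt = inj₁ (there e lt)
    ... | tri≈ _ e _  | inj₂ (inj₁ ag) = inj₂ (inj₁ λ { (here refl) → e ; (there m∈) → ag m∈ })
    ... | tri≈ _ e _  | inj₂ (inj₂ gt) = inj₂ (inj₂ (there (sym e) gt))

    lex-trans : ∀ {ms u v x} → u <[ ms ] v → v <[ ms ] x → u <[ ms ] x
    lex-trans (here p)    (here q)    = here (ℤP.<-trans p q)
    lex-trans (here p)    (there e q) = here (subst (_ <_) e p)
    lex-trans (there e p) (here q)    = here (subst (_< _) (sym e) q)
    lex-trans (there e p) (there f q) = there (trans e f) (lex-trans p q)

    lex-irrefl : ∀ {ms u v} → Agree ms u v → ¬ (u <[ ms ] v)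
    lex-irrefl ag (here p)    = ℤP.<-irrefl (ag (here refl)) p
    lex-irrefl ag (there e p) = lex-irrefl (ag ∘ there) p

    lex-respʳ : ∀ {ms u v x} → Agree ms v x → u <[ ms ] v → u <[ ms ] x
    lex-respʳ ag (here p)    = here (subst (_ <_) (ag (here refl)) p)
    lex-respʳ ag (there e p) = there (trans e (ag (here refl))) (lex-respʳ (ag ∘ there) p)

    lex-respˡ : ∀ {ms u v x} → Agree ms u v → v <[ ms ] x → u <[ ms ] x
    lex-respˡ ag (here p)    = here (subst (_< _) (sym (ag (here refl))) p)
    lex-respˡ ag (there e p) = there (trans (ag (here refl)) e) (lex-respˡ (ag ∘ there) p)

    -- Every monomial is listed after its tail; `done` collects the monomials that have been passed.
    data Closed (done : List Mon) : List Mon → Set where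
      []  : Closed done []
      _∷_ : ∀ {m ms} → (∀ {i m′} → m ≡ i ∷ m′ → m′ ∈ done) → Closed (m ∷ done) ms → Closed done (m ∷ ms)

    private
      shift-coeff : ∀ {done} m l u v → (∀ {i m′} → m ≡ i ∷ m′ → m′ ∈ done) → Agree done u v →
        ∃[ d ] (C m (actF l u) ≡ C m u + d × C m (actF l v) ≡ C m v + d)
      shift-coeff []      l u v h ag = + 0 , refl , refl
      shift-coeff (i ∷ m) l u v h ag = C-shift i m l u v (ag (h refl))

    -- At the first monomial where two elements differ they agree at its tail, which comes earlier.
    -- Both coefficients therefore move by the same amount and their comparison survives.
    lex-act : ∀ {done ms u v} l → Closed done ms → Agree done u v → u <[ ms ] v → actF l u <[ ms ] actF l v
    lex-act {u = u} {v} l (_∷_ {m} h cl) ag (here p) with shift-coeff m l u v h ag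
    ... | d , e , e′ = here (subst₂ _<_ (sym e) (sym e′) (ℤP.+-monoˡ-< d p))
    lex-act {u = u} {v} l (_∷_ {m} h cl) ag (there q p) with shift-coeff m l u v h ag
    ... | d , e , e′ = there (trans e (trans (cong (_+ d) q) (sym e′)))
      (lex-act l cl (λ { (here refl) → q ; (there m∈) → ag m∈ }) p)

    agree-act : ∀ {done ms u v} l → Closed done ms → Agree done u v → Agree ms u v → Agree ms (actF l u) (actF l v)
    agree-act {u = u} {v} l (_∷_ {m} h cl) ag al (here refl) with shift-coeff m l u v h ag
    ... | d , e , e′ = trans e (trans (cong (_+ d) (al (here refl))) (sym e′))
    agree-act l (_∷_ h cl) ag al (there m∈) =
      agree-act l cl (λ { (here refl) → al (here refl) ; (there n∈) → ag n∈ }) (al ∘ there) m∈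

    level : ℕ → List Mon
    level zero    = [] ∷ []
    level (suc n) = concatMap (λ m → map (_∷ m) (allFin k)) (level n)

    -- Ordering by degree puts tails first. Cutting off at degree `n` keeps the comparison finite;
    -- `n` has to be large compared with the words at hand.
    mons : ℕ → List Mon
    mons zero    = level zero
    mons (suc n) = mons n ++ level (suc n)

    ∈-level : ∀ m → m ∈ level (length m)
    ∈-level []      = here refl
    ∈-level (i ∷ m) = ∈-concatMap⁺ (λ m → map (_∷ m) (allFin k)) (Any.map (λ { refl → ∈-map⁺ (_∷ m) (∈-allFin i) }) (∈-level m))

    level-tail : ∀ n {i m} → i ∷ m ∈ level (suc n) → m ∈ level n
    level-tail n {i} {m} p = Any.map f (∈-concatMap⁻ (λ m → map (_∷ m) (allFin k)) {xs = level n} p)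
      where
      f : ∀ {m′} → i ∷ m ∈ map (_∷ m′) (allFin k) → m ≡ m′
      f q with ∈-map⁻ _ q
      ... | _ , _ , refl = refl

    ∈-mons : ∀ {n m} j → j ≤ n → m ∈ level j → m ∈ mons n
    ∈-mons {zero}  zero    z≤n p = p
    ∈-mons {suc n} j j≤ p with ℕP.m≤n⇒m<n∨m≡n j≤
    ... | inj₁ (s≤s j≤n) = ∈-++⁺ˡ (∈-mons j j≤n p)
    ... | inj₂ refl      = ∈-++⁺ʳ (mons n) p

    closed-++ : ∀ {done as bs} → Closed done as → (∀ {i m} → i ∷ m ∈ bs → (m ∈ done) ⊎ (m ∈ as)) → Closed done (as ++ bs)
    closed-++ {bs = []}     []       h = []
    closed-++ {bs = b ∷ bs} []       h = (λ { refl → [ (λ x → x) , (λ ()) ]′ (h (here refl)) }) ∷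
      closed-++ {bs = bs} [] (λ p → inj₁ (there ([ (λ x → x) , (λ ()) ]′ (h (there p)))))
    closed-++ (p ∷ cl) h = p ∷ closed-++ cl (λ q → move (h q))
      where
      move : ∀ {m a done as} → (m ∈ done) ⊎ (m ∈ a ∷ as) → (m ∈ a ∷ done) ⊎ (m ∈ as)
      move (inj₁ x)           = inj₁ (there x)
      move (inj₂ (here refl)) = inj₁ (here refl)
      move (inj₂ (there x))   = inj₂ x

    closed-mons : ∀ n → Closed [] (mons n)
    closed-mons zero    = (λ ()) ∷ []
    closed-mons (suc n) = closed-++ (closed-mons n) (λ p → inj₂ (∈-mons n ℕP.≤-refl (level-tail n p)))

    -- The leading coefficient of a nonempty reduced word: the monomial listing its syllables has the
    -- product of the exponents as coefficient, and longer monomials do not occur.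
    record Leading (i : Fin k) (b : Bool) (z : Word k) : Set where
      field
        m     : Mon
        e     : ℕ
        ok    : T (okᵇ i m)
        short : length m ≤ length z
        lead  : c (i ∷ m) ((i , b) ∷ z) ≡ (sgn b * + suc e) * c m ((i , b) ∷ z)
        rest  : c m ((i , b) ∷ z) ≢ + 0
        long  : ∀ n → suc (length m) ℕ.< length n → c n ((i , b) ∷ z) ≡ + 0
        long′ : ∀ n → T (okᵇ i n) → length m ℕ.< length n → c n ((i , b) ∷ z) ≡ + 0

    c-long : ∀ j n i b z → c (j ∷ n) z ≡ + 0 → (j ≡ i → T (okᵇ j n) → c n z ≡ + 0) → c (j ∷ n) ((i , b) ∷ z) ≡ + 0
    c-long j n i b z p q with j Fin.≟ i | okᵇ j n | q
    ... | no _  | _     | _ = trans (ℤP.+-identityʳ _) p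
    ... | yes _ | false | _ = trans (ℤP.+-identityʳ _) p
    ... | yes e | true  | q = trans (cong₂ _+_ p (trans (cong (sgn b *_) (q e tt)) (ℤP.*-zeroʳ (sgn b)))) refl

    sgn-nz : ∀ b e → sgn b * + suc e ≢ + 0
    sgn-nz true  e ()
    sgn-nz false e ()

    *-nz : ∀ x y → x ≢ + 0 → y ≢ + 0 → x * y ≢ + 0
    *-nz x y p q r with ℤP.i*j≡0⇒i≡0∨j≡0 x r
    ... | inj₁ e = p e
    ... | inj₂ e = q e

    leading : ∀ i b z → T (validᵇ tt ((i , b) ∷ z)) → Leading i b z
    leading i b [] _ = record
      { m = [] ; e = 0 ; ok = tt ; short = z≤n
      ; lead = trans (c-hit i [] b [] tt) (trans (ℤP.+-identityˡ (sgn b * + 1)) (sym (ℤP.*-identityʳ (sgn b * + 1)))) ; rest = λ ()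
      ; long = λ { (j ∷ _ ∷ n) _ → c-long j (_ ∷ n) i b [] refl (λ _ _ → refl) ; (_ ∷ []) (s≤s ()) }
      ; long′ = λ { (j ∷ n) o _ → c-skip (j ∷ n) b [] o } }
    leading i b ((j , b′) ∷ z) t with j Fin.≟ i | leading j b′ z (pop tt (i , b) ((j , b′) ∷ z) t) | valid-≢ tt (i , b) (j , b′) z t
    ... | yes refl | L | ne with b ≟ᵇ b′
    ...   | no b≢ = contradiction (cong (i ,_) (¬-not b≢)) ne
    -- The letter prolongs the first syllable: the monomial stays and the exponent grows by one in
    -- absolute value. Reducedness has excluded the opposite sign.
    ...   | yes refl = record
      { m = m ; e = suc e ; ok = ok ; short = ℕP.m≤n⇒m≤1+n short
      ; lead = trans (c-hit i m b ((i , b) ∷ z) ok) (trans (cong (_+ sgn b * c m ((i , b) ∷ z)) lead)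
          (trans (add (sgn b) (+ suc e) (c m ((i , b) ∷ z))) (cong ((sgn b * + suc (suc e)) *_) (sym (c-skip m b ((i , b) ∷ z) ok)))))
      ; rest = λ q → rest (trans (sym (c-skip m b _ ok)) q)
      ; long = λ { (j ∷ n) (s≤s lt) → c-long j n i b _ (long (j ∷ n) (s≤s lt)) (λ { refl o → long′ n o lt }) }
      ; long′ = λ n o lt → trans (c-skip n b _ o) (long′ n o lt) }
      where
      open Leading L
      add : ∀ s x y → (s * x) * y + s * y ≡ (s * (+ 1 + x)) * y
      add = solve-∀
    -- A new syllable begins, so its generator is put in front of the old monomial and its exponent
    -- is ±1.
    leading i b ((j , b′) ∷ z) t | no j≢i | L | _ = record
      { m = j ∷ m ; e = 0 ; ok = ok′ ; short = s≤s short
      ; lead = trans (c-hit i (j ∷ m) b ((j , b′) ∷ z) ok′) (trans (cong (_+ sgn b * c (j ∷ m) ((j , b′) ∷ z)) (long (i ∷ j ∷ m) ℕP.≤-refl))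
          (trans (ℤP.+-identityˡ _) (cong₂ _*_ (sym (ℤP.*-identityʳ (sgn b))) (sym (c-skip (j ∷ m) b ((j , b′) ∷ z) ok′)))))
      ; rest = λ q → *-nz (sgn b′ * + suc e) _ (sgn-nz b′ e) rest (trans (sym lead) (trans (sym (c-skip (j ∷ m) b ((j , b′) ∷ z) ok′)) q))
      ; long = λ { (j ∷ n) (s≤s lt) → c-long j n i b _ (long (j ∷ n) (ℕP.m<n⇒m<1+n lt)) (λ _ _ → long n lt) }
      ; long′ = λ n o lt → trans (c-skip n b _ o) (long n lt) }
      where
      open Leading L
      ok′ : T (okᵇ i (j ∷ m))
      ok′ with i Fin.≟ j
      ... | yes p = contradiction (sym p) j≢i
      ... | no _  = tt

    -- Faithfulness of the Magnus map: the syllable monomial of a nonempty reduced word has nonzero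
    -- coefficient, and its degree is at most the length of the word, so it is listed in `mons n`.
    -- For `ε` that coefficient is 0.
    detect : ∀ u n → length (stack u) ≤ n → Agree (mons n) u ε → u ≡ ε
    detect (state tt [] _) n le ag = refl
    detect (state tt ((i , b) ∷ z) t) n le ag = contradiction
        (trans (sym lead) (ag (∈-mons (suc (length m)) (ℕP.≤-trans (s≤s short) le) (∈-level (i ∷ m)))))
        (*-nz (sgn b * + suc e) _ (sgn-nz b e) rest)
      where open Leading (leading i b z (recompute (T? _) t))

    length-act : ∀ l u → length (stack (actF l u)) ≤ suc (length (stack u))
    length-act l (state tt [] _) = ℕP.≤-refl
    length-act l (state tt (y ∷ r) t) = go (l ≟ₗ inv y)
      where
      go : ∀ d → length (stack (turn l tt y r d t)) ≤ suc (suc (length r))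
      go (yes _) = ℕP.≤-trans (ℕP.n≤1+n _) (ℕP.n≤1+n _)
      go (no _)  = ℕP.≤-refl

    length-act* : ∀ z u → length (stack (FSet.act* free z u)) ≤ length z ℕ.+ length (stack u)
    length-act* []      u = ℕP.≤-refl
    length-act* (l ∷ z) u = ℕP.≤-trans (length-act l (FSet.act* free z u)) (s≤s (length-act* z u))

    lex-act* : ∀ n z {u v} → u <[ mons n ] v → FSet.act* free z u <[ mons n ] FSet.act* free z v
    lex-act* n []      p = p
    lex-act* n (l ∷ z) p = lex-act l (closed-mons n) (λ ()) (lex-act* n z p)

    agree-act* : ∀ n z {u v} → Agree (mons n) u v → Agree (mons n) (FSet.act* free z u) (FSet.act* free z v)
    agree-act* n []      p = p
    agree-act* n (l ∷ z) p = agree-act l (closed-mons n) (λ ()) (agree-act* n z p)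

    length-invW : ∀ z → length (invW z) ≡ length z
    length-invW []      = refl
    length-invW (l ∷ z) = trans (length-++ (invW z)) (trans (ℕP.+-comm _ 1) (cong suc (length-invW z)))

    -- Translation by the inverse of `v` reduces this to `detect`; the length of the translate is at
    -- most the sum of the two lengths, whence the bound.
    agree⇒≡ : ∀ n u v → length (stack u) ℕ.+ length (stack v) ≤ n → Agree (mons n) u v → u ≡ v
    agree⇒≡ n u v le ag = begin
        u                     ≡⟨ FA.act*-inv′ (stack v) u ⟨
        act* (stack v) (act* (invW (stack v)) u) ≡⟨ cong (act* (stack v)) (detect _ n bound ag′) ⟩
        act* (stack v) ε      ≡⟨ nf-stack v ⟩
        v ∎
      where
      open FSet free using (act*)
      open ≡-Reasoning
      bound : length (stack (act* (invW (stack v)) u)) ≤ n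
      bound = ℕP.≤-trans (length-act* (invW (stack v)) u) (ℕP.≤-trans (ℕP.≤-reflexive
        (trans (cong (ℕ._+ length (stack u)) (length-invW (stack v))) (ℕP.+-comm (length (stack v)) _))) le)
      v⁻¹v : act* (invW (stack v)) v ≡ ε
      v⁻¹v = trans (cong (act* (invW (stack v))) (sym (nf-stack v))) (FA.act*-inv (stack v) ε)
      ag′ : Agree (mons n) (act* (invW (stack v)) u) ε
      ag′ = subst (Agree (mons n) (act* (invW (stack v)) u)) v⁻¹v (agree-act* n (invW (stack v)) ag)

-- The group ring mod 2: convolution and trivial units

module GroupRing where

  open import Defs
  open FiniteSums using (∑)
  open FreeActions
  open Folding
  open FreeGroup
  open MagnusOrder
  open import Data.Bool using (Bool; true; false; _xor_)
  open import Data.Bool.Properties using (xor-assoc; xor-comm; xor-identityʳ; xor-same)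
  open import Data.Nat as ℕ using (ℕ; _≤_)
  import Data.Nat.Properties as ℕP
  open import Data.Vec using ([]; _∷_)
  open import Data.List using (List; []; _∷_; _++_; map; length; filter)
  open import Data.List.Membership.Propositional using (_∈_; _∉_)
  import Data.List.Membership.DecPropositional as DecMem
  open import Data.List.Relation.Unary.Any using (here; there)
  open import Data.List.Relation.Unary.All as All using (All; []; _∷_)
  open import Data.List.Relation.Unary.AllPairs using ([]; _∷_)
  open import Data.List.Relation.Unary.Unique.Propositional using (Unique)
  open import Data.List.Relation.Unary.Unique.Propositional.Properties using (filter⁺)
  open import Data.Product using (_×_; _,_; proj₁; proj₂; ∃-syntax)
  open import Data.Sum using (inj₁; inj₂)
  open import Relation.Nullary using (¬_; yes; no; ⌊_⌋; contradiction; ¬?)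
  open import Relation.Binary using (DecidableEquality)
  open import Relation.Binary.PropositionalEquality
  open import Function using (_∘_)

  private variable
    A : Set

  xorSum : (A → Bool) → List A → Bool
  xorSum h []       = false
  xorSum h (u ∷ us) = h u xor xorSum h us

  xorSum-++ : ∀ (h : A → Bool) us vs → xorSum h (us ++ vs) ≡ xorSum h us xor xorSum h vs
  xorSum-++ h []       vs = refl
  xorSum-++ h (u ∷ us) vs = trans (cong (h u xor_) (xorSum-++ h us vs)) (sym (xor-assoc (h u) _ _))

  xorSum-cong : ∀ {h h′ : A → Bool} us → (∀ u → h u ≡ h′ u) → xorSum h us ≡ xorSum h′ us
  xorSum-cong []       e = refl
  xorSum-cong (u ∷ us) e = cong₂ _xor_ (e u) (xorSum-cong us e)

  xorSum-map : ∀ {B : Set} (h : B → Bool) (φ : A → B) us → xorSum h (map φ us) ≡ xorSum (h ∘ φ) us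
  xorSum-map h φ []       = refl
  xorSum-map h φ (u ∷ us) = cong (h (φ u) xor_) (xorSum-map h φ us)

  xorSum-zero : ∀ {h : A → Bool} us → (∀ {u} → u ∈ us → h u ≡ false) → xorSum h us ≡ false
  xorSum-zero []       e = refl
  xorSum-zero (u ∷ us) e = cong₂ _xor_ (e (here refl)) (xorSum-zero us (e ∘ there))

  xorSum-single : ∀ {h : A → Bool} {us c} → Unique us → c ∈ us → (∀ {u} → u ∈ us → u ≢ c → h u ≡ false) → xorSum h us ≡ h c
  xorSum-single {h = h} {u ∷ us} (u∉ ∷ un) (here refl) e = trans
    (cong (h u xor_) (xorSum-zero us (λ v∈ → e (there v∈) (λ q → All.lookup u∉ v∈ (sym q))))) (xor-identityʳ _)
  xorSum-single {us = u ∷ us} (u∉ ∷ un) (there c∈) e =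
    cong₂ _xor_ (e (here refl) (All.lookup u∉ c∈)) (xorSum-single un c∈ (e ∘ there))

  module Parity {A : Set} (_≟_ : DecidableEquality A) where
    open DecMem _≟_ using (_∈?_)

    toggle : A → List A → List A
    toggle u ν with u ∈? ν
    ... | yes _ = filter (λ v → ¬? (u ≟ v)) ν
    ... | no _  = u ∷ ν

    -- Reduction of the multiplicities mod 2: the elements of odd multiplicity remain, once each.
    norm : List A → List A
    norm []       = []
    norm (u ∷ us) = toggle u (norm us)

    toggle-! : ∀ u {ν} → Unique ν → Unique (toggle u ν)
    toggle-! u {ν} un with u ∈? ν
    ... | yes _ = filter⁺ (λ v → ¬? (u ≟ v)) un
    ... | no u∉ = All.tabulate (λ v∈ e → u∉ (subst (_∈ ν) (sym e) v∈)) ∷ un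

    norm-! : ∀ us → Unique (norm us)
    norm-! []       = []
    norm-! (u ∷ us) = toggle-! u (norm-! us)

    filter-skip : ∀ h u ν → u ∉ ν → xorSum h (filter (λ v → ¬? (u ≟ v)) ν) ≡ xorSum h ν
    filter-skip h u []      u∉ = refl
    filter-skip h u (v ∷ ν) u∉ with u ≟ v
    ... | yes e = contradiction (here e) u∉
    ... | no _  = cong (h v xor_) (filter-skip h u ν (u∉ ∘ there))

    filter-drop : ∀ h u ν → Unique ν → u ∈ ν → xorSum h (filter (λ v → ¬? (u ≟ v)) ν) ≡ h u xor xorSum h ν
    filter-drop h u (v ∷ ν) (v∉ ∷ un) u∈ with u ≟ v
    ... | yes refl = trans (filter-skip h u ν (λ m → All.lookup v∉ m refl))
      (trans (cong (_xor xorSum h ν) (sym (xor-same (h u)))) (xor-assoc (h u) (h u) _))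
    filter-drop h u (v ∷ ν) (v∉ ∷ un) (here e) | no ne = contradiction e ne
    filter-drop h u (v ∷ ν) (v∉ ∷ un) (there u∈) | no ne = trans (cong (h v xor_) (filter-drop h u ν un u∈))
      (truthTable 3 (λ { (a ∷ b ∷ c ∷ []) → a xor (b xor c) }) (λ { (a ∷ b ∷ c ∷ []) → b xor (a xor c) }) _ (h v ∷ h u ∷ xorSum h ν ∷ []))

    xorSum-norm : ∀ h us → xorSum h (norm us) ≡ xorSum h us
    xorSum-norm h []       = refl
    xorSum-norm h (u ∷ us) = trans step (cong (h u xor_) (xorSum-norm h us))
      where
      step : xorSum h (toggle u (norm us)) ≡ h u xor xorSum h (norm us)
      step with u ∈? norm us
      ... | yes u∈ = filter-drop h u (norm us) (norm-! us) u∈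
      ... | no _   = refl

    δ-at : A → A → Bool
    δ-at x u = ⌊ x ≟ u ⌋

    δ-at-refl : ∀ x → δ-at x x ≡ true
    δ-at-refl x with x ≟ x
    ... | yes _ = refl
    ... | no ne = contradiction refl ne

    δ-at-≢ : ∀ {x u} → x ≢ u → δ-at x u ≡ false
    δ-at-≢ {x} {u} ne with x ≟ u
    ... | yes e = contradiction e ne
    ... | no _  = refl

    odd-∈ : ∀ {x ν} → Unique ν → x ∈ ν → xorSum (δ-at x) ν ≡ true
    odd-∈ {x} un x∈ = trans (xorSum-single {h = δ-at x} un x∈ (λ _ ne → δ-at-≢ (ne ∘ sym))) (δ-at-refl x)

    odd⇒∈ : ∀ {x} ν → xorSum (δ-at x) ν ≡ true → x ∈ ν
    odd⇒∈ {x} (u ∷ ν) e with x ≟ u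
    ... | yes p = here p
    ... | no _  = there (odd⇒∈ ν e)

    -- Lists with the same parities represent the same chain: their concatenation has only even
    -- multiplicities and normalizes to the empty list.
    xorSum-resp : ∀ h us vs → (∀ x → xorSum (δ-at x) us ≡ xorSum (δ-at x) vs) → xorSum h us ≡ xorSum h vs
    xorSum-resp h us vs e with norm (us ++ vs) in eq
    ... | [] = cancel (trans (sym (xorSum-++ h us vs)) (trans (sym (xorSum-norm h (us ++ vs))) (cong (xorSum h) eq)))
      where
      cancel : ∀ {a b} → a xor b ≡ false → a ≡ b
      cancel {true}  {true}  _ = refl
      cancel {false} {false} _ = refl
    ... | x ∷ ν = contradiction
      (trans (sym (odd-∈ (norm-! (us ++ vs)) (subst (x ∈_) (sym eq) (here refl))))
        (trans (xorSum-norm (δ-at x) (us ++ vs)) (trans (xorSum-++ (δ-at x) us vs)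
          (trans (cong (_xor xorSum (δ-at x) vs) (e x)) (xor-same (xorSum (δ-at x) vs)))))) (λ ())

  module Convolution {k : ℕ} (S : FSet k) where
    open FSet S
    open Free k
    open Act S
    open Act⁻¹ S

    par-xorSum : ∀ x ys → par x ys ≡ xorSum (λ y → ⌊ x ≟X y ⌋) ys
    par-xorSum x []       = refl
    par-xorSum x (y ∷ ys) = cong (⌊ x ≟X y ⌋ xor_) (par-xorSum x ys)

    infixr 6 _∗_
    _∗_ : List F → List X → List X
    []       ∗ y = []
    (u ∷ us) ∗ y = map (u ▷_) y ++ us ∗ y

    par-▷ : ∀ u x ys → par x (map (u ▷_) ys) ≡ par (u ⁻¹ ▷ x) ys
    par-▷ u x []       = refl
    par-▷ u x (y ∷ ys) = cong₂ _xor_ same (par-▷ u x ys)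
      where
      same : ⌊ x ≟X (u ▷ y) ⌋ ≡ ⌊ (u ⁻¹ ▷ x) ≟X y ⌋
      same with x ≟X (u ▷ y) | (u ⁻¹ ▷ x) ≟X y
      ... | yes _ | yes _ = refl
      ... | no _  | no _  = refl
      ... | yes p | no q  = contradiction (trans (cong (u ⁻¹ ▷_) p) (⁻¹-▷ u y)) q
      ... | no p  | yes q = contradiction (trans (sym (▷-⁻¹ u x)) (cong (u ▷_) q)) p

    -- The coefficient at `x` of the translate of `y` by `u`; summed over `us` it is the coefficient
    -- of the convolution.
    at : List X → X → F → Bool
    at y x u = par (u ⁻¹ ▷ x) y

    par-∗ : ∀ x us y → par x (us ∗ y) ≡ xorSum (at y x) us
    par-∗ x []       y = refl
    par-∗ x (u ∷ us) y = trans (par-++ x (map (u ▷_) y) (us ∗ y)) (cong₂ _xor_ (par-▷ u x y) (par-∗ x us y))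

    at-actF : ∀ y x l u → at y (act l x) (actF l u) ≡ at y x u
    at-actF y x l u = cong (λ z → par z y) (begin
      actF l u ⁻¹ ▷ act l x                     ≡⟨ cong (λ z → actF l u ⁻¹ ▷ act l z) (▷-⁻¹ u x) ⟨
      actF l u ⁻¹ ▷ act l (u ▷ u ⁻¹ ▷ x)        ≡⟨ cong (actF l u ⁻¹ ▷_) (act*-actF l u (u ⁻¹ ▷ x)) ⟨
      actF l u ⁻¹ ▷ actF l u ▷ u ⁻¹ ▷ x         ≡⟨ ⁻¹-▷ (actF l u) _ ⟩
      u ⁻¹ ▷ x ∎)
      where open ≡-Reasoning

    module _ (w : Word k) (E : List (Vtx w × Vtx w)) (f : Vtx w → List F) (g : Vtx w → List X) (y : List X) where

      private
        Φ : X → Vtx w → Vtx w → Bool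
        Φ x a b = xorSum (at y x) (f a) xor xorSum (at y x) (f b)

      -- Convolution with `y` on the right commutes with the letters acting on the left, so it turns
      -- the potential `f` into another solution of the transport rule. Two solutions that agree on
      -- the generating pairs agree on the whole closure.
      equivariant :
        (∀ {a b} → (a , b) ∈ E → ∀ x → δ w S g x a b ≡ Φ x a b) →
        (∀ {h l} → label w h ≡ label w l → Cl w E (origin w h) (origin w l) → Rule w free f h l) →
        (∀ {h l} → label w h ≡ label w l → Cl w E (origin w h) (origin w l) → Rule w S g h l) →
        ∀ {a b} → Cl w E a b → ∀ x → δ w S g x a b ≡ Φ x a b
      equivariant b0 rf′ rg = go
        where
        transport : ∀ {h l} → label w h ≡ label w l → Cl w E (origin w h) (origin w l) →
          ∀ x → Φ (act (label w h , true) x) (terminus w h) (terminus w l) ≡ Φ x (origin w h) (origin w l)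
        transport {h} {l} e c x = begin
          Φ (act lt x) (terminus w h) (terminus w l)
            ≡⟨ xorSum-++ _ (f (terminus w h)) _ ⟨
          xorSum (at y (act lt x)) (f (terminus w h) ++ f (terminus w l))
            ≡⟨ Parity.xorSum-resp _≟S_ _ (f (terminus w h) ++ f (terminus w l)) (map (actF lt) (f (origin w h) ++ f (origin w l))) same ⟩
          xorSum (at y (act lt x)) (map (actF lt) (f (origin w h) ++ f (origin w l)))
            ≡⟨ xorSum-map _ (actF lt) (f (origin w h) ++ f (origin w l)) ⟩
          xorSum (at y (act lt x) ∘ actF lt) (f (origin w h) ++ f (origin w l))
            ≡⟨ xorSum-cong (f (origin w h) ++ f (origin w l)) (at-actF y x lt) ⟩
          xorSum (at y x) (f (origin w h) ++ f (origin w l))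
            ≡⟨ xorSum-++ _ (f (origin w h)) _ ⟩
          Φ x (origin w h) (origin w l) ∎
          where
          open ≡-Reasoning
          module FF = FSet free
          lt = (label w h , true)
          parF : ∀ u us → FF.par u us ≡ xorSum (λ v → ⌊ u ≟S v ⌋) us
          parF u []       = refl
          parF u (v ∷ us) = cong (⌊ u ≟S v ⌋ xor_) (parF u us)
          same : ∀ u → xorSum (Parity.δ-at _≟S_ u) (f (terminus w h) ++ f (terminus w l))
                     ≡ xorSum (Parity.δ-at _≟S_ u) (map (actF lt) (f (origin w h) ++ f (origin w l)))
          same u = begin
            xorSum (Parity.δ-at _≟S_ u) (f (terminus w h) ++ f (terminus w l)) ≡⟨ parF u (f (terminus w h) ++ f (terminus w l)) ⟨
            FF.par u (f (terminus w h) ++ f (terminus w l)) ≡⟨ FF.par-++ u (f (terminus w h)) _ ⟩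
            δ w free f u (terminus w h) (terminus w l) ≡⟨ cong (λ v → δ w free f v (terminus w h) (terminus w l)) (FF.act-inv′ lt u) ⟨
            δ w free f (actF lt (actF (inv lt) u)) (terminus w h) (terminus w l) ≡⟨ rf′ e c (actF (inv lt) u) ⟩
            δ w free f (actF (inv lt) u) (origin w h) (origin w l) ≡⟨ FF.par-++ _ (f (origin w h)) _ ⟨
            FF.par (actF (inv lt) u) (f (origin w h) ++ f (origin w l)) ≡⟨ FF.par-act lt u (f (origin w h) ++ f (origin w l)) ⟨
            FF.par u (map (actF lt) (f (origin w h) ++ f (origin w l))) ≡⟨ parF u (map (actF lt) (f (origin w h) ++ f (origin w l))) ⟩
            _ ∎
        go : ∀ {a b} → Cl w E a b → ∀ x → δ w S g x a b ≡ Φ x a b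
        go (base m) x = b0 m x
        go (rf {a}) x = trans (δ-refl w S g x a) (sym (xor-same (xorSum (at y x) (f a))))
        go (sy {a} {b} c) x = trans (δ-sym w S g x b a) (trans (go c x) (xor-comm (xorSum (at y x) (f a)) _))
        go (tr {a} {b} {d} c c′) x = trans (sym (δ-trans w S g x a b d)) (trans (cong₂ _xor_ (go c x) (go c′ x))
          (truthTable 3 (λ { (a ∷ b ∷ c ∷ []) → (a xor b) xor (b xor c) }) (λ { (a ∷ b ∷ c ∷ []) → a xor c }) _
            (xorSum (at y x) (f a) ∷ xorSum (at y x) (f b) ∷ xorSum (at y x) (f d) ∷ [])))
        go (fo {h} {l} e c) x = begin
          δ w S g x (terminus w h) (terminus w l) ≡⟨ cong (λ z → δ w S g z (terminus w h) (terminus w l)) (act-inv′ lt x) ⟨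
          δ w S g (act lt x′) (terminus w h) (terminus w l) ≡⟨ rg e c x′ ⟩
          δ w S g x′ (origin w h) (origin w l) ≡⟨ go c x′ ⟩
          Φ x′ (origin w h) (origin w l) ≡⟨ transport e c x′ ⟨
          Φ (act lt x′) (terminus w h) (terminus w l) ≡⟨ cong (λ z → Φ z (terminus w h) (terminus w l)) (act-inv′ lt x) ⟩
          Φ x (terminus w h) (terminus w l) ∎
          where
          open ≡-Reasoning
          lt = (label w h , true)
          x′ = act (inv lt) x
        go (ft {h} {l} e c) x = trans (sym (rg e (ft {h = h} {l} e c) x)) (trans (go c _) (transport {h} {l} e (ft {h = h} {l} e c) x))

  module Units (k : ℕ) where
    open Free k
    open Order k
    open FSet free using (par; _≈_)
    open Convolution free
    open FA
    open Parity _≟S_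

    infix 4 _⊑[_]_
    -- A total preorder for each `n`, left invariant by `⊑-▷`. Elements that no monomial up to
    -- degree `n` tells apart are equivalent, so antisymmetry needs a bound on the lengths.
    _⊑[_]_ : F → ℕ → F → Set
    u ⊑[ n ] v = ¬ (v <[ mons n ] u)

    ⊑-trans : ∀ {n u v x} → u ⊑[ n ] v → v ⊑[ n ] x → u ⊑[ n ] x
    ⊑-trans {n} {u} {v} {x} p q r with lex-compare (mons n) u v
    ... | inj₁ lt        = q (lex-trans r lt)
    ... | inj₂ (inj₁ ag) = q (lex-respʳ ag r)
    ... | inj₂ (inj₂ gt) = p gt

    ⊑-antisym : ∀ {n u v} → length (stack u) ℕ.+ length (stack v) ≤ n → u ⊑[ n ] v → v ⊑[ n ] u → u ≡ v
    ⊑-antisym {n} {u} {v} le p q with lex-compare (mons n) u v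
    ... | inj₁ lt        = contradiction lt q
    ... | inj₂ (inj₁ ag) = agree⇒≡ n u v le ag
    ... | inj₂ (inj₂ gt) = contradiction gt p

    ⊑-▷ : ∀ {n} u {v x} → v ⊑[ n ] x → u ▷ v ⊑[ n ] u ▷ x
    ⊑-▷ {n} u {v} {x} p q = p (subst₂ _<[ mons n ]_ (act*-inv (stack u) x) (act*-inv (stack u) v) (lex-act* n (invW (stack u)) q))

    maximum : ∀ {A : Set} n (φ : A → F) a as → ∃[ b ] (b ∈ a ∷ as × (∀ {x} → x ∈ a ∷ as → φ x ⊑[ n ] φ b))
    maximum n φ a [] = a , here refl , λ { (here refl) → lex-irrefl (λ _ → refl) }
    maximum n φ a (a′ ∷ as) with maximum n φ a′ as
    ... | b , b∈ , top with lex-compare (mons n) (φ b) (φ a)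
    ...   | inj₁ lt = a , here refl , λ { (here refl) → lex-irrefl (λ _ → refl) ; (there x∈) → ⊑-trans {n} (top x∈) (λ q → lex-irrefl (λ _ → refl) (lex-trans lt q)) }
    ...   | inj₂ (inj₁ ag) = b , there b∈ , λ { (here refl) → lex-irrefl ag ; (there x∈) → top x∈ }
    ...   | inj₂ (inj₂ gt) = b , there b∈ , λ { (here refl) q → lex-irrefl (λ _ → refl) (lex-trans gt q) ; (there x∈) → top x∈ }

    minimum : ∀ {A : Set} n (φ : A → F) a as → ∃[ b ] (b ∈ a ∷ as × (∀ {x} → x ∈ a ∷ as → φ b ⊑[ n ] φ x))
    minimum n φ a [] = a , here refl , λ { (here refl) → lex-irrefl (λ _ → refl) }
    minimum n φ a (a′ ∷ as) with minimum n φ a′ as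
    ... | b , b∈ , bot with lex-compare (mons n) (φ b) (φ a)
    ...   | inj₂ (inj₂ gt) = a , here refl , λ { (here refl) → lex-irrefl (λ _ → refl) ; (there x∈) → ⊑-trans {n} (λ q → lex-irrefl (λ _ → refl) (lex-trans gt q)) (bot x∈) }
    ...   | inj₂ (inj₁ ag) = b , there b∈ , λ { (here refl) → lex-irrefl (λ m → sym (ag m)) ; (there x∈) → bot x∈ }
    ...   | inj₁ lt = b , there b∈ , λ { (here refl) q → lex-irrefl (λ _ → refl) (lex-trans lt q) ; (there x∈) → bot x∈ }

    size : F → ℕ
    size u = length (stack u)

    size≤ : ∀ {u us} → u ∈ us → size u ≤ ∑ us size
    size≤ (here refl) = ℕP.m≤m+n _ _
    size≤ {us = v ∷ us} (there u∈) = ℕP.≤-trans (size≤ u∈) (ℕP.m≤n+m _ (size v))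

    odd-ε : ∀ {z} → par z (ε ∷ []) ≡ true → z ≡ ε
    odd-ε {z} e with z ≟S ε
    ... | yes p = p

    -- The group ring 𝔽₂[F] has only trivial units: in a left-invariant order, the largest and the
    -- smallest product are each attained exactly once, so neither cancels.
    unit : ∀ us vs → us ∗ vs ≈ ε ∷ [] → ∃[ u ] (us ≈ u ∷ [])
    unit us vs us∗vs≈1 = conclude (norm us) refl (norm vs) refl
      where
      product : ∀ z → xorSum (λ u → xorSum (δ-at (u ⁻¹ ▷ z)) (norm vs)) (norm us) ≡ par z (ε ∷ [])
      product z = begin
        xorSum (λ u → xorSum (δ-at (u ⁻¹ ▷ z)) (norm vs)) (norm us) ≡⟨ xorSum-norm _ us ⟩
        xorSum (λ u → xorSum (δ-at (u ⁻¹ ▷ z)) (norm vs)) us ≡⟨ xorSum-cong us (λ u → trans (xorSum-norm _ vs) (sym (par-xorSum (u ⁻¹ ▷ z) vs))) ⟩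
        xorSum (at vs z) us ≡⟨ par-∗ z us vs ⟨
        par z (us ∗ vs) ≡⟨ us∗vs≈1 z ⟩
        par z (ε ∷ []) ∎
        where open ≡-Reasoning
      conclude : ∀ l → norm us ≡ l → ∀ m → norm vs ≡ m → ∃[ u ] (us ≈ u ∷ [])
      conclude [] el _ _ = contradiction
        (trans (sym (cong (xorSum (λ u → xorSum (δ-at (u ⁻¹ ▷ ε)) (norm vs))) el)) (product ε)) (λ ())
      conclude (_ ∷ _) el [] em = contradiction
        (trans (sym (xorSum-zero (norm us) (λ {u} _ → cong (xorSum (δ-at (u ⁻¹ ▷ ε))) em))) (product ε)) (λ ())
      conclude (l₀ ∷ l) el (m₀ ∷ m) em = q* , λ x → begin
          par x us                 ≡⟨ par-xorSum x us ⟩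
          xorSum (δ-at x) us       ≡⟨ xorSum-norm (δ-at x) us ⟨
          xorSum (δ-at x) (norm us) ≡⟨ xorSum-single (norm-! us) q*∈ (λ u∈ ne → contradiction (all-q* u∈) ne) ⟩
          ⌊ x ≟S q* ⌋              ≡⟨ xor-identityʳ _ ⟨
          par x (q* ∷ []) ∎
        where
        open ≡-Reasoning
        n half : ℕ
        half = ∑ (norm us) size ℕ.+ ∑ (norm vs) size
        -- `half` bounds the length of every product of an element of `us` and one of `vs`, and
        -- antisymmetry is applied to two such products.
        n = half ℕ.+ half
        maxM = maximum n (λ v → v) m₀ m
        minM = minimum n (λ v → v) m₀ m
        M = proj₁ maxM
        μ = proj₁ minM
        maxQ = maximum n (_▷ M) l₀ l
        minQ = minimum n (_▷ μ) l₀ l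
        q* = proj₁ maxQ
        q∘ = proj₁ minQ
        M∈ : M ∈ norm vs
        M∈ = subst (M ∈_) (sym em) (proj₁ (proj₂ maxM))
        μ∈ : μ ∈ norm vs
        μ∈ = subst (μ ∈_) (sym em) (proj₁ (proj₂ minM))
        q*∈ : q* ∈ norm us
        q*∈ = subst (q* ∈_) (sym el) (proj₁ (proj₂ maxQ))
        q∘∈ : q∘ ∈ norm us
        q∘∈ = subst (q∘ ∈_) (sym el) (proj₁ (proj₂ minQ))
        top : ∀ {v} → v ∈ norm vs → v ⊑[ n ] M
        top {v} v∈ = proj₂ (proj₂ maxM) (subst (v ∈_) em v∈)
        bot : ∀ {v} → v ∈ norm vs → μ ⊑[ n ] v
        bot {v} v∈ = proj₂ (proj₂ minM) (subst (v ∈_) em v∈)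
        topQ : ∀ {u} → u ∈ norm us → u ▷ M ⊑[ n ] q* ▷ M
        topQ {u} u∈ = proj₂ (proj₂ maxQ) (subst (u ∈_) el u∈)
        botQ : ∀ {u} → u ∈ norm us → q∘ ▷ μ ⊑[ n ] u ▷ μ
        botQ {u} u∈ = proj₂ (proj₂ minQ) (subst (u ∈_) el u∈)
        size-▷ : ∀ {u v} → u ∈ norm us → v ∈ norm vs → size (u ▷ v) ≤ half
        size-▷ {u} {v} u∈ v∈ = ℕP.≤-trans (length-act* (stack u) v) (ℕP.+-mono-≤ (size≤ u∈) (size≤ v∈))
        small : ∀ {u v u′ v′} → u ∈ norm us → v ∈ norm vs → u′ ∈ norm us → v′ ∈ norm vs → size (u ▷ v) ℕ.+ size (u′ ▷ v′) ≤ n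
        small a b c d = ℕP.+-mono-≤ (size-▷ a b) (size-▷ c d)
        odd-once : ∀ {q v} → q ∈ norm us → v ∈ norm vs →
          (∀ {u r} → u ∈ norm us → r ∈ norm vs → u ▷ r ≡ q ▷ v → u ≡ q) → q ▷ v ≡ ε
        odd-once {q} {v} q∈ v∈ once = odd-ε (trans (sym (product (q ▷ v))) (trans
          (xorSum-single (norm-! us) q∈ (λ {u} u∈ ne → even u u∈ ne))
          (trans (cong (λ z → xorSum (δ-at z) (norm vs)) (FA⁻¹.⁻¹-▷ q v)) (odd-∈ (norm-! vs) v∈))))
          where
          even : ∀ u → u ∈ norm us → u ≢ q → xorSum (δ-at (u ⁻¹ ▷ q ▷ v)) (norm vs) ≡ false
          even u u∈ ne with xorSum (δ-at (u ⁻¹ ▷ q ▷ v)) (norm vs) in eq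
          ... | false = refl
          ... | true  = contradiction (once u∈ (odd⇒∈ (norm vs) eq) (FA⁻¹.▷-⁻¹ u (q ▷ v))) ne
        -- If `u ▷ r` equals `q* ▷ M`, then `q* ▷ M` ⊑ `u ▷ M` by left invariance, and `u ▷ M` ⊑
        -- `q* ▷ M` by the choice of `q*`; cancelling `M` gives `u ≡ q*`. The product occurs once,
        -- so its coefficient is odd, and 1 has only the coefficient at `ε`.
        largest : q* ▷ M ≡ ε
        largest = odd-once q*∈ M∈ λ {u} {r} u∈ r∈ e → ▷-cancelʳ M
          (⊑-antisym (small u∈ M∈ q*∈ M∈) (topQ u∈) (subst (_⊑[ n ] u ▷ M) e (⊑-▷ {n} u (top r∈))))
        smallest : q∘ ▷ μ ≡ ε
        smallest = odd-once q∘∈ μ∈ λ {u} {r} u∈ r∈ e → ▷-cancelʳ μ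
          (⊑-antisym (small u∈ μ∈ q∘∈ μ∈) (subst (u ▷ μ ⊑[ n ]_) e (⊑-▷ {n} u (bot r∈))) (botQ u∈))
        -- Every product lies between the smallest and the largest one, and both of these are `ε`.
        -- In particular `u ▷ M` and `q* ▷ M` coincide.
        all-q* : ∀ {u} → u ∈ norm us → u ≡ q*
        all-q* {u} u∈ = ▷-cancelʳ M (⊑-antisym (small u∈ M∈ q*∈ M∈) (topQ u∈)
          (subst (_⊑[ n ] u ▷ M) (trans smallest (sym largest)) (⊑-trans {n} (botQ u∈) (⊑-▷ {n} u (top μ∈)))))

-- The graph of pairs Υ of the quotient Γ₁ is a forest

module PairGraph where

  open import Defs
  open FiniteSums
  open FreeActions
  open Folding
  open FreeGroup
  open GroupRing
  open import Data.Bool using (Bool; true; false; _xor_; T)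
  open import Data.Nat as ℕ using (ℕ; zero; suc; _+_)
  import Data.Nat.Properties as ℕP
  open import Data.Fin as Fin using (Fin; zero; suc)
  open import Data.Fin.Properties using (any?)
  open import Data.Unit using (tt)
  open import Data.Maybe using (Maybe; just; nothing)
  open import Data.List using (List; []; _∷_; _++_; map; length; filter; allFin; concatMap; deduplicate)
  open import Data.List.Properties using (length-++; length-map; map-id)
  open import Data.List.Membership.Propositional using (_∈_; _∉_)
  open import Data.List.Membership.Propositional.Properties using (∈-filter⁻; ∈-filter⁺; ∈-map⁺; ∈-map⁻; ∈-++⁺ˡ; ∈-++⁺ʳ; ∈-++⁻; ∈-allFin; ∈-deduplicate⁺; ∈-deduplicate⁻)
  import Data.List.Membership.DecPropositional as DecMem
  open import Data.List.Relation.Unary.Any using (here; there)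
  open import Data.List.Relation.Unary.All as All using (All; []; _∷_)
  open import Data.List.Relation.Unary.AllPairs using ([]; _∷_)
  open import Data.List.Relation.Unary.Unique.Propositional using (Unique)
  import Data.List.Relation.Unary.Unique.Propositional.Properties as UP
  open import Data.Product using (_×_; _,_; proj₁; proj₂; ∃; ∃-syntax)
  open import Data.Product.Properties using (≡-dec; ,-injective)
  open import Data.Sum using (_⊎_; inj₁; inj₂)
  open import Data.Empty using (⊥)
  open import Relation.Nullary using (yes; no; Dec; contradiction)
  open import Relation.Nullary.Decidable using (_×-dec_)
  open import Relation.Binary using (DecidableEquality)
  open import Relation.Binary.PropositionalEquality
  open import Function using (_∘_; id)

  private variable
    A : Set

  tri : ℕ → ℕ
  tri zero    = 0
  tri (suc n) = n + tri n

  pairs : List A → List (A × A)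
  pairs []       = []
  pairs (x ∷ xs) = map (x ,_) xs ++ pairs xs

  length-pairs : ∀ (xs : List A) → length (pairs xs) ≡ tri (length xs)
  length-pairs []       = refl
  length-pairs (x ∷ xs) = trans (length-++ (map (x ,_) xs)) (cong₂ _+_ (length-map _ xs) (length-pairs xs))

  ∈-pairs⁻ : ∀ {xs : List A} {a b} → (a , b) ∈ pairs xs → a ∈ xs × b ∈ xs
  ∈-pairs⁻ {xs = x ∷ xs} p with ∈-++⁻ (map (x ,_) xs) p
  ... | inj₁ q with ∈-map⁻ _ q
  ...   | _ , b∈ , refl = here refl , there b∈
  ∈-pairs⁻ {xs = x ∷ xs} p | inj₂ q with ∈-pairs⁻ q
  ... | a∈ , b∈ = there a∈ , there b∈

  ∈-pairs⁺ : ∀ {xs : List A} {a b} → a ≢ b → a ∈ xs → b ∈ xs → (a , b) ∈ pairs xs ⊎ (b , a) ∈ pairs xs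
  ∈-pairs⁺ ne (here refl) (here refl) = contradiction refl ne
  ∈-pairs⁺ ne (here refl) (there b∈)  = inj₁ (∈-++⁺ˡ (∈-map⁺ _ b∈))
  ∈-pairs⁺ ne (there a∈)  (here refl) = inj₂ (∈-++⁺ˡ (∈-map⁺ _ a∈))
  ∈-pairs⁺ {xs = x ∷ xs} ne (there a∈) (there b∈) with ∈-pairs⁺ ne a∈ b∈
  ... | inj₁ p = inj₁ (∈-++⁺ʳ (map (x ,_) xs) p)
  ... | inj₂ p = inj₂ (∈-++⁺ʳ (map (x ,_) xs) p)

  pairs-asym : ∀ {xs : List A} {a b} → Unique xs → (a , b) ∈ pairs xs → (b , a) ∉ pairs xs
  pairs-asym {xs = x ∷ xs} (x∉ ∷ u) p q with ∈-++⁻ (map (x ,_) xs) p | ∈-++⁻ (map (x ,_) xs) q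
  ... | inj₂ p′ | inj₂ q′ = pairs-asym u p′ q′
  ... | inj₁ p′ | inj₁ q′ with ∈-map⁻ _ p′ | ∈-map⁻ _ q′
  ...   | _ , b∈ , refl | _ , _ , refl = All.lookup x∉ b∈ refl
  pairs-asym {xs = x ∷ xs} (x∉ ∷ u) p q | inj₁ p′ | inj₂ q′ with ∈-map⁻ _ p′
  ... | _ , _ , refl = All.lookup x∉ (proj₂ (∈-pairs⁻ q′)) refl
  pairs-asym {xs = x ∷ xs} (x∉ ∷ u) p q | inj₂ p′ | inj₁ q′ with ∈-map⁻ _ q′
  ... | _ , _ , refl = All.lookup x∉ (proj₂ (∈-pairs⁻ p′)) refl

  pairs-irrefl : ∀ {xs : List A} {a} → Unique xs → (a , a) ∉ pairs xs
  pairs-irrefl u p = pairs-asym u p p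

  pairs-! : ∀ {xs : List A} → Unique xs → Unique (pairs xs)
  pairs-! []                      = []
  pairs-! {xs = x ∷ xs} (x∉ ∷ u) = UP.++⁺ (UP.map⁺ (cong proj₂) u) (pairs-! u) disj
    where
    disj : ∀ {v} → v ∈ map (x ,_) xs × v ∈ pairs xs → ⊥
    disj (p , q) with ∈-map⁻ _ p
    ... | _ , _ , refl = All.lookup x∉ (proj₁ (∈-pairs⁻ q)) refl

  edgesWith : ∀ {k} (w : Word k) → Part w → Fin k → List (Vtx w × Vtx w)
  edgesWith w p i = deduplicate (≡-dec Fin._≟_ Fin._≟_)
    (map (λ j → p (origin w j) , p (terminus w j)) (filter (λ j → label w j Fin.≟ i) (allFin (length w))))

  edgeCount : ∀ {k} (w : Word k) → Part w → Fin k → ℕ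
  edgeCount w p i = length (edgesWith w p i)

  -- `p` is Γ₁, labelled by representatives of its blocks (`idem`). The hypothesis `pot` is what
  -- remains of the condition that every further pair generates a quotient with χ = 2.
  module Pairs {k : ℕ} (w : Word k) (p : Part w)
    (gen : Gen w p ((first w , last w) ∷ []))
    (idem : ∀ a → p (p a) ≡ p a)
    (pot : ∀ a b → p a ≢ p b → Potentials w ((first w , last w) ∷ (a , b) ∷ [])
      (λ h l → label w h ≡ label w l × Cl w ((first w , last w) ∷ (a , b) ∷ []) (origin w h) (origin w l)))
    where

    V : Set
    V = Vtx w

    E₀ : List (V × V)
    E₀ = (first w , last w) ∷ []

    E₁ : V × V → List (V × V)
    E₁ P = (first w , last w) ∷ P ∷ []

    folded : Folded w p
    folded h l e = (λ x → proj₂ (gen _ _) (fo {h = h} {l} e (proj₁ (gen _ _) x)))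
                 , (λ x → proj₂ (gen _ _) (ft {h = h} {l} e (proj₁ (gen _ _) x)))

    data Edge : Letter k → V → V → Set where
      fwd : ∀ j → Edge (label w j , true)  (p (origin w j)) (p (terminus w j))
      bwd : ∀ j → Edge (label w j , false) (p (terminus w j)) (p (origin w j))

    Edge-inv : ∀ {l u v} → Edge l u v → Edge (inv l) v u
    Edge-inv (fwd j) = bwd j
    Edge-inv (bwd j) = fwd j

    Edge-det : ∀ {l u u′ v v′} → Edge l u u′ → Edge l v v′ → u ≡ v → u′ ≡ v′
    Edge-det {l} {u} {u′} {v} {v′} e e′ q = go e e′ refl q
      where
      go : ∀ {l l′ u u′ v v′} → Edge l u u′ → Edge l′ v v′ → l ≡ l′ → u ≡ v → u′ ≡ v′
      go (fwd j) (fwd j′) el q = proj₁ (folded j j′ (cong proj₁ el)) q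
      go (bwd j) (bwd j′) el q = proj₂ (folded j j′ (cong proj₁ el)) q
      go (fwd j) (bwd j′) ()
      go (bwd j) (fwd j′) ()

    edge? : ∀ l u → Dec (∃ (Edge l u))
    edge? (i , true) u with any? (λ j → (label w j Fin.≟ i) ×-dec (p (origin w j) Fin.≟ u))
    ... | yes (j , refl , refl) = yes (_ , fwd j)
    ... | no n = no (λ { (_ , fwd j) → n (j , refl , refl) })
    edge? (i , false) u with any? (λ j → (label w j Fin.≟ i) ×-dec (p (terminus w j) Fin.≟ u))
    ... | yes (j , refl , refl) = yes (_ , bwd j)
    ... | no n = no (λ { (_ , bwd j) → n (j , refl , refl) })

    stepA : Letter k → V → Maybe V
    stepA l u with edge? l u
    ... | yes (v , _) = just v
    ... | no _        = nothing

    step⇒edge : ∀ l u {v} → stepA l u ≡ just v → Edge l u v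
    step⇒edge l u q with edge? l u
    step⇒edge l u refl | yes (v , e) = e

    edge⇒step : ∀ {l u v} → Edge l u v → stepA l u ≡ just v
    edge⇒step {l} {u} {v} e with edge? l u
    ... | yes (v′ , e′) = cong just (Edge-det e′ e refl)
    ... | no n          = contradiction (v , e) n

    automaton : Automaton k
    automaton = record { V = V ; _≟V_ = Fin._≟_ ; step = stepA
      ; step-inv = λ l q → edge⇒step (Edge-inv (step⇒edge l _ q)) }

    open Free k using (F; ε; nf; actF; free; nf-stack; _⁻¹; module Act; module Act⁻¹)
    module FS = Completion automaton
    open FS using (completion)
    open FS.State using () renaming (vertex to vertexS; stack to stackS)
    module FR = Free k

    data Route : Word k → V → V → Set where
      []  : ∀ {u} → Route [] u u
      _∷_ : ∀ {l z u v v′} → Edge l v v′ → Route z u v → Route (l ∷ z) u v′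

    -- A reduced word that leaves the finite graph never comes back to it.
    reduced-route : ∀ z u .{t} → T (FR.validᵇ tt z) → let s = FSet.act* completion z (FS.state u [] t) in
      (stackS s ≡ [] × Route z u (vertexS s)) ⊎ (∃[ l ] ∃[ z′ ] ∃[ r ] (z ≡ l ∷ z′ × stackS s ≡ l ∷ r))
    reduced-route [] u ok = inj₁ (refl , [])
    reduced-route (l ∷ z) u {t} ok with FSet.act* completion z (FS.state u [] t) | reduced-route z u {t} (FR.pop tt l z ok)
    ... | FS.state v .[] _ | inj₁ (refl , rt) = go (stepA l v) refl
      where
      go : ∀ m (eq : stepA l v ≡ m) →
        (stackS (FS.leave l v m eq) ≡ [] × Route (l ∷ z) u (vertexS (FS.leave l v m eq))) ⊎
        (∃[ l′ ] ∃[ z′ ] ∃[ r ] (l ∷ z ≡ l′ ∷ z′ × stackS (FS.leave l v m eq) ≡ l′ ∷ r))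
      go (just v′) eq = inj₁ (refl , step⇒edge l v eq ∷ rt)
      go nothing   eq = inj₂ (l , z , [] , refl , refl)
    ... | FS.state v .(y ∷ r) t′ | inj₂ (y , z′ , r , refl , refl) = inj₂ (l , y ∷ z′ , y ∷ r , refl , cong stackS (FS.act-push l v y r {t′} {FS.push v l y r ne t′} ne))
      where
      ne : l ≢ inv y
      ne = FR.valid-≢ tt l y z′ ok

    _≟₂_ : DecidableEquality (V × V)
    _≟₂_ = ≡-dec Fin._≟_ Fin._≟_

    vertices : List V
    vertices = deduplicate Fin._≟_ (map p (allFin (suc (length w))))

    vertices-! : Unique vertices
    vertices-! = Distinct.dedup-! Fin._≟_ (map p (allFin (suc (length w))))

    p∈vertices : ∀ a → p a ∈ vertices
    p∈vertices a = ∈-deduplicate⁺ Fin._≟_ (∈-map⁺ p (∈-allFin a))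

    Ps : List (V × V)
    Ps = pairs vertices

    mk : V → V → V × V
    mk u v with DecMem._∈?_ _≟₂_ (u , v) Ps
    ... | yes _ = u , v
    ... | no _  = v , u

    mk-cases : ∀ u v → mk u v ≡ (u , v) ⊎ mk u v ≡ (v , u)
    mk-cases u v with DecMem._∈?_ _≟₂_ (u , v) Ps
    ... | yes _ = inj₁ refl
    ... | no _  = inj₂ refl

    mk-id : ∀ {u v} → (u , v) ∈ Ps → mk u v ≡ (u , v)
    mk-id {u} {v} m with DecMem._∈?_ _≟₂_ (u , v) Ps
    ... | yes _ = refl
    ... | no n  = contradiction m n

    mk-swap : ∀ {u v} → (v , u) ∈ Ps → mk u v ≡ (v , u)
    mk-swap {u} {v} m with DecMem._∈?_ _≟₂_ (u , v) Ps
    ... | yes m′ = contradiction m′ (pairs-asym vertices-! m)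
    ... | no _   = refl

    mk-∈ : ∀ {u v} → u ≢ v → u ∈ vertices → v ∈ vertices → mk u v ∈ Ps
    mk-∈ {u} {v} ne u∈ v∈ with ∈-pairs⁺ ne u∈ v∈
    ... | inj₁ m = subst (_∈ Ps) (sym (mk-id m)) m
    ... | inj₂ m = subst (_∈ Ps) (sym (mk-swap m)) m

    mk-sym : ∀ {u v} → u ≢ v → u ∈ vertices → v ∈ vertices → mk u v ≡ mk v u
    mk-sym ne u∈ v∈ with ∈-pairs⁺ ne u∈ v∈
    ... | inj₁ m = trans (mk-id m) (sym (mk-swap m))
    ... | inj₂ m = trans (mk-swap m) (sym (mk-id m))

    -- An unordered pair of vertices is represented by whichever of its two orders occurs in Ps; an
    -- edge of Υ is a pair of distinct edges of the quotient with a common label.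
    ΥEdge : Set
    ΥEdge = Fin k × (V × V) × (V × V)

    src tgt : ΥEdge → V × V
    src (i , (o , _) , (o′ , _)) = mk o o′
    tgt (i , (_ , t) , (_ , t′)) = mk t t′

    edges : Fin k → List (V × V)
    edges = edgesWith w p

    edges-! : ∀ i → Unique (edges i)
    edges-! i = Distinct.dedup-! _≟₂_ _

    ∈-edges⁻ : ∀ {i u v} → (u , v) ∈ edges i → Edge (i , true) u v
    ∈-edges⁻ {i} m with ∈-map⁻ _ (∈-deduplicate⁻ _≟₂_ (map (λ j → p (origin w j) , p (terminus w j)) (filter (λ j → label w j Fin.≟ i) (allFin (length w)))) m)
    ... | j , j∈ , refl with proj₂ (∈-filter⁻ (λ j → label w j Fin.≟ i) {xs = allFin (length w)} j∈)
    ...   | refl = fwd j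

    ∈-edges⁺ : ∀ {i u v} → Edge (i , true) u v → (u , v) ∈ edges i
    ∈-edges⁺ (fwd j) = ∈-deduplicate⁺ _≟₂_ (∈-map⁺ (λ j → p (origin w j) , p (terminus w j))
      (∈-filter⁺ (λ j′ → label w j′ Fin.≟ label w j) (∈-allFin j) refl))

    ΥEdges : List ΥEdge
    ΥEdges = concatMap (λ i → map (i ,_) (pairs (edges i))) (allFin k)

    ∈-ΥEdges⁻ : ∀ {i P Q} → (i , P , Q) ∈ ΥEdges → (P , Q) ∈ pairs (edges i)
    ∈-ΥEdges⁻ {i} {P} {Q} m = go (allFin k) m
      where
      go : ∀ is → (i , P , Q) ∈ concatMap (λ i → map (i ,_) (pairs (edges i))) is → (P , Q) ∈ pairs (edges i)
      go (i′ ∷ is) m with ∈-++⁻ (map (i′ ,_) (pairs (edges i′))) m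
      ... | inj₂ m′ = go is m′
      ... | inj₁ m′ with ∈-map⁻ _ m′
      ...   | _ , n , refl = n

    ∈-ΥEdges⁺ : ∀ {i P Q} → (P , Q) ∈ pairs (edges i) → (i , P , Q) ∈ ΥEdges
    ∈-ΥEdges⁺ {i} m = go (allFin k) (∈-allFin i)
      where
      go : ∀ is → i ∈ is → _ ∈ concatMap (λ i → map (i ,_) (pairs (edges i))) is
      go (i′ ∷ is) (here refl) = ∈-++⁺ˡ (∈-map⁺ _ m)
      go (i′ ∷ is) (there i∈)  = ∈-++⁺ʳ (map (i′ ,_) (pairs (edges i′))) (go is i∈)

    ΥEdges-! : Unique ΥEdges
    ΥEdges-! = go (allFin k) (UP.allFin⁺ k)
      where
      fam : Fin k → List ΥEdge
      fam i = map (i ,_) (pairs (edges i))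
      owner : ∀ is {e} → e ∈ concatMap fam is → proj₁ e ∈ is
      owner (i ∷ is) m with ∈-++⁻ (fam i) m
      ... | inj₂ m′ = there (owner is m′)
      ... | inj₁ m′ with ∈-map⁻ _ m′
      ...   | _ , _ , refl = here refl
      go : ∀ is → Unique is → Unique (concatMap fam is)
      go []       _        = []
      go (i ∷ is) (i∉ ∷ u) = UP.++⁺ (UP.map⁺ (cong proj₂) (pairs-! (edges-! i))) (go is u) disj
        where
        disj : ∀ {e} → e ∈ fam i × e ∈ concatMap fam is → ⊥
        disj (m , m′) with ∈-map⁻ _ m
        ... | _ , _ , refl = All.lookup i∉ (owner is m′) refl

    length-ΥEdges : length ΥEdges ≡ ∑ (allFin k) (λ i → tri (edgeCount w p i))
    length-ΥEdges = go (allFin k)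
      where
      go : ∀ is → length (concatMap (λ i → map (i ,_) (pairs (edges i))) is) ≡ ∑ is (λ i → tri (edgeCount w p i))
      go []       = refl
      go (i ∷ is) = trans (length-++ (map (i ,_) (pairs (edges i))))
        (cong₂ _+_ (trans (length-map _ (pairs (edges i))) (length-pairs (edges i))) (go is))

    record Ends (e : ΥEdge) : Set where
      field
        {o o′ t t′} : V
        shape : e ≡ (proj₁ e , (o , t) , (o′ , t′))
        e₁ : Edge (proj₁ e , true) o t
        e₂ : Edge (proj₁ e , true) o′ t′
        o≢ : o ≢ o′
        t≢ : t ≢ t′

    ends : ∀ {e} → e ∈ ΥEdges → Ends e
    ends {i , (o , t) , (o′ , t′)} m = record { shape = refl ; e₁ = a ; e₂ = b
        ; o≢ = λ q → ne (cong₂ _,_ q (Edge-det a b q))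
        ; t≢ = λ q → ne (cong₂ _,_ (Edge-det (Edge-inv a) (Edge-inv b) q) q) }
      where
      n = ∈-ΥEdges⁻ m
      a = ∈-edges⁻ (proj₁ (∈-pairs⁻ n))
      b = ∈-edges⁻ (proj₂ (∈-pairs⁻ n))
      ne : (o , t) ≢ (o′ , t′)
      ne refl = pairs-irrefl (edges-! i) n

    end∈ : ∀ {l u v} → Edge l u v → u ∈ vertices × v ∈ vertices
    end∈ (fwd j) = p∈vertices _ , p∈vertices _
    end∈ (bwd j) = p∈vertices _ , p∈vertices _

    mk-inj : ∀ {a b c d} → mk a b ≡ mk c d → (a ≡ c × b ≡ d) ⊎ (a ≡ d × b ≡ c)
    mk-inj {a} {b} {c} {d} q with mk-cases a b | mk-cases c d
    ... | inj₁ x | inj₁ y = inj₁ (,-injective (trans (sym x) (trans q y)))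
    ... | inj₁ x | inj₂ y = inj₂ (,-injective (trans (sym x) (trans q y)))
    ... | inj₂ x | inj₁ y with ,-injective (trans (sym x) (trans q y))
    ...   | b≡c , a≡d = inj₂ (a≡d , b≡c)
    mk-inj q | inj₂ x | inj₂ y with ,-injective (trans (sym x) (trans q y))
    ... | b≡d , a≡c = inj₁ (a≡c , b≡d)

    private
      Υ-same : ∀ {i a b a′ b′} → (i , a , b) ∈ ΥEdges → (i , a′ , b′) ∈ ΥEdges →
        (a ≡ a′ × b ≡ b′) ⊎ (a ≡ b′ × b ≡ a′) → (i , a , b) ≡ (i , a′ , b′)
      Υ-same m m′ (inj₁ (refl , refl)) = refl
      Υ-same {i} m m′ (inj₂ (refl , refl)) = contradiction (∈-ΥEdges⁻ m) (pairs-asym (edges-! i) (∈-ΥEdges⁻ m′))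

    -- In the folded graph Γ₁ a label and an origin determine an edge. Hence a label and the two
    -- origins determine the two edges, and their order is the one chosen in `ΥEdges`. So Υ is
    -- folded too.
    Υ-folded-src : ∀ {e e′} → e ∈ ΥEdges → e′ ∈ ΥEdges → proj₁ e ≡ proj₁ e′ → src e ≡ src e′ → e ≡ e′
    Υ-folded-src {i , (o , t) , (o′ , t′)} {_ , (ô , t̂) , (ô′ , t̂′)} m m′ refl q = Υ-same m m′ (go (mk-inj q))
      where
      open Ends (ends m) using () renaming (e₁ to a₁; e₂ to a₂)
      open Ends (ends m′) using () renaming (e₁ to b₁; e₂ to b₂)
      go : _ → _
      go (inj₁ (x , y)) = inj₁ (cong₂ _,_ x (Edge-det a₁ b₁ x) , cong₂ _,_ y (Edge-det a₂ b₂ y))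
      go (inj₂ (x , y)) = inj₂ (cong₂ _,_ x (Edge-det a₁ b₂ x) , cong₂ _,_ y (Edge-det a₂ b₁ y))

    Υ-folded-tgt : ∀ {e e′} → e ∈ ΥEdges → e′ ∈ ΥEdges → proj₁ e ≡ proj₁ e′ → tgt e ≡ tgt e′ → e ≡ e′
    Υ-folded-tgt {i , (o , t) , (o′ , t′)} {_ , (ô , t̂) , (ô′ , t̂′)} m m′ refl q = Υ-same m m′ (go (mk-inj q))
      where
      open Ends (ends m) using () renaming (e₁ to a₁; e₂ to a₂)
      open Ends (ends m′) using () renaming (e₁ to b₁; e₂ to b₂)
      go : _ → _
      go (inj₁ (x , y)) = inj₁ (cong₂ _,_ (Edge-det (Edge-inv a₁) (Edge-inv b₁) x) x , cong₂ _,_ (Edge-det (Edge-inv a₂) (Edge-inv b₂) y) y)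
      go (inj₂ (x , y)) = inj₂ (cong₂ _,_ (Edge-det (Edge-inv a₁) (Edge-inv b₂) x) x , cong₂ _,_ (Edge-det (Edge-inv a₂) (Edge-inv b₁) y) y)

    data Link (L : List ΥEdge) : Letter k → V × V → V × V → Set where
      up   : ∀ {e} → e ∈ L → Link L (proj₁ e , true)  (src e) (tgt e)
      down : ∀ {e} → e ∈ L → Link L (proj₁ e , false) (tgt e) (src e)

    data Path (L : List ΥEdge) : Word k → V × V → V × V → Set where
      []  : ∀ {P} → Path L [] P P
      _∷_ : ∀ {l z P Q R} → Link L l Q R → Path L z P Q → Path L (l ∷ z) P R

    Link-inv : ∀ {L l P Q} → Link L l P Q → Link L (inv l) Q P
    Link-inv (up m)   = down m
    Link-inv (down m) = up m

    path-++ : ∀ {L z z′ P Q R} → Path L z P Q → Path L z′ Q R → Path L (z′ ++ z) P R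
    path-++ π []       = π
    path-++ π (e ∷ π′) = e ∷ path-++ π π′

    path-rev : ∀ {L z P Q} → Path L z P Q → Path L (FR.invW z) Q P
    path-rev []      = []
    path-rev (e ∷ π) = path-++ (Link-inv e ∷ []) (path-rev π)

    Connected : List ΥEdge → V × V → V × V → Set
    Connected L P Q = ∃[ z ] Path L z P Q

    Link-mono : ∀ {L L′ l P Q} → (∀ {e} → e ∈ L → e ∈ L′) → Link L l P Q → Link L′ l P Q
    Link-mono s (up m)   = up (s m)
    Link-mono s (down m) = down (s m)

    path-mono : ∀ {L L′ z P Q} → (∀ {e} → e ∈ L → e ∈ L′) → Path L z P Q → Path L′ z P Q
    path-mono s []      = []
    path-mono s (e ∷ π) = Link-mono s e ∷ path-mono s π

    Link-det : ∀ {L l P Q Q′} → (∀ {e} → e ∈ L → e ∈ ΥEdges) → Link L l P Q → Link L l P Q′ → Q ≡ Q′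
    Link-det {L} s e e′ = go e e′ refl refl
      where
      go : ∀ {l l′ P P′ Q Q′} → Link L l P Q → Link L l′ P′ Q′ → l ≡ l′ → P ≡ P′ → Q ≡ Q′
      go (up m)   (up m′)   el q = cong tgt (Υ-folded-src (s m) (s m′) (cong proj₁ el) q)
      go (down m) (down m′) el q = cong src (Υ-folded-tgt (s m) (s m′) (cong proj₁ el) q)
      go (up _)   (down _)  ()
      go (down _) (up _)    ()

    -- As Υ is folded, two successive letters that cancel belong to a backtracking along a single
    -- edge, which can be left out of the path.
    path-nf : ∀ {L z P Q} → (∀ {e} → e ∈ L → e ∈ ΥEdges) → Path L z P Q → Path L (FR.stack (nf z)) P Q
    path-nf s [] = []
    path-nf {L} {l ∷ z} {P} {Q} s (e ∷ π) = push (nf z) (path-nf s π)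
      where
      push : ∀ u → Path L (FR.stack u) P _ → Path L (FR.stack (actF l u)) P Q
      push (FR.state tt [] _)      π = e ∷ π
      push (FR.state tt (y ∷ r) t) (e′ ∷ π) = go (l ≟ₗ inv y)
        where
        go : ∀ d → Path L (FR.stack (FR.turn l tt y r d t)) P Q
        go (yes refl) = subst (Path L r P) (Link-det s (Link-inv e′) e) π
        go (no _)     = e ∷ e′ ∷ π

    module Potential (P : V × V) (S : FSet k) (v : V × V → List (FSet.X S))
      (P≢ : p (proj₁ P) ≢ p (proj₂ P)) (v₀ : v (first w , last w) ≡ []) where
      open FSet S

      f : V → List X
      f = proj₁ (pot (proj₁ P) (proj₂ P) P≢ S v)

      rule : ∀ {h l} → label w h ≡ label w l → Cl w (E₁ P) (origin w h) (origin w l) → Rule w S f h l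
      rule e c = proj₂ (proj₂ (pot (proj₁ P) (proj₂ P) P≢ S v)) (e , c)

      at-e₀ : ∀ x → δ w S f x (first w) (last w) ≡ false
      at-e₀ x = trans (proj₁ (proj₂ (pot (proj₁ P) (proj₂ P) P≢ S v)) (here refl) x) (cong (par x) v₀)

      at-P : ∀ x → δ w S f x (proj₁ P) (proj₂ P) ≡ par x (v P)
      at-P x = proj₁ (proj₂ (pot (proj₁ P) (proj₂ P) P≢ S v)) (there (here refl)) x

      -- The difference vanishes at {s₀, s_m}, and the transport rule preserves zero; the potential
      -- thus descends to the vertices of Γ₁.
      flat : ∀ {a b} → Cl w E₀ a b → ∀ x → δ w S f x a b ≡ false
      flat (base (here refl)) x = at-e₀ x
      flat (rf {a}) x = δ-refl w S f x a
      flat (sy {a} {b} c) x = trans (δ-sym w S f x b a) (flat c x)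
      flat (tr {a} {b} {d} c c′) x = trans (sym (δ-trans w S f x a b d)) (cong₂ _xor_ (flat c x) (flat c′ x))
      flat (fo {h} {l} e c) x = trans (cong (λ z → δ w S f z (terminus w h) (terminus w l)) (sym (act-inv′ (label w h , true) x)))
        (trans (rule {h} {l} e (Cl-mono w (λ { (here q) → here q }) c) _) (flat c _))
      flat (ft {h} {l} e c) x = trans (sym (rule {h} {l} e (Cl-mono w (λ { (here q) → here q }) (ft {h = h} {l} e c)) x)) (flat c _)

      flat-p : ∀ a x → δ w S f x (p a) a ≡ false
      flat-p a = flat (proj₁ (gen (p a) a) (idem a))

      at-p : ∀ a x → par x (f (p a)) ≡ par x (f a)
      at-p a x = zero⇒≡ (flat-p a x)
        where
        zero⇒≡ : ∀ {a b} → a xor b ≡ false → a ≡ b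
        zero⇒≡ {true}  {true}  _ = refl
        zero⇒≡ {false} {false} _ = refl

      δ-p : ∀ a b x → δ w S f x (p a) (p b) ≡ δ w S f x a b
      δ-p a b x = cong₂ _xor_ (at-p a x) (at-p b x)

      Cl-p : ∀ {a b} → Cl w (E₁ P) (p a) (p b) → Cl w (E₁ P) a b
      Cl-p {a} {b} c = tr (up′ a) (tr c (sy (up′ b)))
        where
        up′ : ∀ a → Cl w (E₁ P) a (p a)
        up′ a = Cl-mono w (λ { (here q) → here q }) (proj₁ (gen a (p a)) (sym (idem a)))

      move : ∀ {l a a′ b b′} → Edge l a a′ → Edge l b b′ → Cl w (E₁ P) a b → ∀ x → δ w S f (act l x) a′ b′ ≡ δ w S f x a b
      move e e′ = go e e′ refl
        where
        go : ∀ {l l′ a a′ b b′} → Edge l a a′ → Edge l′ b b′ → l ≡ l′ → Cl w (E₁ P) a b → ∀ x → δ w S f (act l x) a′ b′ ≡ δ w S f x a b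
        go (fwd j) (fwd j′) q c x = trans (δ-p _ _ _) (trans (rule {j} {j′} (cong proj₁ q) (Cl-p c) x) (sym (δ-p _ _ x)))
        go (bwd j) (bwd j′) q c x = trans (δ-p _ _ _) (trans
          (sym (rule {j} {j′} (cong proj₁ q) (ft {h = j} {j′} (cong proj₁ q) (Cl-p c)) _))
          (trans (cong (λ z → δ w S f z (terminus w j) (terminus w j′)) (act-inv′ (label w j , true) x)) (sym (δ-p _ _ x))))
        go (fwd _) (bwd _) ()
        go (bwd _) (fwd _) ()

    up-p : ∀ P a → Cl w (E₁ P) a (p a)
    up-p P a = Cl-mono w (λ { (here q) → here q }) (proj₁ (gen a (p a)) (sym (idem a)))

    Cl-move : ∀ {P l a a′ b b′} → Edge l a a′ → Edge l b b′ → Cl w (E₁ P) a b → Cl w (E₁ P) a′ b′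
    Cl-move {P} e e′ = go e e′ refl
      where
      go : ∀ {l l′ a a′ b b′} → Edge l a a′ → Edge l′ b b′ → l ≡ l′ → Cl w (E₁ P) a b → Cl w (E₁ P) a′ b′
      go (fwd j) (fwd j′) q c = tr (sy (up-p P _)) (tr (fo {h = j} {j′} (cong proj₁ q) (tr (up-p P _) (tr c (sy (up-p P _))))) (up-p P _))
      go (bwd j) (bwd j′) q c = tr (sy (up-p P _)) (tr (ft {h = j} {j′} (cong proj₁ q) (tr (up-p P _) (tr c (sy (up-p P _))))) (up-p P _))
      go (fwd _) (bwd _) ()
      go (bwd _) (fwd _) ()

    record Moved (l : Letter k) (P Q : V × V) : Set where
      field
        {a b a′ b′} : V
        from : P ≡ (a , b) ⊎ P ≡ (b , a)
        to   : Q ≡ (a′ , b′) ⊎ Q ≡ (b′ , a′)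
        m₁ : Edge l a a′
        m₂ : Edge l b b′

    link-moved : ∀ {l P Q} → Link ΥEdges l P Q → Moved l P Q
    link-moved (up {e} m) = record { from = mk-cases _ _ ; to = mk-cases _ _ ; m₁ = Ends.e₁ (ends m) ; m₂ = Ends.e₂ (ends m) }
    link-moved (down {e} m) = record { from = mk-cases _ _ ; to = mk-cases _ _ ; m₁ = Edge-inv (Ends.e₁ (ends m)) ; m₂ = Edge-inv (Ends.e₂ (ends m)) }

    Cl₂ : V × V → V × V → Set
    Cl₂ P Q = Cl w (E₁ P) (proj₁ Q) (proj₂ Q)

    Cl₂-link : ∀ {P l Q R} → Link ΥEdges l Q R → Cl₂ P Q → Cl₂ P R
    Cl₂-link {P} e c with link-moved e
    ... | record { from = fr ; to = to ; m₁ = m₁ ; m₂ = m₂ } = out to (Cl-move {P} m₁ m₂ (into fr c))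
      where
      into : ∀ {Q a b} → Q ≡ (a , b) ⊎ Q ≡ (b , a) → Cl₂ P Q → Cl w (E₁ P) a b
      into (inj₁ refl) c = c
      into (inj₂ refl) c = sy c
      out : ∀ {Q a b} → Q ≡ (a , b) ⊎ Q ≡ (b , a) → Cl w (E₁ P) a b → Cl₂ P Q
      out (inj₁ refl) c = c
      out (inj₂ refl) c = sy c

    Cl₂-path : ∀ {P z Q} → Path ΥEdges z P Q → Cl₂ P Q
    Cl₂-path []      = base (there (here refl))
    Cl₂-path {P} (e ∷ π) = Cl₂-link {P} e (Cl₂-path π)

    fixed : ∀ {v} → v ∈ vertices → p v ≡ v
    fixed v∈ with ∈-map⁻ p (∈-deduplicate⁻ Fin._≟_ (map p (allFin (suc (length w)))) v∈)
    ... | u , _ , refl = idem u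

    Ps-≢ : ∀ {P} → P ∈ Ps → p (proj₁ P) ≢ p (proj₂ P)
    Ps-≢ {a , b} m q = pairs-irrefl vertices-! (subst (λ z → (z , b) ∈ Ps) a≡b m)
      where
      a≡b : a ≡ b
      a≡b = trans (sym (fixed (proj₁ (∈-pairs⁻ m)))) (trans q (fixed (proj₂ (∈-pairs⁻ m))))

    -- the value of a potential with f(P) = [ε] after following a path is the label of the path
    module Unit-at (P : V × V) (P∈ : P ∈ Ps) where
      private
        e₀ : V × V
        e₀ = first w , last w
        val : V × V → List F
        val Q with Q ≟₂ e₀
        ... | yes _ = []
        ... | no _  = ε ∷ []
        val-e₀ : val e₀ ≡ []
        val-e₀ with e₀ ≟₂ e₀
        ... | yes _ = refl
        ... | no n  = contradiction refl n
        e₀-≡ : p (first w) ≡ p (last w)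
        e₀-≡ = proj₂ (gen _ _) (base (here refl))
        val-P : val P ≡ ε ∷ []
        val-P with P ≟₂ e₀
        ... | yes refl = contradiction e₀-≡ (Ps-≢ P∈)
        ... | no _     = refl
      open Potential P free val (Ps-≢ P∈) val-e₀ public
      open FSet free using (par; act*)

      f-P : ∀ x → δ w free f x (proj₁ P) (proj₂ P) ≡ par x (ε ∷ [])
      f-P x = trans (at-P x) (cong (par x) val-P)

      value : V × V → F → Bool
      value Q x = δ w free f x (proj₁ Q) (proj₂ Q)

      value-link : ∀ {l Q R} → Link ΥEdges l Q R → Cl₂ P Q → ∀ x → value R (actF l x) ≡ value Q x
      value-link e c x with link-moved e
      ... | record { a = a ; b = b ; a′ = a′ ; b′ = b′ ; from = fr ; to = to ; m₁ = m₁ ; m₂ = m₂ } =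
          trans (norm to) (trans (move m₁ m₂ (into fr c) x) (sym (norm fr)))
        where
        into : ∀ {Q a b} → Q ≡ (a , b) ⊎ Q ≡ (b , a) → Cl₂ P Q → Cl w (E₁ P) a b
        into (inj₁ refl) c = c
        into (inj₂ refl) c = sy c
        norm : ∀ {Q a b x} → Q ≡ (a , b) ⊎ Q ≡ (b , a) → value Q x ≡ δ w free f x a b
        norm (inj₁ refl) = refl
        norm {a = a} {b} {x} (inj₂ refl) = δ-sym w free f x b a

      value-path : ∀ {z Q} → Path ΥEdges z P Q → ∀ x → value Q (act* z x) ≡ par x (ε ∷ [])
      value-path []      x = f-P x
      value-path (e ∷ π) x = trans (value-link e (Cl₂-path π) _) (value-path π x)

      -- The value at `Q` is a single group element, and it can be read off along either path, so
      -- both labels represent it.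
      label-unique : ∀ {l z Q} → Path ΥEdges z P Q → Path ΥEdges (l ∷ []) P Q → nf z ≡ actF l ε
      label-unique {l} {z} {Q} π ρ = trans (sym (FSet.act-inv′ free l (nf z))) (cong (actF l) back)
        where
        odd : par (actF (inv l) (nf z)) (ε ∷ []) ≡ true
        odd = trans (sym (value-path ρ (actF (inv l) (nf z)))) (trans (cong (value Q) (FSet.act-inv′ free l (nf z)))
          (trans (value-path π ε) refl))
        back : actF (inv l) (nf z) ≡ ε
        back = Units.odd-ε k odd

    module MP = Merge {V × V} {V × V} _≟₂_

    record Partial (L : List ΥEdge) : Set where
      field
        ρ     : V × V → V × V
        sound : ∀ {P Q} → ρ P ≡ ρ Q → Connected L P Q
        joins : ∀ {e} → e ∈ L → ρ (src e) ≡ ρ (tgt e)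
        stays : ∀ {P} → P ∈ Ps → ρ P ∈ Ps
        idemρ : ∀ P → ρ (ρ P) ≡ ρ P
        count : Distinct.D _≟₂_ (map ρ Ps) + length L ≡ length Ps

    -- The edges of Υ are added one at a time. No edge joins two pairs that are already connected,
    -- so each one lowers the number of components by exactly one.
    components : ∀ L → Unique L → (∀ {e} → e ∈ L → e ∈ ΥEdges) → Partial L
    components [] _ _ = record { ρ = id ; sound = λ { refl → [] , [] } ; joins = λ () ; stays = id ; idemρ = λ _ → refl
      ; count = trans (ℕP.+-identityʳ _) (Distinct.D-unique _≟₂_ (pairs-! vertices-!)
          (λ {z} → subst (z ∈_) (map-id Ps)) (λ {z} → subst (z ∈_) (sym (map-id Ps)))) }
    components (e ∷ L) (e∉ ∷ u) sub = record
        { ρ = ρ′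
        ; sound = snd ∘ MP.merge-inv ρ
        ; joins = λ { (here refl) → MP.merge-joins ρ ; (there m) → MP.merge-mono ρ (joins m) }
        ; stays = stays′
        ; idemρ = idem′
        ; count = trans (ℕP.+-suc _ (length L)) (trans (cong (_+ length L) (sym (MP.D-merge ρ apart src∈ tgt∈))) count) }
      where
      open Partial (components L u (sub ∘ there))
      en = ends (sub (here refl))
      src∈ : src e ∈ Ps
      src∈ = mk-∈ (Ends.o≢ en) (proj₁ (end∈ (Ends.e₁ en))) (proj₁ (end∈ (Ends.e₂ en)))
      tgt∈ : tgt e ∈ Ps
      tgt∈ = mk-∈ (Ends.t≢ en) (proj₂ (end∈ (Ends.e₁ en))) (proj₂ (end∈ (Ends.e₂ en)))
      ρ′ = MP.merge ρ (src e) (tgt e)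
      apart : ρ (src e) ≢ ρ (tgt e)
      -- Otherwise an old path joins the ends of `e`, and its reduced label is the single letter of
      -- `e`. That path reduces to one edge of `L` with the source and label of `e`, which is `e`
      -- itself since Υ is folded; but `e` is new.
      apart q with sound q
      ... | z , π = absurd (subst (λ z → Path L z (src e) (tgt e)) lbl (path-nf (sub ∘ there) π))
        where
        lbl : FR.stack (nf z) ≡ (proj₁ e , true) ∷ []
        lbl = cong FR.stack (Unit-at.label-unique (src e) src∈ (path-mono (sub ∘ there) π) (up (sub (here refl)) ∷ []))
        absurd : Path L ((proj₁ e , true) ∷ []) (src e) (tgt e) → ⊥
        absurd (lk ∷ []) = go lk refl refl
          where
          go : ∀ {l P Q} → Link L l P Q → l ≡ (proj₁ e , true) → P ≡ src e → ⊥
          go (up m) el q = All.lookup e∉ m (sym (Υ-folded-src (sub (there m)) (sub (here refl)) (cong proj₁ el) q))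
          go (down _) ()
      wk : ∀ {P Q} → Connected L P Q → Connected (e ∷ L) P Q
      wk (z , π) = z , path-mono there π
      ctrans : ∀ {P Q R} → Connected (e ∷ L) P Q → Connected (e ∷ L) Q R → Connected (e ∷ L) P R
      ctrans (_ , π) (_ , π′) = _ , path-++ π π′
      csym : ∀ {P Q} → Connected (e ∷ L) P Q → Connected (e ∷ L) Q P
      csym (_ , π) = _ , path-rev π
      bridge : Connected (e ∷ L) (src e) (tgt e)
      bridge = _ , up (here refl) ∷ []
      snd : ∀ {P Q} → MP.Related ρ (src e) (tgt e) P Q → Connected (e ∷ L) P Q
      snd (MP.same x)     = wk (sound x)
      snd (MP.cross x y)  = ctrans (wk (sound x)) (ctrans bridge (csym (wk (sound y))))
      snd (MP.cross′ x y) = ctrans (wk (sound x)) (ctrans (csym bridge) (csym (wk (sound y))))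
      stays′ : ∀ {P} → P ∈ Ps → ρ′ P ∈ Ps
      stays′ {P} m with ρ P ≟₂ ρ (src e)
      ... | yes _ = stays tgt∈
      ... | no _  = stays m
      idem′ : ∀ P → ρ′ (ρ′ P) ≡ ρ′ P
      idem′ P with ρ P ≟₂ ρ (src e)
      ... | yes _ = trans (MP.merge-≢ ρ (λ q → apart (trans (sym q) (idemρ (tgt e))))) (idemρ (tgt e))
      ... | no n  = trans (MP.merge-≢ ρ (λ q → n (trans (sym (idemρ P)) q))) (idemρ P)

    open Partial (components ΥEdges ΥEdges-! id) public

    reps : List (V × V)
    reps = deduplicate _≟₂_ (map ρ Ps)

    reps-! : Unique reps
    reps-! = Distinct.dedup-! _≟₂_ (map ρ Ps)

    reps∈ : ∀ {R} → R ∈ reps → R ∈ Ps × ρ R ≡ R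
    reps∈ R∈ with ∈-map⁻ ρ (∈-deduplicate⁻ _≟₂_ (map ρ Ps) R∈)
    ... | P , P∈ , refl = stays P∈ , idemρ P

    length-reps : length reps + ∑ (allFin k) (λ i → tri (edgeCount w p i)) ≡ tri (numVertices w p)
    length-reps = trans (cong (length reps +_) (sym length-ΥEdges)) (trans count (length-pairs vertices))

    covered : ∀ a b → p a ≢ p b → ∃[ R ] (R ∈ reps × (∀ {c d} → Cl w (E₁ (a , b)) c d → Cl w (E₁ R) c d) × (∀ {c d} → Cl w (E₁ R) c d → Cl w (E₁ (a , b)) c d))
    covered a b ne = ρ P , ∈-deduplicate⁺ _≟₂_ (∈-map⁺ ρ P∈) ,
        (λ c → swap {P} (Cl₂-path (proj₂ (sound (idemρ P)))) (swap′ c)) ,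
        (λ c → swap″ (swap {ρ P} (Cl₂-path (proj₂ (sound (sym (idemρ P))))) c))
      where
      P = mk (p a) (p b)
      P∈ : P ∈ Ps
      P∈ = mk-∈ ne (p∈vertices a) (p∈vertices b)
      swap : ∀ {Q R} → Cl₂ R Q → ∀ {c d} → Cl w (E₁ Q) c d → Cl w (E₁ R) c d
      swap r (base (here q))         = base (here q)
      swap r (base (there (here refl))) = r
      swap r rf        = rf
      swap {Q} {R} r (sy c)    = sy (swap {Q} {R} r c)
      swap {Q} {R} r (tr c c′) = tr (swap {Q} {R} r c) (swap {Q} {R} r c′)
      swap {Q} {R} r (fo {h} {l} e c)  = fo {h = h} {l} e (swap {Q} {R} r c)
      swap {Q} {R} r (ft {h} {l} e c)  = ft {h = h} {l} e (swap {Q} {R} r c)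
      P-pair : P ≡ (p a , p b) ⊎ P ≡ (p b , p a)
      P-pair = mk-cases (p a) (p b)
      mkPP : ∀ {Q} → Q ≡ (p a , p b) ⊎ Q ≡ (p b , p a) → Cl₂ Q (a , b)
      mkPP {Q} (inj₁ refl) = tr (up-p Q a) (tr (base (there (here refl))) (sy (up-p Q b)))
      mkPP {Q} (inj₂ refl) = tr (up-p Q a) (tr (sy (base (there (here refl)))) (sy (up-p Q b)))
      mkPQ : ∀ {Q} → Q ≡ (p a , p b) ⊎ Q ≡ (p b , p a) → Cl₂ (a , b) Q
      mkPQ {Q} (inj₁ refl) = tr (sy (up-p (a , b) a)) (tr (base (there (here refl))) (up-p (a , b) b))
      mkPQ {Q} (inj₂ refl) = tr (sy (up-p (a , b) b)) (tr (sy (base (there (here refl)))) (up-p (a , b) a))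
      swap′ : ∀ {c d} → Cl w (E₁ (a , b)) c d → Cl w (E₁ P) c d
      swap′ = swap {a , b} {P} (mkPP P-pair)
      swap″ : ∀ {c d} → Cl w (E₁ P) c d → Cl w (E₁ (a , b)) c d
      swap″ = swap {P} {a , b} (mkPQ P-pair)

    -- Two routes with a common label move a pair of vertices edge by edge along Υ; the two vertices
    -- stay distinct because folding also works backwards.
    routes-ρ : ∀ {z a a′ b b′} → Route z a a′ → Route z b b′ → a ≢ b → a ∈ vertices → b ∈ vertices →
      a′ ≢ b′ × a′ ∈ vertices × b′ ∈ vertices × ρ (mk a b) ≡ ρ (mk a′ b′)
    routes-ρ [] [] ne a∈ b∈ = ne , a∈ , b∈ , refl
    routes-ρ {l ∷ z} (_∷_ {v = u} {u′} e r) (_∷_ {v = v} {v′} e′ r′) ne a∈ b∈ with routes-ρ r r′ ne a∈ b∈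
    ... | ne′ , _ , _ , q = (λ x → ne′ (Edge-det (Edge-inv e) (Edge-inv e′) x)) , proj₂ (end∈ e) , proj₂ (end∈ e′) , trans q (link l e e′ ne′)
      where
      forward : ∀ {i u u′ v v′} → Edge (i , true) u u′ → Edge (i , true) v v′ → u ≢ v → u′ ≢ v′ → ρ (mk u v) ≡ ρ (mk u′ v′)
      forward e e′ ne ne′ with ∈-pairs⁺ (λ x → ne (cong proj₁ x)) (∈-edges⁺ e) (∈-edges⁺ e′)
      ... | inj₁ m = joins (∈-ΥEdges⁺ m)
      ... | inj₂ m = trans (cong ρ (mk-sym ne (proj₁ (end∈ e)) (proj₁ (end∈ e′)))) (trans (joins (∈-ΥEdges⁺ m))
                       (cong ρ (mk-sym (ne′ ∘ sym) (proj₂ (end∈ e′)) (proj₂ (end∈ e)))))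
      link : ∀ l {u u′ v v′} → Edge l u u′ → Edge l v v′ → u ≢ v → ρ (mk u v) ≡ ρ (mk u′ v′)
      link (i , true)  e e′ ne = forward e e′ ne (λ x → ne (Edge-det (Edge-inv e) (Edge-inv e′) x))
      link (i , false) e e′ ne = sym (forward (Edge-inv e) (Edge-inv e′) (λ x → ne (Edge-det (Edge-inv e) (Edge-inv e′) x)) ne)

-- Distinct components of Υ generate distinct quotients

module PairComponents where

  open import Defs
  open FiniteSums
  open FreeActions
  open Folding
  open FreeGroup
  open GroupRing
  open PairGraph
  open import Data.Bool using (Bool; true; false; _xor_)
  open import Data.Bool.Properties using (xor-same; xor-identityʳ)
  open import Data.Nat as ℕ using (ℕ; _+_)
  open import Data.Unit using (tt)
  open import Data.List using (List; []; _∷_; _++_; length; allFin)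
  open import Data.List.Relation.Unary.Unique.Propositional using (Unique)
  open import Data.List.Membership.Propositional using (_∈_)
  open import Data.List.Relation.Unary.Any using (here; there)
  open import Data.Product using (_×_; _,_; proj₁; proj₂; ∃-syntax)
  open import Data.Sum using (_⊎_; inj₁; inj₂)
  open import Relation.Nullary using (¬_; yes; no; Dec; ⌊_⌋; contradiction)
  open import Relation.Binary.PropositionalEquality
  open import Function using (_∘_)

  private
    yes-true : ∀ {P : Set} (d : Dec P) → P → ⌊ d ⌋ ≡ true
    yes-true (yes _) _ = refl
    yes-true (no n)  q = contradiction q n

    no-false : ∀ {P : Set} (d : Dec P) → ¬ P → ⌊ d ⌋ ≡ false
    no-false (yes q) n = contradiction q n
    no-false (no _)  _ = refl

    xor-true : ∀ {P Q : Set} (d : Dec P) (e : Dec Q) → ⌊ d ⌋ xor ⌊ e ⌋ ≡ true → P ⊎ Q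
    xor-true (yes q) _       _ = inj₁ q
    xor-true (no _)  (yes q) _ = inj₂ q

  module Separation {k : ℕ} (w : Word k) (p : Part w)
    (gen : Gen w p ((first w , last w) ∷ []))
    (idem : ∀ a → p (p a) ≡ p a)
    (pot : ∀ a b → p a ≢ p b → Potentials w ((first w , last w) ∷ (a , b) ∷ [])
      (λ h l → label w h ≡ label w l × Cl w ((first w , last w) ∷ (a , b) ∷ []) (origin w h) (origin w l)))
    where

    open Pairs w p gen idem pot
    open FS using (completion)

    -- The tautological potential. It obeys the transport rule because the letter of an edge of Γ₁
    -- takes the state of its origin to that of its terminus.
    point : V → List FS.State
    point a = FS.state (p a) [] tt ∷ []

    private
      module C = FSet completion
      module G = FSet (FR.free)

    par-point : ∀ x a → C.par x (point a) ≡ ⌊ x FS.≟S FS.state (p a) [] tt ⌋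
    par-point x a = xor-identityʳ _

    point-rule : ∀ h l → label w h ≡ label w l → Rule w completion point h l
    point-rule h l e x = cong₂ _xor_ (one _ h refl) (one _ l (sym e))
      where
      one : ∀ i j → label w j ≡ i → C.par (C.act (i , true) x) (point (terminus w j)) ≡ C.par x (point (origin w j))
      one _ j refl = trans (cong (λ s → C.par (C.act lt x) (s ∷ [])) (sym (FS.act-step lt (edge⇒step (fwd j)))))
        (trans (C.par-act lt (C.act lt x) (point (origin w j))) (cong (λ y → C.par y (point (origin w j))) (C.act-inv lt x)))
        where lt = (label w j , true)

    module _ {R R′ : V × V} (R∈ : R ∈ reps) (R′∈ : R′ ∈ reps)
      (into : ∀ {c d} → Cl w (E₁ R) c d → Cl w (E₁ R′) c d) (from : ∀ {c d} → Cl w (E₁ R′) c d → Cl w (E₁ R) c d) where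

      private
        a b a′ b′ : V
        a = proj₁ R
        b = proj₂ R
        a′ = proj₁ R′
        b′ = proj₂ R′
        module f = Unit-at R (proj₁ (reps∈ R∈))
        module g = Unit-at R′ (proj₁ (reps∈ R′∈))

        parF : ∀ u us → G.par u us ≡ xorSum (Parity.δ-at FR._≟S_ u) us
        parF = Convolution.par-xorSum FR.free

        xorResp : ∀ (h : FR.F → Bool) us vs → (∀ x → G.par x us ≡ G.par x vs) → xorSum h us ≡ xorSum h vs
        xorResp h us vs q = Parity.xorSum-resp FR._≟S_ h us vs (λ x → trans (sym (parF x us)) (trans (q x) (parF x vs)))

        -- The value at `R′` of the potential that is 1 at `R`.
        λs : List FR.F
        λs = f.f a′ ++ f.f b′

        -- every other potential on the quotient is the convolution of f with its value at R
        expand : ∀ (S : FSet k) (h : V → List (FSet.X S)) → (∀ x → δ w S h x (first w) (last w) ≡ false) →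
          (∀ {i j} → label w i ≡ label w j → Cl w (E₁ R) (origin w i) (origin w j) → Rule w S h i j) →
          ∀ x → δ w S h x a′ b′ ≡ xorSum (Convolution.at S (h a ++ h b) x) λs
        expand S h h₀ hr x = trans (Conv.equivariant w (E₁ R) f.f h y on-base f.rule hr (from (base (there (here refl)))) x)
            (sym (xorSum-++ _ (f.f a′) (f.f b′)))
          where
          module Conv = Convolution S
          y = h a ++ h b
          on-base : ∀ {c d} → (c , d) ∈ E₁ R → ∀ x → δ w S h x c d ≡ xorSum (Conv.at y x) (f.f c) xor xorSum (Conv.at y x) (f.f d)
          on-base (here refl) x = trans (h₀ x) (trans (xorResp (Conv.at y x) [] (f.f (first w) ++ f.f (last w))
              (λ u → trans (sym (f.at-e₀ u)) (sym (G.par-++ u (f.f (first w)) _)))) (xorSum-++ _ (f.f (first w)) _))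
          on-base (there (here refl)) x = trans (sym (FSet.par-++ S x (h a) (h b))) (trans (sym (xor-identityʳ _))
            (trans (xorResp (Conv.at y x) (FR.ε ∷ []) (f.f a ++ f.f b) (λ u → trans (sym (f.f-P u)) (sym (G.par-++ u (f.f a) _))))
              (xorSum-++ _ (f.f a) _)))

        -- Expanding the potential of `R′`, which is 1 at `R′`, shows that `λs` times the value of
        -- that potential at `R` is 1. A one-sided inverse is enough for `Units.unit`.
        λ-unit : ∃[ u ] (∀ x → G.par x λs ≡ G.par x (u ∷ []))
        λ-unit = Units.unit k λs (g.f a ++ g.f b) (λ x → trans (Convolution.par-∗ FR.free x λs _)
          (trans (sym (expand FR.free g.f g.at-e₀ (λ e c → g.rule e (into c)) x)) (g.f-P x)))

        module Translate (u : FR.F) (λ≈u : ∀ x → G.par x λs ≡ G.par x (u ∷ [])) where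

          open FR.Act completion using (_▷_)
          open FR.Act⁻¹ completion using (⁻¹-▷)

          -- The expansion of the tautological potential, with `λs` replaced by the single element
          -- `u`: as a set of two states, `R′` is the translate of `R` by `u`.
          image : ∀ x → δ w completion point x a′ b′ ≡ δ w completion point ((u FR.⁻¹) ▷ x) a b
          image x = trans (expand completion point (λ y → p₀ y) (λ {i} {j} e _ → point-rule i j e) x)
            (trans (xorResp _ λs (u ∷ []) λ≈u) (trans (xor-identityʳ _) (C.par-++ ((u FR.⁻¹) ▷ x) (point a) (point b))))
            where
            p₀ : ∀ y → δ w completion point y (first w) (last w) ≡ false
            p₀ y = trans (cong (λ v → C.par y (FS.state v [] tt ∷ []) xor C.par y (point (last w))) (proj₂ (gen _ _) (base (here refl))))
              (xor-same (C.par y (point (last w))))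

          R-≢ = Ps-≢ (proj₁ (reps∈ R∈))

          pt : V → FS.State
          pt v = FS.state (p v) [] tt

          hit : ∀ {c d} → p c ≢ p d → δ w completion point (pt c) c d ≡ true
          hit {c} {d} ne = cong₂ _xor_
            (trans (par-point (pt c) c) (yes-true (pt c FS.≟S pt c) refl))
            (trans (par-point (pt c) d) (no-false (pt c FS.≟S pt d) (ne ∘ cong FS.vertex)))

          landed : ∀ {x c d} → δ w completion point x c d ≡ true → x ≡ pt c ⊎ x ≡ pt d
          landed {x} {c} {d} q = xor-true (x FS.≟S pt c) (x FS.≟S pt d)
            (trans (sym (cong₂ _xor_ (par-point x c) (par-point x d))) q)

          u▷a : u ▷ pt a ≡ pt a′ ⊎ u ▷ pt a ≡ pt b′
          u▷a = landed (trans (image (u ▷ pt a)) (trans (cong (λ x → δ w completion point x a b) (⁻¹-▷ u (pt a))) (hit R-≢)))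

          u▷b : u ▷ pt b ≡ pt a′ ⊎ u ▷ pt b ≡ pt b′
          u▷b = landed (trans (image (u ▷ pt b)) (trans (cong (λ x → δ w completion point x a b) (⁻¹-▷ u (pt b)))
            (trans (δ-sym w completion point (pt b) a b) (hit (R-≢ ∘ sym)))))

          u▷-inj : ∀ {s} → u ▷ pt a ≡ s → u ▷ pt b ≡ s → ∀ {A : Set} → A
          u▷-inj q r = contradiction (cong FS.vertex (trans (sym (⁻¹-▷ u (pt a))) (trans (cong ((u FR.⁻¹) ▷_) (trans q (sym r))) (⁻¹-▷ u (pt b))))) R-≢

          fix : ∀ {P} → P ∈ Ps → p (proj₁ P) ≡ proj₁ P × p (proj₂ P) ≡ proj₂ P
          fix m with ∈-pairs⁻ m
          ... | x , y = fixed x , fixed y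

          -- `u` takes a vertex of Γ₁ to a vertex of Γ₁. Its word is reduced and could not return
          -- from an attached tree, so it labels a route inside Γ₁.
          route : ∀ {c d} → u ▷ pt c ≡ pt d → Route (FR.stack u) (p c) (p d)
          route {c} {d} q = arrive q (reduced-route (FR.stack u) (p c) {tt} (FR.valid! u))
            where
            arrive : ∀ {z v s} → s ≡ pt d →
              (FS.stack s ≡ [] × Route z v (FS.vertex s)) ⊎ (∃[ l ] ∃[ z′ ] ∃[ r ] (z ≡ l ∷ z′ × FS.stack s ≡ l ∷ r)) → Route z v (p d)
            arrive refl (inj₁ (_ , r)) = r
            arrive refl (inj₂ (_ , _ , _ , _ , ()))

          same-component : ∀ {c d} → Route (FR.stack u) (p a) (p c) → Route (FR.stack u) (p b) (p d) → ρ (mk (p a) (p b)) ≡ ρ (mk (p c) (p d))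
          same-component r r′ = proj₂ (proj₂ (proj₂ (routes-ρ r r′ R-≢ (p∈vertices a) (p∈vertices b))))

          mk-R : ∀ {P} → P ∈ Ps → mk (p (proj₁ P)) (p (proj₂ P)) ≡ P
          mk-R {P} m = trans (cong₂ mk (proj₁ (fix m)) (proj₂ (fix m))) (mk-id m)

          mk-R′ : ∀ {P} → P ∈ Ps → mk (p (proj₂ P)) (p (proj₁ P)) ≡ P
          mk-R′ {P} m = trans (cong₂ mk (proj₂ (fix m)) (proj₁ (fix m))) (mk-swap m)

          finish : ∀ {Q} → ρ (mk (p a) (p b)) ≡ ρ Q → Q ≡ R′ → R ≡ R′
          finish q refl = trans (sym (proj₂ (reps∈ R∈))) (trans (cong ρ (sym (mk-R (proj₁ (reps∈ R∈))))) (trans q (proj₂ (reps∈ R′∈))))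

          translated : R ≡ R′
          translated = conclude u▷a u▷b
            where
            conclude : u ▷ pt a ≡ pt a′ ⊎ u ▷ pt a ≡ pt b′ → u ▷ pt b ≡ pt a′ ⊎ u ▷ pt b ≡ pt b′ → R ≡ R′
            conclude (inj₁ q) (inj₁ r) = u▷-inj q r
            conclude (inj₂ q) (inj₂ r) = u▷-inj q r
            conclude (inj₁ q) (inj₂ r) = finish (same-component (route q) (route r)) (mk-R (proj₁ (reps∈ R′∈)))
            conclude (inj₂ q) (inj₁ r) = finish (same-component (route q) (route r)) (mk-R′ (proj₁ (reps∈ R′∈)))

      separated : R ≡ R′
      separated = Translate.translated (proj₁ λ-unit) (proj₂ λ-unit)

  -- The components of Υ are in bijection with the quotients generated by {s₀,s_m} and one more pair.
  record Components {k : ℕ} (w : Word k) (p : Part w) : Set where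
    private
      E₁ : Vtx w × Vtx w → List (Vtx w × Vtx w)
      E₁ P = (first w , last w) ∷ P ∷ []
    field
      reps      : List (Vtx w × Vtx w)
      reps-!    : Unique reps
      apart     : ∀ {R} → R ∈ reps → p (proj₁ R) ≢ p (proj₂ R)
      number    : length reps + ∑ (allFin k) (λ i → tri (edgeCount w p i)) ≡ tri (numVertices w p)
      covered   : ∀ a b → p a ≢ p b → ∃[ R ] (R ∈ reps × (∀ {c d} → Cl w (E₁ (a , b)) c d → Cl w (E₁ R) c d)
                                                       × (∀ {c d} → Cl w (E₁ R) c d → Cl w (E₁ (a , b)) c d))
      separated : ∀ {R R′} → R ∈ reps → R′ ∈ reps → (∀ {c d} → Cl w (E₁ R) c d → Cl w (E₁ R′) c d) →
                  (∀ {c d} → Cl w (E₁ R′) c d → Cl w (E₁ R) c d) → R ≡ R′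

  components-of : ∀ {k} (w : Word k) (p : Part w) → Gen w p ((first w , last w) ∷ []) → (∀ a → p (p a) ≡ p a) →
    (∀ a b → p a ≢ p b → Potentials w ((first w , last w) ∷ (a , b) ∷ [])
      (λ h l → label w h ≡ label w l × Cl w ((first w , last w) ∷ (a , b) ∷ []) (origin w h) (origin w l))) → Components w p
  components-of w p gen idem pot = record
    { reps = Pairs.reps w p gen idem pot
    ; reps-! = Pairs.reps-! w p gen idem pot
    ; apart = λ m → Pairs.Ps-≢ w p gen idem pot (proj₁ (Pairs.reps∈ w p gen idem pot m))
    ; number = Pairs.length-reps w p gen idem pot
    ; covered = Pairs.covered w p gen idem pot
    ; separated = Separation.separated w p gen idem pot }

-- Vectors over a finite set, grouped by which entries coincide

module Patterns where

  open import Defs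
  open FiniteSums
  open import Data.Bool using (Bool; not)
  open import Data.Nat as ℕ using (ℕ; zero; suc; _+_; _*_; _∸_; pred; _≤_; z≤n; s≤s)
  open import Data.Nat.Properties
  open import Data.Fin as Fin using (Fin; zero; suc)
  import Data.Fin.Properties as FinP
  open import Data.Vec as Vec using (Vec; []; _∷_; lookup)
  import Data.Vec.Properties as VecP
  open import Data.List using (List; []; _∷_; _++_; map; length; concatMap; allFin)
  open import Data.List.Properties using (length-map; length-tabulate; map-∘)
  open import Data.List.Membership.Propositional using (_∈_; _∉_)
  open import Data.List.Membership.Propositional.Properties using (∈-map⁺; ∈-map⁻; ∈-++⁺ˡ; ∈-++⁺ʳ; ∈-++⁻; ∈-allFin)
  import Data.List.Membership.DecPropositional as DecMem
  open import Data.List.Relation.Unary.Any using (here; there)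
  open import Data.List.Relation.Unary.All as All using (All; []; _∷_)
  open import Data.List.Relation.Unary.AllPairs using ([]; _∷_)
  open import Data.List.Relation.Unary.Unique.Propositional using (Unique)
  import Data.List.Relation.Unary.Unique.Propositional.Properties as UP
  open import Data.Product using (_×_; _,_; proj₁; proj₂; ∃-syntax)
  open import Data.Sum using (_⊎_; inj₁; inj₂)
  open import Data.Empty using (⊥)
  open import Relation.Nullary using (¬_; yes; no; Dec; ⌊_⌋; contradiction)
  open import Relation.Binary using (DecidableEquality)
  open import Relation.Binary.PropositionalEquality
  open import Function using (_∘_; id)

  -- The falling factorial n(n-1)⋯(n-v+1); it vanishes for v > n.
  fall : ℕ → ℕ → ℕ
  fall n zero    = 1
  fall n (suc v) = n * fall (pred n) v

  ∑-vecsOf : ∀ {A : Set} (xs : List A) r (f : Vec A (suc r) → ℕ) →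
    ∑ (vecsOf xs (suc r)) f ≡ ∑ xs (λ x → ∑ (vecsOf xs r) (f ∘ (x ∷_)))
  ∑-vecsOf xs r f = trans (∑-concatMap _ xs f) (∑-cong xs (λ x → ∑-map (x ∷_) (vecsOf xs r) f))

  ∈-vecsOf : ∀ {A : Set} (xs : List A) {r} (v : Vec A r) → v ∈ vecsOf xs r → ∀ i → lookup v i ∈ xs
  ∈-vecsOf xs {suc r} v m = go xs m id
    where
    go : ∀ ys → v ∈ concatMap (λ x → map (x ∷_) (vecsOf xs r)) ys → (∀ {y} → y ∈ ys → y ∈ xs) → ∀ i → lookup v i ∈ xs
    go (y ∷ ys) m s i with ∈-++⁻ (map (y ∷_) (vecsOf xs r)) m
    ... | inj₂ m′ = go ys m′ (s ∘ there) i
    ... | inj₁ m′ with ∈-map⁻ _ m′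
    go (y ∷ ys) m s zero    | inj₁ m′ | _ , _ , refl = s (here refl)
    go (y ∷ ys) m s (suc i) | inj₁ m′ | u , n , refl = ∈-vecsOf xs u n i

  module _ {n : ℕ} where
    open DecMem (FinP._≟_ {n}) using (_∈?_)

    absentᵇ : List (Fin n) → Fin n → Bool
    absentᵇ L x = not ⌊ x ∈? L ⌋

    ∑-split : ∀ (F : Fin n → ℕ) {L} → Unique L → ∑ (allFin n) F ≡ ∑ L F + ∑ (allFin n) (λ x → 𝟙 (absentᵇ L x) * F x)
    ∑-split F {[]} _ = ∑-cong (allFin n) (λ x → sym (+-identityʳ (F x)))
    ∑-split F {y ∷ L} (y∉ ∷ u) = begin
      ∑ (allFin n) F                                              ≡⟨ ∑-split F u ⟩
      ∑ L F + ∑ (allFin n) (λ x → 𝟙 (absentᵇ L x) * F x)          ≡⟨ cong (∑ L F +_) (∑-cong (allFin n) pick) ⟩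
      ∑ L F + ∑ (allFin n) (λ x → 𝟙 ⌊ x FinP.≟ y ⌋ * F x + 𝟙 (absentᵇ (y ∷ L) x) * F x)
        ≡⟨ cong (∑ L F +_) (∑-+ (allFin n) _ _) ⟩
      ∑ L F + (∑ (allFin n) (λ x → 𝟙 ⌊ x FinP.≟ y ⌋ * F x) + rest) ≡⟨ cong (λ z → ∑ L F + (z + rest)) single ⟩
      ∑ L F + (F y + rest)                                        ≡⟨ +-assoc (∑ L F) (F y) rest ⟨
      (∑ L F + F y) + rest                                        ≡⟨ cong (_+ rest) (+-comm (∑ L F) (F y)) ⟩
      (F y + ∑ L F) + rest ∎
      where
      open ≡-Reasoning
      rest = ∑ (allFin n) (λ x → 𝟙 (absentᵇ (y ∷ L) x) * F x)
      single : ∑ (allFin n) (λ x → 𝟙 ⌊ x FinP.≟ y ⌋ * F x) ≡ F y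
      single = trans (∑-single _ (UP.allFin⁺ n) (∈-allFin y) (λ {x} _ ne → off x ne)) on
        where
        off : ∀ x → x ≢ y → 𝟙 ⌊ x FinP.≟ y ⌋ * F x ≡ 0
        off x ne with x FinP.≟ y
        ... | yes e = contradiction e ne
        ... | no _  = refl
        on : 𝟙 ⌊ y FinP.≟ y ⌋ * F y ≡ F y
        on with y FinP.≟ y
        ... | yes _ = +-identityʳ (F y)
        ... | no ne = contradiction refl ne
      pick : ∀ x → 𝟙 (absentᵇ L x) * F x ≡ 𝟙 ⌊ x FinP.≟ y ⌋ * F x + 𝟙 (absentᵇ (y ∷ L) x) * F x
      pick x with x FinP.≟ y | x ∈? L
      ... | no _     | yes _ = refl
      ... | no _     | no _  = refl
      ... | yes refl | no _  = sym (+-identityʳ (F x + 0))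
      ... | yes refl | yes m = contradiction refl (All.lookup y∉ m)

    ∑-absent : ∀ {L} → Unique L → ∑ (allFin n) (λ x → 𝟙 (absentᵇ L x)) ≡ n ∸ length L
    ∑-absent {L} u = sym (begin
      n ∸ length L                                     ≡⟨ cong (_∸ length L) (trans (sym (length-tabulate {n = n} id)) (trans (sym (*-identityʳ _)) (sym (∑-const (allFin n) 1)))) ⟩
      ∑ (allFin n) (λ _ → 1) ∸ length L                ≡⟨ cong (_∸ length L) (∑-split (λ _ → 1) u) ⟩
      (∑ L (λ _ → 1) + ∑ (allFin n) (λ x → 𝟙 (absentᵇ L x) * 1)) ∸ length L
        ≡⟨ cong₂ (λ a b → (a + b) ∸ length L) (trans (∑-const L 1) (*-identityʳ _)) (∑-cong (allFin n) (λ x → *-identityʳ _)) ⟩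
      (length L + ∑ (allFin n) (λ x → 𝟙 (absentᵇ L x))) ∸ length L ≡⟨ m+n∸m≡n (length L) _ ⟩
      ∑ (allFin n) (λ x → 𝟙 (absentᵇ L x)) ∎)
      where open ≡-Reasoning

  -- Partitions of {0,…,r-1} in canonical form: the label of a block is its first member.  Each
  -- pattern carries the number of labels from js that it introduces.
  module _ {A : Set} where

    keep introduce : ∀ {r} → A → Vec A r × ℕ → Vec A (suc r) × ℕ
    keep l x      = l ∷ proj₁ x , proj₂ x
    introduce j x = j ∷ proj₁ x , suc (proj₂ x)

    weight : ∀ {r} → ℕ → (Vec A r → ℕ) → Vec A r × ℕ → ℕ
    weight n G x = fall n (proj₂ x) * G (proj₁ x)

    pats : ∀ {r} → List A → Vec A r → List (Vec A r × ℕ)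
    pats ls []       = ([] , 0) ∷ []
    pats ls (j ∷ js) = concatMap (λ l → map (keep l) (pats ls js)) ls
                       ++ map (introduce j) (pats (j ∷ ls) js)

    data PatView {r} (ls : List A) (j : A) (js : Vec A r) : Vec A (suc r) × ℕ → Set where
      old : ∀ {l p ν} → l ∈ ls → (p , ν) ∈ pats ls js → PatView ls j js (l ∷ p , ν)
      new : ∀ {p ν} → (p , ν) ∈ pats (j ∷ ls) js → PatView ls j js (j ∷ p , suc ν)

    patView : ∀ {r} ls j (js : Vec A r) {x} → x ∈ pats ls (j ∷ js) → PatView ls j js x
    patView {r} ls j js {x} m with ∈-++⁻ (concatMap (λ l → map (keep l) (pats ls js)) ls) m
    ... | inj₂ m′ with ∈-map⁻ _ m′
    ...   | _ , n , refl = new n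
    patView {r} ls j js {x} m | inj₁ m′ = go ls m′ id
      where
      go : ∀ ks → x ∈ concatMap (λ l → map (keep l) (pats ls js)) ks → (∀ {l} → l ∈ ks → l ∈ ls) → PatView ls j js x
      go (l ∷ ks) m s with ∈-++⁻ (map (keep l) (pats ls js)) m
      ... | inj₂ m′ = go ks m′ (s ∘ there)
      ... | inj₁ m′ with ∈-map⁻ _ m′
      ...   | _ , n , refl = old (s (here refl)) n

    old∈ : ∀ {r ls j} {js : Vec A r} {l p ν} → l ∈ ls → (p , ν) ∈ pats ls js → (l ∷ p , ν) ∈ pats ls (j ∷ js)
    old∈ {ls = ls} {j} {js} {l} {p} {ν} l∈ m = ∈-++⁺ˡ (go ls l∈)
      where
      go : ∀ ks → l ∈ ks → (l ∷ p , ν) ∈ concatMap (λ l → map (keep l) (pats ls js)) ks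
      go (l′ ∷ ks) (here refl) = ∈-++⁺ˡ (∈-map⁺ _ m)
      go (l′ ∷ ks) (there q)   = ∈-++⁺ʳ (map _ (pats ls js)) (go ks q)

    new∈ : ∀ {r ls j} {js : Vec A r} {p ν} → (p , ν) ∈ pats (j ∷ ls) js → (j ∷ p , suc ν) ∈ pats ls (j ∷ js)
    new∈ {ls = ls} {js = js} m = ∈-++⁺ʳ (concatMap (λ l → map (keep l) (pats ls js)) ls) (∈-map⁺ _ m)

    pat-canonical : ∀ {r} ls (js : Vec A r) {p ν} → (p , ν) ∈ pats ls js → ∀ i →
      lookup p i ∈ ls ⊎ (∃[ i′ ] (i′ Fin.≤ i × lookup p i ≡ lookup js i′ × lookup p i′ ≡ lookup js i′))
    pat-canonical ls (j ∷ js) m i with patView ls j js m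
    pat-canonical ls (j ∷ js) m zero    | old l∈ _ = inj₁ l∈
    pat-canonical ls (j ∷ js) m (suc i) | old _ m′ with pat-canonical ls js m′ i
    ... | inj₁ q = inj₁ q
    ... | inj₂ (i′ , le , a , b) = inj₂ (suc i′ , s≤s le , a , b)
    pat-canonical ls (j ∷ js) m zero    | new m′ = inj₂ (zero , z≤n , refl , refl)
    pat-canonical ls (j ∷ js) m (suc i) | new m′ with pat-canonical (j ∷ ls) js m′ i
    ... | inj₁ (here q)  = inj₂ (zero , z≤n , q , refl)
    ... | inj₁ (there q) = inj₁ q
    ... | inj₂ (i′ , le , a , b) = inj₂ (suc i′ , s≤s le , a , b)

    module _ (_≟_ : DecidableEquality A) where
      open Distinct _≟_

      pat-count : ∀ {r} ls (js : Vec A r) {p ν} → Unique ls → (∀ {x} → x ∈ ls → x ∉ Vec.toList js) → Unique (Vec.toList js) →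
        (p , ν) ∈ pats ls js → length ls + ν ≡ D (Vec.toList p ++ ls)
      pat-count ls [] u d u′ (here refl) = trans (+-identityʳ _) (sym (D-unique u id id))
      pat-count ls (j ∷ js) u d (j∉ ∷ u′) m with patView ls j js m
      ... | old {p = p} l∈ m′ = trans (pat-count ls js u (λ x∈ → d x∈ ∘ there) u′ m′) (sym (D-∈ (∈-++⁺ʳ (Vec.toList p) l∈)))
      ... | new {p} {ν} m′ = trans (+-suc (length ls) ν) (trans
          (pat-count (j ∷ ls) js (All.tabulate (λ x∈ e → d x∈ (here (sym e))) ∷ u) d′ u′ m′)
          (D-same to from))
        where
        d′ : ∀ {x} → x ∈ j ∷ ls → x ∉ Vec.toList js
        d′ (here refl) q = All.lookup j∉ q refl
        d′ (there x∈)  q = d x∈ (there q)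
        to : ∀ {z} → z ∈ Vec.toList p ++ j ∷ ls → z ∈ j ∷ (Vec.toList p ++ ls)
        to z∈ with ∈-++⁻ (Vec.toList p) z∈
        ... | inj₁ q         = there (∈-++⁺ˡ q)
        ... | inj₂ (here e)  = here e
        ... | inj₂ (there q) = there (∈-++⁺ʳ (Vec.toList p) q)
        from : ∀ {z} → z ∈ j ∷ (Vec.toList p ++ ls) → z ∈ Vec.toList p ++ j ∷ ls
        from (here e) = ∈-++⁺ʳ (Vec.toList p) (here e)
        from (there z∈) with ∈-++⁻ (Vec.toList p) z∈
        ... | inj₁ q = ∈-++⁺ˡ q
        ... | inj₂ q = ∈-++⁺ʳ (Vec.toList p) (there q)

    pats-! : ∀ {r} ls (js : Vec A r) → Unique ls → (∀ {x} → x ∈ ls → x ∉ Vec.toList js) → Unique (Vec.toList js) → Unique (map proj₁ (pats ls js))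
    pats-! ls [] u d u′ = [] ∷ []
    pats-! {suc r} ls (j ∷ js) u d (j∉ ∷ u′) = subst Unique (sym split) (UP.++⁺ (olds ls u id) news disj)
      where
      rec : Unique (map proj₁ (pats ls js))
      rec = pats-! ls js u (λ x∈ → d x∈ ∘ there) u′
      d′ : ∀ {x} → x ∈ j ∷ ls → x ∉ Vec.toList js
      d′ (here refl) q = All.lookup j∉ q refl
      d′ (there x∈)  q = d x∈ (there q)
      oldL : List A → List (Vec A (suc r))
      oldL ks = concatMap (λ l → map (l ∷_) (map proj₁ (pats ls js))) ks
      newL : List (Vec A (suc r))
      newL = map (j ∷_) (map proj₁ (pats (j ∷ ls) js))
      news : Unique newL
      news = UP.map⁺ VecP.∷-injectiveʳ (pats-! (j ∷ ls) js (All.tabulate (λ x∈ e → d x∈ (here (sym e))) ∷ u) d′ u′)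
      head-old : ∀ ks {v} → v ∈ oldL ks → Vec.head v ∈ ks
      head-old (l ∷ ks) m with ∈-++⁻ (map (l ∷_) (map proj₁ (pats ls js))) m
      ... | inj₂ m′ = there (head-old ks m′)
      ... | inj₁ m′ with ∈-map⁻ _ m′
      ...   | _ , _ , refl = here refl
      olds : ∀ ks → Unique ks → (∀ {l} → l ∈ ks → l ∈ ls) → Unique (oldL ks)
      olds []       _        _ = []
      olds (l ∷ ks) (l∉ ∷ v) s = UP.++⁺ (UP.map⁺ VecP.∷-injectiveʳ rec) (olds ks v (s ∘ there)) dj
        where
        dj : ∀ {v} → v ∈ map (l ∷_) (map proj₁ (pats ls js)) × v ∈ oldL ks → ⊥
        dj (a , b) with ∈-map⁻ _ a
        ... | _ , _ , refl = All.lookup l∉ (head-old ks b) refl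
      disj : ∀ {v} → v ∈ oldL ls × v ∈ newL → ⊥
      disj (a , b) with ∈-map⁻ _ b
      ... | _ , _ , refl = d (head-old ls a) (here refl)
      split-old : ∀ ks → map proj₁ (concatMap (λ l → map (keep l) (pats ls js)) ks) ≡ oldL ks
      split-old []       = refl
      split-old (l ∷ ks) = trans (Data.List.Properties.map-++ proj₁ (map _ (pats ls js)) _)
        (cong₂ _++_ (trans (sym (map-∘ (pats ls js))) (map-∘ (pats ls js))) (split-old ks))
      split : map proj₁ (pats ls (j ∷ js)) ≡ oldL ls ++ newL
      split = trans (Data.List.Properties.map-++ proj₁ (concatMap _ ls) _)
        (cong₂ _++_ (split-old ls) (trans (sym (map-∘ (pats (j ∷ ls) js))) (map-∘ (pats (j ∷ ls) js))))

    module _ {n : ℕ} where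

      find : (used : List (Fin n × A)) (x : Fin n) → Dec (∃[ l ] ((x , l) ∈ used))
      find []              x = no (λ ())
      find ((y , l) ∷ used) x with x FinP.≟ y
      ... | yes refl = yes (l , here refl)
      ... | no ne with find used x
      ...   | yes (l′ , m) = yes (l′ , there m)
      ...   | no nm = no (λ { (l′ , here refl) → ne refl ; (l′ , there m) → nm (l′ , m) })

      codeHead : ∀ {used : List (Fin n × A)} {x} → Dec (∃[ l ] ((x , l) ∈ used)) → A → A × List (Fin n × A)
      codeHead {used} {x} (yes (l , _)) j = l , used
      codeHead {used} {x} (no _)        j = j , (x , j) ∷ used

      -- Each entry receives the label of the position where its value first occurred; `used` is the
      -- table of the values met so far.
      code : ∀ {r} → List (Fin n × A) → Vec A r → Vec (Fin n) r → Vec A r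
      code used []       []      = []
      code used (j ∷ js) (x ∷ t) = proj₁ (codeHead (find used x) j) ∷ code (proj₂ (codeHead (find used x) j)) js t

      assoc-det : ∀ {used : List (Fin n × A)} {x l l′} → Unique (map proj₁ used) → (x , l) ∈ used → (x , l′) ∈ used → l ≡ l′
      assoc-det (_ ∷ u)  (here refl) (here refl) = refl
      assoc-det (x∉ ∷ u) (here refl) (there m)   = contradiction refl (All.lookup x∉ (∈-map⁺ proj₁ m))
      assoc-det (x∉ ∷ u) (there m)   (here refl) = contradiction refl (All.lookup x∉ (∈-map⁺ proj₁ m))
      assoc-det (_ ∷ u)  (there m)   (there m′)  = assoc-det u m m′

      assoc-inj : ∀ {used : List (Fin n × A)} {x x′ l} → Unique (map proj₂ used) → (x , l) ∈ used → (x′ , l) ∈ used → x ≡ x′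
      assoc-inj (_ ∷ u)  (here refl) (here refl) = refl
      assoc-inj (x∉ ∷ u) (here refl) (there m)   = contradiction refl (All.lookup x∉ (∈-map⁺ proj₂ m))
      assoc-inj (x∉ ∷ u) (there m)   (here refl) = contradiction refl (All.lookup x∉ (∈-map⁺ proj₂ m))
      assoc-inj (_ ∷ u)  (there m)   (there m′)  = assoc-inj u m m′

      fresh : ∀ {used : List (Fin n × A)} {x} → ¬ (∃[ l ] ((x , l) ∈ used)) → x ∉ map proj₁ used
      fresh {used} nf m with ∈-map⁻ proj₁ {xs = used} m
      ... | (_ , l) , m′ , refl = nf (l , m′)

      record Table (used : List (Fin n × A)) {r} (js : Vec A r) : Set where
        constructor table
        field
          keys   : Unique (map proj₁ used)
          labels : Unique (map proj₂ used)
          apart  : ∀ {x} → x ∈ map proj₂ used → x ∉ Vec.toList js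
          rest   : Unique (Vec.toList js)

      Table-old : ∀ {used r j} {js : Vec A r} → Table used (j ∷ js) → Table used js
      Table-old (table k l a (_ ∷ u)) = table k l (λ x∈ → a x∈ ∘ there) u

      Table-new : ∀ {used r j} {js : Vec A r} {x} → Table used (j ∷ js) → ¬ (∃[ l ] ((x , l) ∈ used)) → Table ((x , j) ∷ used) js
      Table-new {used} {j = j} {js} {x} (table k l a (j∉ ∷ u)) nf = table
        (All.tabulate (λ m e → fresh nf (subst (_∈ map proj₁ used) (sym e) m)) ∷ k)
        (All.tabulate (λ m e → a m (here (sym e))) ∷ l) ap u
        where
        ap : ∀ {z} → z ∈ j ∷ map proj₂ used → z ∉ Vec.toList js
        ap (here refl) q = All.lookup j∉ q refl
        ap (there m)   q = a m (there q)

      code-table : ∀ {r} {used} {js : Vec A r} t → Table used js →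
        ∃[ used′ ] (Unique (map proj₁ used′) × Unique (map proj₂ used′) × (∀ {e} → e ∈ used → e ∈ used′) ×
          (∀ i → (lookup t i , lookup (code used js t) i) ∈ used′))
      code-table {used = used} {[]} [] T = used , Table.keys T , Table.labels T , id , λ ()
      code-table {used = used} {j ∷ js} (x ∷ t) T with find used x
      ... | yes (l , m) with code-table t (Table-old T)
      ...   | used′ , a , b , s , c = used′ , a , b , s , λ { zero → s m ; (suc i) → c i }
      code-table {used = used} {j ∷ js} (x ∷ t) T | no nf with code-table t (Table-new T nf)
      ...   | used′ , a , b , s , c = used′ , a , b , s ∘ there , λ { zero → s (here refl) ; (suc i) → c i }

      code-kernel : ∀ {r} (js : Vec A r) t → Unique (Vec.toList js) → ∀ i i′ →
        (lookup (code [] js t) i ≡ lookup (code [] js t) i′ → lookup t i ≡ lookup t i′) ×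
        (lookup t i ≡ lookup t i′ → lookup (code [] js t) i ≡ lookup (code [] js t) i′)
      code-kernel js t u i i′ with code-table t (table {used = []} [] [] (λ ()) u)
      ... | used′ , a , b , _ , c =
        (λ e → assoc-inj b (c i) (subst (λ l → (lookup t i′ , l) ∈ used′) (sym e) (c i′))) ,
        (λ e → assoc-det a (c i) (subst (λ x → (x , lookup (code [] js t) i′) ∈ used′) (sym e) (c i′)))

      code∈pats : ∀ {r} used (js : Vec A r) t → ∃[ ν ] ((code used js t , ν) ∈ pats (map proj₂ used) js)
      code∈pats used []       []      = 0 , here refl
      code∈pats used (j ∷ js) (x ∷ t) with find used x
      ... | yes (l , m) with code∈pats used js t
      ...   | ν , q = ν , old∈ {js = js} (∈-map⁺ proj₂ m) q
      code∈pats used (j ∷ js) (x ∷ t) | no _ with code∈pats ((x , j) ∷ used) js t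
      ...   | ν , q = suc ν , new∈ {ls = map proj₂ used} {js = js} q

      -- The next entry is either a known value, whose label is then forced, or one of the n -
      -- |used| unknown ones, which all contribute the same amount. The latter choices accumulate to
      -- a falling factorial.
      ∑-code : ∀ {r} used (js : Vec A r) (G : Vec A r → ℕ) → Unique (map proj₁ used) →
        ∑ (vecsOf (allFin n) r) (G ∘ code used js) ≡ ∑ (pats (map proj₂ used) js) (weight (n ∸ length used) G)
      ∑-code used [] G u = cong (_+ 0) (sym (+-identityʳ (G [])))
      ∑-code {suc r} used (j ∷ js) G u = begin
        ∑ (vecsOf (allFin n) (suc r)) (G ∘ code used (j ∷ js))
          ≡⟨ ∑-vecsOf (allFin n) r _ ⟩
        ∑ (allFin n) H
          ≡⟨ ∑-split H u ⟩
        ∑ (map proj₁ used) H + ∑ (allFin n) (λ x → 𝟙 (absentᵇ (map proj₁ used) x) * H x)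
          ≡⟨ cong₂ _+_ olds news ⟩
        ∑ (concatMap (λ l → map (keep l) (pats ls js)) ls) W + ∑ (map (introduce j) (pats (j ∷ ls) js)) W
          ≡⟨ ∑-++ (concatMap (λ l → map (keep l) (pats ls js)) ls) _ W ⟨
        ∑ (pats ls (j ∷ js)) W ∎
        where
        open ≡-Reasoning
        ls = map proj₂ used
        H : Fin n → ℕ
        H x = ∑ (vecsOf (allFin n) r) (λ t → G (code used (j ∷ js) (x ∷ t)))
        W : Vec A (suc r) × ℕ → ℕ
        W = weight (n ∸ length used) G
        Old : A → ℕ
        Old l = ∑ (pats ls js) (weight (n ∸ length used) (G ∘ (l ∷_)))
        H-old : ∀ {x l} → (x , l) ∈ used → H x ≡ Old l
        H-old {x} {l} m with find used x
        ... | no nf = contradiction (l , m) nf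
        ... | yes (l′ , m′) with assoc-det u m m′
        ...   | refl = ∑-code used js (G ∘ (l ∷_)) u
        New : ℕ
        New = ∑ (pats (j ∷ ls) js) (weight (n ∸ suc (length used)) (G ∘ (j ∷_)))
        H-new : ∀ x → x ∉ map proj₁ used → H x ≡ New
        H-new x nx with find used x
        ... | yes (l , m) = contradiction (∈-map⁺ proj₁ m) nx
        ... | no nf = ∑-code ((x , j) ∷ used) js (G ∘ (j ∷_)) (All.tabulate (λ m e → nx (subst (_∈ map proj₁ used) (sym e) m)) ∷ u)
        olds : ∑ (map proj₁ used) H ≡ ∑ (concatMap (λ l → map (keep l) (pats ls js)) ls) W
        olds = begin
          ∑ (map proj₁ used) H ≡⟨ ∑-map proj₁ used H ⟩
          ∑ used (H ∘ proj₁) ≡⟨ ∑-cong-∈ used H-old ⟩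
          ∑ used (Old ∘ proj₂) ≡⟨ ∑-map proj₂ used Old ⟨
          ∑ ls Old ≡⟨ ∑-cong ls (λ l → ∑-map _ (pats ls js) W) ⟨
          ∑ ls (λ l → ∑ (map (keep l) (pats ls js)) W) ≡⟨ ∑-concatMap _ ls W ⟨
          _ ∎
        news : ∑ (allFin n) (λ x → 𝟙 (absentᵇ (map proj₁ used) x) * H x) ≡ ∑ (map (introduce j) (pats (j ∷ ls) js)) W
        news = begin
          ∑ (allFin n) (λ x → 𝟙 (absentᵇ (map proj₁ used) x) * H x) ≡⟨ ∑-cong (allFin n) sel ⟩
          ∑ (allFin n) (λ x → 𝟙 (absentᵇ (map proj₁ used) x) * New) ≡⟨ ∑-*ʳ (allFin n) _ New ⟩
          ∑ (allFin n) (λ x → 𝟙 (absentᵇ (map proj₁ used) x)) * New ≡⟨ cong (_* New) (trans (∑-absent u) (cong (n ∸_) (length-map proj₁ used))) ⟩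
          (n ∸ length used) * New ≡⟨ ∑-*ˡ (pats (j ∷ ls) js) (n ∸ length used) _ ⟨
          ∑ (pats (j ∷ ls) js) (λ z → (n ∸ length used) * (weight (n ∸ suc (length used)) (G ∘ (j ∷_))) z) ≡⟨ ∑-cong (pats (j ∷ ls) js) wt ⟩
          ∑ (pats (j ∷ ls) js) (W ∘ (introduce j)) ≡⟨ ∑-map _ (pats (j ∷ ls) js) W ⟨
          _ ∎
          where
          sel : ∀ x → 𝟙 (absentᵇ (map proj₁ used) x) * H x ≡ 𝟙 (absentᵇ (map proj₁ used) x) * New
          sel x with DecMem._∈?_ FinP._≟_ x (map proj₁ used)
          ... | yes _ = refl
          ... | no nx = cong (_+ 0) (H-new x nx)
          wt : ∀ z → (n ∸ length used) * (weight (n ∸ suc (length used)) (G ∘ (j ∷_))) z ≡ W ((introduce j) z)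
          wt (p , ν) = trans (sym (*-assoc (n ∸ length used) _ _)) (cong (λ z → ((n ∸ length used) * fall z ν) * G (j ∷ p)) (sym (pred[m∸n]≡m∸[1+n] n (length used))))

-- Counting permutations with prescribed values

module Permutations where

  open import Defs
  open FiniteSums
  open Patterns
  open import Data.Bool using (Bool; true; false; not; _∧_; if_then_else_)
  open import Data.Bool.ListAction using (any)
  open import Data.Nat as ℕ using (ℕ; zero; suc; _+_; _*_; _∸_; s≤s; _!)
  open import Data.Nat.Properties
  open import Data.Fin as Fin using (Fin; zero; suc)
  import Data.Fin.Properties as FinP
  open import Data.Maybe using (Maybe; just; nothing)
  open import Data.Maybe.Properties using (just-injective)
  open import Data.Vec as Vec using (Vec; []; _∷_; lookup; toList; tabulate)
  import Data.Vec.Properties as VecP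
  open import Data.List using (List; []; _∷_; _++_; map; length; allFin; filterᵇ)
  import Data.List.Properties as LP
  open import Data.List.Membership.Propositional using (_∈_; _∉_)
  open import Data.List.Membership.Propositional.Properties using (∈-map⁻; ∈-++⁺ˡ; ∈-++⁺ʳ; ∈-++⁻; ∈-allFin)
  import Data.List.Membership.DecPropositional as DecMem
  open import Data.List.Relation.Unary.Any using (here; there)
  open import Data.List.Relation.Unary.All as All using (All; []; _∷_)
  open import Data.List.Relation.Unary.AllPairs using ([]; _∷_)
  open import Data.List.Relation.Unary.Unique.Propositional using (Unique)
  import Data.List.Relation.Unary.Unique.Propositional.Properties as UP
  open import Data.Product using (Σ; _×_; _,_; proj₂; ∃-syntax)
  open import Data.Product.Properties using (≡-dec)
  open import Data.Sum using (inj₁; inj₂)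
  open import Relation.Nullary using (yes; no; Dec; ⌊_⌋; contradiction)
  open import Relation.Binary using (DecidableEquality)
  open import Relation.Binary.PropositionalEquality
  open import Function using (_∘_; id)

  ∏ : ∀ k → (Fin k → ℕ) → ℕ
  ∏ zero    f = 1
  ∏ (suc k) f = f zero * ∏ k (f ∘ suc)

  ∏-cong : ∀ k {f g : Fin k → ℕ} → (∀ i → f i ≡ g i) → ∏ k f ≡ ∏ k g
  ∏-cong zero    e = refl
  ∏-cong (suc k) e = cong₂ _*_ (e zero) (∏-cong k (e ∘ suc))

  ∏-one : ∀ k → ∏ k (λ _ → 1) ≡ 1
  ∏-one zero    = refl
  ∏-one (suc k) = trans (+-identityʳ _) (∏-one k)

  ∏-pick : ∀ k {f g : Fin k → ℕ} j c → g j ≡ c * f j → (∀ i → i ≢ j → g i ≡ f i) → ∏ k g ≡ c * ∏ k f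
  ∏-pick (suc k) zero    c e h = trans (cong₂ _*_ e (∏-cong k (λ i → h (suc i) λ ()))) (*-assoc c _ _)
  ∏-pick (suc k) {f} {g} (suc j) c e h = begin
    g zero * ∏ k (g ∘ suc)       ≡⟨ cong₂ _*_ (h zero λ ()) (∏-pick k j c e (λ i ne → h (suc i) (ne ∘ FinP.suc-injective))) ⟩
    f zero * (c * ∏ k (f ∘ suc)) ≡⟨ *-assoc (f zero) c _ ⟨
    (f zero * c) * ∏ k (f ∘ suc) ≡⟨ cong (_* ∏ k (f ∘ suc)) (*-comm (f zero) c) ⟩
    (c * f zero) * ∏ k (f ∘ suc) ≡⟨ *-assoc c _ _ ⟩
    c * (f zero * ∏ k (f ∘ suc)) ∎
    where open ≡-Reasoning

  ∏-≢0 : ∀ k {f : Fin k → ℕ} → ∏ k f ≢ 0 → ∀ i → f i ≢ 0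
  ∏-≢0 (suc k) {f} ne zero    e = ne (cong (_* ∏ k (f ∘ suc)) e)
  ∏-≢0 (suc k) {f} ne (suc i) e = ∏-≢0 k {f ∘ suc} (λ z → ne (trans (cong (f zero *_) z) (*-zeroʳ (f zero)))) i e

  ∑-≢0 : ∀ {A : Set} (xs : List A) {f} → ∑ xs f ≢ 0 → ∃[ x ] (x ∈ xs × f x ≢ 0)
  ∑-≢0 []       ne = contradiction refl ne
  ∑-≢0 (x ∷ xs) {f} ne with f x ≟ 0
  ... | no nz = x , here refl , nz
  ... | yes z with ∑-≢0 xs {f} (λ e → ne (cong₂ _+_ z e))
  ...   | y , y∈ , nz = y , there y∈ , nz

  ∑-vecsOf-∏ : ∀ {A : Set} (xs : List A) k (g : Fin k → A → ℕ) →
    ∑ (vecsOf xs k) (λ v → ∏ k (λ i → g i (lookup v i))) ≡ ∏ k (λ i → ∑ xs (g i))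
  ∑-vecsOf-∏ xs zero    g = refl
  ∑-vecsOf-∏ xs (suc k) g = begin
    ∑ (vecsOf xs (suc k)) (λ v → ∏ (suc k) (λ i → g i (lookup v i))) ≡⟨ ∑-vecsOf xs k _ ⟩
    ∑ xs (λ x → ∑ (vecsOf xs k) (λ v → g zero x * ∏ k (λ i → g (suc i) (lookup v i)))) ≡⟨ ∑-cong xs (λ x → ∑-*ˡ (vecsOf xs k) (g zero x) _) ⟩
    ∑ xs (λ x → g zero x * ∑ (vecsOf xs k) (λ v → ∏ k (λ i → g (suc i) (lookup v i)))) ≡⟨ ∑-*ʳ xs (g zero) _ ⟩
    ∑ xs (g zero) * ∑ (vecsOf xs k) (λ v → ∏ k (λ i → g (suc i) (lookup v i))) ≡⟨ cong (∑ xs (g zero) *_) (∑-vecsOf-∏ xs k (g ∘ suc)) ⟩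
    ∏ (suc k) (λ i → ∑ xs (g i)) ∎
    where open ≡-Reasoning

  𝟙-yes : ∀ {P : Set} (d : Dec P) → P → 𝟙 ⌊ d ⌋ ≡ 1
  𝟙-yes (yes _) _ = refl
  𝟙-yes (no n)  p = contradiction p n

  𝟙-true : ∀ {b} → 𝟙 b ≢ 0 → b ≡ true
  𝟙-true {true}  _ = refl
  𝟙-true {false} n = contradiction refl n

  ⌊⌋-true : ∀ {P : Set} (d : Dec P) → ⌊ d ⌋ ≡ true → P
  ⌊⌋-true (yes p) _ = p

  ⌊⌋-⇔ : ∀ {P Q : Set} (d : Dec P) (e : Dec Q) → (P → Q) → (Q → P) → ⌊ d ⌋ ≡ ⌊ e ⌋
  ⌊⌋-⇔ (yes _) (yes _) _ _ = refl
  ⌊⌋-⇔ (no _)  (no _)  _ _ = refl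
  ⌊⌋-⇔ (yes p) (no n)  f _ = contradiction (f p) n
  ⌊⌋-⇔ (no n)  (yes q) _ g = contradiction (g q) n

  ∧-true : ∀ {a b} → a ∧ b ≡ true → a ≡ true × b ≡ true
  ∧-true {true} {true} _ = refl , refl

  Bool-⇔ : ∀ {a b : Bool} → (a ≡ true → b ≡ true) → (b ≡ true → a ≡ true) → a ≡ b
  Bool-⇔ {true}  {true}  _ _ = refl
  Bool-⇔ {false} {false} _ _ = refl
  Bool-⇔ {true}  {false} f _ = sym (f refl)
  Bool-⇔ {false} {true}  _ g = g refl

  module Sn (n : ℕ) where
    open DecMem (FinP._≟_ {n}) using (_∈?_)

    Perm : Set
    Perm = Vec (Fin n) n

    distinct⇒ : ∀ (xs : List (Fin n)) → allDistinct xs ≡ true → Unique xs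
    distinct⇒ []       _ = []
    distinct⇒ (x ∷ xs) e with ∧-true {not (any (λ y → ⌊ x FinP.≟ y ⌋) xs)} e
    ... | a , b = All.tabulate (λ y∈ q → go xs a (subst (_∈ xs) (sym q) y∈)) ∷ distinct⇒ xs b
      where
      go : ∀ ys → not (any (λ y → ⌊ x FinP.≟ y ⌋) ys) ≡ true → x ∉ ys
      go (y ∷ ys) e m with x FinP.≟ y
      go (y ∷ ys) e (here q)  | no ne = ne q
      go (y ∷ ys) e (there m) | no ne = go ys e m

    ⇒distinct : ∀ (xs : List (Fin n)) → Unique xs → allDistinct xs ≡ true
    ⇒distinct []       _        = refl
    ⇒distinct (x ∷ xs) (x∉ ∷ u) = cong₂ _∧_ (cong not (go xs (λ m → All.lookup x∉ m refl))) (⇒distinct xs u)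
      where
      go : ∀ ys → x ∉ ys → any (λ y → ⌊ x FinP.≟ y ⌋) ys ≡ false
      go []       _ = refl
      go (y ∷ ys) m with x FinP.≟ y
      ... | yes e = contradiction (here e) m
      ... | no _  = go ys (m ∘ there)

    toList-lookup : ∀ {r} (v : Vec (Fin n) r) i → lookup v i ∈ toList v
    toList-lookup (x ∷ v) zero    = here refl
    toList-lookup (x ∷ v) (suc i) = there (toList-lookup v i)

    ∈-toList : ∀ {r} (v : Vec (Fin n) r) {x} → x ∈ toList v → ∃[ i ] (lookup v i ≡ x)
    ∈-toList (x ∷ v) (here refl) = zero , refl
    ∈-toList (x ∷ v) (there m) with ∈-toList v m
    ... | i , e = suc i , e

    unique⇒inj : ∀ {r} (v : Vec (Fin n) r) → Unique (toList v) → ∀ i j → lookup v i ≡ lookup v j → i ≡ j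
    unique⇒inj (x ∷ v) (x∉ ∷ u) zero    zero    e = refl
    unique⇒inj (x ∷ v) (x∉ ∷ u) zero    (suc j) e = contradiction e (All.lookup x∉ (toList-lookup v j))
    unique⇒inj (x ∷ v) (x∉ ∷ u) (suc i) zero    e = contradiction (sym e) (All.lookup x∉ (toList-lookup v i))
    unique⇒inj (x ∷ v) (x∉ ∷ u) (suc i) (suc j) e = cong suc (unique⇒inj v u i j e)

    length-toList : ∀ {A : Set} {r} (v : Vec A r) → length (toList v) ≡ r
    length-toList []      = refl
    length-toList (x ∷ v) = cong suc (length-toList v)

    ∈Sym⇒unique : ∀ {σ : Perm} → σ ∈ Sym n → Unique (toList σ)
    ∈Sym⇒unique {σ} m = distinct⇒ (toList σ) (go (vecsOf (allFin n) n) m)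
      where
      go : ∀ vs → σ ∈ filterᵇ (λ v → allDistinct (toList v)) vs → allDistinct (toList σ) ≡ true
      go (v ∷ vs) m with allDistinct (toList v) in eq
      go (v ∷ vs) (here refl) | true = eq
      go (v ∷ vs) (there m)   | true = go vs m
      go (v ∷ vs) m           | false = go vs m

    perm-onto : ∀ (σ : Perm) → Unique (toList σ) → ∀ y → ∃[ x ] (app σ x ≡ y)
    perm-onto σ u y with y ∈? toList σ
    ... | yes m = ∈-toList σ m
    ... | no ny = contradiction (⊆-length {ys = allFin n} (All.tabulate (λ m e → ny (subst (_∈ toList σ) (sym e) m)) ∷ u) (λ {z} _ → ∈-allFin z))
      (λ le → <-irrefl refl (≤-trans (s≤s (≤-reflexive (sym (length-toList σ)))) (≤-trans le (≤-reflexive (LP.length-tabulate id)))))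

    -- The search function local to appInv has no name; it is recovered by unification once allFin n
    -- has been abstracted to a variable.
    invSearch : (σ : Perm) (y : Fin n) → Σ (List (Fin n) → Fin n) λ f →
      (f (allFin n) ≡ appInv σ y) × (∀ x xs → f (x ∷ xs) ≡ (if ⌊ app σ x FinP.≟ y ⌋ then x else f xs))
    invSearch σ y = f , eq , λ _ _ → refl
      where
      f : List (Fin n) → Fin n
      f = _
      eq : f (allFin n) ≡ appInv σ y
      eq with allFin n
      ... | xs = refl

    app-appInv : ∀ (σ : Perm) → Unique (toList σ) → ∀ y → app σ (appInv σ y) ≡ y
    app-appInv σ u y with invSearch σ y | perm-onto σ u y
    ... | f , eq , step | x₀ , e₀ = trans (cong (app σ) (sym eq)) (go (allFin n) (∈-allFin x₀))
      where
      go : ∀ xs → x₀ ∈ xs → app σ (f xs) ≡ y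
      go (x ∷ xs) m rewrite step x xs with app σ x FinP.≟ y
      ... | yes e = e
      go (x ∷ xs) (here refl) | no ne = contradiction e₀ ne
      go (x ∷ xs) (there m)   | no ne = go xs m

    appInv-⇔ : ∀ (σ : Perm) → Unique (toList σ) → ∀ x y → 𝟙 ⌊ appInv σ y FinP.≟ x ⌋ ≡ 𝟙 ⌊ app σ x FinP.≟ y ⌋
    appInv-⇔ σ u x y = cong 𝟙 (⌊⌋-⇔ (appInv σ y FinP.≟ x) (app σ x FinP.≟ y)
      (λ { refl → app-appInv σ u y }) (λ { refl → unique⇒inj σ u _ _ (app-appInv σ u (app σ x)) }))

    -- Injectivity and the prescriptions `ps` are tested together, entry by entry, so that the count
    -- obeys a recursion on the positions.
    okᵇ : ∀ {r} → List (Fin n) → Vec (Maybe (Fin n)) r → Vec (Fin n) r → Bool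
    okᵇ used []             []      = true
    okᵇ used (just y ∷ ps)  (x ∷ v) = (⌊ x FinP.≟ y ⌋ ∧ absentᵇ used x) ∧ okᵇ (x ∷ used) ps v
    okᵇ used (nothing ∷ ps) (x ∷ v) = absentᵇ used x ∧ okᵇ (x ∷ used) ps v

    values : ∀ {r} → Vec (Maybe (Fin n)) r → List (Fin n)
    values []             = []
    values (just y ∷ ps)  = y ∷ values ps
    values (nothing ∷ ps) = values ps

    free# : ∀ {r} → Vec (Maybe (Fin n)) r → ℕ
    free# []             = 0
    free# (just y ∷ ps)  = free# ps
    free# (nothing ∷ ps) = suc (free# ps)

    free+values : ∀ {r} (ps : Vec (Maybe (Fin n)) r) → free# ps + length (values ps) ≡ r
    free+values []             = refl
    free+values (just y ∷ ps)  = trans (+-suc (free# ps) _) (cong suc (free+values ps))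
    free+values (nothing ∷ ps) = cong suc (free+values ps)

    vecs : ∀ r → List (Vec (Fin n) r)
    vecs r = vecsOf (allFin n) r

    S : ∀ {r} → List (Fin n) → Vec (Maybe (Fin n)) r → ℕ
    S used ps = ∑ (vecs _) (𝟙 ∘ okᵇ used ps)

    absent-no : ∀ {L : List (Fin n)} {x} → x ∈ L → absentᵇ L x ≡ false
    absent-no {L} {x} m with x ∈? L
    ... | yes _ = refl
    ... | no nm = contradiction m nm

    absent-yes : ∀ {L : List (Fin n)} {x} → x ∉ L → absentᵇ L x ≡ true
    absent-yes {L} {x} m with x ∈? L
    ... | yes m′ = contradiction m′ m
    ... | no _   = refl

    absent⁻ : ∀ {L : List (Fin n)} {x} → absentᵇ L x ≡ true → x ∉ L
    absent⁻ {L} {x} e with x ∈? L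
    ... | no nm = nm

    S-just : ∀ {r} used y (ps : Vec (Maybe (Fin n)) r) → S used (just y ∷ ps) ≡ 𝟙 (absentᵇ used y) * S (y ∷ used) ps
    S-just {r} used y ps = begin
      S used (just y ∷ ps) ≡⟨ ∑-vecsOf (allFin n) r _ ⟩
      ∑ (allFin n) (λ x → ∑ (vecs r) (λ v → 𝟙 ((⌊ x FinP.≟ y ⌋ ∧ absentᵇ used x) ∧ okᵇ (x ∷ used) ps v)))
        ≡⟨ ∑-cong (allFin n) (λ x → trans (∑-cong (vecs r) (λ v → 𝟙-∧ (⌊ x FinP.≟ y ⌋ ∧ absentᵇ used x) _)) (∑-*ˡ (vecs r) (𝟙 (⌊ x FinP.≟ y ⌋ ∧ absentᵇ used x)) (𝟙 ∘ okᵇ (x ∷ used) ps))) ⟩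
      ∑ (allFin n) (λ x → 𝟙 (⌊ x FinP.≟ y ⌋ ∧ absentᵇ used x) * S (x ∷ used) ps)
        ≡⟨ ∑-single _ (UP.allFin⁺ n) (∈-allFin y) (λ {x} _ ne → cong (_* S (x ∷ used) ps) (off x ne)) ⟩
      𝟙 (⌊ y FinP.≟ y ⌋ ∧ absentᵇ used y) * S (y ∷ used) ps
        ≡⟨ cong (_* S (y ∷ used) ps) on ⟩
      𝟙 (absentᵇ used y) * S (y ∷ used) ps ∎
      where
      open ≡-Reasoning
      off : ∀ x → x ≢ y → 𝟙 (⌊ x FinP.≟ y ⌋ ∧ absentᵇ used x) ≡ 0
      off x ne with x FinP.≟ y
      ... | yes e = contradiction e ne
      ... | no _  = refl
      on : 𝟙 (⌊ y FinP.≟ y ⌋ ∧ absentᵇ used y) ≡ 𝟙 (absentᵇ used y)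
      on with y FinP.≟ y
      ... | yes _ = refl
      ... | no ne = contradiction refl ne

    S-nothing : ∀ {r} used (ps : Vec (Maybe (Fin n)) r) → S used (nothing ∷ ps) ≡ ∑ (allFin n) (λ x → 𝟙 (absentᵇ used x) * S (x ∷ used) ps)
    S-nothing {r} used ps = trans (∑-vecsOf (allFin n) r _)
      (∑-cong (allFin n) (λ x → trans (∑-cong (vecs r) (λ v → 𝟙-∧ (absentᵇ used x) _)) (∑-*ˡ (vecs r) (𝟙 (absentᵇ used x)) (𝟙 ∘ okᵇ (x ∷ used) ps))))

    S-clash : ∀ {r} {used} (ps : Vec (Maybe (Fin n)) r) {y} → y ∈ used → y ∈ values ps → S used ps ≡ 0
    S-clash {used = used} (just y′ ∷ ps) y∈ (here refl) = trans (S-just used y′ ps) (cong (λ b → 𝟙 b * S (y′ ∷ used) ps) (absent-no y∈))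
    S-clash {used = used} (just y′ ∷ ps) y∈ (there m) = trans (S-just used y′ ps)
      (trans (cong (𝟙 (absentᵇ used y′) *_) (S-clash ps (there y∈) m)) (*-zeroʳ (𝟙 (absentᵇ used y′))))
    S-clash {used = used} (nothing ∷ ps) y∈ m = trans (S-nothing used ps)
      (trans (∑-cong (allFin n) (λ x → trans (cong (𝟙 (absentᵇ used x) *_) (S-clash ps (there y∈) m)) (*-zeroʳ (𝟙 (absentᵇ used x))))) (∑-zero (allFin n)))

    -- A free position may take any value that is neither used nor prescribed later on: by
    -- `S-clash`, taking a value that is prescribed later leaves no completion.
    S-count : ∀ {r} {used} (ps : Vec (Maybe (Fin n)) r) → Unique used → Unique (values ps) → (∀ {x} → x ∈ used → x ∉ values ps) →
      S used ps ≡ fall (n ∸ (length used + length (values ps))) (free# ps)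
    S-count [] u u′ d = refl
    S-count {used = used} (just y ∷ ps) u (y∉ ∷ u′) d = begin
      S used (just y ∷ ps) ≡⟨ S-just used y ps ⟩
      𝟙 (absentᵇ used y) * S (y ∷ used) ps ≡⟨ cong (λ b → 𝟙 b * S (y ∷ used) ps) (absent-yes (λ m → d m (here refl))) ⟩
      1 * S (y ∷ used) ps ≡⟨ *-identityˡ _ ⟩
      S (y ∷ used) ps ≡⟨ S-count ps (All.tabulate (λ m e → d (subst (_∈ used) (sym e) m) (here refl)) ∷ u) u′ d′ ⟩
      fall (n ∸ (suc (length used) + length (values ps))) (free# ps) ≡⟨ cong (λ z → fall (n ∸ z) (free# ps)) (+-suc (length used) _) ⟨
      fall (n ∸ (length used + length (values (just y ∷ ps)))) (free# ps) ∎
      where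
      open ≡-Reasoning
      d′ : ∀ {x} → x ∈ y ∷ used → x ∉ values ps
      d′ (here refl) m = All.lookup y∉ m refl
      d′ (there x∈)  m = d x∈ (there m)
    S-count {used = used} (nothing ∷ ps) u u′ d = begin
      S used (nothing ∷ ps) ≡⟨ S-nothing used ps ⟩
      ∑ (allFin n) (λ x → 𝟙 (absentᵇ used x) * S (x ∷ used) ps) ≡⟨ ∑-cong (allFin n) each ⟩
      ∑ (allFin n) (λ x → 𝟙 (absentᵇ (used ++ values ps) x) * K) ≡⟨ ∑-*ʳ (allFin n) _ K ⟩
      ∑ (allFin n) (λ x → 𝟙 (absentᵇ (used ++ values ps) x)) * K ≡⟨ cong (_* K) (∑-absent (UP.++⁺ u u′ (λ { (a , b) → d a b }))) ⟩
      (n ∸ length (used ++ values ps)) * K ≡⟨ cong₂ (λ a b → (n ∸ a) * fall b (free# ps)) (LP.length-++ used) (sym (pred[m∸n]≡m∸[1+n] n (length used + length (values ps)))) ⟩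
      fall (n ∸ (length used + length (values ps))) (suc (free# ps)) ∎
      where
      open ≡-Reasoning
      K = fall (n ∸ suc (length used + length (values ps))) (free# ps)
      each : ∀ x → 𝟙 (absentᵇ used x) * S (x ∷ used) ps ≡ 𝟙 (absentᵇ (used ++ values ps) x) * K
      each x with x ∈? used | x ∈? (used ++ values ps)
      ... | yes m | yes _ = refl
      ... | yes m | no nm = contradiction (∈-++⁺ˡ m) nm
      ... | no nm | no n2 = cong (_+ 0) (S-count ps (All.tabulate (λ m e → nm (subst (_∈ used) (sym e) m)) ∷ u) u′ d′)
        where
        d′ : ∀ {z} → z ∈ x ∷ used → z ∉ values ps
        d′ (here refl) m = n2 (∈-++⁺ʳ used m)
        d′ (there z∈)  m = d z∈ m
      ... | no nm | yes m with ∈-++⁻ used m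
      ...   | inj₁ m′ = contradiction m′ nm
      ...   | inj₂ m′ = trans (+-identityʳ _) (S-clash ps (here refl) m′)

    fall-! : ∀ r → fall r r ≡ r !
    fall-! zero    = refl
    fall-! (suc r) = cong (suc r *_) (fall-! r)

    Match : ∀ {r} → Vec (Maybe (Fin n)) r → Vec (Fin n) r → Set
    Match ps v = ∀ i y → lookup ps i ≡ just y → lookup v i ≡ y

    ok⇒ : ∀ {r} used (ps : Vec (Maybe (Fin n)) r) v → okᵇ used ps v ≡ true →
      Unique (toList v) × (∀ {x} → x ∈ toList v → x ∉ used) × Match ps v
    ok⇒ used [] [] e = [] , (λ ()) , λ ()
    ok⇒ used (just y ∷ ps) (x ∷ v) e with ∧-true {⌊ x FinP.≟ y ⌋ ∧ absentᵇ used x} e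
    ... | a , b with ∧-true {⌊ x FinP.≟ y ⌋} a | ok⇒ (x ∷ used) ps v b
    ...   | c , d | u , dj , mt = (All.tabulate (λ m q → dj m (here (sym q))) ∷ u) ,
      (λ { (here refl) → absent⁻ d ; (there m) → dj m ∘ there }) ,
      λ { zero y′ q → trans (⌊⌋-true (x FinP.≟ y) c) (just-injective q) ; (suc i) → mt i }
    ok⇒ used (nothing ∷ ps) (x ∷ v) e with ∧-true {absentᵇ used x} e
    ... | d , b with ok⇒ (x ∷ used) ps v b
    ...   | u , dj , mt = (All.tabulate (λ m q → dj m (here (sym q))) ∷ u) ,
      (λ { (here refl) → absent⁻ d ; (there m) → dj m ∘ there }) ,
      λ { zero y′ () ; (suc i) → mt i }

    ⇒ok : ∀ {r} used (ps : Vec (Maybe (Fin n)) r) v → Unique (toList v) → (∀ {x} → x ∈ toList v → x ∉ used) → Match ps v → okᵇ used ps v ≡ true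
    ⇒ok used [] [] u d m = refl
    ⇒ok used (p ∷ ps) (x ∷ v) (x∉ ∷ u) d m with ⇒ok (x ∷ used) ps v u (λ { q (here refl) → All.lookup x∉ q refl ; q (there r) → d (there q) r }) (m ∘ suc)
    ⇒ok used (nothing ∷ ps) (x ∷ v) (x∉ ∷ u) d m | ih rewrite absent-yes {used} {x} (d (here refl)) = ih
    ⇒ok used (just y ∷ ps) (x ∷ v) (x∉ ∷ u) d m | ih rewrite absent-yes {used} {x} (d (here refl)) with x FinP.≟ y
    ... | yes _ = ih
    ... | no ne = contradiction (m zero y refl) ne

    respectsᵇ : Perm → List (Fin n × Fin n) → Bool
    respectsᵇ σ []             = true
    respectsᵇ σ ((a , b) ∷ cs) = ⌊ app σ a FinP.≟ b ⌋ ∧ respectsᵇ σ cs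

    respects⇒ : ∀ σ cs → respectsᵇ σ cs ≡ true → ∀ {a b} → (a , b) ∈ cs → app σ a ≡ b
    respects⇒ σ ((a , b) ∷ cs) e m with ∧-true {⌊ app σ a FinP.≟ b ⌋} e
    respects⇒ σ ((a , b) ∷ cs) e (here refl) | p , q = ⌊⌋-true (app σ a FinP.≟ b) p
    respects⇒ σ ((a , b) ∷ cs) e (there m)   | p , q = respects⇒ σ cs q m

    ⇒respects : ∀ σ cs → (∀ {a b} → (a , b) ∈ cs → app σ a ≡ b) → respectsᵇ σ cs ≡ true
    ⇒respects σ [] h = refl
    ⇒respects σ ((a , b) ∷ cs) h with app σ a FinP.≟ b
    ... | yes _ = ⇒respects σ cs (h ∘ there)
    ... | no ne = contradiction (h (here refl)) ne

    count : List (Fin n × Fin n) → ℕ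
    count cs = ∑ (Sym n) (λ σ → 𝟙 (respectsᵇ σ cs))

    record PInj (cs : List (Fin n × Fin n)) : Set where
      field
        func : ∀ {a b b′} → (a , b) ∈ cs → (a , b′) ∈ cs → b ≡ b′
        inj  : ∀ {a a′ b} → (a , b) ∈ cs → (a′ , b) ∈ cs → a ≡ a′

    count-bad : ∀ {cs} → count cs ≢ 0 → PInj cs
    count-bad {cs} ne with ∑-≢0 (Sym n) ne
    ... | σ , σ∈ , nz = record
      { func = λ m m′ → trans (sym (r m)) (r m′)
      ; inj  = λ m m′ → unique⇒inj σ (∈Sym⇒unique σ∈) _ _ (trans (r m) (sym (r m′))) }
      where
      r : ∀ {a b} → (a , b) ∈ cs → app σ a ≡ b
      r = respects⇒ σ cs (𝟙-true nz)

    _≟₂_ : DecidableEquality (Fin n × Fin n)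
    _≟₂_ = ≡-dec FinP._≟_ FinP._≟_

    find₁ : (cs : List (Fin n × Fin n)) (a : Fin n) → Dec (∃[ b ] ((a , b) ∈ cs))
    find₁ []             a = no (λ ())
    find₁ ((c , b) ∷ cs) a with a FinP.≟ c
    ... | yes refl = yes (b , here refl)
    ... | no ne with find₁ cs a
    ...   | yes (b′ , m) = yes (b′ , there m)
    ...   | no nm = no (λ { (_ , here refl) → ne refl ; (_ , there m) → nm (_ , m) })

    presAt : List (Fin n × Fin n) → Fin n → Maybe (Fin n)
    presAt cs a with find₁ cs a
    ... | yes (b , _) = just b
    ... | no _        = nothing

    presAt⇒ : ∀ cs a {b} → presAt cs a ≡ just b → (a , b) ∈ cs
    presAt⇒ cs a e with find₁ cs a
    presAt⇒ cs a refl | yes (b , m) = m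

    graph : ∀ {r} → (Fin r → Fin n) → (Fin r → Maybe (Fin n)) → List (Fin n × Fin n)
    graph {zero}  ι f = []
    graph {suc r} ι f with f zero
    ... | just b  = (ι zero , b) ∷ graph (ι ∘ suc) (f ∘ suc)
    ... | nothing = graph (ι ∘ suc) (f ∘ suc)

    graph-values : ∀ {r} (ι : Fin r → Fin n) f → map proj₂ (graph ι f) ≡ values (tabulate f)
    graph-values {zero}  ι f = refl
    graph-values {suc r} ι f with f zero
    ... | just b  = cong (b ∷_) (graph-values (ι ∘ suc) (f ∘ suc))
    ... | nothing = graph-values (ι ∘ suc) (f ∘ suc)

    graph∈ : ∀ {r} (ι : Fin r → Fin n) f {a b} → (a , b) ∈ graph ι f → ∃[ i ] (a ≡ ι i × f i ≡ just b)
    graph∈ {suc r} ι f m with f zero in eq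
    graph∈ {suc r} ι f (here refl) | just b = zero , refl , eq
    graph∈ {suc r} ι f (there m)   | just b with graph∈ (ι ∘ suc) (f ∘ suc) m
    ... | i , e , q = suc i , e , q
    graph∈ {suc r} ι f m | nothing with graph∈ (ι ∘ suc) (f ∘ suc) m
    ... | i , e , q = suc i , e , q

    ∈graph : ∀ {r} (ι : Fin r → Fin n) f i {b} → f i ≡ just b → (ι i , b) ∈ graph ι f
    ∈graph {suc r} ι f zero e with f zero
    ∈graph {suc r} ι f zero refl | just b = here refl
    ∈graph {suc r} ι f (suc i) e with f zero
    ... | just b  = there (∈graph (ι ∘ suc) (f ∘ suc) i e)
    ... | nothing = ∈graph (ι ∘ suc) (f ∘ suc) i e

    graph-! : ∀ {r} (ι : Fin r → Fin n) f → (∀ {i j} → ι i ≡ ι j → i ≡ j) → Unique (graph ι f)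
    graph-! {zero}  ι f h = []
    graph-! {suc r} ι f h with f zero
    ... | nothing = graph-! (ι ∘ suc) (f ∘ suc) (FinP.suc-injective ∘ h)
    ... | just b  = All.tabulate apart ∷ graph-! (ι ∘ suc) (f ∘ suc) (FinP.suc-injective ∘ h)
      where
      apart : ∀ {x} → x ∈ graph (ι ∘ suc) (f ∘ suc) → (ι zero , b) ≢ x
      apart m refl with graph∈ (ι ∘ suc) (f ∘ suc) m
      ... | i , e , _ with h e
      ...   | ()

    map-snd-! : ∀ {xs : List (Fin n × Fin n)} → Unique xs → (∀ {a a′ b} → (a , b) ∈ xs → (a′ , b) ∈ xs → a ≡ a′) → Unique (map proj₂ xs)
    map-snd-! [] h = []
    map-snd-! {(a , b) ∷ xs} (x∉ ∷ u) h = All.tabulate apart ∷ map-snd-! u (λ m m′ → h (there m) (there m′))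
      where
      apart : ∀ {y} → y ∈ map proj₂ xs → b ≢ y
      apart m refl with ∈-map⁻ proj₂ m
      ... | (a′ , _) , m′ , refl with h (here refl) (there m′)
      ...   | refl = All.lookup x∉ m′ refl

    -- Repeated constraints are listed once by passing to the graph of the partial function; a
    -- partial injection with d entries then leaves n - d values to be permuted freely.
    count-good : ∀ {cs} → PInj cs → count cs ≡ (n ∸ Distinct.D _≟₂_ cs) !
    count-good {cs} pinj = begin
      count cs ≡⟨ ∑-filterᵇ _ (vecs n) _ ⟩
      ∑ (vecs n) (λ v → 𝟙 (allDistinct (toList v)) * 𝟙 (respectsᵇ v cs)) ≡⟨ ∑-cong (vecs n) same ⟩
      S [] ps ≡⟨ S-count ps [] vals! (λ ()) ⟩
      fall (n ∸ length (values ps)) (free# ps) ≡⟨ cong₂ (λ a b → fall (n ∸ a) b) dist (trans (sym (m+n∸n≡m (free# ps) (length (values ps)))) (cong₂ _∸_ (free+values ps) dist)) ⟩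
      fall (n ∸ D cs) (n ∸ D cs) ≡⟨ fall-! (n ∸ D cs) ⟩
      (n ∸ D cs) ! ∎
      where
      open ≡-Reasoning
      open Distinct _≟₂_ using (D; D-unique)
      open PInj pinj
      ps = tabulate (presAt cs)
      gr = graph id (presAt cs)
      gr⇒ : ∀ {x} → x ∈ gr → x ∈ cs
      gr⇒ {a , b} m with graph∈ id (presAt cs) m
      ... | i , refl , e = presAt⇒ cs i e
      ⇒pres : ∀ {a b} → (a , b) ∈ cs → presAt cs a ≡ just b
      ⇒pres {a} {b} m with find₁ cs a
      ... | yes (b′ , m′) = cong just (func m′ m)
      ... | no nm = contradiction (b , m) nm
      ⇒gr : ∀ {x} → x ∈ cs → x ∈ gr
      ⇒gr {a , b} m = ∈graph id (presAt cs) a (⇒pres m)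
      gr! : Unique gr
      gr! = graph-! id (presAt cs) id
      dist : length (values ps) ≡ D cs
      dist = trans (cong length (sym (graph-values id (presAt cs)))) (trans (LP.length-map proj₂ gr) (sym (D-unique gr! ⇒gr gr⇒)))
      vals! : Unique (values ps)
      vals! = subst Unique (graph-values id (presAt cs)) (map-snd-! gr! (λ m m′ → inj (gr⇒ m) (gr⇒ m′)))
      match⇒ : ∀ v → Match ps v → ∀ {a b} → (a , b) ∈ cs → lookup v a ≡ b
      match⇒ v mt {a} {b} m = mt a b (trans (VecP.lookup∘tabulate (presAt cs) a) (⇒pres m))
      ⇒match : ∀ v → (∀ {a b} → (a , b) ∈ cs → lookup v a ≡ b) → Match ps v
      ⇒match v h i y e = h (presAt⇒ cs i (trans (sym (VecP.lookup∘tabulate (presAt cs) i)) e))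
      same : ∀ v → 𝟙 (allDistinct (toList v)) * 𝟙 (respectsᵇ v cs) ≡ 𝟙 (okᵇ [] ps v)
      same v = trans (sym (𝟙-∧ (allDistinct (toList v)) _)) (cong 𝟙 (Bool-⇔ to from))
        where
        to : allDistinct (toList v) ∧ respectsᵇ v cs ≡ true → okᵇ [] ps v ≡ true
        to e with ∧-true {allDistinct (toList v)} e
        ... | a , b = ⇒ok [] ps v (distinct⇒ (toList v) a) (λ _ ()) (⇒match v (respects⇒ v cs b))
        from : okᵇ [] ps v ≡ true → allDistinct (toList v) ∧ respectsᵇ v cs ≡ true
        from e with ok⇒ [] ps v e
        ... | u , _ , mt = cong₂ _∧_ (⇒distinct (toList v) u) (⇒respects v cs (match⇒ v mt))

-- Fixed points of a word as a sum over realizable quotients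

module FixedPointCount where

  open import Defs
  open FiniteSums
  open GeneratingSets using (_≋_; origin-suc; terminus-suc; allFin-suc)
  open PairGraph using (edgeCount)
  open Patterns
  open Permutations
  open import Data.Bool using (Bool; true; false; _∧_; if_then_else_)
  open import Data.Nat as ℕ using (ℕ; zero; suc; _+_; _*_; _∸_; _≤_; _!)
  open import Data.Nat.Properties
  open import Data.Fin as Fin using (Fin; zero; suc; fromℕ)
  import Data.Fin.Properties as FinP
  open import Data.Vec as Vec using (Vec; []; _∷_; lookup; toList; tabulate)
  import Data.Vec.Properties as VecP
  open import Data.List using (List; []; _∷_; map; length; allFin; filter)
  import Data.List.Properties as LP
  open import Data.List.Membership.Propositional using (_∈_)
  open import Data.List.Membership.Propositional.Properties using (∈-map⁺; ∈-map⁻; ∈-allFin; ∈-filter⁻; ∈-filter⁺)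
  open import Data.List.Relation.Unary.All using ([]; _∷_)
  open import Data.List.Relation.Unary.AllPairs using ([]; _∷_)
  open import Data.List.Relation.Unary.Unique.Propositional using (Unique)
  import Data.List.Relation.Unary.Unique.Propositional.Properties as UP
  open import Data.Product using (_×_; _,_; proj₁; proj₂; ∃-syntax)
  open import Data.Product.Properties using (≡-dec)
  open import Data.Sum using (inj₂)
  open import Relation.Nullary using (yes; no; Dec; ⌊_⌋; contradiction)
  open import Relation.Nullary.Decidable using (_×-dec_; _→-dec_)
  open import Relation.Unary using (Decidable)
  open import Relation.Binary.PropositionalEquality
  open import Function using (_∘_; id)

  filter-map : ∀ {A B : Set} {P : B → Set} (P? : Decidable P) (f : A → B) xs → filter P? (map f xs) ≡ map f (filter (P? ∘ f) xs)
  filter-map P? f []       = refl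
  filter-map P? f (x ∷ xs) with P? (f x)
  ... | yes _ = cong (f x ∷_) (filter-map P? f xs)
  ... | no _  = filter-map P? f xs

  ∑-filter : ∀ {A : Set} {P : A → Set} (P? : Decidable P) xs (f : A → ℕ) → ∑ (filter P? xs) f ≡ ∑ xs (λ x → 𝟙 ⌊ P? x ⌋ * f x)
  ∑-filter P? []       f = refl
  ∑-filter P? (x ∷ xs) f with P? x
  ... | yes _ = cong₂ _+_ (sym (+-identityʳ (f x))) (∑-filter P? xs f)
  ... | no _  = ∑-filter P? xs f

  map-lookup : ∀ {A : Set} {r} (v : Vec A r) → map (lookup v) (allFin r) ≡ toList v
  map-lookup []      = refl
  map-lookup {r = suc r} (x ∷ v) = cong (x ∷_) (trans (LP.map-tabulate suc (lookup (x ∷ v))) (trans (sym (LP.map-tabulate id (lookup v))) (map-lookup v)))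

  module _ {n k : ℕ} where
    open Sn n

    -- The rightmost letter acts first, so a point moves from s_m to s₀, against the trail: the
    -- permutation of a label takes the terminus of an edge to its origin.
    constraints : (w : Word k) → Fin k → Vec (Fin n) (suc (length w)) → List (Fin n × Fin n)
    constraints w i t = map (λ j → lookup t (terminus w j) , lookup t (origin w j)) (filter (λ j → label w j Fin.≟ i) (allFin (length w)))

    constraints-∷ : ∀ x w i y t → constraints (x ∷ w) i (y ∷ t) ≡
      (if ⌊ proj₁ x Fin.≟ i ⌋ then (lookup (y ∷ t) (terminus (x ∷ w) zero) , lookup (y ∷ t) (origin (x ∷ w) zero)) ∷ constraints w i t else constraints w i t)
    constraints-∷ x w i y t = trans (cong (map g) (cong (filter P?) (allFin-suc (length w)))) split
      where
      P? = λ j → label (x ∷ w) j Fin.≟ i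
      g = λ j → lookup (y ∷ t) (terminus (x ∷ w) j) , lookup (y ∷ t) (origin (x ∷ w) j)
      tl : map g (filter P? (map suc (allFin (length w)))) ≡ constraints w i t
      tl = trans (cong (map g) (filter-map P? suc (allFin (length w)))) (trans (sym (LP.map-∘ (filter (P? ∘ suc) (allFin (length w)))))
        (LP.map-cong (λ j → cong₂ (λ a b → lookup (y ∷ t) a , lookup (y ∷ t) b) (terminus-suc x w j) (origin-suc x w j)) _))
      split : map g (filter P? (zero ∷ map suc (allFin (length w)))) ≡ (if ⌊ proj₁ x Fin.≟ i ⌋ then g zero ∷ constraints w i t else constraints w i t)
      split with proj₁ x Fin.≟ i
      ... | yes _ = cong (g zero ∷_) tl
      ... | no _  = tl

    compatᵇ : Vec Perm k → (w : Word k) → Vec (Fin n) (suc (length w)) → Bool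
    compatᵇ σs []            t       = true
    compatᵇ σs ((i , α) ∷ w) (y ∷ t) = ⌊ appLetter (lookup σs i) α (lookup t zero) FinP.≟ y ⌋ ∧ compatᵇ σs w t

    trail : Vec Perm k → (w : Word k) → Fin n → Vec (Fin n) (suc (length w))
    trail σs []      x = x ∷ []
    trail σs (l ∷ w) x = evalWord σs (l ∷ w) x ∷ trail σs w x

    trail-first : ∀ σs w x → lookup (trail σs w x) zero ≡ evalWord σs w x
    trail-first σs []      x = refl
    trail-first σs (l ∷ w) x = refl

    trail-last : ∀ σs w x → lookup (trail σs w x) (fromℕ (length w)) ≡ x
    trail-last σs []      x = refl
    trail-last σs (l ∷ w) x = trail-last σs w x

    -- For given permutations, a compatible labelling of the trail is determined by its last entry.
    ∑-trail : ∀ σs w (G : Vec (Fin n) (suc (length w)) → ℕ) →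
      ∑ (vecs (suc (length w))) (λ t → 𝟙 (compatᵇ σs w t) * G t) ≡ ∑ (allFin n) (G ∘ trail σs w)
    ∑-trail σs [] G = trans (∑-vecsOf (allFin n) 0 _) (∑-cong (allFin n) (λ x → trans (+-identityʳ _) (+-identityʳ _)))
    ∑-trail σs (l@(i , α) ∷ w) G = begin
      ∑ (vecs (suc (suc (length w)))) (λ t → 𝟙 (compatᵇ σs (l ∷ w) t) * G t)
        ≡⟨ ∑-vecsOf (allFin n) (suc (length w)) _ ⟩
      ∑ (allFin n) (λ y → ∑ (vecs (suc (length w))) (λ t → 𝟙 (⌊ next t FinP.≟ y ⌋ ∧ compatᵇ σs w t) * G (y ∷ t)))
        ≡⟨ ∑-swap (allFin n) (vecs (suc (length w))) _ ⟩
      ∑ (vecs (suc (length w))) (λ t → ∑ (allFin n) (λ y → 𝟙 (⌊ next t FinP.≟ y ⌋ ∧ compatᵇ σs w t) * G (y ∷ t)))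
        ≡⟨ ∑-cong (vecs (suc (length w))) one ⟩
      ∑ (vecs (suc (length w))) (λ t → 𝟙 (compatᵇ σs w t) * G (next t ∷ t))
        ≡⟨ ∑-trail σs w (λ t → G (next t ∷ t)) ⟩
      ∑ (allFin n) (λ x → G (next (trail σs w x) ∷ trail σs w x))
        ≡⟨ ∑-cong (allFin n) (λ x → cong (λ z → G (appLetter (lookup σs i) α z ∷ trail σs w x)) (trail-first σs w x)) ⟩
      ∑ (allFin n) (G ∘ trail σs (l ∷ w)) ∎
      where
      open ≡-Reasoning
      next : Vec (Fin n) (suc (length w)) → Fin n
      next t = appLetter (lookup σs i) α (lookup t zero)
      one : ∀ t → ∑ (allFin n) (λ y → 𝟙 (⌊ next t FinP.≟ y ⌋ ∧ compatᵇ σs w t) * G (y ∷ t)) ≡ 𝟙 (compatᵇ σs w t) * G (next t ∷ t)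
      one t = trans (∑-single _ (UP.allFin⁺ n) (∈-allFin (next t)) off) on
        where
        off : ∀ {y} → y ∈ allFin n → y ≢ next t → 𝟙 (⌊ next t FinP.≟ y ⌋ ∧ compatᵇ σs w t) * G (y ∷ t) ≡ 0
        off {y} _ ne with next t FinP.≟ y
        ... | yes e = contradiction (sym e) ne
        ... | no _  = refl
        on : 𝟙 (⌊ next t FinP.≟ next t ⌋ ∧ compatᵇ σs w t) * G (next t ∷ t) ≡ 𝟙 (compatᵇ σs w t) * G (next t ∷ t)
        on with next t FinP.≟ next t
        ... | yes _ = refl
        ... | no ne = contradiction refl ne

    letter-constraint : ∀ (σ : Perm) → Unique (toList σ) → ∀ (i : Fin k) α (w : Word k) y (t : Vec (Fin n) (suc (length w))) →
      𝟙 ⌊ appLetter σ α (lookup t zero) FinP.≟ y ⌋ ≡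
      𝟙 ⌊ app σ (lookup (y ∷ t) (terminus ((i , α) ∷ w) zero)) FinP.≟ lookup (y ∷ t) (origin ((i , α) ∷ w) zero) ⌋
    letter-constraint σ u i true  w y t = refl
    letter-constraint σ u i false w y t = appInv-⇔ σ u y (lookup t zero)

    compat-∏ : ∀ (σs : Vec Perm k) → (∀ i → Unique (toList (lookup σs i))) → ∀ w t →
      𝟙 (compatᵇ σs w t) ≡ ∏ k (λ i → 𝟙 (respectsᵇ (lookup σs i) (constraints w i t)))
    compat-∏ σs u []            t       = sym (∏-one k)
    compat-∏ σs u ((j , α) ∷ w) (y ∷ t) = begin
      𝟙 (⌊ appLetter (lookup σs j) α (lookup t zero) FinP.≟ y ⌋ ∧ compatᵇ σs w t)
        ≡⟨ 𝟙-∧ ⌊ appLetter (lookup σs j) α (lookup t zero) FinP.≟ y ⌋ _ ⟩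
      𝟙 ⌊ appLetter (lookup σs j) α (lookup t zero) FinP.≟ y ⌋ * 𝟙 (compatᵇ σs w t)
        ≡⟨ cong₂ _*_ (letter-constraint (lookup σs j) (u j) j α w y t) (compat-∏ σs u w t) ⟩
      𝟙 ⌊ app (lookup σs j) (proj₁ c) FinP.≟ proj₂ c ⌋ * ∏ k (λ i → 𝟙 (respectsᵇ (lookup σs i) (constraints w i t)))
        ≡⟨ ∏-pick k j (𝟙 ⌊ app (lookup σs j) (proj₁ c) FinP.≟ proj₂ c ⌋) at-j off-j ⟨
      ∏ k (λ i → 𝟙 (respectsᵇ (lookup σs i) (constraints ((j , α) ∷ w) i (y ∷ t)))) ∎
      where
      open ≡-Reasoning
      c = lookup (y ∷ t) (terminus ((j , α) ∷ w) zero) , lookup (y ∷ t) (origin ((j , α) ∷ w) zero)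
      at-j : 𝟙 (respectsᵇ (lookup σs j) (constraints ((j , α) ∷ w) j (y ∷ t))) ≡
        𝟙 ⌊ app (lookup σs j) (proj₁ c) FinP.≟ proj₂ c ⌋ * 𝟙 (respectsᵇ (lookup σs j) (constraints w j t))
      at-j = trans (cong (λ cs → 𝟙 (respectsᵇ (lookup σs j) cs)) (trans (constraints-∷ (j , α) w j y t) pick))
          (𝟙-∧ ⌊ app (lookup σs j) (proj₁ c) FinP.≟ proj₂ c ⌋ _)
        where
        pick : (if ⌊ j Fin.≟ j ⌋ then c ∷ constraints w j t else constraints w j t) ≡ c ∷ constraints w j t
        pick with j Fin.≟ j
        ... | yes _ = refl
        ... | no ne = contradiction refl ne
      off-j : ∀ i → i ≢ j → 𝟙 (respectsᵇ (lookup σs i) (constraints ((j , α) ∷ w) i (y ∷ t))) ≡ 𝟙 (respectsᵇ (lookup σs i) (constraints w i t))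
      off-j i ne = cong (λ cs → 𝟙 (respectsᵇ (lookup σs i) cs)) (trans (constraints-∷ (j , α) w i y t) pick)
        where
        pick : (if ⌊ j Fin.≟ i ⌋ then c ∷ constraints w i t else constraints w i t) ≡ constraints w i t
        pick with j Fin.≟ i
        ... | yes e = contradiction (sym e) ne
        ... | no _  = refl

    -- The sums over permutations and over labellings of the trail are exchanged. For a fixed
    -- labelling the conditions on the individual permutations are independent, hence the product.
    totalFixed-∑ : ∀ w → totalFixed n w ≡
      ∑ (vecs (suc (length w))) (λ t → 𝟙 ⌊ lookup t zero FinP.≟ lookup t (fromℕ (length w)) ⌋ * ∏ k (λ i → count (constraints w i t)))
    totalFixed-∑ w = begin
      ∑ (vecsOf (Sym n) k) (fixedPoints w) ≡⟨ ∑-cong (vecsOf (Sym n) k) fixed ⟩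
      ∑ (vecsOf (Sym n) k) (λ σs → ∑ ts (λ t → 𝟙 (compatᵇ σs w t) * closed t)) ≡⟨ ∑-swap (vecsOf (Sym n) k) ts _ ⟩
      ∑ ts (λ t → ∑ (vecsOf (Sym n) k) (λ σs → 𝟙 (compatᵇ σs w t) * closed t)) ≡⟨ ∑-cong ts inner ⟩
      ∑ ts (λ t → closed t * ∏ k (λ i → count (constraints w i t))) ∎
      where
      open ≡-Reasoning
      ts = vecs (suc (length w))
      closed : Vec (Fin n) (suc (length w)) → ℕ
      closed t = 𝟙 ⌊ lookup t zero FinP.≟ lookup t (fromℕ (length w)) ⌋
      fixed : ∀ σs → fixedPoints w σs ≡ ∑ ts (λ t → 𝟙 (compatᵇ σs w t) * closed t)
      fixed σs = trans (length-filterᵇ _ (allFin n)) (trans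
        (∑-cong (allFin n) (λ x → cong₂ (λ a b → 𝟙 ⌊ a FinP.≟ b ⌋) (sym (trail-first σs w x)) (sym (trail-last σs w x))))
        (sym (∑-trail σs w closed)))
      inner : ∀ t → ∑ (vecsOf (Sym n) k) (λ σs → 𝟙 (compatᵇ σs w t) * closed t) ≡ closed t * ∏ k (λ i → count (constraints w i t))
      inner t = trans (∑-*ʳ (vecsOf (Sym n) k) _ (closed t)) (trans (*-comm _ (closed t)) (cong (closed t *_)
        (trans (∑-cong-∈ (vecsOf (Sym n) k) (λ {σs} m → compat-∏ σs (λ i → ∈Sym⇒unique (∈-vecsOf (Sym n) σs m i)) w t))
          (∑-vecsOf-∏ (Sym n) k (λ i σ → 𝟙 (respectsᵇ σ (constraints w i t)))))))

  module _ {k : ℕ} (w : Word k) where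

    private
      V : Set
      V = Vtx w
      N : ℕ
      N = suc (length w)

    positions : Vec V N
    positions = tabulate id

    positions-! : Unique (toList positions)
    positions-! = subst Unique (trans (sym (LP.map-id (allFin N))) (trans (LP.map-cong (λ i → sym (VecP.lookup∘tabulate id i)) (allFin N)) (map-lookup positions))) (UP.allFin⁺ N)

    Closed : Part w → Set
    Closed p = Folded w p × p (first w) ≡ p (last w)

    closed? : ∀ p → Dec (Closed p)
    closed? p = FinP.all? (λ h → FinP.all? (λ l → (label w h Fin.≟ label w l) →-dec
        (((p (origin w h) Fin.≟ p (origin w l)) →-dec (p (terminus w h) Fin.≟ p (terminus w l))) ×-dec
         ((p (terminus w h) Fin.≟ p (terminus w l)) →-dec (p (origin w h) Fin.≟ p (origin w l))))))
      ×-dec (p (first w) Fin.≟ p (last w))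

    patterns : List (Vec V N)
    patterns = map proj₁ (pats [] positions)

    quotients : List (Vec V N)
    quotients = filter (closed? ∘ lookup) patterns

    quotients-! : Unique quotients
    quotients-! = UP.filter⁺ (closed? ∘ lookup) (pats-! [] positions [] (λ ()) positions-!)

    quotient-closed : ∀ {p} → p ∈ quotients → Closed (lookup p)
    quotient-closed m = proj₂ (∈-filter⁻ (closed? ∘ lookup) {xs = patterns} m)

    private
      canonical : ∀ {p} → p ∈ quotients → ∀ i → lookup p i Fin.≤ i × lookup p (lookup p i) ≡ lookup p i
      canonical m i with ∈-map⁻ proj₁ (proj₁ (∈-filter⁻ (closed? ∘ lookup) {xs = patterns} m))
      ... | (p , ν) , m′ , refl with pat-canonical [] positions m′ i
      ...   | inj₂ (i′ , le , a , b) = subst (Fin._≤ i) (sym pi≡i′) le , trans (cong (lookup p) pi≡i′) (trans b (sym a))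
        where
        pi≡i′ : lookup p i ≡ i′
        pi≡i′ = trans a (VecP.lookup∘tabulate id i′)

    quotient-idem : ∀ {p} → p ∈ quotients → ∀ i → lookup p (lookup p i) ≡ lookup p i
    quotient-idem m i = proj₂ (canonical m i)

    -- In canonical form the label of a block is its least member, which depends on the partition
    -- alone.
    quotient-unique : ∀ {p q} → p ∈ quotients → q ∈ quotients → _≋_ w (lookup p) (lookup q) → p ≡ q
    quotient-unique {p} {q} p∈ q∈ s = ext p q (λ i → FinP.≤-antisym
        (subst (Fin._≤ lookup q i) (proj₂ (s _ _) (quotient-idem q∈ i)) (proj₁ (canonical p∈ (lookup q i))))
        (subst (Fin._≤ lookup p i) (proj₁ (s _ _) (quotient-idem p∈ i)) (proj₁ (canonical q∈ (lookup p i)))))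
      where
      ext : ∀ {A : Set} {r} (u v : Vec A r) → (∀ i → lookup u i ≡ lookup v i) → u ≡ v
      ext []      []      h = refl
      ext (x ∷ u) (y ∷ v) h = cong₂ _∷_ (h zero) (ext u v (h ∘ suc))

    quotient-complete : ∀ p → Closed p → ∃[ q ] (q ∈ quotients × _≋_ w (lookup q) p)
    quotient-complete p cl = q , ∈-filter⁺ (closed? ∘ lookup) (∈-map⁺ proj₁ (proj₂ (code∈pats [] positions t))) closed , same
      where
      t = tabulate p
      q = code [] positions t
      tab : ∀ i → lookup t i ≡ p i
      tab = VecP.lookup∘tabulate p
      same : _≋_ w (lookup q) p
      same a b = (λ e → trans (sym (tab a)) (trans (proj₁ (code-kernel positions t positions-! a b) e) (tab b)))
               , (λ e → proj₂ (code-kernel positions t positions-! a b) (trans (tab a) (trans e (sym (tab b)))))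
      closed : Closed (lookup q)
      closed = (λ h l e → (λ x → proj₂ (same _ _) (proj₁ (proj₁ cl h l e) (proj₁ (same _ _) x)))
                        , (λ x → proj₂ (same _ _) (proj₂ (proj₁ cl h l e) (proj₁ (same _ _) x)))) , proj₂ (same _ _) (proj₂ cl)

    module _ (n : ℕ) where
      open Sn n

      term : Part w → ℕ
      term p = ∏ k (λ i → (n ∸ edgeCount w p i) !)

      module _ (t : Vec (Fin n) N) (p : Part w)
        (ker : ∀ a b → (p a ≡ p b → lookup t a ≡ lookup t b) × (lookup t a ≡ lookup t b → p a ≡ p b)) where

        private
          cs : Fin k → List (Fin n × Fin n)
          cs i = constraints w i t
          member : ∀ {i c} → c ∈ cs i → ∃[ j ] (label w j ≡ i × c ≡ (lookup t (terminus w j) , lookup t (origin w j)))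
          member {i} m with ∈-map⁻ _ m
          ... | j , j∈ , refl = j , proj₂ (∈-filter⁻ (λ j → label w j Fin.≟ i) {xs = allFin (length w)} j∈) , refl
          ∈cs : ∀ j → (lookup t (terminus w j) , lookup t (origin w j)) ∈ cs (label w j)
          ∈cs j = ∈-map⁺ _ (∈-filter⁺ (λ j′ → label w j′ Fin.≟ label w j) (∈-allFin j) refl)

        folded⇒PInj : Folded w p → ∀ i → PInj (cs i)
        folded⇒PInj f i = record { func = fn ; inj = ij }
          where
          fn : ∀ {a b b′} → (a , b) ∈ cs i → (a , b′) ∈ cs i → b ≡ b′
          fn m m′ with member m | member m′
          ... | j , lj , refl | j′ , lj′ , e with cong proj₁ e | cong proj₂ e
          ...   | et | refl = proj₁ (ker _ _) (proj₂ (f j j′ (trans lj (sym lj′))) (proj₂ (ker _ _) et))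
          ij : ∀ {a a′ b} → (a , b) ∈ cs i → (a′ , b) ∈ cs i → a ≡ a′
          ij m m′ with member m | member m′
          ... | j , lj , refl | j′ , lj′ , e with cong proj₁ e | cong proj₂ e
          ...   | refl | eo = proj₁ (ker _ _) (proj₁ (f j j′ (trans lj (sym lj′))) (proj₂ (ker _ _) eo))

        PInj⇒folded : (∀ i → PInj (cs i)) → Folded w p
        PInj⇒folded h j l e =
          (λ x → proj₂ (ker _ _) (PInj.inj (h (label w l)) (mj (proj₁ (ker _ _) x)) (∈cs l))) ,
          (λ x → proj₂ (ker _ _) (PInj.func (h (label w l)) (mt (proj₁ (ker _ _) x)) (∈cs l)))
          where
          mj : lookup t (origin w j) ≡ lookup t (origin w l) → (lookup t (terminus w j) , lookup t (origin w l)) ∈ cs (label w l)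
          mj q = subst₂ (λ o i → (lookup t (terminus w j) , o) ∈ cs i) q e (∈cs j)
          mt : lookup t (terminus w j) ≡ lookup t (terminus w l) → (lookup t (terminus w l) , lookup t (origin w j)) ∈ cs (label w l)
          mt q = subst₂ (λ o i → (o , lookup t (origin w j)) ∈ cs i) q e (∈cs j)

        D-cs : ∀ i → Distinct.D _≟₂_ (cs i) ≡ edgeCount w p i
        D-cs i = D-kernel _≟₂_ (≡-dec Fin._≟_ Fin._≟_) (filter (λ j → label w j Fin.≟ i) (allFin (length w)))
          {λ j → lookup t (terminus w j) , lookup t (origin w j)} {λ j → p (origin w j) , p (terminus w j)}
          (λ _ _ e → cong₂ _,_ (proj₂ (ker _ _) (cong proj₂ e)) (proj₂ (ker _ _) (cong proj₁ e)))
          (λ _ _ e → cong₂ _,_ (proj₁ (ker _ _) (cong proj₂ e)) (proj₁ (ker _ _) (cong proj₁ e)))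

        -- Two equally labelled edges that violate folding would ask a permutation for two values at
        -- one point, or for one value at two points, and then the product of counts is zero. So
        -- only closed kernels contribute.
        summand : 𝟙 ⌊ lookup t zero FinP.≟ lookup t (fromℕ (length w)) ⌋ * ∏ k (λ i → count (cs i)) ≡ 𝟙 ⌊ closed? p ⌋ * term p
        summand with closed? p
        ... | yes (f , e) = trans (cong (_* ∏ k (λ i → count (cs i))) (𝟙-yes (lookup t zero FinP.≟ _) (proj₁ (ker _ _) e)))
            (cong (1 *_) (∏-cong k (λ i → trans (count-good (folded⇒PInj f i)) (cong (λ d → (n ∸ d) !) (D-cs i)))))
        ... | no nc with lookup t zero FinP.≟ lookup t (fromℕ (length w))
        ...   | no _  = refl
        ...   | yes e with ∏ k (λ i → count (cs i)) ≟ 0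
        ...     | yes z = trans (+-identityʳ _) z
        ...     | no nz = contradiction (PInj⇒folded (λ i → count-bad (∏-≢0 k nz i)) , proj₂ (ker _ _) e) nc

      -- Labellings of the trail are grouped by their kernel: a kernel with v blocks arises from
      -- `fall n v` labellings, all with the same summand.
      totalFixed-quotients : totalFixed n w ≡ ∑ quotients (λ p → fall n (numVertices w (lookup p)) * term (lookup p))
      totalFixed-quotients = begin
        totalFixed n w ≡⟨ totalFixed-∑ w ⟩
        ∑ (vecs N) (λ t → 𝟙 ⌊ lookup t zero FinP.≟ lookup t (fromℕ (length w)) ⌋ * ∏ k (λ i → count (constraints w i t)))
          ≡⟨ ∑-cong (vecs N) (λ t → summand t (lookup (code [] positions t)) (code-kernel positions t positions-!)) ⟩
        ∑ (vecs N) (G ∘ code [] positions) ≡⟨ ∑-code [] positions G [] ⟩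
        ∑ (pats [] positions) (weight n G) ≡⟨ ∑-cong-∈ (pats [] positions) wt ⟩
        ∑ (pats [] positions) (H ∘ proj₁) ≡⟨ ∑-map proj₁ (pats [] positions) H ⟨
        ∑ patterns H ≡⟨ ∑-filter (closed? ∘ lookup) patterns _ ⟨
        ∑ quotients (λ p → fall n (numVertices w (lookup p)) * term (lookup p)) ∎
        where
        open ≡-Reasoning
        G H : Vec V N → ℕ
        G p = 𝟙 ⌊ closed? (lookup p) ⌋ * term (lookup p)
        H p = 𝟙 ⌊ closed? (lookup p) ⌋ * (fall n (numVertices w (lookup p)) * term (lookup p))
        wt : ∀ {x} → x ∈ pats [] positions → weight n G x ≡ H (proj₁ x)
        wt {p , ν} m = trans (cong (λ z → fall n z * G p) ν≡) (begin
          fall n v * (c * term (lookup p)) ≡⟨ *-assoc (fall n v) c _ ⟨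
          (fall n v * c) * term (lookup p) ≡⟨ cong (_* term (lookup p)) (*-comm (fall n v) c) ⟩
          (c * fall n v) * term (lookup p) ≡⟨ *-assoc c _ _ ⟩
          c * (fall n v * term (lookup p)) ∎)
          where
          v = numVertices w (lookup p)
          c = 𝟙 ⌊ closed? (lookup p) ⌋
          ν≡ : ν ≡ v
          ν≡ = trans (pat-count Fin._≟_ [] positions [] (λ ()) positions-! m)
            (cong (Distinct.D Fin._≟_) (trans (LP.++-identityʳ (toList p)) (sym (map-lookup p))))

-- Rational sequences and their limits

module Convergence where

  open import Defs
  open import Data.Nat as ℕ using (ℕ; zero; suc; z≤n; s≤s)
  import Data.Nat.Properties as ℕP
  open import Data.Integer as ℤ using (ℤ; +_; -[1+_])
  import Data.Integer.Properties as ℤP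
  open import Data.Rational as ℚ using (ℚ; 0ℚ; 1ℚ; ½; _+_; _*_; _-_; -_; _<_; _≤_; ∣_∣; _/_; toℚᵘ; positive; nonNegative; 1/_; mkℚ)
  open import Data.Rational.Properties as ℚP
  import Data.Rational.Unnormalised as ℚᵘ
  import Data.Rational.Unnormalised.Properties as ℚᵘP
  open import Data.Rational.Solver
  open import Data.Product using (_×_; _,_; proj₁; proj₂; ∃-syntax)
  open import Data.Sum using (_⊎_; inj₁; inj₂)
  open import Relation.Nullary using (Dec; yes; no; contradiction)
  open import Relation.Binary.PropositionalEquality hiding (resp; J; [_])
  open import Function using (_∘_)
  open +-*-Solver using (solve; _:=_; _:+_; _:*_; :-_; con; _:-_)

  ι : ℤ → ℚ
  ι z = z / 1

  private
    u : ℤ → ℚᵘ.ℚᵘ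
    u z = ℚᵘ.mkℚᵘ z 0

    ι≃ : ∀ z → toℚᵘ (ι z) ℚᵘ.≃ u z
    ι≃ z = toℚᵘ-fromℚᵘ (u z)

  ι-+ : ∀ a b → ι (a ℤ.+ b) ≡ ι a + ι b
  ι-+ a b = toℚᵘ-injective (ℚᵘP.≃-trans (ι≃ (a ℤ.+ b)) (ℚᵘP.≃-trans
    (ℚᵘ.*≡* (cong (ℤ._* + 1) (sym (cong₂ ℤ._+_ (ℤP.*-identityʳ a) (ℤP.*-identityʳ b)))))
    (ℚᵘP.≃-trans (ℚᵘP.+-cong (ℚᵘP.≃-sym (ι≃ a)) (ℚᵘP.≃-sym (ι≃ b))) (ℚᵘP.≃-sym (toℚᵘ-homo-+ (ι a) (ι b))))))

  ι-* : ∀ a b → ι (a ℤ.* b) ≡ ι a * ι b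
  ι-* a b = toℚᵘ-injective (ℚᵘP.≃-trans (ι≃ (a ℤ.* b)) (ℚᵘP.≃-trans
    (ℚᵘ.*≡* refl)
    (ℚᵘP.≃-trans (ℚᵘP.*-cong (ℚᵘP.≃-sym (ι≃ a)) (ℚᵘP.≃-sym (ι≃ b))) (ℚᵘP.≃-sym (toℚᵘ-homo-* (ι a) (ι b))))))

  ι-neg : ∀ a → ι (ℤ.- a) ≡ - ι a
  ι-neg a = trans (sym (+-identityʳ _)) (trans (cong (λ z → ι (ℤ.- a) + z) (sym (+-inverseʳ (ι a))))
    (trans (sym (+-assoc (ι (ℤ.- a)) (ι a) (- ι a))) (trans (cong (_+ - ι a) (trans (sym (ι-+ (ℤ.- a) a)) (cong ι (ℤP.+-inverseˡ a)))) (+-identityˡ _))))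

  ι-mono-≤ : ∀ {a b} → a ℤ.≤ b → ι a ≤ ι b
  ι-mono-≤ {a} {b} le = toℚᵘ-cancel-≤ (ℚᵘP.≤-trans (ℚᵘP.≤-reflexive (ι≃ a)) (ℚᵘP.≤-trans
    (ℚᵘ.*≤* (subst₂ ℤ._≤_ (sym (ℤP.*-identityʳ a)) (sym (ℤP.*-identityʳ b)) le)) (ℚᵘP.≤-reflexive (ℚᵘP.≃-sym (ι≃ b)))))

  ι-cancel-< : ∀ {a b} → ι a < ι b → a ℤ.< b
  ι-cancel-< {a} {b} lt with a ℤ.<? b
  ... | yes p = p
  ... | no ¬p = contradiction (<-≤-trans lt (ι-mono-≤ (ℤP.≮⇒≥ ¬p))) (<-irrefl refl)

  ι-mono-< : ∀ {a b} → a ℤ.< b → ι a < ι b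
  ι-mono-< {a} {b} lt = toℚᵘ-cancel-< (ℚᵘP.≤-<-trans (ℚᵘP.≤-reflexive (ι≃ a)) (ℚᵘP.<-≤-trans
    (ℚᵘ.*<* (subst₂ ℤ._<_ (sym (ℤP.*-identityʳ a)) (sym (ℤP.*-identityʳ b)) lt)) (ℚᵘP.≤-reflexive (ℚᵘP.≃-sym (ι≃ b)))))

  /-* : ∀ z d .{{_ : ℕ.NonZero d}} → (z / d) * ι (+ d) ≡ ι z
  /-* z (suc d) = toℚᵘ-injective (ℚᵘP.≃-trans (toℚᵘ-homo-* (z / suc d) (ι (+ suc d))) (ℚᵘP.≃-trans
    (ℚᵘP.*-cong (toℚᵘ-fromℚᵘ (ℚᵘ.mkℚᵘ z d)) (ι≃ (+ suc d)))
    (ℚᵘP.≃-trans (ℚᵘ.*≡* (trans (ℤP.*-assoc z (+ suc d) (+ 1)) (cong (λ x → z ℤ.* x) (trans (ℤP.*-identityʳ (+ suc d)) (cong (λ z → + suc z) (sym (ℕP.*-identityʳ d))))))) (ℚᵘP.≃-sym (ι≃ z)))))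

  archimedes : ∀ q → ∃[ n ] (q < ι (+ n))
  archimedes q@(mkℚ z d _) = suc ℤ.∣ z ∣ , toℚᵘ-cancel-< (ℚᵘP.<-≤-trans
      (ℚᵘ.*<* (ℤP.<-≤-trans (ℤP.≤-<-trans (ℤP.≤-trans (ℤP.≤-reflexive (ℤP.*-identityʳ z)) (z≤∣z∣ z)) (ℤ.+<+ (ℕP.n<1+n _)))
        (ℤP.≤-trans (ℤP.≤-reflexive (sym (ℤP.*-identityʳ (+ suc ℤ.∣ z ∣)))) (ℤP.*-monoˡ-≤-nonNeg (+ suc ℤ.∣ z ∣) (ℤ.+≤+ (s≤s z≤n))))))
      (ℚᵘP.≤-reflexive (ℚᵘP.≃-sym (ι≃ (+ suc ℤ.∣ z ∣)))))
    where
    z≤∣z∣ : ∀ z → z ℤ.≤ + ℤ.∣ z ∣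
    z≤∣z∣ (+ n)    = ℤP.≤-refl
    z≤∣z∣ -[1+ n ] = ℤ.-≤+

  *-cancelʳ : ∀ {x y} c → 0ℚ < c → x * c ≡ y * c → x ≡ y
  *-cancelʳ c c>0 e = ≤-antisym (*-cancelʳ-≤-pos c {{positive c>0}} (≤-reflexive e)) (*-cancelʳ-≤-pos c {{positive c>0}} (≤-reflexive (sym e)))

  0<* : ∀ {x y} → 0ℚ < x → 0ℚ < y → 0ℚ < x * y
  0<* {x} {y} p q = positive⁻¹ (x * y) {{pos*pos⇒pos x {{positive p}} y {{positive q}}}}

  record Conv (s : ℕ → ℚ) (L : ℚ) : Set where
    constructor conv
    field close : ∀ (ε : ℚ) → 0ℚ < ε → ∃[ N ] ∀ M → N ℕ.≤ M → ∣ s M - L ∣ < ε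
  open Conv public

  conv-ext : ∀ {s t L} → (∀ M → s M ≡ t M) → Conv s L → Conv t L
  close (conv-ext {L = L} e c) ε pos with close c ε pos
  ... | N , h = N , λ M le → subst (λ x → ∣ x - L ∣ < ε) (e M) (h M le)

  conv-suc : ∀ {s L} → Conv (s ∘ suc) L → Conv s L
  close (conv-suc c) ε pos with close c ε pos
  ... | N , h = suc N , λ { (suc M) (s≤s le) → h M le }

  conv-suc⁻ : ∀ {s L} → Conv s L → Conv (s ∘ suc) L
  close (conv-suc⁻ c) ε pos with close c ε pos
  ... | N , h = N , λ M le → h (suc M) (ℕP.m≤n⇒m≤1+n le)

  conv-const : ∀ L → Conv (λ _ → L) L
  close (conv-const L) ε pos = 0 , λ M _ → subst (_< ε) (sym (trans (cong ∣_∣ (+-inverseʳ L)) refl)) pos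

  private
    half-pos : ∀ {ε} → 0ℚ < ε → 0ℚ < ½ * ε
    half-pos p = 0<* (positive⁻¹ ½) p

    halves : ∀ ε → ½ * ε + ½ * ε ≡ ε
    halves ε = trans (sym (*-distribʳ-+ ε ½ ½)) (*-identityˡ ε)

    small : ∀ c ε → 0ℚ < ε → ∃[ η ] (0ℚ < η × ∣ c ∣ * η ≤ ε)
    small c ε p = inv * ε , 0<* inv>0 p , bound
      where
      q = 1ℚ + ∣ c ∣
      q>0 : 0ℚ < q
      q>0 = subst (_< q) (+-identityʳ 0ℚ) (+-mono-<-≤ (positive⁻¹ 1ℚ) (0≤∣p∣ c))
      inv = (1/ q) {{pos⇒nonZero q {{positive q>0}}}}
      inv>0 : 0ℚ < inv
      inv>0 = positive⁻¹ inv {{1/pos⇒pos q {{positive q>0}}}}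
      c≤q : ∣ c ∣ ≤ q
      c≤q = subst (_≤ q) (+-identityˡ ∣ c ∣) (+-monoˡ-≤ ∣ c ∣ (<⇒≤ (positive⁻¹ 1ℚ)))
      bound : ∣ c ∣ * (inv * ε) ≤ ε
      bound = ≤-trans (*-monoʳ-≤-nonNeg (inv * ε) {{nonNegative (<⇒≤ (0<* inv>0 p))}} c≤q)
        (≤-reflexive (trans (sym (*-assoc q inv ε)) (trans (cong (_* ε) (*-inverseʳ q {{pos⇒nonZero q {{positive q>0}}}})) (*-identityˡ ε))))

  conv-lin : ∀ {s t L K} c → Conv s L → Conv t K → Conv (λ M → s M + c * t M) (L + c * K)
  close (conv-lin {s} {t} {L} {K} c cs ct) ε pos = N ℕ.⊔ N′ , λ M le → subst₂ _<_ (cong ∣_∣ (sym (regroup (s M) (t M) c L K))) (halves ε)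
      (≤-<-trans (∣p+q∣≤∣p∣+∣q∣ (s M - L) (c * (t M - K)))
        (+-mono-<-≤ (proj₂ S M (ℕP.≤-trans (ℕP.m≤m⊔n N N′) le))
          (≤-trans (≤-reflexive (∣p*q∣≡∣p∣*∣q∣ c (t M - K)))
            (≤-trans (*-monoˡ-≤-nonNeg ∣ c ∣ {{∣-∣-nonNeg c}} (<⇒≤ (proj₂ T M (ℕP.≤-trans (ℕP.m≤n⊔m N N′) le)))) (proj₂ (proj₂ sm))))))
    where
    sm = small c (½ * ε) (half-pos pos)
    S = close cs (½ * ε) (half-pos pos)
    T = close ct (proj₁ sm) (proj₁ (proj₂ sm))
    N = proj₁ S
    N′ = proj₁ T
    regroup : ∀ x y c L K → (x + c * y) - (L + c * K) ≡ (x - L) + c * (y - K)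
    regroup = solve 5 (λ x y c L K → (x :+ c :* y) :- (L :+ c :* K) := (x :- L) :+ c :* (y :- K)) refl

  private
    drop-lemma : ∀ c ε h x → h + h ≡ (1ℚ - c) * ε → h + c * x ≡ (x - h) - (1ℚ - c) * (x - ε)
    drop-lemma c ε h x e = trans (split c h x) (trans (cong (λ z → ((x - h) - (1ℚ - c) * x) + z) e) (rejoin x h (1ℚ - c) ε))
      where
      split : ∀ c h x → h + c * x ≡ ((x - h) - (1ℚ - c) * x) + (h + h)
      split = solve 3 (λ c h x → h :+ c :* x := ((x :- h) :- (con 1ℚ :- c) :* x) :+ (h :+ h)) refl
      rejoin : ∀ x h d e → ((x - h) - d * x) + d * e ≡ (x - h) - d * (x - e)
      rejoin = solve 4 (λ x h d e → ((x :- h) :- d :* x) :+ d :* e := (x :- h) :- d :* (x :- e)) refl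

  -- While |s − L| ≥ ε it drops by a fixed amount at each step, and once below ε it stays there.
  conv-contract : ∀ {s t q L} c → 0ℚ ≤ c → c < 1ℚ → (∀ M → s (suc M) ≡ t (suc M) + c * s M) → Conv t q → L ≡ q + c * L → Conv s L
  close (conv-contract {s} {t} {q} {L} c c≥0 c<1 rec ct fix) ε ε>0 = J ℕ.+ N₀ , final
    where
    d = 1ℚ - c
    d>0 : 0ℚ < d
    d>0 = subst (_< d) (+-inverseʳ c) (+-monoˡ-< (- c) c<1)
    -- This choice gives η + c x = (x - η) - d (x - ε), a decrease by at least η as long as x ≥ ε.
    η = ½ * (d * ε)
    η>0 : 0ℚ < η
    η>0 = half-pos (0<* d>0 ε>0)
    N₀ = proj₁ (close ct η η>0)
    near : ∀ M → N₀ ℕ.≤ M → ∣ t M - q ∣ < η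
    near = proj₂ (close ct η η>0)
    y : ℕ → ℚ
    y j = ∣ s (j ℕ.+ N₀) - L ∣
    Y = y 0
    step : ∀ j → y (suc j) ≤ η + c * y j
    step j = begin
      ∣ s (suc (j ℕ.+ N₀)) - L ∣ ≡⟨ cong ∣_∣ (trans (cong₂ (λ a b → a - b) (rec (j ℕ.+ N₀)) fix) (regroup (t (suc (j ℕ.+ N₀))) (s (j ℕ.+ N₀)))) ⟩
      ∣ (t (suc (j ℕ.+ N₀)) - q) + c * (s (j ℕ.+ N₀) - L) ∣ ≤⟨ ∣p+q∣≤∣p∣+∣q∣ (t (suc (j ℕ.+ N₀)) - q) _ ⟩
      ∣ t (suc (j ℕ.+ N₀)) - q ∣ + ∣ c * (s (j ℕ.+ N₀) - L) ∣ ≤⟨ +-mono-≤ (<⇒≤ (near _ (ℕP.m≤n⇒m≤1+n (ℕP.m≤n+m N₀ j))))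
          (≤-reflexive (trans (∣p*q∣≡∣p∣*∣q∣ c _) (cong (_* y j) (0≤p⇒∣p∣≡p c≥0)))) ⟩
      η + c * y j ∎
      where
      open ≤-Reasoning
      regroup : ∀ a b → (a + c * b) - (q + c * L) ≡ (a - q) + c * (b - L)
      regroup a b = solve 5 (λ x y c L K → (x :+ c :* y) :- (L :+ c :* K) := (x :- L) :+ c :* (y :- K)) refl a b c q L
    drop : ∀ x → η + c * x ≡ (x - η) - d * (x - ε)
    drop x = drop-lemma c ε η x (halves (d * ε))
    ηε : η + c * ε ≡ ε - η
    ηε = trans (drop ε) (trans (cong (λ z → (ε - η) - z) (trans (cong (d *_) (+-inverseʳ ε)) (*-zeroʳ d))) (+-identityʳ (ε - η)))
    either : ∀ j → y j < ε ⊎ y j ≤ Y - ι (+ j) * η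
    either zero    = inj₂ (≤-reflexive (sym (trans (cong (λ z → Y - z) (*-zeroˡ η)) (+-identityʳ Y))))
    either (suc j) = next (either j) (y j ℚ.<? ε)
      where
      below : y j < ε → y (suc j) < ε
      below lt = ≤-<-trans (step j) (≤-<-trans (+-monoʳ-≤ η (*-monoˡ-≤-nonNeg c {{nonNegative c≥0}} (<⇒≤ lt)))
          (≤-<-trans (≤-reflexive ηε) (subst (ε - η <_) (+-identityʳ ε) (+-monoʳ-< ε (neg-antimono-< η>0)))))
      nn : ε ≤ y j → 0ℚ ≤ d * (y j - ε)
      nn le = subst (_≤ d * (y j - ε)) (*-zeroʳ d) (*-monoˡ-≤-nonNeg d {{nonNegative (<⇒≤ d>0)}}
        (subst (_≤ y j - ε) (+-inverseʳ ε) (+-monoˡ-≤ (- ε) le)))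
      regroup : ∀ Y j h → (Y - j * h) - h ≡ Y - (1ℚ + j) * h
      regroup = solve 3 (λ Y j h → (Y :- j :* h) :- h := Y :- (con 1ℚ :+ j) :* h) refl
      next : y j < ε ⊎ y j ≤ Y - ι (+ j) * η → Dec (y j < ε) → y (suc j) < ε ⊎ y (suc j) ≤ Y - ι (+ suc j) * η
      next _ (yes lt) = inj₁ (below lt)
      next (inj₁ lt) (no _) = inj₁ (below lt)
      next (inj₂ le) (no ge) = inj₂ (≤-trans (step j) (≤-trans (≤-reflexive (drop (y j))) (≤-trans
            (subst ((y j - η) - d * (y j - ε) ≤_) (+-identityʳ (y j - η)) (+-monoʳ-≤ (y j - η) (neg-antimono-≤ (nn (≮⇒≥ ge)))))
            (≤-trans (+-monoˡ-≤ (- η) le) (≤-reflexive (trans (regroup Y (ι (+ j)) η) (cong (λ z → Y - z * η) (sym (ι-+ (+ 1) (+ j))))))))))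
    -- After `J` steps the accumulated decrease J η exceeds the initial distance `Y`; a distance
    -- that has not fallen below ε by then would be negative.
    arch = archimedes (Y * (1/ η) {{pos⇒nonZero η {{positive η>0}}}})
    J = proj₁ arch
    Y<Jη : Y < ι (+ J) * η
    Y<Jη = subst (_< ι (+ J) * η) (trans (*-assoc Y _ η) (trans (cong (Y *_) (*-inverseˡ η {{pos⇒nonZero η {{positive η>0}}}})) (*-identityʳ Y)))
      (*-monoˡ-<-pos η {{positive η>0}} (proj₂ arch))
    final : ∀ M → J ℕ.+ N₀ ℕ.≤ M → ∣ s M - L ∣ < ε
    final M le = subst (λ k → ∣ s k - L ∣ < ε) M≡ (case (either j))
      where
      j = M ℕ.∸ N₀
      M≡ : j ℕ.+ N₀ ≡ M
      M≡ = ℕP.m∸n+n≡m (ℕP.≤-trans (ℕP.m≤n+m N₀ J) le)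
      J≤j : J ℕ.≤ j
      J≤j = subst (ℕ._≤ j) (ℕP.m+n∸n≡m J N₀) (ℕP.∸-monoˡ-≤ N₀ le)
      case : y j < ε ⊎ y j ≤ Y - ι (+ j) * η → y j < ε
      case (inj₁ lt) = lt
      case (inj₂ le) = contradiction (≤-<-trans (≤-trans (0≤∣p∣ (s (j ℕ.+ N₀) - L)) le)
          (<-≤-trans (+-monoˡ-< (- (ι (+ j) * η)) Y<Jη) (≤-trans
            (+-monoˡ-≤ (- (ι (+ j) * η)) (*-monoʳ-≤-nonNeg η {{nonNegative (<⇒≤ η>0)}} (ι-mono-≤ (ℤ.+≤+ J≤j))))
            (≤-reflexive (+-inverseʳ (ι (+ j) * η)))))) (<-irrefl refl)

-- Integer power series at 1/n and uniqueness of their coefficients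

module PowerSeries where

  open import Defs
  open Convergence
  open import Data.Nat as ℕ using (ℕ; zero; suc; z≤n; s≤s)
  import Data.Nat.Properties as ℕP
  open import Data.Integer as ℤ using (ℤ; +_; -[1+_])
  import Data.Integer.Properties as ℤP
  open import Data.Rational as ℚ using (ℚ; 0ℚ; 1ℚ; ½; _+_; _*_; _-_; -_; _<_; _≤_; ∣_∣; positive; nonNegative)
  open import Data.Rational.Properties as ℚP
  open import Data.Rational.Solver
  open import Data.Product using (_×_; _,_; proj₁; proj₂; ∃-syntax)
  open import Data.Sum using (_⊎_; inj₁; inj₂)
  open import Relation.Nullary using (Dec; yes; no; contradiction)
  open import Relation.Binary.PropositionalEquality hiding (resp; J; [_])
  open import Function using (_∘_)
  open +-*-Solver using (solve; _:=_; _:+_; _:*_; :-_; con; _:-_)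

  Seq : Set
  Seq = ℕ → ℤ

  zeroS oneS : Seq
  zeroS _ = + 0
  oneS zero    = + 1
  oneS (suc _) = + 0

  shiftS : Seq → Seq
  shiftS a zero    = + 0
  shiftS a (suc j) = a j

  -- the coefficients of (1 + c x)·a and of a / (1 − c x)
  mulS geomS : ℤ → Seq → Seq
  mulS c a zero    = a 0
  mulS c a (suc j) = a (suc j) ℤ.+ c ℤ.* a j
  geomS c a zero    = a 0
  geomS c a (suc j) = a (suc j) ℤ.+ c ℤ.* geomS c a j

  addS : Seq → Seq → Seq
  addS a b j = a j ℤ.+ b j

  scaleS : ℤ → Seq → Seq
  scaleS c a j = c ℤ.* a j

  module Point (m : ℕ) where

    r : ℚ
    r = recipSuc m

    n : ℚ
    n = ι (+ suc m)

    rn : r * n ≡ 1ℚ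
    rn = /-* (+ 1) (suc m)

    n>0 : 0ℚ < n
    n>0 = ι-mono-< {+ 0} {+ suc m} (ℤ.+<+ (s≤s z≤n))

    r>0 : 0ℚ < r
    r>0 = *-cancelʳ-<-nonNeg n {{nonNegative (<⇒≤ n>0)}} (subst₂ _<_ (sym (*-zeroˡ n)) (sym rn) (positive⁻¹ 1ℚ))

    PS : Seq → ℕ → ℚ
    PS a = partialSum a m

    pw : ℕ → ℚ
    pw = powℚ r

    PS-add : ∀ a b M → PS (addS a b) M ≡ PS a M + 1ℚ * PS b M
    PS-add a b zero    = refl
    PS-add a b (suc M) = trans (cong₂ (λ x y → x + y * pw M) (PS-add a b M) (ι-+ (a M) (b M))) (alg (PS a M) (PS b M) (ι (a M)) (ι (b M)) (pw M))
      where
      alg : ∀ A B x y p → (A + 1ℚ * B) + (x + y) * p ≡ (A + x * p) + 1ℚ * (B + y * p)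
      alg = solve 5 (λ A B x y p → (A :+ con 1ℚ :* B) :+ (x :+ y) :* p := (A :+ x :* p) :+ con 1ℚ :* (B :+ y :* p)) refl

    PS-scale : ∀ c a M → PS (scaleS c a) M ≡ 0ℚ + ι c * PS a M
    PS-scale c a zero    = sym (trans (+-identityˡ _) (*-zeroʳ (ι c)))
    PS-scale c a (suc M) = trans (cong₂ (λ x y → x + y * pw M) (PS-scale c a M) (ι-* c (a M))) (alg (ι c) (PS a M) (ι (a M)) (pw M))
      where
      alg : ∀ c A x p → (0ℚ + c * A) + (c * x) * p ≡ 0ℚ + c * (A + x * p)
      alg = solve 4 (λ c A x p → (con 0ℚ :+ c :* A) :+ (c :* x) :* p := con 0ℚ :+ c :* (A :+ x :* p)) refl

    PS-shift : ∀ a M → PS (shiftS a) (suc M) ≡ 0ℚ + r * PS a M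
    PS-shift a zero    = sym (trans (+-identityˡ _) (trans (*-zeroʳ r) refl))
    PS-shift a (suc M) = trans (cong (_+ ι (a M) * (r * pw M)) (PS-shift a M)) (alg r (PS a M) (ι (a M)) (pw M))
      where
      alg : ∀ r A x p → (0ℚ + r * A) + x * (r * p) ≡ 0ℚ + r * (A + x * p)
      alg = solve 4 (λ r A x p → (con 0ℚ :+ r :* A) :+ x :* (r :* p) := con 0ℚ :+ r :* (A :+ x :* p)) refl

    private
      step : ∀ (A B x y c r p : ℚ) → (A + (c * r) * B) + (x + c * y) * (r * p) ≡ (A + x * (r * p)) + (c * r) * (B + y * p)
      step = solve 7 (λ A B x y c r p → (A :+ (c :* r) :* B) :+ (x :+ c :* y) :* (r :* p) := (A :+ x :* (r :* p)) :+ (c :* r) :* (B :+ y :* p)) refl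

      ι-lin : ∀ x c y → ι (x ℤ.+ c ℤ.* y) ≡ ι x + ι c * ι y
      ι-lin x c y = trans (ι-+ x (c ℤ.* y)) (cong (λ z → ι x + z) (ι-* c y))

    PS-mul : ∀ c a M → PS (mulS c a) (suc M) ≡ PS a (suc M) + (ι c * r) * PS a M
    PS-mul c a zero    = sym (trans (cong (λ z → PS a 1 + z) (*-zeroʳ (ι c * r))) (+-identityʳ _))
    PS-mul c a (suc M) = trans (cong₂ (λ x y → x + y * (r * pw M)) (PS-mul c a M) (ι-lin (a (suc M)) c (a M)))
      (step (PS a (suc M)) (PS a M) (ι (a (suc M))) (ι (a M)) (ι c) r (pw M))

    PS-geom : ∀ c a M → PS (geomS c a) (suc M) ≡ PS a (suc M) + (ι c * r) * PS (geomS c a) M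
    PS-geom c a zero    = sym (trans (cong (λ z → PS a 1 + z) (*-zeroʳ (ι c * r))) (+-identityʳ _))
    PS-geom c a (suc M) = trans (cong₂ (λ x y → x + y * (r * pw M)) (PS-geom c a M) (ι-lin (a (suc M)) c (geomS c a M)))
      (step (PS a (suc M)) (PS (geomS c a) M) (ι (a (suc M))) (ι (geomS c a M)) (ι c) r (pw M))

    infix 4 _⟶_
    _⟶_ : Seq → ℚ → Set
    a ⟶ L = Conv (PS a) L

    one-conv : oneS ⟶ 1ℚ
    one-conv = conv-suc (conv-ext (sym ∘ ones) (conv-const 1ℚ))
      where
      ones : ∀ M → PS oneS (suc M) ≡ 1ℚ
      ones zero    = refl
      ones (suc M) = trans (cong₂ _+_ (ones M) (*-zeroˡ (r * pw M))) (+-identityʳ 1ℚ)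

    zero-conv : zeroS ⟶ 0ℚ
    zero-conv = conv-ext (sym ∘ zeros) (conv-const 0ℚ)
      where
      zeros : ∀ M → PS zeroS M ≡ 0ℚ
      zeros zero    = refl
      zeros (suc M) = trans (cong₂ _+_ (zeros M) (*-zeroˡ (pw M))) (+-identityʳ 0ℚ)

    add-conv : ∀ {a b L K} → a ⟶ L → b ⟶ K → addS a b ⟶ L + K
    add-conv {a} {b} {L} {K} ca cb = subst (addS a b ⟶_) (cong (λ z → L + z) (*-identityˡ K)) (conv-ext (sym ∘ PS-add a b) (conv-lin 1ℚ ca cb))

    scale-conv : ∀ c {a L} → a ⟶ L → scaleS c a ⟶ ι c * L
    scale-conv c {a} {L} ca = subst (scaleS c a ⟶_) (+-identityˡ (ι c * L)) (conv-ext (sym ∘ PS-scale c a) (conv-lin (ι c) (conv-const 0ℚ) ca))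

    shift-conv : ∀ {a L} → a ⟶ L → shiftS a ⟶ r * L
    shift-conv {a} {L} ca = conv-suc (subst (Conv (PS (shiftS a) ∘ suc)) (+-identityˡ (r * L)) (conv-ext (sym ∘ PS-shift a) (conv-lin r (conv-const 0ℚ) ca)))

    mul-conv : ∀ c {a L} → a ⟶ L → mulS c a ⟶ L * (1ℚ + ι c * r)
    mul-conv c {a} {L} ca = conv-suc (subst (Conv (PS (mulS c a) ∘ suc)) (alg L (ι c * r)) (conv-ext (sym ∘ PS-mul c a) (conv-lin (ι c * r) (conv-suc⁻ ca) ca)))
      where
      alg : ∀ L x → L + x * L ≡ L * (1ℚ + x)
      alg = solve 2 (λ L x → L :+ x :* L := L :* (con 1ℚ :+ x)) refl

    -- The partial sums of a / (1 - l x) satisfy an affine recursion with factor l/n < 1, so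
    -- convergence follows by contraction, without multiplying series.
    geom-conv : ∀ l → l ℕ.< suc m → ∀ h → h * (1ℚ - ι (+ l) * r) ≡ 1ℚ → ∀ {a L} → a ⟶ L → geomS (+ l) a ⟶ L * h
    geom-conv l l<n h hinv {a} {L} ca = conv-contract x x≥0 x<1 (PS-geom (+ l) a) ca fix
      where
      x = ι (+ l) * r
      x≥0 : 0ℚ ≤ x
      x≥0 = subst (_≤ x) (*-zeroˡ r) (*-monoʳ-≤-nonNeg r {{nonNegative (<⇒≤ r>0)}} (ι-mono-≤ {+ 0} {+ l} (ℤ.+≤+ z≤n)))
      x<1 : x < 1ℚ
      x<1 = subst (x <_) (trans (*-comm n r) rn) (*-monoˡ-<-pos r {{positive r>0}} (ι-mono-< {+ l} {+ suc m} (ℤ.+<+ l<n)))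
      alg : ∀ L h x → L * h ≡ L * (h * (1ℚ - x)) + x * (L * h)
      alg = solve 3 (λ L h x → L :* h := L :* (h :* (con 1ℚ :- x)) :+ x :* (L :* h)) refl
      fix : L * h ≡ L + x * (L * h)
      fix = trans (alg L h x) (cong (_+ x * (L * h)) (trans (cong (L *_) hinv) (*-identityʳ L)))

    PS-front : ∀ a M → PS a (suc M) ≡ ι (a 0) + r * PS (a ∘ suc) M
    PS-front a zero    = solve 2 (λ x r → con 0ℚ :+ x :* con 1ℚ := x :+ r :* con 0ℚ) refl (ι (a 0)) r
    PS-front a (suc M) = trans (cong (_+ ι (a (suc M)) * (r * pw M)) (PS-front a M)) (alg (ι (a 0)) r (PS (a ∘ suc) M) (ι (a (suc M))) (pw M))
      where
      alg : ∀ z r A x p → (z + r * A) + x * (r * p) ≡ z + r * (A + x * p)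
      alg = solve 5 (λ z r A x p → (z :+ r :* A) :+ x :* (r :* p) := z :+ r :* (A :+ x :* p)) refl

  powℚ-* : ∀ x y M → powℚ (x * y) M ≡ powℚ x M * powℚ y M
  powℚ-* x y zero    = refl
  powℚ-* x y (suc M) = trans (cong ((x * y) *_) (powℚ-* x y M)) (alg x y (powℚ x M) (powℚ y M))
    where
    alg : ∀ x y p q → (x * y) * (p * q) ≡ (x * p) * (y * q)
    alg = solve 4 (λ x y p q → (x :* y) :* (p :* q) := (x :* p) :* (y :* q)) refl

  powℚ-≥0 : ∀ {x} → 0ℚ ≤ x → ∀ M → 0ℚ ≤ powℚ x M
  powℚ-≥0 p zero    = <⇒≤ (positive⁻¹ 1ℚ)
  powℚ-≥0 {x} p (suc M) = subst (_≤ x * powℚ x M) (*-zeroʳ x) (*-monoˡ-≤-nonNeg x {{nonNegative p}} (powℚ-≥0 p M))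

  Null : ℕ → Seq → Set
  Null m₀ d = ∀ m → m₀ ℕ.≤ m → Conv (partialSum d m) 0ℚ

  module Uniqueness (m₀ : ℕ) where

    module P₀ = Point m₀

    bounded : ∀ d → Conv (partialSum d m₀) 0ℚ → ∃[ C ] (0ℚ ≤ C × ∀ M → ∣ ι (d M) * powℚ P₀.r M ∣ ≤ C)
    bounded d cv = proj₁ fin , proj₁ (proj₂ fin) , all
      where
      τ : ℕ → ℚ
      τ M = ∣ ι (d M) * powℚ P₀.r M ∣
      N = proj₁ (close cv ½ (positive⁻¹ ½))
      near : ∀ M → N ℕ.≤ M → ∣ partialSum d m₀ M - 0ℚ ∣ < ½
      near = proj₂ (close cv ½ (positive⁻¹ ½))
      tail : ∀ M → N ℕ.≤ M → τ M ≤ 1ℚ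
      tail M le = ≤-trans (≤-reflexive (cong ∣_∣ (alg (ι (d M) * powℚ P₀.r M) (partialSum d m₀ M))))
        (≤-trans (∣p-q∣≤∣p∣+∣q∣ (partialSum d m₀ (suc M) - 0ℚ) (partialSum d m₀ M - 0ℚ))
          (+-mono-≤ {y = ½} {v = ½} (<⇒≤ (near (suc M) (ℕP.m≤n⇒m≤1+n le))) (<⇒≤ (near M le))))
        where
        alg : ∀ x s → x ≡ ((s + x) - 0ℚ) - (s - 0ℚ)
        alg = solve 2 (λ x s → x := ((s :+ x) :- con 0ℚ) :- (s :- con 0ℚ)) refl
      upTo : ∀ K → ∃[ C ] (0ℚ ≤ C × 1ℚ ≤ C × ∀ M → M ℕ.< K → τ M ≤ C)
      upTo zero = 1ℚ , <⇒≤ (positive⁻¹ 1ℚ) , ≤-refl , λ _ ()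
      upTo (suc K) = C + τ K , nn , ≤-trans c1 C≤ , bd
        where
        C = proj₁ (upTo K)
        c0 = proj₁ (proj₂ (upTo K))
        c1 = proj₁ (proj₂ (proj₂ (upTo K)))
        C≤ : C ≤ C + τ K
        C≤ = subst (_≤ C + τ K) (+-identityʳ C) (+-monoʳ-≤ C (0≤∣p∣ (ι (d K) * powℚ P₀.r K)))
        nn : 0ℚ ≤ C + τ K
        nn = ≤-trans c0 C≤
        τ≤ : τ K ≤ C + τ K
        τ≤ = subst (_≤ C + τ K) (+-identityˡ (τ K)) (+-monoˡ-≤ (τ K) c0)
        bd : ∀ M → M ℕ.< suc K → τ M ≤ C + τ K
        bd M (s≤s le) = case (ℕP.m≤n⇒m<n∨m≡n le)
          where
          case : M ℕ.< K ⊎ M ≡ K → τ M ≤ C + τ K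
          case (inj₁ lt)   = ≤-trans (proj₂ (proj₂ (proj₂ (upTo K))) M lt) C≤
          case (inj₂ refl) = τ≤
      fin = upTo N
      all : ∀ M → τ M ≤ proj₁ fin
      all M = case (M ℕ.<? N)
        where
        case : Dec (M ℕ.< N) → τ M ≤ proj₁ fin
        case (yes lt) = proj₂ (proj₂ (proj₂ fin)) M lt
        case (no ge)  = ≤-trans (tail M (ℕP.≮⇒≥ ge)) (proj₁ (proj₂ (proj₂ fin)))

    -- At n = K·(m₀+1) the terms are dominated by the geometric series C·K^{-j}; for large K the
    -- integer d₀ is therefore closer to 0 than 1.
    null-head : ∀ d → Null m₀ d → d 0 ≡ + 0
    null-head d null = zero-int (d 0) lt1
      where
      bd = bounded d (null m₀ ℕP.≤-refl)
      C = proj₁ bd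
      C≥0 : 0ℚ ≤ C
      C≥0 = proj₁ (proj₂ bd)
      -- K exceeds 4C, so that the tail, which is at most 2C/K, is at most ½. The extra successor in
      -- `K′` secures K ≥ 2 as well.
      arch = archimedes ((1ℚ + 1ℚ) * ((1ℚ + 1ℚ) * C))
      K′ = suc (proj₁ arch)
      -- This makes m + 1 = (K′ + 1)(m₀ + 1): the argument 1/(m₀ + 1) of the series is divided by K.
      m = m₀ ℕ.+ K′ ℕ.* suc m₀
      module Pm = Point m
      module Pκ = Point K′
      κ = Pκ.r
      K = ι (+ suc K′)
      r≡ : Pm.r ≡ P₀.r * κ
      r≡ = *-cancelʳ Pm.n Pm.n>0 (trans Pm.rn (sym (trans (cong ((P₀.r * κ) *_) (trans (cong ι (ℤP.pos-* (suc K′) (suc m₀))) (ι-* (+ suc K′) (+ suc m₀))))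
        (trans (alg P₀.r κ K P₀.n) (trans (cong₂ _*_ P₀.rn Pκ.rn) (*-identityˡ 1ℚ))))))
        where
        alg : ∀ r κ K n → (r * κ) * (K * n) ≡ (r * n) * (κ * K)
        alg = solve 4 (λ r κ K n → (r :* κ) :* (K :* n) := (r :* n) :* (κ :* K)) refl
      κ≥0 : 0ℚ ≤ κ
      κ≥0 = <⇒≤ Pκ.r>0
      κ2 : κ + κ ≤ 1ℚ
      κ2 = ≤-trans (≤-reflexive (alg κ)) (≤-trans (*-monoˡ-≤-nonNeg κ {{nonNegative κ≥0}} {1ℚ + 1ℚ} {K} (ι-mono-≤ {+ 2} {+ suc K′} (ℤ.+≤+ (s≤s (s≤s z≤n))))) (≤-reflexive Pκ.rn))
        where
        alg : ∀ κ → κ + κ ≡ κ * (1ℚ + 1ℚ)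
        alg = solve 1 (λ κ → κ :+ κ := κ :* (con 1ℚ :+ con 1ℚ)) refl
      κp = powℚ κ
      term : ∀ M → ∣ ι (d M) * Pm.pw M ∣ ≤ C * κp M
      term M = ≤-trans (≤-reflexive (trans (cong ∣_∣ (trans (cong (λ z → ι (d M) * powℚ z M) r≡) (trans (cong (ι (d M) *_) (powℚ-* P₀.r κ M)) (sym (*-assoc (ι (d M)) _ _)))))
          (trans (∣p*q∣≡∣p∣*∣q∣ (ι (d M) * powℚ P₀.r M) (κp M)) (cong (∣ ι (d M) * powℚ P₀.r M ∣ *_) (0≤p⇒∣p∣≡p (powℚ-≥0 κ≥0 M))))))
        (*-monoʳ-≤-nonNeg (κp M) {{nonNegative (powℚ-≥0 κ≥0 M)}} (proj₂ (proj₂ bd) M))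
      G : ℕ → ℚ
      G zero    = 0ℚ
      G (suc M) = G M + κp (suc M)
      -- The second summand is the slack that the induction needs: since 2κ ≤ 1, two copies of the
      -- next power of κ fit into one copy of the present one.
      G-bound : ∀ M → G M + (κp (suc M) + κp (suc M)) ≤ κ + κ
      G-bound zero = ≤-reflexive (alg κ)
        where
        alg : ∀ κ → 0ℚ + (κ * 1ℚ + κ * 1ℚ) ≡ κ + κ
        alg = solve 1 (λ κ → con 0ℚ :+ (κ :* con 1ℚ :+ κ :* con 1ℚ) := κ :+ κ) refl
      G-bound (suc M) = ≤-trans (+-monoʳ-≤ (G M + κp (suc M)) shrink) (≤-trans (≤-reflexive (+-assoc (G M) (κp (suc M)) (κp (suc M)))) (G-bound M))
        where
        p = κp (suc M)
        shrink : κ * p + κ * p ≤ p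
        shrink = ≤-trans (≤-reflexive (sym (*-distribʳ-+ p κ κ))) (≤-trans (*-monoʳ-≤-nonNeg p {{nonNegative (powℚ-≥0 κ≥0 (suc M))}} κ2) (≤-reflexive (*-identityˡ p)))
      G≤ : ∀ M → G M ≤ κ + κ
      G≤ M = ≤-trans (subst (_≤ G M + (κp (suc M) + κp (suc M))) (+-identityʳ (G M)) (+-monoʳ-≤ (G M) (≤-trans (powℚ-≥0 κ≥0 (suc M)) (subst (_≤ κp (suc M) + κp (suc M)) (+-identityʳ _) (+-monoʳ-≤ (κp (suc M)) (powℚ-≥0 κ≥0 (suc M))))))) (G-bound M)
      far : ∀ M → ∣ Pm.PS d (suc M) - ι (d 0) ∣ ≤ C * G M
      far zero    = ≤-reflexive (trans (cong ∣_∣ (alg (ι (d 0)))) (sym (*-zeroʳ C)))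
        where
        alg : ∀ x → (0ℚ + x * 1ℚ) - x ≡ 0ℚ
        alg = solve 1 (λ x → (con 0ℚ :+ x :* con 1ℚ) :- x := con 0ℚ) refl
      far (suc M) = ≤-trans (≤-reflexive (cong ∣_∣ (alg (Pm.PS d (suc M)) (ι (d (suc M)) * Pm.pw (suc M)) (ι (d 0)))))
        (≤-trans (∣p+q∣≤∣p∣+∣q∣ (Pm.PS d (suc M) - ι (d 0)) (ι (d (suc M)) * Pm.pw (suc M)))
          (≤-trans (+-mono-≤ (far M) (term (suc M))) (≤-reflexive (sym (*-distribˡ-+ C (G M) (κp (suc M)))))))
        where
        alg : ∀ s x z → (s + x) - z ≡ (s - z) + x
        alg = solve 3 (λ s x z → (s :+ x) :- z := (s :- z) :+ x) refl
      C4 : (1ℚ + 1ℚ) * ((1ℚ + 1ℚ) * C) ≤ K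
      C4 = <⇒≤ (<-≤-trans (proj₂ arch) (ι-mono-≤ {+ proj₁ arch} {+ suc K′} (ℤ.+≤+ (ℕP.≤-trans (ℕP.n≤1+n _) (ℕP.n≤1+n _)))))
      C2κ : C * (κ + κ) ≤ ½
      C2κ = *-cancelʳ-≤-pos (1ℚ + 1ℚ) {{positive {1ℚ + 1ℚ} (positive⁻¹ (1ℚ + 1ℚ))}} (≤-trans (≤-reflexive (alg C κ))
        (≤-trans (*-monoʳ-≤-nonNeg κ {{nonNegative κ≥0}} C4) (≤-reflexive (trans (*-comm K κ) Pκ.rn))))
        where
        alg : ∀ C κ → (C * (κ + κ)) * (1ℚ + 1ℚ) ≡ ((1ℚ + 1ℚ) * ((1ℚ + 1ℚ) * C)) * κ
        alg = solve 2 (λ C κ → (C :* (κ :+ κ)) :* (con 1ℚ :+ con 1ℚ) := ((con 1ℚ :+ con 1ℚ) :* ((con 1ℚ :+ con 1ℚ) :* C)) :* κ) refl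
      cv = close (null m (ℕP.m≤m+n m₀ _)) ½ (positive⁻¹ ½)
      M = proj₁ cv
      lt1 : ∣ ι (d 0) ∣ < 1ℚ
      lt1 = ≤-<-trans (≤-reflexive (cong ∣_∣ (alg (ι (d 0)) (Pm.PS d (suc M)))))
        (≤-<-trans (∣p-q∣≤∣p∣+∣q∣ (Pm.PS d (suc M) - 0ℚ) (Pm.PS d (suc M) - ι (d 0)))
          (+-mono-<-≤ {y = ½} {v = ½} (proj₂ cv (suc M) (ℕP.n≤1+n M))
            (≤-trans (far M) (≤-trans (*-monoˡ-≤-nonNeg C {{nonNegative C≥0}} (G≤ M)) C2κ))))
        where
        alg : ∀ x s → x ≡ (s - 0ℚ) - (s - x)
        alg = solve 2 (λ x s → x := (s :- con 0ℚ) :- (s :- x)) refl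
      zero-int : ∀ z → ∣ ι z ∣ < 1ℚ → z ≡ + 0
      zero-int (+ zero) _ = refl
      zero-int (+ suc k) lt = contradiction (ι-cancel-< {+ suc k} {+ 1} (subst (_< 1ℚ) (0≤p⇒∣p∣≡p (ι-mono-≤ {+ 0} {+ suc k} (ℤ.+≤+ z≤n))) lt)) λ { (ℤ.+<+ (s≤s ())) }
      zero-int -[1+ k ] lt = contradiction (ι-cancel-< {+ suc k} {+ 1} (subst (_< 1ℚ)
        (trans (cong ∣_∣ (ι-neg (+ suc k))) (trans (∣-p∣≡∣p∣ (ι (+ suc k))) (0≤p⇒∣p∣≡p (ι-mono-≤ {+ 0} {+ suc k} (ℤ.+≤+ z≤n))))) lt)) λ { (ℤ.+<+ (s≤s ())) }

    -- Once the constant coefficient is zero, multiplication by n removes one factor x = 1/n from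
    -- every partial sum.
    null-tail : ∀ d → Null m₀ d → d 0 ≡ + 0 → Null m₀ (d ∘ suc)
    null-tail d null d0 m le = subst (Conv (Pm.PS (d ∘ suc))) (trans (+-identityˡ _) (*-zeroʳ Pm.n))
        (conv-ext eq (conv-lin Pm.n (conv-const 0ℚ) (conv-suc⁻ (null m le))))
      where
      module Pm = Point m
      eq : ∀ M → 0ℚ + Pm.n * Pm.PS d (suc M) ≡ Pm.PS (d ∘ suc) M
      eq M = trans (cong (λ z → 0ℚ + Pm.n * z) (trans (Pm.PS-front d M) (cong (λ z → ι z + Pm.r * Pm.PS (d ∘ suc) M) d0)))
        (trans (alg Pm.n Pm.r (Pm.PS (d ∘ suc) M)) (trans (cong (_* Pm.PS (d ∘ suc) M) Pm.rn) (*-identityˡ _)))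
        where
        alg : ∀ n r x → 0ℚ + n * (0ℚ + r * x) ≡ (r * n) * x
        alg = solve 3 (λ n r x → con 0ℚ :+ n :* (con 0ℚ :+ r :* x) := (r :* n) :* x) refl

    null-coeff : ∀ d → Null m₀ d → ∀ j → d j ≡ + 0
    null-coeff d null zero    = null-head d null
    null-coeff d null (suc j) = null-coeff (d ∘ suc) (null-tail d null (null-head d null)) j

    unique : ∀ a b (q : ℕ → ℚ) → (∀ m → m₀ ℕ.≤ m → Conv (partialSum a m) (q m)) → (∀ m → m₀ ℕ.≤ m → Conv (partialSum b m) (q m)) →
      ∀ j → a j ≡ b j
    unique a b q ca cb j = ℤP.i-j≡0⇒i≡j (a j) (b j) (trans (cong (λ z → a j ℤ.+ z) (sym (ℤP.-1*i≡-i (b j)))) (null-coeff d null j))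
      where
      d : Seq
      d = addS a (scaleS -[1+ 0 ] b)
      null : Null m₀ d
      null m le = subst (Conv (partialSum d m)) (alg (q m)) (Point.add-conv m (ca m le) (Point.scale-conv m -[1+ 0 ] (cb m le)))
        where
        alg : ∀ x → x + - 1ℚ * x ≡ 0ℚ
        alg = solve 1 (λ x → x :+ (:- con 1ℚ) :* x := con 0ℚ) refl

-- The expansion of (E - 1)/n and its leading coefficients

module WordExpansion where

  open import Defs
  open FiniteSums
  open GeneratingSets using (χ+vertices; allFin-suc)
  open PairGraph using (tri; edgeCount)
  open Patterns using (fall)
  open Permutations using (∏)
  open FixedPointCount
  open Convergence
  open PowerSeries
  open import Data.Nat as ℕ using (ℕ; zero; suc; s≤s; _!)
  import Data.Nat.Properties as ℕP
  open import Data.Integer as ℤ using (ℤ; +_; -[1+_])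
  import Data.Integer.Properties as ℤP
  open import Data.Integer.Tactic.RingSolver using (solve-∀)
  open import Data.Rational as ℚ using (ℚ; 0ℚ; 1ℚ; _+_; _*_; _-_; -_; _<_; _≤_)
  open import Data.Rational.Properties as ℚP hiding (≤-trans; ≤-reflexive; _≟_)
  open import Data.Rational.Solver
  open import Data.Fin as Fin using (Fin; zero; suc)
  open import Data.Vec as Vec using (Vec; lookup)
  open import Data.List using (List; []; _∷_; map; filter; length; allFin)
  import Data.List.Properties as LP
  open import Data.List.Membership.Propositional using (_∈_; _∉_)
  open import Data.List.Membership.Propositional.Properties using (∈-map⁺; ∈-map⁻; ∈-allFin; ∈-filter⁺; ∈-filter⁻; ∈-deduplicate⁻)
  import Data.List.Membership.DecPropositional as DecMem
  open import Data.List.Relation.Unary.Any using (here; there)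
  import Data.List.Relation.Unary.Unique.Propositional.Properties as UP
  open import Data.Product using (_×_; _,_; proj₁; proj₂)
  open import Data.Product.Properties using (≡-dec)
  open import Relation.Nullary using (Dec; yes; no; ⌊_⌋; contradiction)
  open import Relation.Binary.PropositionalEquality hiding (resp; J; [_])
  open import Function using (_∘_; id)
  open +-*-Solver using (solve; _:=_; _:+_; _:*_; :-_; con; _:-_)

  sumF : ∀ k → (Fin k → ℕ) → ℕ
  sumF zero    f = 0
  sumF (suc k) f = f zero ℕ.+ sumF k (f ∘ suc)

  ∑-sumF : ∀ k f → ∑ (allFin k) f ≡ sumF k f
  ∑-sumF zero    f = refl
  ∑-sumF (suc k) f = trans (cong (λ xs → ∑ xs f) (allFin-suc k)) (cong (f zero ℕ.+_) (trans (∑-map suc (allFin k) f) (∑-sumF k (f ∘ suc))))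

  shifts : ℕ → Seq
  shifts zero    = oneS
  shifts (suc c) = shiftS (shifts c)

  mulFall divFall : ℕ → Seq → Seq
  mulFall zero    a = a
  mulFall (suc v) a = mulS (ℤ.- (+ v)) (mulFall v a)
  divFall zero    a = a
  divFall (suc e) a = geomS (+ e) (divFall e a)

  divAll : ∀ k → (Fin k → ℕ) → Seq → Seq
  divAll zero    es a = a
  divAll (suc k) es a = divFall (es zero) (divAll k (es ∘ suc) a)

  -- the coefficients of x^c · Π_{i<v} (1 − i x) / Π_i Π_{l<eᵢ} (1 − l x)
  expansion : ∀ {k} → ℕ → ℕ → (Fin k → ℕ) → Seq
  expansion {k} c v es = mulFall v (divAll k es (shifts c))

  record Leading (c : ℕ) (s : ℤ) (a : Seq) : Set where
    field
      low  : ∀ {j} → j ℕ.< c → a j ≡ + 0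
      top  : a c ≡ + 1
      next : a (suc c) ≡ s

  leading-shifts : ∀ c → Leading c (+ 0) (shifts c)
  leading-shifts zero    = record { low = λ () ; top = refl ; next = refl }
  leading-shifts (suc c) = record { low = lo ; top = Leading.top ih ; next = Leading.next ih }
    where
    ih = leading-shifts c
    lo : ∀ {j} → j ℕ.< suc c → shifts (suc c) j ≡ + 0
    lo {zero}  _ = refl
    lo {suc j} (s≤s lt) = Leading.low ih lt

  private
    below : ∀ {c s a} → Leading c s a → (x : ℤ) → ∀ (f : Seq) → f 0 ≡ a 0 → (∀ j → f (suc j) ≡ a (suc j) ℤ.+ x ℤ.* f j) →
      ∀ {j} → j ℕ.< c → f j ≡ + 0
    below L x f f0 fs {zero}  lt = trans f0 (Leading.low L lt)
    below L x f f0 fs {suc j} lt = trans (fs j) (trans (cong₂ ℤ._+_ (Leading.low L lt) (trans (cong (x ℤ.*_) (below L x f f0 fs (ℕP.<-trans (ℕP.n<1+n j) lt))) (ℤP.*-zeroʳ x))) refl)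

    at-top : ∀ {c s a} → Leading c s a → (x : ℤ) → ∀ (f : Seq) → f 0 ≡ a 0 → (∀ j → f (suc j) ≡ a (suc j) ℤ.+ x ℤ.* f j) → f c ≡ + 1
    at-top {zero}  L x f f0 fs = trans f0 (Leading.top L)
    at-top {suc c} L x f f0 fs = trans (fs c) (trans (cong₂ ℤ._+_ (Leading.top L) (trans (cong (x ℤ.*_) (below L x f f0 fs (ℕP.n<1+n c))) (ℤP.*-zeroʳ x))) refl)

  leading-geom : ∀ {c s a} x → Leading c s a → Leading c (s ℤ.+ x) (geomS x a)
  leading-geom {c} {a = a} x L = record
    { low = below L x (geomS x a) refl (λ _ → refl)
    ; top = at-top L x (geomS x a) refl (λ _ → refl)
    ; next = cong₂ ℤ._+_ (Leading.next L) (trans (cong (x ℤ.*_) (at-top L x (geomS x a) refl (λ _ → refl))) (ℤP.*-identityʳ x)) }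

  leading-mul : ∀ {c s a} x → Leading c s a → Leading c (s ℤ.+ x) (mulS x a)
  leading-mul {c} {a = a} x L = record
    { low = lo ; top = tp c L
    ; next = cong₂ ℤ._+_ (Leading.next L) (trans (cong (x ℤ.*_) (Leading.top L)) (ℤP.*-identityʳ x)) }
    where
    lo : ∀ {j} → j ℕ.< c → mulS x a j ≡ + 0
    lo {zero}  lt = Leading.low L lt
    lo {suc j} lt = cong₂ ℤ._+_ (Leading.low L lt) (trans (cong (x ℤ.*_) (Leading.low L (ℕP.<-trans (ℕP.n<1+n j) lt))) (ℤP.*-zeroʳ x))
    tp : ∀ c {s} → Leading c s a → mulS x a c ≡ + 1
    tp zero    L = Leading.top L
    tp (suc c) L = cong₂ ℤ._+_ (Leading.top L) (trans (cong (x ℤ.*_) (Leading.low L (ℕP.n<1+n c))) (ℤP.*-zeroʳ x))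

  leading-mulFall : ∀ v {c s a} → Leading c s a → Leading c (s ℤ.+ ℤ.- (+ tri v)) (mulFall v a)
  leading-mulFall zero    {c} {s} {a} L = subst (λ z → Leading c z a) (sym (ℤP.+-identityʳ s)) L
  leading-mulFall (suc v) {c} {s} {a} L = subst (λ z → Leading c z (mulFall (suc v) a)) (trans (alg s (+ tri v) (+ v)) (cong (λ z → s ℤ.+ ℤ.- z) (sym (ℤP.pos-+ v (tri v)))))
      (leading-mul (ℤ.- (+ v)) (leading-mulFall v L))
    where
    alg : ∀ s t v → (s ℤ.+ ℤ.- t) ℤ.+ ℤ.- v ≡ s ℤ.+ ℤ.- (v ℤ.+ t)
    alg = solve-∀

  leading-divFall : ∀ e {c s a} → Leading c s a → Leading c (s ℤ.+ + tri e) (divFall e a)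
  leading-divFall zero    {c} {s} {a} L = subst (λ z → Leading c z a) (sym (ℤP.+-identityʳ s)) L
  leading-divFall (suc e) {c} {s} {a} L = subst (λ z → Leading c z (divFall (suc e) a)) (trans (alg s (+ tri e) (+ e)) (cong (λ z → s ℤ.+ z) (sym (ℤP.pos-+ e (tri e)))))
      (leading-geom (+ e) (leading-divFall e L))
    where
    alg : ∀ s t v → (s ℤ.+ t) ℤ.+ v ≡ s ℤ.+ (v ℤ.+ t)
    alg = solve-∀

  leading-divAll : ∀ k es {c s a} → Leading c s a → Leading c (s ℤ.+ + sumF k (tri ∘ es)) (divAll k es a)
  leading-divAll zero    es {c} {s} {a} L = subst (λ z → Leading c z a) (sym (ℤP.+-identityʳ s)) L
  leading-divAll (suc k) es {c} {s} {a} L = subst (λ z → Leading c z (divAll (suc k) es a))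
      (trans (alg s (+ tri (es zero)) (+ sumF k (tri ∘ es ∘ suc))) (cong (λ z → s ℤ.+ z) (sym (ℤP.pos-+ (tri (es zero)) _))))
      (leading-divFall (es zero) (leading-divAll k (es ∘ suc) L))
    where
    alg : ∀ s t v → (s ℤ.+ v) ℤ.+ t ≡ s ℤ.+ (t ℤ.+ v)
    alg = solve-∀

  -- The linear coefficients of all factors added up; `tri v` is 0 + 1 + ⋯ + (v - 1) = C(v,2).
  slope : ∀ {k} → ℕ → (Fin k → ℕ) → ℤ
  slope {k} v es = + sumF k (tri ∘ es) ℤ.+ ℤ.- (+ tri v)

  leading-expansion : ∀ {k} c v (es : Fin k → ℕ) → Leading c (slope v es) (expansion c v es)
  leading-expansion {k} c v es = subst (λ z → Leading c z (expansion c v es)) (cong (λ z → z ℤ.+ ℤ.- (+ tri v)) (ℤP.+-identityˡ (+ sumF k (tri ∘ es))))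
    (leading-mulFall v (leading-divAll k es (leading-shifts c)))

  module Value (m : ℕ) where
    open Point m

    -- The value n/(n - l) of 1/(1 - l x) at x = 1/n, where n = m + 1.
    h : ℕ → ℚ
    h l = n * recipSuc (m ℕ.∸ l)

    private
      ι-minus : ∀ {l} → l ℕ.≤ m → ι (+ suc (m ℕ.∸ l)) ≡ n - ι (+ l)
      ι-minus {l} le = trans (alg (ι (+ suc (m ℕ.∸ l))) (ι (+ l))) (cong (_- ι (+ l)) (trans (sym (ι-+ (+ suc (m ℕ.∸ l)) (+ l)))
          (cong (λ z → ι (+ suc z)) (ℕP.m∸n+n≡m le))))
        where
        alg : ∀ x y → x ≡ (x + y) - y
        alg = solve 2 (λ x y → x := (x :+ y) :- y) refl

      h-suc : ∀ l → h l * ι (+ suc (m ℕ.∸ l)) ≡ n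
      h-suc l = trans (*-assoc n _ _) (trans (cong (n *_) (/-* (+ 1) (suc (m ℕ.∸ l)))) (*-identityʳ n))

    h-inv : ∀ {l} → l ℕ.< suc m → h l * (1ℚ - ι (+ l) * r) ≡ 1ℚ
    h-inv {l} (s≤s le) = *-cancelʳ n n>0 (begin
      (h l * (1ℚ - ι (+ l) * r)) * n ≡⟨ alg (h l) (ι (+ l)) r n ⟩
      h l * (n - ι (+ l) * (r * n))  ≡⟨ cong (λ z → h l * (n - ι (+ l) * z)) rn ⟩
      h l * (n - ι (+ l) * 1ℚ)       ≡⟨ cong (λ z → h l * (n - z)) (*-identityʳ (ι (+ l))) ⟩
      h l * (n - ι (+ l))            ≡⟨ cong (h l *_) (ι-minus le) ⟨
      h l * ι (+ suc (m ℕ.∸ l))      ≡⟨ h-suc l ⟩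
      n                              ≡⟨ *-identityˡ n ⟨
      1ℚ * n ∎)
      where
      open ≡-Reasoning
      alg : ∀ h l r n → (h * (1ℚ - l * r)) * n ≡ h * (n - l * (r * n))
      alg = solve 4 (λ h l r n → (h :* (con 1ℚ :- l :* r)) :* n := h :* (n :- l :* (r :* n))) refl

    ff gg : ℕ → ℚ
    ff zero    = 1ℚ
    ff (suc v) = ff v * (1ℚ + ι (ℤ.- (+ v)) * r)
    gg zero    = 1ℚ
    gg (suc e) = gg e * h e

    gAll : ∀ k → (Fin k → ℕ) → ℚ
    gAll zero    es = 1ℚ
    gAll (suc k) es = gAll k (es ∘ suc) * gg (es zero)

    shifts-conv : ∀ c → shifts c ⟶ pw c
    shifts-conv zero    = one-conv
    shifts-conv (suc c) = shift-conv (shifts-conv c)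

    divFall-conv : ∀ e → e ℕ.≤ suc m → ∀ {a L} → a ⟶ L → divFall e a ⟶ L * gg e
    divFall-conv zero    le {a} {L} ca = subst (a ⟶_) (sym (*-identityʳ L)) ca
    divFall-conv (suc e) le {a} {L} ca = subst (divFall (suc e) a ⟶_) (*-assoc L (gg e) (h e))
      (geom-conv e le (h e) (h-inv le) (divFall-conv e (ℕP.≤-trans (ℕP.n≤1+n e) le) ca))

    divAll-conv : ∀ k es → (∀ i → es i ℕ.≤ suc m) → ∀ {a L} → a ⟶ L → divAll k es a ⟶ L * gAll k es
    divAll-conv zero    es le {a} {L} ca = subst (a ⟶_) (sym (*-identityʳ L)) ca
    divAll-conv (suc k) es le {a} {L} ca = subst (divAll (suc k) es a ⟶_) (*-assoc L (gAll k (es ∘ suc)) (gg (es zero)))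
      (divFall-conv (es zero) (le zero) (divAll-conv k (es ∘ suc) (le ∘ suc) ca))

    mulFall-conv : ∀ v {a L} → a ⟶ L → mulFall v a ⟶ L * ff v
    mulFall-conv zero    {a} {L} ca = subst (a ⟶_) (sym (*-identityʳ L)) ca
    mulFall-conv (suc v) {a} {L} ca = subst (mulFall (suc v) a ⟶_) (*-assoc L (ff v) _) (mul-conv (ℤ.- (+ v)) (mulFall-conv v ca))

    value : ∀ {k} → ℕ → ℕ → (Fin k → ℕ) → ℚ
    value {k} c v es = (pw c * gAll k es) * ff v

    expansion-conv : ∀ {k} c v (es : Fin k → ℕ) → (∀ i → es i ℕ.≤ suc m) → expansion c v es ⟶ value c v es
    expansion-conv {k} c v es le = mulFall-conv v (divAll-conv k es le (shifts-conv c))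

    N : ℕ → ℚ
    N = powℚ n

    -- `fall` splits off its first factor, whereas `mulFall` adds the last one. The rational
    -- difference is harmless for v > x, since `fall x v` is then zero.
    ι-fall : ∀ x v → ι (+ fall x (suc v)) ≡ ι (+ fall x v) * (ι (+ x) - ι (+ v))
    ι-fall x zero = trans (cong (λ z → ι (+ z)) (ℕP.*-identityʳ x)) (alg (ι (+ x)))
      where
      alg : ∀ x → x ≡ 1ℚ * (x - 0ℚ)
      alg = solve 1 (λ x → x := con 1ℚ :* (x :- con 0ℚ)) refl
    ι-fall zero (suc v) = sym (*-zeroˡ (ι (+ 0) - ι (+ suc v)))
    ι-fall (suc x) (suc v) = begin
      ι (+ (suc x ℕ.* fall x (suc v))) ≡⟨ trans (cong ι (ℤP.pos-* (suc x) (fall x (suc v)))) (ι-* (+ suc x) (+ fall x (suc v))) ⟩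
      ι (+ suc x) * ι (+ fall x (suc v)) ≡⟨ cong (ι (+ suc x) *_) (ι-fall x v) ⟩
      ι (+ suc x) * (ι (+ fall x v) * (ι (+ x) - ι (+ v))) ≡⟨ *-assoc (ι (+ suc x)) _ _ ⟨
      (ι (+ suc x) * ι (+ fall x v)) * (ι (+ x) - ι (+ v)) ≡⟨ cong₂ _*_ (sym (trans (cong ι (ℤP.pos-* (suc x) (fall x v))) (ι-* (+ suc x) (+ fall x v)))) diff ⟩
      ι (+ fall (suc x) (suc v)) * (ι (+ suc x) - ι (+ suc v)) ∎
      where
      open ≡-Reasoning
      diff : ι (+ x) - ι (+ v) ≡ ι (+ suc x) - ι (+ suc v)
      diff = trans (alg (ι (+ x)) (ι (+ v))) (cong₂ _-_ (sym (ι-+ (+ 1) (+ x))) (sym (ι-+ (+ 1) (+ v))))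
        where
        alg : ∀ a b → a - b ≡ (1ℚ + a) - (1ℚ + b)
        alg = solve 2 (λ a b → a :- b := (con 1ℚ :+ a) :- (con 1ℚ :+ b)) refl

    ff-fall : ∀ v → ff v * N v ≡ ι (+ fall (suc m) v)
    ff-fall zero    = refl
    ff-fall (suc v) = begin
      (ff v * (1ℚ + ι (ℤ.- (+ v)) * r)) * (n * N v) ≡⟨ cong (λ z → (ff v * (1ℚ + z * r)) * (n * N v)) (ι-neg (+ v)) ⟩
      (ff v * (1ℚ + - ι (+ v) * r)) * (n * N v)     ≡⟨ alg (ff v) (ι (+ v)) r n (N v) ⟩
      (ff v * N v) * (n - ι (+ v) * (r * n))        ≡⟨ cong₂ (λ a b → a * (n - ι (+ v) * b)) (ff-fall v) rn ⟩
      ι (+ fall (suc m) v) * (n - ι (+ v) * 1ℚ)     ≡⟨ cong (λ z → ι (+ fall (suc m) v) * (n - z)) (*-identityʳ (ι (+ v))) ⟩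
      ι (+ fall (suc m) v) * (n - ι (+ v))          ≡⟨ ι-fall (suc m) v ⟨
      ι (+ fall (suc m) (suc v)) ∎
      where
      open ≡-Reasoning
      alg : ∀ f v r n p → (f * (1ℚ + - v * r)) * (n * p) ≡ (f * p) * (n - v * (r * n))
      alg = solve 5 (λ f v r n p → (f :* (con 1ℚ :+ (:- v) :* r)) :* (n :* p) := (f :* p) :* (n :- v :* (r :* n))) refl

    gg-! : ∀ e → e ℕ.≤ suc m → gg e * ι (+ (suc m !)) ≡ N e * ι (+ ((suc m ℕ.∸ e) !))
    gg-! zero    le = refl
    gg-! (suc e) le@(s≤s e≤m) = begin
      (gg e * h e) * ι (+ (suc m !))  ≡⟨ alg (gg e) (h e) (ι (+ (suc m !))) ⟩
      h e * (gg e * ι (+ (suc m !)))  ≡⟨ cong (h e *_) (gg-! e (ℕP.≤-trans (ℕP.n≤1+n e) le)) ⟩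
      h e * (N e * ι (+ ((suc m ℕ.∸ e) !))) ≡⟨ cong (λ z → h e * (N e * ι (+ (z !)))) (ℕP.+-∸-assoc 1 e≤m) ⟩
      h e * (N e * ι (+ (suc (m ℕ.∸ e) !))) ≡⟨ cong (λ z → h e * (N e * z)) (trans (cong ι (ℤP.pos-* (suc (m ℕ.∸ e)) ((m ℕ.∸ e) !))) (ι-* (+ suc (m ℕ.∸ e)) (+ ((m ℕ.∸ e) !)))) ⟩
      h e * (N e * (ι (+ suc (m ℕ.∸ e)) * ι (+ ((m ℕ.∸ e) !)))) ≡⟨ alg′ (h e) (N e) (ι (+ suc (m ℕ.∸ e))) (ι (+ ((m ℕ.∸ e) !))) ⟩
      (h e * ι (+ suc (m ℕ.∸ e))) * (N e * ι (+ ((m ℕ.∸ e) !))) ≡⟨ cong (_* (N e * ι (+ ((m ℕ.∸ e) !)))) (h-suc e) ⟩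
      n * (N e * ι (+ ((m ℕ.∸ e) !))) ≡⟨ *-assoc n (N e) _ ⟨
      N (suc e) * ι (+ ((m ℕ.∸ e) !)) ∎
      where
      open ≡-Reasoning
      alg : ∀ g h x → (g * h) * x ≡ h * (g * x)
      alg = solve 3 (λ g h x → (g :* h) :* x := h :* (g :* x)) refl
      alg′ : ∀ h p s f → h * (p * (s * f)) ≡ (h * s) * (p * f)
      alg′ = solve 4 (λ h p s f → h :* (p :* (s :* f)) := (h :* s) :* (p :* f)) refl

    N-+ : ∀ a b → N (a ℕ.+ b) ≡ N a * N b
    N-+ zero    b = sym (*-identityˡ (N b))
    N-+ (suc a) b = trans (cong (n *_) (N-+ a b)) (sym (*-assoc n (N a) (N b)))

    gAll-! : ∀ k es → (∀ i → es i ℕ.≤ suc m) →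
      gAll k es * ι (+ ((suc m !) ℕ.^ k)) ≡ N (sumF k es) * ι (+ ∏ k (λ i → (suc m ℕ.∸ es i) !))
    gAll-! zero    es le = refl
    gAll-! (suc k) es le = begin
      (gAll k (es ∘ suc) * gg (es zero)) * ι (+ ((suc m !) ℕ.* (suc m !) ℕ.^ k))
        ≡⟨ cong ((gAll k (es ∘ suc) * gg (es zero)) *_) (trans (cong ι (ℤP.pos-* (suc m !) ((suc m !) ℕ.^ k))) (ι-* (+ (suc m !)) (+ ((suc m !) ℕ.^ k)))) ⟩
      (gAll k (es ∘ suc) * gg (es zero)) * (ι (+ (suc m !)) * ι (+ ((suc m !) ℕ.^ k)))
        ≡⟨ alg (gAll k (es ∘ suc)) (gg (es zero)) (ι (+ (suc m !))) (ι (+ ((suc m !) ℕ.^ k))) ⟩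
      (gg (es zero) * ι (+ (suc m !))) * (gAll k (es ∘ suc) * ι (+ ((suc m !) ℕ.^ k)))
        ≡⟨ cong₂ _*_ (gg-! (es zero) (le zero)) (gAll-! k (es ∘ suc) (le ∘ suc)) ⟩
      (N (es zero) * ι (+ ((suc m ℕ.∸ es zero) !))) * (N (sumF k (es ∘ suc)) * ι (+ P))
        ≡⟨ interchange (N (es zero)) (ι (+ ((suc m ℕ.∸ es zero) !))) (N (sumF k (es ∘ suc))) (ι (+ P)) ⟩
      (N (es zero) * N (sumF k (es ∘ suc))) * (ι (+ ((suc m ℕ.∸ es zero) !)) * ι (+ P))
        ≡⟨ cong₂ _*_ (sym (N-+ (es zero) _)) (sym (trans (cong ι (ℤP.pos-* ((suc m ℕ.∸ es zero) !) P)) (ι-* (+ ((suc m ℕ.∸ es zero) !)) (+ P)))) ⟩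
      N (sumF (suc k) es) * ι (+ ∏ (suc k) (λ i → (suc m ℕ.∸ es i) !)) ∎
      where
      open ≡-Reasoning
      P = ∏ k (λ i → (suc m ℕ.∸ es (suc i)) !)
      alg : ∀ a b c d → (a * b) * (c * d) ≡ (b * c) * (a * d)
      alg = solve 4 (λ a b c d → (a :* b) :* (c :* d) := (b :* c) :* (a :* d)) refl
      interchange : ∀ a b c d → (a * b) * (c * d) ≡ (a * c) * (b * d)
      interchange = solve 4 (λ a b c d → (a :* b) :* (c :* d) := (a :* c) :* (b :* d)) refl

    pwN : ∀ c → pw c * N c ≡ 1ℚ
    pwN zero    = refl
    pwN (suc c) = trans (alg r (pw c) n (N c)) (trans (cong₂ _*_ rn (pwN c)) (*-identityˡ 1ℚ))
      where
      alg : ∀ r p n q → (r * p) * (n * q) ≡ (r * n) * (p * q)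
      alg = solve 4 (λ r p n q → (r :* p) :* (n :* q) := (r :* n) :* (p :* q)) refl

    -- The powers of n cancel precisely because c + v = 1 + Σ eᵢ, which is the definition of χ.
    value-count : ∀ {k} c v (es : Fin k → ℕ) → (∀ i → es i ℕ.≤ suc m) → c ℕ.+ v ≡ suc (sumF k es) →
      (n * value c v es) * ι (+ ((suc m !) ℕ.^ k)) ≡ ι (+ (fall (suc m) v ℕ.* ∏ k (λ i → (suc m ℕ.∸ es i) !)))
    value-count {k} c v es le eq = begin
      (n * ((pw c * gAll k es) * ff v)) * F ≡⟨ alg n (pw c) (gAll k es) (ff v) F ⟩
      ((n * (gAll k es * F)) * pw c) * ff v ≡⟨ cong (λ z → ((n * z) * pw c) * ff v) (gAll-! k es le) ⟩
      ((n * (N (sumF k es) * ι (+ P))) * pw c) * ff v ≡⟨ alg2 n (N (sumF k es)) (ι (+ P)) (pw c) (ff v) ⟩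
      (((n * N (sumF k es)) * pw c) * ff v) * ι (+ P) ≡⟨ cong (λ z → ((z * pw c) * ff v) * ι (+ P)) (trans (cong N (sym eq)) (N-+ c v)) ⟩
      (((N c * N v) * pw c) * ff v) * ι (+ P) ≡⟨ alg3 (N c) (N v) (pw c) (ff v) (ι (+ P)) ⟩
      ((pw c * N c) * (ff v * N v)) * ι (+ P) ≡⟨ cong₂ (λ a b → (a * b) * ι (+ P)) (pwN c) (ff-fall v) ⟩
      (1ℚ * ι (+ fall (suc m) v)) * ι (+ P) ≡⟨ cong (_* ι (+ P)) (*-identityˡ (ι (+ fall (suc m) v))) ⟩
      ι (+ fall (suc m) v) * ι (+ P) ≡⟨ trans (cong ι (ℤP.pos-* (fall (suc m) v) P)) (ι-* (+ fall (suc m) v) (+ P)) ⟨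
      ι (+ (fall (suc m) v ℕ.* P)) ∎
      where
      open ≡-Reasoning
      F = ι (+ ((suc m !) ℕ.^ k))
      P = ∏ k (λ i → (suc m ℕ.∸ es i) !)
      alg : ∀ n p g f F → (n * ((p * g) * f)) * F ≡ ((n * (g * F)) * p) * f
      alg = solve 5 (λ n p g f F → (n :* ((p :* g) :* f)) :* F := ((n :* (g :* F)) :* p) :* f) refl
      alg2 : ∀ n s P p f → ((n * (s * P)) * p) * f ≡ (((n * s) * p) * f) * P
      alg2 = solve 5 (λ n s P p f → ((n :* (s :* P)) :* p) :* f := (((n :* s) :* p) :* f) :* P) refl
      alg3 : ∀ c v p f P → (((c * v) * p) * f) * P ≡ ((p * c) * (f * v)) * P
      alg3 = solve 5 (λ c v p f P → (((c :* v) :* p) :* f) :* P := ((p :* c) :* (f :* v)) :* P) refl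

  sumS : List Seq → Seq
  sumS []       = zeroS
  sumS (a ∷ as) = addS a (sumS as)

  module _ {k : ℕ} (w : Word k) where

    private
      V : Set
      V = Vtx w

    edgeCount≤ : ∀ p i → edgeCount w p i ℕ.≤ length w
    edgeCount≤ p i = ℕP.≤-trans (⊆-length (Distinct.dedup-! (≡-dec Fin._≟_ Fin._≟_) L) (∈-deduplicate⁻ (≡-dec Fin._≟_ Fin._≟_) L))
      (ℕP.≤-trans (ℕP.≤-reflexive (LP.length-map _ (filter (λ j → label w j Fin.≟ i) (allFin (length w)))))
        (ℕP.≤-trans (LP.length-filter _ (allFin (length w))) (ℕP.≤-reflexive (LP.length-tabulate id))))
      where L = map (λ j → p (origin w j) , p (terminus w j)) (filter (λ j → label w j Fin.≟ i) (allFin (length w)))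

    numEdges-sum : ∀ p → numEdges w p ≡ sumF k (edgeCount w p)
    numEdges-sum p = trans (go (allFin (length w))) (∑-sumF k (edgeCount w p))
      where
      module D₃ = Distinct (≡-dec Fin._≟_ (≡-dec (Fin._≟_ {suc (length w)}) (Fin._≟_ {suc (length w)})))
      _≟₂_ = ≡-dec (Fin._≟_ {suc (length w)}) (Fin._≟_ {suc (length w)})
      module D₂ = Distinct _≟₂_
      two : EIdx w → V × V
      two j = p (origin w j) , p (terminus w j)
      three : EIdx w → Fin k × V × V
      three j = label w j , two j
      sel : List (EIdx w) → Fin k → List (EIdx w)
      sel js i = filter (λ j → label w j Fin.≟ i) js
      keep : ∀ x js → sel (x ∷ js) (label w x) ≡ x ∷ sel js (label w x)
      keep x js with label w x Fin.≟ label w x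
      ... | yes _ = refl
      ... | no ne = contradiction refl ne
      skip : ∀ x js i → i ≢ label w x → sel (x ∷ js) i ≡ sel js i
      skip x js i ne with label w x Fin.≟ i
      ... | yes e = contradiction (sym e) ne
      ... | no _  = refl
      bump : ∀ (f g : Fin k → ℕ) l → g l ≡ suc (f l) → (∀ i → i ≢ l → g i ≡ f i) → ∑ (allFin k) g ≡ suc (∑ (allFin k) f)
      bump f g l gl gi = trans (∑-cong (allFin k) each) (trans (∑-+ (allFin k) _ f) (cong (ℕ._+ ∑ (allFin k) f)
          (trans (∑-single _ (UP.allFin⁺ k) (∈-allFin l) (λ {i} _ ne → off i ne)) (on (l Fin.≟ l)))))
        where
        off : ∀ i → i ≢ l → 𝟙 ⌊ i Fin.≟ l ⌋ ≡ 0
        off i ne with i Fin.≟ l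
        ... | yes e = contradiction e ne
        ... | no _  = refl
        on : (d : Dec (l ≡ l)) → 𝟙 ⌊ d ⌋ ≡ 1
        on (yes _) = refl
        on (no ne) = contradiction refl ne
        each : ∀ i → g i ≡ 𝟙 ⌊ i Fin.≟ l ⌋ ℕ.+ f i
        each i with i Fin.≟ l
        ... | yes refl = gl
        ... | no ne    = gi i ne
      go : ∀ js → D₃.D (map three js) ≡ ∑ (allFin k) (λ i → D₂.D (map two (sel js i)))
      go [] = sym (∑-zero (allFin k))
      go (x ∷ js) = case (DecMem._∈?_ _≟₂_ (two x) (map two (sel js l)))
        where
        l = label w x
        g = λ i → D₂.D (map two (sel (x ∷ js) i))
        f = λ i → D₂.D (map two (sel js i))
        other : ∀ i → i ≢ l → g i ≡ f i
        other i ne = cong (D₂.D ∘ map two) (skip x js i ne)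
        here-l : g l ≡ D₂.D (two x ∷ map two (sel js l))
        here-l = cong (D₂.D ∘ map two) (keep x js)
        case : Dec (two x ∈ map two (sel js l)) → D₃.D (three x ∷ map three js) ≡ ∑ (allFin k) g
        case (yes m) = trans (D₃.D-∈ m₃) (trans (go js) (sym (∑-cong (allFin k) same)))
          where
          m₃ : three x ∈ map three js
          m₃ with ∈-map⁻ two m
          ... | j , j∈ , e with ∈-filter⁻ (λ j → label w j Fin.≟ l) {xs = js} j∈
          ...   | j∈′ , lj = subst (_∈ map three js) (cong₂ _,_ lj (sym e)) (∈-map⁺ three j∈′)
          same : ∀ i → g i ≡ f i
          same i with i Fin.≟ l
          ... | yes refl = trans here-l (D₂.D-∈ m)
          ... | no ne    = other i ne
        case (no nm) = trans (D₃.D-∉ nm₃) (trans (cong suc (go js)) (sym (bump f g l (trans here-l (D₂.D-∉ nm)) other)))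
          where
          nm₃ : three x ∉ map three js
          nm₃ m₃ with ∈-map⁻ three m₃
          ... | j , j∈ , e = nm (subst (_∈ map two (sel js l)) (sym (cong proj₂ e)) (∈-map⁺ two (∈-filter⁺ (λ j → label w j Fin.≟ l) j∈ (sym (cong proj₁ e)))))

    seqOf : Part w → Seq
    seqOf p = expansion (χ w p) (numVertices w p) (edgeCount w p)

    quotientSeqs : List Seq
    quotientSeqs = map (seqOf ∘ lookup) (quotients w)

    -- the coefficients of (E − 1)/n, one summand for each realizable quotient
    coefficients : Seq
    coefficients = addS (sumS quotientSeqs) (scaleS -[1+ 0 ] (shiftS oneS))

    -- n ≥ |w| bounds every edge count by n, so the factors 1 - l/n that are inverted have l < n.
    coefficients-expand : IsExpansion w coefficients
    coefficients-expand m le = close (subst (coefficients ⟶_) total (add-conv (sum-conv (quotients w)) (scale-conv -[1+ 0 ] (shift-conv one-conv))))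
      where
      open Point m
      open Value m
      val : Vec V (suc (length w)) → ℚ
      val p = value (χ w (lookup p)) (numVertices w (lookup p)) (edgeCount w (lookup p))
      TV : List (Vec V (suc (length w))) → ℚ
      TV []       = 0ℚ
      TV (p ∷ ps) = val p + TV ps
      sum-conv : ∀ ps → sumS (map (seqOf ∘ lookup) ps) ⟶ TV ps
      sum-conv []       = zero-conv
      sum-conv (p ∷ ps) = add-conv (expansion-conv (χ w (lookup p)) (numVertices w (lookup p)) (edgeCount w (lookup p)) (λ i → ℕP.≤-trans (edgeCount≤ (lookup p) i) le)) (sum-conv ps)
      F = ι (+ ((suc m !) ℕ.^ k))
      wt : Vec V (suc (length w)) → ℕ
      wt p = fall (suc m) (numVertices w (lookup p)) ℕ.* term w (suc m) (lookup p)
      each : ∀ {p} → p ∈ quotients w → (n * val p) * F ≡ ι (+ wt p)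
      each {p} p∈ = value-count (χ w (lookup p)) (numVertices w (lookup p)) (edgeCount w (lookup p)) (λ i → ℕP.≤-trans (edgeCount≤ (lookup p) i) le)
        (trans (χ+vertices w (proj₁ (quotient-closed w p∈))) (cong suc (numEdges-sum (lookup p))))
      sums : ∀ ps → (∀ {p} → p ∈ ps → p ∈ quotients w) → (n * TV ps) * F ≡ ι (+ ∑ ps wt)
      sums []       s = trans (cong (_* F) (*-zeroʳ n)) (*-zeroˡ F)
      sums (p ∷ ps) s = trans (alg n (val p) (TV ps) F) (trans (cong₂ _+_ (each (s (here refl))) (sums ps (s ∘ there)))
          (sym (trans (cong ι (ℤP.pos-+ (wt p) (∑ ps wt))) (ι-+ (+ wt p) (+ ∑ ps wt)))))
        where
        alg : ∀ n a b F → (n * (a + b)) * F ≡ (n * a) * F + (n * b) * F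
        alg = solve 4 (λ n a b F → (n :* (a :+ b)) :* F := (n :* a) :* F :+ (n :* b) :* F) refl
      instance
        F≢0 : ℕ.NonZero ((suc m !) ℕ.^ k)
        F≢0 = ℕP.m^n≢0 (suc m !) k {{suc m ℕP.!≢0}}
      F>0 : 0ℚ < F
      F>0 = ι-mono-< {+ 0} {+ ((suc m !) ℕ.^ k)} (ℤ.+<+ (ℕ.>-nonZero⁻¹ _))
      E≡ : expectation (suc m) w ≡ n * TV (quotients w)
      E≡ = *-cancelʳ F F>0 (trans (/-* (+ totalFixed (suc m) w) ((suc m !) ℕ.^ k))
        (trans (cong (λ z → ι (+ z)) (totalFixed-quotients w (suc m))) (sym (sums (quotients w) id))))
      total : TV (quotients w) + ι -[1+ 0 ] * (r * 1ℚ) ≡ (expectation (suc m) w - 1ℚ) * r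
      total = sym (trans (cong (λ z → (z - 1ℚ) * r) E≡) (trans (alg n (TV (quotients w)) r) (trans (cong (λ z → z * TV (quotients w) + - 1ℚ * (r * 1ℚ)) rn) (cong (λ z → z + - 1ℚ * (r * 1ℚ)) (*-identityˡ (TV (quotients w)))))))
        where
        alg : ∀ n t r → (n * t - 1ℚ) * r ≡ (r * n) * t + - 1ℚ * (r * 1ℚ)
        alg = solve 3 (λ n t r → (n :* t :- con 1ℚ) :* r := (r :* n) :* t :+ (:- con 1ℚ) :* (r :* con 1ℚ)) refl

-- Comparing the coefficients with the number of type A quotients

module Comparison where

  open import Defs
  open FiniteSums
  open Folding
  open GeneratingSets
  open PairGraph
  open PairComponents
  open FixedPointCount
  open Convergence using (conv)
  open PowerSeries
  open WordExpansion
  open import Data.Nat as ℕ using (ℕ; suc; z≤n; s≤s; _≤_; _<_)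
  import Data.Nat.Properties as ℕP
  import Data.Rational as ℚ
  open import Data.Integer as ℤ using (ℤ; +_; -[1+_])
  import Data.Integer.Properties as ℤP
  open import Data.Integer.Tactic.RingSolver using (solve-∀)
  open import Data.Fin as Fin using (Fin; suc)
  open import Data.Vec as Vec using (Vec; lookup)
  import Data.Vec.Properties as VecP
  open import Data.List using (List; []; _∷_; map; filter; length)
  import Data.List.Properties as LP
  open import Data.List.Membership.Propositional using (_∈_; _∉_; find)
  open import Data.List.Membership.Propositional.Properties using (∈-map⁺; ∈-map⁻; ∈-filter⁺; ∈-filter⁻)
  import Data.List.Membership.DecPropositional as DecMem
  open import Data.List.Relation.Unary.Any using (here; there)
  open import Data.List.Relation.Unary.All as All using (All; []; _∷_)
  open import Data.List.Relation.Unary.All.Properties using (¬All⇒Any¬)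
  open import Data.List.Relation.Unary.AllPairs using ([]; _∷_)
  open import Data.List.Relation.Unary.Unique.Propositional using (Unique)
  import Data.List.Relation.Unary.Unique.Propositional.Properties as UP
  open import Data.Product using (_×_; _,_; proj₁; proj₂; ∃-syntax)
  open import Data.Sum using (_⊎_; inj₁; inj₂)
  open import Data.Empty using (⊥)
  open import Relation.Nullary using (¬_; Dec; yes; no; contradiction)
  open import Relation.Nullary.Decidable using (decidable-stable)
  open import Relation.Binary.PropositionalEquality hiding (resp; J; [_])
  open import Function using (_∘_; id; mk⇔)
  open import Function.Bundles using (_⇔_)

  sumℤ : {A : Set} → (A → ℤ) → List A → ℤ
  sumℤ f []       = + 0
  sumℤ f (x ∷ xs) = f x ℤ.+ sumℤ f xs

  module LeadingSums {A : Set} (size : A → ℕ) (slopes : A → ℤ) (seq : A → Seq) (lead : ∀ q → Leading (size q) (slopes q) (seq q)) where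

    sumS-map : ∀ qs j → sumS (map seq qs) j ≡ sumℤ (λ q → seq q j) qs
    sumS-map []       j = refl
    sumS-map (q ∷ qs) j = cong (λ z → seq q j ℤ.+ z) (sumS-map qs j)

    level : ℕ → List A → List A
    level c = filter (λ q → size q ℕ.≟ c)

    private
      at : ∀ c {q} → size q ≡ c → seq q c ≡ + 1
      at c {q} e = trans (cong (seq q) (sym e)) (Leading.top (lead q))

      hit : ∀ c {q} qs → size q ≡ c → level c (q ∷ qs) ≡ q ∷ level c qs
      hit c qs e = LP.filter-accept (λ q → size q ℕ.≟ c) e

      miss : ∀ c {q} qs → size q ≢ c → level c (q ∷ qs) ≡ level c qs
      miss c qs ne = LP.filter-reject (λ q → size q ℕ.≟ c) ne

      # : List A → ℤ
      # qs = + length qs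

    sum₀ : ∀ qs → sumS (map seq qs) 0 ≡ + length (level 0 qs)
    sum₀ qs = trans (sumS-map qs 0) (go qs)
      where
      go : ∀ qs → sumℤ (λ q → seq q 0) qs ≡ # (level 0 qs)
      go [] = refl
      go (q ∷ qs) with size q ℕ.≟ 0
      ... | yes e = trans (cong₂ ℤ._+_ (at 0 e) (go qs)) (cong # (sym (hit 0 qs e)))
      ... | no ne = trans (cong₂ ℤ._+_ (Leading.low (lead q) (ℕP.n≢0⇒n>0 ne)) (go qs))
                          (trans (ℤP.+-identityˡ (# (level 0 qs))) (cong # (sym (miss 0 qs ne))))

    sum₁ : ∀ qs → (∀ {q} → q ∈ qs → size q ≢ 0) → sumS (map seq qs) 1 ≡ + length (level 1 qs)
    sum₁ qs h = trans (sumS-map qs 1) (go qs h)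
      where
      go : ∀ qs → (∀ {q} → q ∈ qs → size q ≢ 0) → sumℤ (λ q → seq q 1) qs ≡ # (level 1 qs)
      go [] h = refl
      go (q ∷ qs) h with size q ℕ.≟ 1
      ... | yes e = trans (cong₂ ℤ._+_ (at 1 e) (go qs (h ∘ there))) (cong # (sym (hit 1 qs e)))
      ... | no ne = trans (cong₂ ℤ._+_ (Leading.low (lead q) (ℕP.≤∧≢⇒< (ℕP.n≢0⇒n>0 (h (here refl))) (ne ∘ sym))) (go qs (h ∘ there)))
                          (trans (ℤP.+-identityˡ (# (level 1 qs))) (cong # (sym (miss 1 qs ne))))

    -- Expansions starting at the power 2 give their leading 1, those starting at the power 1 give
    -- their slope, and later ones give nothing.
    sum₂ : ∀ qs → (∀ {q} → q ∈ qs → size q ≢ 0) → sumS (map seq qs) 2 ≡ sumℤ slopes (level 1 qs) ℤ.+ + length (level 2 qs)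
    sum₂ qs h = trans (sumS-map qs 2) (go qs h)
      where
      alg₁ : ∀ s a b → s ℤ.+ (a ℤ.+ b) ≡ (s ℤ.+ a) ℤ.+ b
      alg₁ = solve-∀
      alg₂ : ∀ a b → + 1 ℤ.+ (a ℤ.+ b) ≡ a ℤ.+ (+ 1 ℤ.+ b)
      alg₂ = solve-∀
      R : List A → List A → ℤ
      R xs ys = sumℤ slopes xs ℤ.+ # ys
      go : ∀ qs → (∀ {q} → q ∈ qs → size q ≢ 0) → sumℤ (λ q → seq q 2) qs ≡ R (level 1 qs) (level 2 qs)
      go [] h = refl
      go (q ∷ qs) h with size q ℕ.≟ 1 | size q ℕ.≟ 2
      ... | yes e | yes e′ = contradiction (trans (sym e) e′) (λ ())
      ... | yes e | no n2  = trans (cong₂ ℤ._+_ (trans (cong (λ j → seq q (suc j)) (sym e)) (Leading.next (lead q))) (go qs (h ∘ there)))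
        (trans (alg₁ (slopes q) (sumℤ slopes (level 1 qs)) (# (level 2 qs))) (cong₂ R (sym (hit 1 qs e)) (sym (miss 2 qs n2))))
      ... | no n1 | yes e  = trans (cong₂ ℤ._+_ (at 2 e) (go qs (h ∘ there)))
        (trans (alg₂ (sumℤ slopes (level 1 qs)) (# (level 2 qs))) (cong₂ R (sym (miss 1 qs n1)) (sym (hit 2 qs e))))
      ... | no n1 | no n2  = trans (cong₂ ℤ._+_ (Leading.low (lead q) (ℕP.≤∧≢⇒< (ℕP.≤∧≢⇒< (ℕP.n≢0⇒n>0 (h (here refl))) (n1 ∘ sym)) (n2 ∘ sym)))
        (go qs (h ∘ there))) (trans (ℤP.+-identityˡ (R (level 1 qs) (level 2 qs))) (cong₂ R (sym (miss 1 qs n1)) (sym (miss 2 qs n2))))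

  module _ {k : ℕ} (w : Word k) where

    private
      V : Set
      V = Vtx w
      Q : Set
      Q = Vec V (suc (length w))

      e₀ : V × V
      e₀ = first w , last w

      χQ : Q → ℕ
      χQ q = χ w (lookup q)

      slopeQ : Q → ℤ
      slopeQ q = slope (numVertices w (lookup q)) (edgeCount w (lookup q))

      _≟Q_ : (p q : Q) → Dec (p ≡ q)
      _≟Q_ = VecP.≡-dec Fin._≟_

      lead : ∀ q → Leading (χQ q) (slopeQ q) (seqOf w (lookup q))
      lead q = leading-expansion (χQ q) (numVertices w (lookup q)) (edgeCount w (lookup q))

      open LeadingSums χQ slopeQ (seqOf w ∘ lookup) lead using (level; sum₀; sum₁; sum₂)

      b : Seq
      b = coefficients w

    b₀ : b 0 ≡ + length (level 0 (quotients w))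
    b₀ = trans (ℤP.+-identityʳ _) (sum₀ (quotients w))

    b₁ : (∀ {q} → q ∈ quotients w → χQ q ≢ 0) → b 1 ≡ + length (level 1 (quotients w)) ℤ.+ -[1+ 0 ]
    b₁ h = cong (λ z → z ℤ.+ -[1+ 0 ]) (sum₁ (quotients w) h)

    b₂ : (∀ {q} → q ∈ quotients w → χQ q ≢ 0) →
      b 2 ≡ sumℤ slopeQ (level 1 (quotients w)) ℤ.+ + length (level 2 (quotients w))
    b₂ h = trans (ℤP.+-identityʳ _) (sum₂ (quotients w) h)

    closed : ∀ {E} → e₀ ∈ E → (G : Generated w E) → Closed w (Generated.p G)
    closed m G = Generated.folded G , proj₂ (Generated.gen G _ _) (base m)

    canonical : ∀ {E} → e₀ ∈ E → Generated w E → ∃[ q ] (q ∈ quotients w × Gen w (lookup q) E)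
    canonical m G = proj₁ qE , proj₁ (proj₂ qE) , ≋-Gen w (≋-sym w (proj₂ (proj₂ qE))) (Generated.gen G)
      where qE = quotient-complete w (Generated.p G) (closed m G)

    abstract
      -- Opaque, as later arguments use the specification and never the partition computed by
      -- folding.
      generated : ∀ E → e₀ ∈ E → ∃[ q ] (q ∈ quotients w × Gen w (lookup q) E)
      generated E m = canonical m (generate w E)

    p₁ : Q
    p₁ = proj₁ (generated (e₀ ∷ []) (here refl))

    p₁∈ : p₁ ∈ quotients w
    p₁∈ = proj₁ (proj₂ (generated (e₀ ∷ []) (here refl)))

    gen₁ : Gen w (lookup p₁) (e₀ ∷ [])
    gen₁ = proj₂ (proj₂ (generated (e₀ ∷ []) (here refl)))

    contains-e₀ : ∀ {E} → (e₀ ∈ E ⊎ (last w , first w) ∈ E) → Cl w E (first w) (last w)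
    contains-e₀ (inj₁ m) = base m
    contains-e₀ (inj₂ m) = sy (base m)

    Cl-subst : ∀ {E E′} → (∀ {a b} → (a , b) ∈ E → Cl w E′ a b) → ∀ {a b} → Cl w E a b → Cl w E′ a b
    Cl-subst h (base m)  = h m
    Cl-subst h rf        = rf
    Cl-subst h (sy c)    = sy (Cl-subst h c)
    Cl-subst h (tr c c′) = tr (Cl-subst h c) (Cl-subst h c′)
    Cl-subst h (fo {i} {j} e c) = fo {h = i} {j} e (Cl-subst h c)
    Cl-subst h (ft {i} {j} e c) = ft {h = i} {j} e (Cl-subst h c)

    -- Type A allows {s₀, s_m} in either order and at any place of the list. Here it is brought to
    -- the front; a singleton is padded by repeating it.
    through-e₀ : ∀ E → (e₀ ∈ E ⊎ (last w , first w) ∈ E) → length E ≤ 2 →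
      ∃[ P ] ((∀ {a b} → Cl w E a b → Cl w (e₀ ∷ P ∷ []) a b) × (∀ {a b} → Cl w (e₀ ∷ P ∷ []) a b → Cl w E a b))
    through-e₀ [] (inj₁ ()) le
    through-e₀ [] (inj₂ ()) le
    through-e₀ (_ ∷ _ ∷ _ ∷ _) m (s≤s (s≤s ()))
    through-e₀ (P ∷ []) m le = e₀ , Cl-subst (to m) , Cl-subst (λ { (here refl) → contains-e₀ m ; (there (here refl)) → contains-e₀ m })
      where
      to : (e₀ ∈ P ∷ [] ⊎ (last w , first w) ∈ P ∷ []) → ∀ {a b} → (a , b) ∈ P ∷ [] → Cl w (e₀ ∷ e₀ ∷ []) a b
      to (inj₁ (here refl)) (here refl) = base (here refl)
      to (inj₂ (here refl)) (here refl) = sy (base (here refl))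
    through-e₀ (P ∷ R ∷ []) m le = other m
      where
      other : (e₀ ∈ P ∷ R ∷ [] ⊎ (last w , first w) ∈ P ∷ R ∷ []) →
        ∃[ S ] ((∀ {a b} → Cl w (P ∷ R ∷ []) a b → Cl w (e₀ ∷ S ∷ []) a b) × (∀ {a b} → Cl w (e₀ ∷ S ∷ []) a b → Cl w (P ∷ R ∷ []) a b))
      other (inj₁ (here refl)) = R , id , id
      other (inj₁ (there (here refl))) = P , Cl-subst (λ { (here refl) → base (there (here refl)) ; (there (here refl)) → base (here refl) })
                                           , Cl-subst (λ { (here refl) → base (there (here refl)) ; (there (here refl)) → base (here refl) })
      other (inj₂ (here refl)) = R , Cl-subst (λ { (here refl) → sy (base (here refl)) ; (there (here refl)) → base (there (here refl)) })
                                   , Cl-subst (λ { (here refl) → sy (base (here refl)) ; (there (here refl)) → base (there (here refl)) })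
      other (inj₂ (there (here refl))) = P , Cl-subst (λ { (here refl) → base (there (here refl)) ; (there (here refl)) → sy (base (here refl)) })
                                           , Cl-subst (λ { (here refl) → sy (base (there (here refl))) ; (there (here refl)) → base (here refl) })

    ≋-lookup : ∀ {q q′} → q ∈ quotients w → q′ ∈ quotients w → ∀ {E} → Gen w (lookup q) E → Gen w (lookup q′) E → q ≡ q′
    ≋-lookup q∈ q′∈ g g′ = quotient-unique w q∈ q′∈ (Gen-≋ w g g′)

    -- The situation β ≥ 2.
    module Tight (χ≢0 : ∀ {q} → q ∈ quotients w → χQ q ≢ 0) (χ1 : ∀ {q} → q ∈ quotients w → χQ q ≡ 1 → q ≡ p₁) where

      χp₁ : χQ p₁ ≡ 1
      χp₁ = ℕP.≤-antisym (χ≤length w gen₁) (ℕP.n≢0⇒n>0 (χ≢0 p₁∈))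

      -- A quotient with χ ≤ 1 would have to be Γ₁, which does not identify `a` and `b`.
      pair-χ : ∀ {a b q} → lookup p₁ a ≢ lookup p₁ b → q ∈ quotients w → Gen w (lookup q) (e₀ ∷ (a , b) ∷ []) → ¬ (χQ q ≤ 1)
      pair-χ {a} {b} {q} ne q∈ g le = go (ℕP.m≤n⇒m<n∨m≡n le)
        where
        go : χQ q < 1 ⊎ χQ q ≡ 1 → ⊥
        go (inj₁ (s≤s z)) = χ≢0 q∈ (ℕP.n≤0⇒n≡0 z)
        go (inj₂ e) = ne (subst (λ p → lookup p a ≡ lookup p b) (χ1 q∈ e) (proj₂ (g a b) (base (there (here refl)))))

      -- Two generating pairs give e + 1 ≤ v + 2, and strict inequality would mean χ ≤ 1. As this is
      -- excluded, no step of the folding was lossy and the potentials have survived.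
      pot : ∀ a b → lookup p₁ a ≢ lookup p₁ b → Potentials w (e₀ ∷ (a , b) ∷ [])
        (λ h l → label w h ≡ label w l × Cl w (e₀ ∷ (a , b) ∷ []) (origin w h) (origin w l))
      pot a b ne = go (Generated.count G)
        where
        E = e₀ ∷ (a , b) ∷ []
        G = generate w E
        pG = Generated.p G
        qG = quotient-complete w pG (closed (here refl) G)
        q = proj₁ qG
        gq : Gen w (lookup q) E
        gq = ≋-Gen w (≋-sym w (proj₂ (proj₂ qG))) (Generated.gen G)
        go : (suc (numEdges w pG) < numVertices w pG ℕ.+ 2) ⊎ (suc (numEdges w pG) ≡ numVertices w pG ℕ.+ 2 × Potentials w E (SameEdge w pG)) → _
        go (inj₂ (_ , ps)) = λ S v → proj₁ (ps S v) , (λ {x} {y} → proj₁ (proj₂ (ps S v)) {x} {y}) , λ { (e , c) → proj₂ (proj₂ (ps S v)) (e , proj₂ (Generated.gen G _ _) c) }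
        go (inj₁ lt) = contradiction (ℕP.≤-trans (ℕP.≤-reflexive (χ-≋ w (proj₂ (proj₂ qG))))
            (ℕP.m≤n+o⇒m∸n≤o (suc (numEdges w pG)) (numVertices w pG) (ℕP.≤-pred (ℕP.≤-trans lt (ℕP.≤-reflexive (ℕP.+-suc (numVertices w pG) 1))))))
          (pair-χ ne (proj₁ (proj₂ qG)) gq)

      abstract
        comps : Components w (lookup p₁)
        comps = components-of w (lookup p₁) gen₁ (quotient-idem w p₁∈) pot

      open Components comps public

      genQ : V × V → Q
      genQ P = proj₁ (generated (e₀ ∷ P ∷ []) (here refl))

      genQ∈ : ∀ P → genQ P ∈ quotients w
      genQ∈ P = proj₁ (proj₂ (generated (e₀ ∷ P ∷ []) (here refl)))

      genQ-gen : ∀ P → Gen w (lookup (genQ P)) (e₀ ∷ P ∷ [])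
      genQ-gen P = proj₂ (proj₂ (generated (e₀ ∷ P ∷ []) (here refl)))

      typeA : List Q
      typeA = map genQ reps

      genQ-inj : ∀ {R R′} → R ∈ reps → R′ ∈ reps → genQ R ≡ genQ R′ → R ≡ R′
      genQ-inj {R} {R′} R∈ R′∈ e = separated R∈ R′∈
        (λ c → proj₁ (genQ-gen R′ _ _) (subst (λ q → lookup q _ ≡ lookup q _) e (proj₂ (genQ-gen R _ _) c)))
        (λ c → proj₁ (genQ-gen R _ _) (subst (λ q → lookup q _ ≡ lookup q _) (sym e) (proj₂ (genQ-gen R′ _ _) c)))

      typeA-! : Unique typeA
      typeA-! = go reps reps-! id
        where
        go : ∀ Rs → Unique Rs → (∀ {R} → R ∈ Rs → R ∈ reps) → Unique (map genQ Rs)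
        go []       _        s = []
        go (R ∷ Rs) (R∉ ∷ u) s = All.tabulate (λ m e → distinct m e) ∷ go Rs u (s ∘ there)
          where
          distinct : ∀ {q} → q ∈ map genQ Rs → genQ R ≢ q
          distinct m e with ∈-map⁻ genQ m
          ... | R′ , R′∈ , refl = All.lookup R∉ R′∈ (genQ-inj (s (here refl)) (s (there R′∈)) e)

      χ₂ : List Q
      χ₂ = level 2 (quotients w)

      typeA⊆χ₂ : ∀ {q} → q ∈ typeA → q ∈ χ₂
      typeA⊆χ₂ m with ∈-map⁻ genQ m
      ... | R , R∈ , refl = ∈-filter⁺ (λ q → χQ q ℕ.≟ 2) (genQ∈ R)
        (ℕP.≤-antisym (χ≤length w (genQ-gen R)) (ℕP.≰⇒> (pair-χ (apart R∈) (genQ∈ R) (genQ-gen R))))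

      generated-typeA : ∀ {q} P → q ∈ χ₂ → Gen w (lookup q) (e₀ ∷ P ∷ []) → q ∈ typeA
      generated-typeA {q} (a , c) q∈ g = go (lookup p₁ a Fin.≟ lookup p₁ c)
        where
        q∈Q : q ∈ quotients w
        q∈Q = proj₁ (∈-filter⁻ (λ q → χQ q ℕ.≟ 2) {xs = quotients w} q∈)
        χ≡2 : χQ q ≡ 2
        χ≡2 = proj₂ (∈-filter⁻ (λ q → χQ q ℕ.≟ 2) {xs = quotients w} q∈)
        g′ : lookup p₁ a ≡ lookup p₁ c → Gen w (lookup q) (e₀ ∷ [])
        g′ e x y = Cl-subst (λ { (here refl) → base (here refl) ; (there (here refl)) → proj₁ (gen₁ a c) e }) ∘ proj₁ (g x y)
                 , proj₂ (g x y) ∘ Cl-subst (λ { (here refl) → base (here refl) })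
        from-rep : (∃[ R ] (R ∈ reps × (∀ {x y} → Cl w (e₀ ∷ (a , c) ∷ []) x y → Cl w (e₀ ∷ R ∷ []) x y) ×
          (∀ {x y} → Cl w (e₀ ∷ R ∷ []) x y → Cl w (e₀ ∷ (a , c) ∷ []) x y))) → q ∈ typeA
        from-rep (R , R∈ , to , from) = subst (_∈ typeA) (≋-lookup (genQ∈ R) q∈Q (genQ-gen R) (λ x y → to ∘ proj₁ (g x y) , proj₂ (g x y) ∘ from)) (∈-map⁺ genQ R∈)
        go : Dec (lookup p₁ a ≡ lookup p₁ c) → q ∈ typeA
        go (no ne) = from-rep (covered a c ne)
        -- If Γ₁ already identifies the extra pair, then `q` is Γ₁ itself, whose χ is 1 and not 2.
        go (yes e) = contradiction (trans (sym χp₁) (trans (cong χQ (≋-lookup p₁∈ q∈Q gen₁ (g′ e))) χ≡2)) (λ ())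

      level₁ : level 1 (quotients w) ≡ p₁ ∷ []
      level₁ = single (UP.filter⁺ (λ q → χQ q ℕ.≟ 1) (quotients-! w)) (∈-filter⁺ (λ q → χQ q ℕ.≟ 1) p₁∈ χp₁)
          (λ m → let (q∈ , e) = ∈-filter⁻ (λ q → χQ q ℕ.≟ 1) {xs = quotients w} m in χ1 q∈ e)
        where
        single : ∀ {xs : List Q} {x} → Unique xs → x ∈ xs → (∀ {y} → y ∈ xs → y ≡ x) → xs ≡ x ∷ []
        single {y ∷ []}      u m h = cong (_∷ []) (h (here refl))
        single {y ∷ z ∷ xs} ((y≢z ∷ _) ∷ _) m h = contradiction (trans (h (here refl)) (sym (h (there (here refl))))) y≢z

      b₁≡0 : b 1 ≡ + 0
      b₁≡0 = trans (b₁ χ≢0) (cong (λ l → + length l ℤ.+ -[1+ 0 ]) level₁)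

      -- Γ₁ is the only quotient that contributes its slope, and since Υ is a forest (`number`) that
      -- slope is minus the number of components, hence of type A quotients.
      b₂≡ : b 2 ≡ + length χ₂ ℤ.+ ℤ.- (+ length typeA)
      b₂≡ = trans (b₂ χ≢0) (trans (cong (λ l → sumℤ slopeQ l ℤ.+ + length χ₂) level₁)
        (trans (cong (λ z → (z ℤ.+ + 0) ℤ.+ + length χ₂) slope₁) (alg (+ length typeA) (+ length χ₂))))
        where
        alg : ∀ a b → (ℤ.- a ℤ.+ + 0) ℤ.+ b ≡ b ℤ.+ ℤ.- a
        alg = solve-∀
        T = sumF k (tri ∘ edgeCount w (lookup p₁))
        v = numVertices w (lookup p₁)
        slope₁ : slopeQ p₁ ≡ ℤ.- (+ length typeA)
        slope₁ = trans (cong (λ z → + T ℤ.+ ℤ.- z) (trans (cong +_ (sym count)) (ℤP.pos-+ (length typeA) T))) (alg′ (+ T) (+ length typeA))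
          where
          count : length typeA ℕ.+ T ≡ tri v
          count = trans (cong₂ ℕ._+_ (LP.length-map genQ reps) (sym (∑-sumF k (tri ∘ edgeCount w (lookup p₁))))) number
          alg′ : ∀ t a → t ℤ.+ ℤ.- (a ℤ.+ t) ≡ ℤ.- a
          alg′ = solve-∀

    private
      ≋-refl : ∀ {q q′ : Q} → q ≡ q′ → _≋_ w (lookup q) (lookup q′)
      ≋-refl refl a b = id , id

      minimal : ∀ {p E} → GeneratedBy w p E → χ w p ≡ length E → ∀ E′ → GeneratedBy w p E′ → length E ≤ length E′
      minimal {p} _ e E′ g = ℕP.≤-trans (ℕP.≤-reflexive (sym e)) (χ≤length w (GeneratedBy⇒Gen w {p} g))

      realizable⇒closed : ∀ {p} → Realizable w p → Closed w p
      realizable⇒closed {p} rz = realizable⇒folded w {p} rz , proj₁ rz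

      short : ∀ {p} {E : List (V × V)} → Folded w p → (∀ E′ → GeneratedBy w p E′ → length E ≤ length E′) → length E ≤ χ w p
      short {p} f m = ℕP.≤-trans (m (proj₁ sg) (proj₁ (proj₂ sg))) (proj₂ (proj₂ sg))
        where sg = smallGenerators w {p} f

      contains-length : ∀ {A : Set} {x : A} {xs} → x ∈ xs → 1 ≤ length xs
      contains-length (here _)  = s≤s z≤n
      contains-length (there _) = s≤s z≤n

      e₀-length : ∀ {E} → (e₀ ∈ E ⊎ (last w , first w) ∈ E) → 1 ≤ length E
      e₀-length (inj₁ m) = contains-length m
      e₀-length (inj₂ m) = contains-length m

      -- A list that contains {s₀, s_m} is not empty, hence not of smallest size when the empty list
      -- generates.
      χ0⇒B : ∀ {p} → Folded w p → χ w p ≡ 0 → TypeB w p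
      χ0⇒B {p} f e (E , g , m , c) = contradiction (ℕP.≤-trans (e₀-length c) (ℕP.≤-trans (short {p} {E} f m) (ℕP.≤-reflexive e))) (λ ())

      short-e₀ : ∀ E → (e₀ ∈ E ⊎ (last w , first w) ∈ E) → length E ≤ 1 → ∀ {a b} → (Cl w E a b → Cl w (e₀ ∷ []) a b) × (Cl w (e₀ ∷ []) a b → Cl w E a b)
      short-e₀ []          (inj₁ ()) le
      short-e₀ []          (inj₂ ()) le
      short-e₀ (_ ∷ _ ∷ _) m (s≤s ())
      short-e₀ (P ∷ []) m le = Cl-subst (to m) , Cl-subst (λ { (here refl) → contains-e₀ m })
        where
        to : (e₀ ∈ P ∷ [] ⊎ (last w , first w) ∈ P ∷ []) → ∀ {a b} → (a , b) ∈ P ∷ [] → Cl w (e₀ ∷ []) a b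
        to (inj₁ (here refl)) (here refl) = base (here refl)
        to (inj₂ (here refl)) (here refl) = sy (base (here refl))

      unique-b : ∀ a → IsExpansion w a → ∀ j → a j ≡ b j
      unique-b a ex = Uniqueness.unique (length w) a b (λ m → (expectation (suc m) w ℚ.- ℚ.1ℚ) ℚ.* recipSuc m)
        (λ m le → conv (ex m (ℕP.m≤n⇒m≤1+n le))) (λ m le → conv (coefficients-expand w m (ℕP.m≤n⇒m≤1+n le)))

      empty : ∀ {A : Set} (xs : List A) → + length xs ≡ + 0 → ∀ {x} → x ∉ xs
      empty [] _ ()
      empty (x ∷ xs) ()

    -- a₀ = 0 excludes χ = 0, so χ(Γ₁) = 1, and a₁ = 0 then makes Γ₁ the only quotient with χ = 1.
    -- Finally a₂ ≠ 0 says that the list `typeA`, which is contained in `χ₂`, does not exhaust it.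
    φ⇒β : φ≡2 w → β≡2 w
    φ⇒β (a , ex , a0 , a1 , a2) = (lookup q , folded⇒realizable w {lookup q} (proj₁ clq) (proj₂ clq) , q-B , χ≡2) , others
      where
      χ≢0 : ∀ {q} → q ∈ quotients w → χQ q ≢ 0
      χ≢0 q∈ e = empty (level 0 (quotients w)) (trans (sym b₀) (trans (sym (unique-b a ex 0)) a0)) (∈-filter⁺ (λ q → χQ q ℕ.≟ 0) q∈ e)
      one-left : length (level 1 (quotients w)) ≡ 1
      one-left = ℤP.+-injective (ℤP.i-j≡0⇒i≡j (+ length (level 1 (quotients w))) (+ 1) (trans (sym (b₁ χ≢0)) (trans (sym (unique-b a ex 1)) a1)))
      p₁-level : p₁ ∈ level 1 (quotients w)
      p₁-level = ∈-filter⁺ (λ q → χQ q ℕ.≟ 1) p₁∈ (ℕP.≤-antisym (χ≤length w gen₁) (ℕP.n≢0⇒n>0 (χ≢0 p₁∈)))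
      only : ∀ {xs : List Q} {x y} → length xs ≡ 1 → x ∈ xs → y ∈ xs → x ≡ y
      only {_ ∷ []} _ (here refl) (here refl) = refl
      χ1 : ∀ {q} → q ∈ quotients w → χQ q ≡ 1 → q ≡ p₁
      χ1 q∈ e = only one-left (∈-filter⁺ (λ q → χQ q ℕ.≟ 1) q∈ e) p₁-level
      open Tight χ≢0 χ1
      open DecMem _≟Q_ using (_∈?_)
      not-all : ¬ All (_∈ typeA) χ₂
      not-all al = a2 (trans (unique-b a ex 2) (trans b₂≡ (trans (cong (λ z → + z ℤ.+ ℤ.- (+ length typeA))
        (ℕP.≤-antisym (⊆-length (UP.filter⁺ (λ q → χQ q ℕ.≟ 2) (quotients-! w)) (All.lookup al)) (⊆-length typeA-! typeA⊆χ₂))) (ℤP.+-inverseʳ (+ length typeA)))))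
      missing = find (¬All⇒Any¬ (_∈? typeA) χ₂ not-all)
      q = proj₁ missing
      q∈χ₂ = proj₁ (proj₂ missing)
      q∉A : q ∉ typeA
      q∉A = proj₂ (proj₂ missing)
      q∈ : q ∈ quotients w
      q∈ = proj₁ (∈-filter⁻ (λ q → χQ q ℕ.≟ 2) {xs = quotients w} q∈χ₂)
      χ≡2 : χQ q ≡ 2
      χ≡2 = proj₂ (∈-filter⁻ (λ q → χQ q ℕ.≟ 2) {xs = quotients w} q∈χ₂)
      clq : Closed w (lookup q)
      clq = quotient-closed w q∈
      q-B : TypeB w (lookup q)
      q-B (E , g , m , c) = q∉A (generated-typeA (proj₁ t) q∈χ₂
          (λ x y → proj₁ (proj₂ t) ∘ proj₁ (GeneratedBy⇒Gen w {lookup q} g x y) , proj₂ (GeneratedBy⇒Gen w {lookup q} g x y) ∘ proj₂ (proj₂ t)))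
        where t = through-e₀ E c (ℕP.≤-trans (short {lookup q} {E} (proj₁ clq) m) (ℕP.≤-reflexive χ≡2))
      others : ∀ p → Realizable w p → TypeB w p → 2 ≤ χ w p
      others p rz B = ℕP.≤∧≢⇒< (ℕP.n≢0⇒n>0 (λ e → χ≢0 q′∈ (trans (χ-≋ w s) e))) (λ e → B (A (sym e)))
        where
        qp = quotient-complete w p (realizable⇒closed {p} rz)
        q′∈ = proj₁ (proj₂ qp)
        s = proj₂ (proj₂ qp)
        A : χ w p ≡ 1 → TypeA w p
        A e = e₀ ∷ [] , gp , minimal {p} gp e , inj₁ (here refl)
          where
          gp : GeneratedBy w p (e₀ ∷ [])
          gp = Gen⇒GeneratedBy w (≋-Gen w (≋-trans w (≋-refl (sym (χ1 q′∈ (trans (χ-≋ w s) e)))) s) gen₁)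

    -- A quotient with χ = 0, or with χ = 1 and different from Γ₁, would be of type B and is
    -- excluded by β ≥ 2. The given type B quotient lies in `χ₂` outside `typeA`, which makes the
    -- difference a₂ positive.
    β⇒φ : β≡2 w → φ≡2 w
    β⇒φ ((p , rz , B , χp) , others) = b , coefficients-expand w , b₀≡0 , b₁≡0 , b₂≢0
      where
      χ≢0 : ∀ {q} → q ∈ quotients w → χQ q ≢ 0
      χ≢0 {q} q∈ e = contradiction (ℕP.≤-trans (others (lookup q) (folded⇒realizable w {lookup q} (proj₁ cl) (proj₂ cl)) (χ0⇒B {lookup q} (proj₁ cl) e)) (ℕP.≤-reflexive e)) (λ ())
        where cl = quotient-closed w q∈
      χ1 : ∀ {q} → q ∈ quotients w → χQ q ≡ 1 → q ≡ p₁
      χ1 {q} q∈ e = decidable-stable (q ≟Q p₁) (λ ne → contradiction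
          (ℕP.≤-trans (others (lookup q) (folded⇒realizable w {lookup q} (proj₁ cl) (proj₂ cl)) (isB ne)) (ℕP.≤-reflexive e)) (λ { (s≤s ()) }))
        where
        cl = quotient-closed w q∈
        isB : q ≢ p₁ → TypeB w (lookup q)
        isB ne (E , g , m , c) = ne (≋-lookup q∈ p₁∈ g₁ gen₁)
          where
          le : length E ≤ 1
          le = ℕP.≤-trans (short {lookup q} {E} (proj₁ cl) m) (ℕP.≤-reflexive e)
          g₁ : Gen w (lookup q) (e₀ ∷ [])
          g₁ x y = proj₁ (short-e₀ E c le) ∘ proj₁ (GeneratedBy⇒Gen w {lookup q} g x y) , proj₂ (GeneratedBy⇒Gen w {lookup q} g x y) ∘ proj₂ (short-e₀ E c le)
      open Tight χ≢0 χ1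
      b₀≡0 : b 0 ≡ + 0
      b₀≡0 = trans b₀ (cong (λ l → + length l) (none (quotients w) id))
        where
        none : ∀ qs → (∀ {q} → q ∈ qs → q ∈ quotients w) → level 0 qs ≡ []
        none []       s = refl
        none (q ∷ qs) s = trans (LP.filter-reject (λ q → χQ q ℕ.≟ 0) {xs = qs} (χ≢0 (s (here refl)))) (none qs (s ∘ there))
      qp = quotient-complete w p (realizable⇒closed {p} rz)
      q = proj₁ qp
      q∈χ₂ : q ∈ χ₂
      q∈χ₂ = ∈-filter⁺ (λ q → χQ q ℕ.≟ 2) (proj₁ (proj₂ qp)) (trans (χ-≋ w (proj₂ (proj₂ qp))) χp)
      q∉A : q ∉ typeA
      q∉A m = refute (∈-map⁻ genQ m)
        where
        refute : ∃[ R ] (R ∈ reps × q ≡ genQ R) → ⊥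
        refute (R , _ , e) = B (e₀ ∷ R ∷ [] , gp , minimal {p} gp χp , inj₁ (here refl))
          where
          gp : GeneratedBy w p (e₀ ∷ R ∷ [])
          gp = Gen⇒GeneratedBy w (≋-Gen w (≋-trans w (≋-refl (sym e)) (proj₂ (proj₂ qp))) (genQ-gen R))
      bigger : length typeA < length χ₂
      bigger = ⊆-length {xs = q ∷ typeA} (All.tabulate (λ m e → q∉A (subst (_∈ typeA) (sym e) m)) ∷ typeA-!)
        (λ { (here refl) → q∈χ₂ ; (there m) → typeA⊆χ₂ m })
      b₂≢0 : b 2 ≢ + 0
      b₂≢0 z = ℕP.<-irrefl (sym (ℤP.+-injective (ℤP.i-j≡0⇒i≡j (+ length χ₂) (+ length typeA) (trans (sym b₂≡) z)))) bigger

open import Defs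
open import Data.Nat using (ℕ; _≤_)
open import Function.Bundles using (_⇔_; mk⇔)
open Comparison using (φ⇒β; β⇒φ)

theorem1 : (k : ℕ) → 1 ≤ k → (w : Word k) → φ≡2 w ⇔ β≡2 w
theorem1 k _ w = mk⇔ (φ⇒β w) (β⇒φ w)
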